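{- For all positive integers $n,x$ and nonnegative integers $k\leq n-1$, we have $$ \begin{aligned} \operatorname{M}(F_{n,x}\setminus\triangleleft_2(k))={}& \binom {4k+1}{2k}\, \frac {(n+k)!} {(x+n-k)_{2k+1}} \prod _{s=1} ^{n}\frac {(2x+2s)_{4n-4s+1}} {(2s)_{4n-4s+1}}\\ &\times \sum _{i=0} ^{n-k-1} \frac { (\tfrac 12)_{i}} {i!\,(n-k-i-1)!^2\,(n+k-i+1)_{n-k}\,(n+k-i+1)_i\,(2n-i+\frac {1} {2})_i}\\ &\quad\cdot \Big((x)_{i}\,(x+i+1)_{n-k-i-1}\,(x+n+k+1)_{n-k}\\ &\qquad- (x)_{n-k}\,(x+n+k+1)_{n-k-i-1}\,(x+2n-i+1)_{i}\Big). \end{aligned} $$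
   Context: Consider the tiling of the plane by unit triangles, drawn so that one family of lattice lines is vertical; lozenges are unions of two adjacent unit triangles. Let $\ell$ be a vertical lattice line, and choose rectangular coordinates in which $\ell$ is the $y$-axis, the origin is a lattice point on $\ell$, and the unit is the lattice spacing. Let $H_{n,x}$ be the lattice hexagon of side-lengths $2n,2n,2x,2n,2n,2x$ (in counter-clockwise order, starting with the southwestern side) centered at the origin, so that it is symmetric about $\ell$. Let $F_{n,x}$ be the region obtained from the left half of $H_{n,x}$ by regarding its boundary along $\ell$ as free, i.e., lozenges in a tiling of $F_{n,x}$ are allowed to protrude halfway out across $\ell$. Let $\triangleleft_2(k)$ denote a triangular hole of side-length 2 pointing to the left, placed so that the center of its right side has coordinates $(-k\sqrt3,0)$ (i.e., this center and the origin are the endpoints of a string of $k$ contiguous horizontal lozenges). For a region $R$, $\operatorname{M}(R)$ denotes the number of lozenge tilings of $R$ (where along free boundary portions lozenges may protrude out). $(\alpha)_m=\alpha(\alpha+1)\cdots(\alpha+m-1)$ for $m\ge1$, $(\alpha)_0=1$, is the Pochhammer symbol. -}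

module Defs where

open import Data.Bool using (Bool; true; false; _∧_; _∨_; not; if_then_else_)
open import Data.Nat as ℕ using (ℕ; zero; suc; _∸_; _≡ᵇ_; _!)
open import Data.Nat.Combinatorics using (_C_)
open import Data.Integer as ℤ using (ℤ; +_; -_; _≤ᵇ_)
import Data.Integer.Properties as ℤP
open import Data.Rational as ℚ using (ℚ; 0ℚ; 1ℚ; ½; _÷_; ≢-nonZero)
open import Data.Rational.Properties using () renaming (_≟_ to _≟ℚ_)
open import Data.List using (List; []; _∷_; map; filterᵇ; concatMap; length; _++_; zip; foldr)
open import Data.Bool.ListAction using (any; all)
open import Data.Vec as V using (Vec; toList)
open import Data.Product using (_×_; _,_; proj₁; proj₂)
open import Relation.Nullary using (yes; no)
open import Relation.Nullary.Decidable using (⌊_⌋)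

-- Geometry of the triangular lattice.
--
-- Coordinates: the vertical lattice lines are x = a·(√3/2), a ∈ ℤ
-- (a = 0 is the line ℓ, the y-axis).  We use the doubled height Y = 2y,
-- so the lattice points are the pairs (a , Y) with a + Y even, and a unit
-- vertical lattice segment on line a goes from (a , Y) to (a , Y + 2).
--
-- Every unit triangle has exactly one vertical side.  We record it by
--   * its direction: ◁ (pointing left, apex on line a - 1) or
--                    ▷ (pointing right, apex on line a + 1),
--   * the line a carrying its vertical side, and
--   * the lower end Y of its vertical side (with a + Y even).
-- Vertices:  ◁ a Y : (a,Y), (a,Y+2), (a-1,Y+1)
--            ▷ a Y : (a,Y), (a,Y+2), (a+1,Y+1)

data Dir : Set where
  ◁ ▷ : Dir

record Tri : Set where
  constructor tri
  field
    dir : Dir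
    col : ℤ
    low : ℤ

Point : Set
Point = ℤ × ℤ

vertices : Tri → List Point
vertices (tri ◁ a Y) = (a , Y) ∷ (a , Y ℤ.+ + 2) ∷ (a ℤ.- + 1 , Y ℤ.+ + 1) ∷ []
vertices (tri ▷ a Y) = (a , Y) ∷ (a , Y ℤ.+ + 2) ∷ (a ℤ.+ + 1 , Y ℤ.+ + 1) ∷ []

infix 4 _==ℤ_ _==D_ _==T_

_==ℤ_ : ℤ → ℤ → Bool
a ==ℤ b = ⌊ a ℤ.≟ b ⌋

_==D_ : Dir → Dir → Bool
◁ ==D ◁ = true
▷ ==D ▷ = true
_ ==D _ = false

_==T_ : Tri → Tri → Bool
tri d a Y ==T tri e b Z = (d ==D e) ∧ (a ==ℤ b) ∧ (Y ==ℤ Z)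

adjacent : Tri → Tri → Bool
adjacent (tri ◁ a Y) (tri ▷ b Z) =
  ((b ==ℤ a) ∧ (Z ==ℤ Y)) ∨
  ((b ==ℤ (a ℤ.- + 1)) ∧ ((Z ==ℤ (Y ℤ.+ + 1)) ∨ (Z ==ℤ (Y ℤ.- + 1))))
adjacent _ _ = false

-- Regions with (possibly) free boundary, and the number of tilings.
--
-- A region consists of a finite list 'inside' of unit triangles (without
-- repetitions) and a finite list 'free' of unit triangles outside the
-- region across its free boundary, into which lozenges may protrude.
-- A lozenge is a pair (◁-triangle , ▷-triangle) of adjacent triangles of
-- inside ++ free, not both in free.  A tiling is a set of lozenges covering
-- every inside triangle exactly once and every free triangle at most once.

record Region : Set where
  field
    inside : List Tri
    free   : List Tri
open Region public

isDir : Dir → Tri → Bool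
isDir d t = d ==D Tri.dir t

_∈ᵇ_ : Tri → List Tri → Bool
t ∈ᵇ ts = any (t ==T_) ts

lozenges : Region → List (Tri × Tri)
lozenges R =
  concatMap (λ l → map (l ,_)
    (filterᵇ (λ r → adjacent l r ∧ not ((l ∈ᵇ free R) ∧ (r ∈ᵇ free R)))
       (filterᵇ (isDir ▷) cells)))
    (filterᵇ (isDir ◁) cells)
  where
  cells = inside R ++ free R

covers : Tri × Tri → Tri → Bool
covers (l , r) t = (l ==T t) ∨ (r ==T t)

multiplicity : List (Bool × (Tri × Tri)) → Tri → ℕ
multiplicity sel t =
  foldr (λ { (b , L) m → if b ∧ covers L t then suc m else m }) 0 sel

isTiling : (R : Region) → Vec Bool (length (lozenges R)) → Bool
isTiling R s =
  all (λ t → multiplicity sel t ≡ᵇ 1) (inside R) ∧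
  all (λ t → multiplicity sel t ℕ.≤ᵇ 1) (free R)
  where sel = zip (toList s) (lozenges R)

countVec : (m : ℕ) → (Vec Bool m → Bool) → ℕ
countVec zero    p = if p V.[] then 1 else 0
countVec (suc m) p = countVec m (λ v → p (true V.∷ v)) ℕ.+ countVec m (λ v → p (false V.∷ v))

M : Region → ℕ
M R = countVec (length (lozenges R)) (isTiling R)

ℤrange : ℤ → ℕ → List ℤ
ℤrange lo zero    = []
ℤrange lo (suc m) = lo ∷ ℤrange (lo ℤ.+ + 1) m

inConvex : (Point → Bool) → Tri → Bool
inConvex P t = all P (vertices t)

-- closed left half of H_{n,x}: -2n ≤ a ≤ 0, |Y| ≤ 2x + 2n + a
-- (vertices of H_{n,x} in (a,Y) coordinates: (∓2n,±2x), (0,±(2x+2n)))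
inLeftHalf : ℕ → ℕ → Point → Bool
inLeftHalf n x (a , Y) =
  (- (+ (2 ℕ.* n)) ≤ᵇ a) ∧ (a ≤ᵇ + 0) ∧
  (- (+ (2 ℕ.* x ℕ.+ 2 ℕ.* n) ℤ.+ a) ≤ᵇ Y) ∧ (Y ≤ᵇ (+ (2 ℕ.* x ℕ.+ 2 ℕ.* n) ℤ.+ a))

-- closed triangular hole ◁₂(k): vertices (-2k,-2), (-2k,2), (-2k-2,0);
-- its right side is centered at (-k√3,0), i.e. (a,Y) = (-2k,0)
inHole : ℕ → Point → Bool
inHole k (a , Y) =
  (- (+ (2 ℕ.* k ℕ.+ 2)) ≤ᵇ a) ∧ (a ≤ᵇ - (+ (2 ℕ.* k))) ∧
  (- (a ℤ.+ + (2 ℕ.* k ℕ.+ 2)) ≤ᵇ Y) ∧ (Y ≤ᵇ (a ℤ.+ + (2 ℕ.* k ℕ.+ 2)))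

isLatticeTri : Tri → Bool
isLatticeTri (tri _ a Y) = (ℤ.∣ a ℤ.+ Y ∣ ℕ.% 2) ≡ᵇ 0

allTrisBox : ℕ → ℕ → List Tri
allTrisBox n x =
  concatMap (λ a → concatMap (λ Y → tri ◁ a Y ∷ tri ▷ a Y ∷ [])
                     (ℤrange (- (+ (2 ℕ.* x ℕ.+ 2 ℕ.* n))) (4 ℕ.* x ℕ.+ 4 ℕ.* n ℕ.+ 1)))
    (ℤrange (- (+ (2 ℕ.* n))) (2 ℕ.* n ℕ.+ 1))

holeyInside : ℕ → ℕ → ℕ → List Tri
holeyInside n x k =
  filterᵇ (λ t →
     isLatticeTri t ∧ inConvex (inLeftHalf n x) t ∧ not (inConvex (inHole k) t))
    (allTrisBox n x)

acrossℓ : List Tri → List Tri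
acrossℓ ts = concatMap f ts
  where
  f : Tri → List Tri
  f (tri ◁ a Y) = if (a ==ℤ + 0) then tri ▷ a Y ∷ [] else []
  f (tri ▷ a Y) = []

FminusHole : ℕ → ℕ → ℕ → Region
FminusHole n x k = record { inside = holeyInside n x k ; free = acrossℓ (holeyInside n x k) }

ℕ→ℚ : ℕ → ℚ
ℕ→ℚ m = + m ℚ./ 1

-- total division (never used with a zero divisor below)
_/'_ : ℚ → ℚ → ℚ
p /' q with q ≟ℚ 0ℚ
... | yes _ = 0ℚ
... | no q≢0 = _÷_ p q {{≢-nonZero q≢0}}

poch : ℚ → ℕ → ℚ
poch α zero    = 1ℚ
poch α (suc m) = poch α m ℚ.* (α ℚ.+ ℕ→ℚ m)

sumBelow : ℕ → (ℕ → ℚ) → ℚ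
sumBelow zero    f = 0ℚ
sumBelow (suc m) f = sumBelow m f ℚ.+ f m

prod1to : ℕ → (ℕ → ℚ) → ℚ
prod1to zero    f = 1ℚ
prod1to (suc m) f = prod1to m f ℚ.* f (suc m)

rhs : ℕ → ℕ → ℕ → ℚ
rhs n x k =
  ((ℕ→ℚ ((4 ℕ.* k ℕ.+ 1) C (2 ℕ.* k)) ℚ.* ℕ→ℚ ((n ℕ.+ k) !))
     /' poch (ℕ→ℚ (x ℕ.+ n ∸ k)) (2 ℕ.* k ℕ.+ 1))
  ℚ.* prod1to n (λ s → poch (ℕ→ℚ (2 ℕ.* x ℕ.+ 2 ℕ.* s)) (4 ℕ.* n ∸ 4 ℕ.* s ℕ.+ 1)
                       /' poch (ℕ→ℚ (2 ℕ.* s)) (4 ℕ.* n ∸ 4 ℕ.* s ℕ.+ 1))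
  ℚ.* sumBelow (n ∸ k) term
  where
  term : ℕ → ℚ
  term i =
    (poch ½ i /'
      (ℕ→ℚ (i !) ℚ.* ℕ→ℚ ((n ∸ k ∸ i ∸ 1) !) ℚ.* ℕ→ℚ ((n ∸ k ∸ i ∸ 1) !)
        ℚ.* poch (ℕ→ℚ (n ℕ.+ k ∸ i ℕ.+ 1)) (n ∸ k)
        ℚ.* poch (ℕ→ℚ (n ℕ.+ k ∸ i ℕ.+ 1)) i
        ℚ.* poch (ℕ→ℚ (2 ℕ.* n ∸ i) ℚ.+ ½) i))
    ℚ.* (poch (ℕ→ℚ x) i ℚ.* poch (ℕ→ℚ (x ℕ.+ i ℕ.+ 1)) (n ∸ k ∸ i ∸ 1)
           ℚ.* poch (ℕ→ℚ (x ℕ.+ n ℕ.+ k ℕ.+ 1)) (n ∸ k)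
         ℚ.- poch (ℕ→ℚ x) (n ∸ k) ℚ.* poch (ℕ→ℚ (x ℕ.+ n ℕ.+ k ℕ.+ 1)) (n ∸ k ∸ i ∸ 1)
           ℚ.* poch (ℕ→ℚ (x ℕ.+ 2 ℕ.* n ∸ i ℕ.+ 1)) i)

{-# OPTIONS --safe #-}
-- Cover the region line by line, moving towards ℓ. The right-pointing triangles still uncovered on the line at
-- distance τ from ℓ behave like non-intersecting walks with steps ±1, with τ steps left and free ends; the hole
-- emits two more walks from its right side. Their number is the Pfaffian of the signed numbers ω of pairs of walks
-- (Okada, Stembridge): both sides obey the same recursion in τ, since an alternating function kills collisions.
-- The starting points are symmetric about the horizontal axis, so row operations turn the Pfaffian into the
-- determinant of the Hankel matrix h(a + b), h(t) = C(2t+1, t), on the indices n, …, n + x - 1, k. Eliminating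
-- n, …, n + x - 1 leaves the product of the pivots, which is the product in the formula up to a factor, times the
-- Schur complement K x k k. The latter and the sum in the formula, suitably normalised, have the same increments in
-- x, by partial fractions and telescoping in the summation index, and agree at x = 0.
module Submission where

open import Defs
open import Data.Nat using (ℕ; _≤_; _∸_)
open import Relation.Binary.PropositionalEquality using (_≡_)

import Algebra.Solver.Ring
open import Algebra.Solver.Ring.AlmostCommutativeRing using (AlmostCommutativeRing; _-Raw-AlmostCommutative⟶_; fromCommutativeRing)
open import Data.Bool as Bool using (Bool; true; false; _∧_; _∨_; not; if_then_else_)
open import Data.Bool.ListAction using (all; and)
open import Data.Bool.Properties using (∧-identityʳ; ∧-zeroʳ; ∨-zeroʳ)
open import Data.Empty using (⊥; ⊥-elim)
open import Data.Integer as ℤ using (ℤ; +_; -[1+_])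
import Data.Integer.Properties as ℤP
open import Algebra.Properties.AbelianGroup ℤP.+-0-abelianGroup using (∙-cancelˡ; ∙-cancelʳ)
open import Data.Integer.Solver using () renaming (module +-*-Solver to ℤS)
open import Data.List using (List; []; _∷_; map; filterᵇ; concatMap; length; _++_; zip)
open import Data.List.Membership.Propositional using (_∈_; _∉_)
open import Data.List.Membership.Propositional.Properties
  using (∈-∃++; ∈-concatMap⁻; ∈-map⁻; ∈-map⁺; ∈-++⁻; ∈-++⁺ˡ; ∈-++⁺ʳ)
open import Data.List.Properties using (++-assoc; ++-identityʳ; length-++; length-map; map-++; map-cong; map-∘)
open import Data.List.Relation.Unary.All as All using (All; []; _∷_)
open import Data.List.Relation.Unary.AllPairs using (AllPairs; []; _∷_)
open import Data.List.Relation.Unary.Any using (Any; here; there)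
open import Data.List.Relation.Unary.Unique.Propositional using (Unique)
import Data.List.Relation.Unary.Unique.Propositional.Properties as UniqueP
import Data.Maybe
open import Data.Nat as ℕ using (zero; suc; _<_; _≤ᵇ_; _≡ᵇ_; _!; z≤n; s≤s)
open import Data.Nat.Combinatorics
  using (_C_; nCk+nC[k+1]≡[n+1]C[k+1]; nCk≡nC[n∸k]; k>n⇒nCk≡0; nCk≡n!/k![n-k]!; k![n∸k]!∣n!)
open import Data.Nat.DivMod using (_%_; m*n%n≡0; m/n*n≡m; [m+kn]%n≡m%n)
import Data.Nat.Properties as ℕP
open import Data.Nat.Properties using (_!*_!≢0)
open import Data.Nat.Solver using () renaming (module +-*-Solver to ℕS)
open import Data.Product using (_×_; _,_; proj₁; proj₂; ∃; ∃₂)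
open import Data.Rational as ℚ using (ℚ; 0ℚ; 1ℚ; ½; _+_; _*_; _-_; -_; 1/_; ≢-nonZero)
import Data.Rational.Properties as ℚP
open import Data.Rational.Unnormalised as ℚᵘ using (mkℚᵘ; *≡*)
import Data.Rational.Unnormalised.Properties as ℚᵘP
open import Data.Sum using (_⊎_; inj₁; inj₂)
open import Data.Vec as V using (Vec; toList)
open import Function using (_∘_)
open import Relation.Binary.PropositionalEquality
open import Relation.Nullary using (Dec; yes; no; ¬_)
open import Relation.Nullary.Decidable using (dec⇒maybe; dec-true; isYes≗does)

-- There is no path bijection and no sign-reversing involution. The number of tilings and the
-- Pfaffian are both functions of the list of uncovered positions on one line, and it suffices that
-- they obey the same recursion from line to line. Additivity in each slot lets all walks move
-- independently, and alternation removes the terms in which two walks meet. As the two walks of the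
-- hole are kept as extra vectors on all lines left of it, alternation also removes the terms in
-- which a walk runs into the hole. Without steps left, `ω` is the sign of a difference and an
-- increasing list has Pfaffian 1: this is the free boundary. The difference of two ±1 walks sees
-- only the total number of steps, which is why the matrix is Hankel; its pivots and Schur
-- complements come from orthogonal polynomials for the moments C(2t+1, t). The increments of the
-- Schur complement are products, whereas the recurrence in x of the sum contains a second sum `σ`,
-- free of x. Hence `σ` must be evaluated in closed form, by a separate downward induction on k
-- whose telescoping rests on the polynomial certificate `W` in `wz`.

-- The integers inside the rationals, for the ring solver

fromℤ : ℤ → ℚ
fromℤ i = i ℚ./ 1

fromℤ-lift : ∀ i → ℚ.toℚᵘ (fromℤ i) ℚᵘ.≃ mkℚᵘ i 0
fromℤ-lift i = ℚP.toℚᵘ-fromℚᵘ (mkℚᵘ i 0)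

fromℤ-+ : ∀ i j → fromℤ (i ℤ.+ j) ≡ fromℤ i + fromℤ j
fromℤ-+ i j = ℚP.toℚᵘ-injective (ℚᵘP.≃-trans (fromℤ-lift (i ℤ.+ j))
  (ℚᵘP.≃-sym (ℚᵘP.≃-trans (ℚP.toℚᵘ-homo-+ (fromℤ i) (fromℤ j))
    (ℚᵘP.≃-trans (ℚᵘP.+-cong (fromℤ-lift i) (fromℤ-lift j)) (*≡* (cong (ℤ._* + 1) (cong₂ ℤ._+_ (ℤP.*-identityʳ i) (ℤP.*-identityʳ j))))))))

fromℤ-* : ∀ i j → fromℤ (i ℤ.* j) ≡ fromℤ i * fromℤ j
fromℤ-* i j = ℚP.toℚᵘ-injective (ℚᵘP.≃-trans (fromℤ-lift (i ℤ.* j))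
  (ℚᵘP.≃-sym (ℚᵘP.≃-trans (ℚP.toℚᵘ-homo-* (fromℤ i) (fromℤ j)) (ℚᵘP.*-cong (fromℤ-lift i) (fromℤ-lift j)))))

fromℤ-neg : ∀ i → fromℤ (ℤ.- i) ≡ - fromℤ i
fromℤ-neg i = ℚP.toℚᵘ-injective (ℚᵘP.≃-trans (fromℤ-lift (ℤ.- i))
  (ℚᵘP.≃-sym (ℚᵘP.≃-trans (ℚP.toℚᵘ-homo‿- (fromℤ i)) (ℚᵘP.-‿cong (fromℤ-lift i)))))

ℚring : AlmostCommutativeRing _ _
ℚring = fromCommutativeRing ℚP.+-*-commutativeRing

-- Integer coefficients keep the normal forms free of fraction arithmetic; ½ therefore enters later
-- identities as a variable.
ℤ⟶ℚ : ℤ.+-*-rawRing -Raw-AlmostCommutative⟶ ℚring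
ℤ⟶ℚ = record { ⟦_⟧ = fromℤ ; +-homo = fromℤ-+ ; *-homo = fromℤ-* ; -‿homo = fromℤ-neg ; 0-homo = refl ; 1-homo = refl }

open Algebra.Solver.Ring ℤ.+-*-rawRing ℚring ℤ⟶ℚ
  (λ i j → Data.Maybe.map (cong fromℤ) (dec⇒maybe (i ℤ.≟ j)))
  using (Polynomial; solve; con; _:=_; _:+_; _:*_; _:-_; :-_)

-- Tilings as sequences of choices

sumOver : {A : Set} → (A → ℕ) → List A → ℕ
sumOver g []       = 0
sumOver g (a ∷ as) = g a ℕ.+ sumOver g as

sumOver-cong : {A : Set} {f g : A → ℕ} (as : List A) → (∀ {a} → a ∈ as → f a ≡ g a) →
               sumOver f as ≡ sumOver g as
sumOver-cong []       eq = refl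
sumOver-cong (a ∷ as) eq = cong₂ ℕ._+_ (eq (here refl)) (sumOver-cong as (eq ∘ there))

all-cong : {A : Set} {p q : A → Bool} → (∀ a → p a ≡ q a) → ∀ as → all p as ≡ all q as
all-cong eq as = cong and (map-cong eq as)

all-sound : {A : Set} (p : A → Bool) (as : List A) → all p as ≡ true → ∀ {a} → a ∈ as → p a ≡ true
all-sound p (a ∷ as) eq m with p a in pa
all-sound p (a ∷ as) eq (here refl) | true = pa
all-sound p (a ∷ as) eq (there m)   | true = all-sound p as eq m

all-complete : {A : Set} (p : A → Bool) (as : List A) → (∀ {a} → a ∈ as → p a ≡ true) → all p as ≡ true
all-complete p []       h = refl
all-complete p (a ∷ as) h rewrite h {a} (here refl) = all-complete p as (h ∘ there)

==ℤ-refl : ∀ a → (a ==ℤ a) ≡ true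
==ℤ-refl a = trans (isYes≗does (a ℤ.≟ a)) (dec-true (a ℤ.≟ a) refl)

==ℤ-sound : ∀ {a b} → (a ==ℤ b) ≡ true → a ≡ b
==ℤ-sound {a} {b} eq with a ℤ.≟ b
... | yes p = p

==D-refl : ∀ d → (d ==D d) ≡ true
==D-refl ◁ = refl
==D-refl ▷ = refl

==D-sound : ∀ d e → (d ==D e) ≡ true → d ≡ e
==D-sound ◁ ◁ _ = refl
==D-sound ▷ ▷ _ = refl

==T-refl : ∀ t → (t ==T t) ≡ true
==T-refl (tri d a Y) rewrite ==D-refl d | ==ℤ-refl a | ==ℤ-refl Y = refl

∧-split : ∀ {a b} → a ∧ b ≡ true → a ≡ true × b ≡ true
∧-split {true} {true} _ = refl , refl

==T-sound : ∀ {s t} → (s ==T t) ≡ true → s ≡ t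
==T-sound {tri d a Y} {tri e b Z} eq with ∧-split {d ==D e} eq
... | p , q with ∧-split {a ==ℤ b} q
... | q₁ , q₂ with ==D-sound d e p | ==ℤ-sound {a} q₁ | ==ℤ-sound {Y} q₂
... | refl | refl | refl = refl

==T-false : ∀ {s t} → s ≢ t → (s ==T t) ≡ false
==T-false {s} {t} ne with s ==T t in eq
... | true  = ⊥-elim (ne (==T-sound eq))
... | false = refl

covers-left : ∀ l r → covers (l , r) l ≡ true
covers-left l r rewrite ==T-refl l = refl

covers-right : ∀ l r → covers (l , r) r ≡ true
covers-right l r rewrite ==T-refl r = ∨-zeroʳ _

covers-other : ∀ {l r t} → l ≢ t → r ≢ t → covers (l , r) t ≡ false
covers-other p q rewrite ==T-false p | ==T-false q = refl

module Cover (ins fr : List Tri) where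

  valid : (Tri → ℕ) → Bool
  valid μ = all (λ t → μ t ≡ᵇ 1) ins ∧ all (λ t → μ t ≤ᵇ 1) fr

  add : Tri × Tri → (Tri → ℕ) → Tri → ℕ
  add L μ t = if covers L t then suc (μ t) else μ t

  -- The number of sublists of Ls that complete the covering numbers μ to those of a tiling.
  total : List (Tri × Tri) → (Tri → ℕ) → ℕ
  total []       μ = if valid μ then 1 else 0
  total (L ∷ Ls) μ = total Ls (add L μ) ℕ.+ total Ls μ

  valid-cong : ∀ {μ ν} → (∀ t → μ t ≡ ν t) → valid μ ≡ valid ν
  valid-cong eq = cong₂ _∧_ (all-cong (λ t → cong (_≡ᵇ 1) (eq t)) ins)
                            (all-cong (λ t → cong (_≤ᵇ 1) (eq t)) fr)

  countVec-cong : ∀ m {p q : Vec Bool m → Bool} → (∀ v → p v ≡ q v) → countVec m p ≡ countVec m q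
  countVec-cong zero    eq rewrite eq V.[] = refl
  countVec-cong (suc m) eq =
    cong₂ ℕ._+_ (countVec-cong m (λ v → eq (true V.∷ v))) (countVec-cong m (λ v → eq (false V.∷ v)))

  -- Selected lozenges move one at a time into the accumulator `μ`, so that hopeless selections can
  -- be cut off before all choices are made.
  countVec-total : ∀ Ls μ →
    countVec (length Ls) (λ s → valid (λ t → multiplicity (zip (toList s) Ls) t ℕ.+ μ t)) ≡ total Ls μ
  countVec-total []       μ = refl
  countVec-total (L ∷ Ls) μ = cong₂ ℕ._+_
    (trans (countVec-cong (length Ls) (λ v → valid-cong (λ t → step (multiplicity (zip (toList v) Ls) t) t)))
           (countVec-total Ls (add L μ)))
    (countVec-total Ls μ)
    where
    step : ∀ m t → (if covers L t then suc m else m) ℕ.+ μ t ≡ m ℕ.+ add L μ t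
    step m t with covers L t
    ... | true  = sym (ℕP.+-suc m (μ t))
    ... | false = refl

  -- Covering numbers only grow, so a triangle covered twice, inside or free, rules out every
  -- completion.
  total-over : ∀ Ls {μ t} → t ∈ ins ⊎ t ∈ fr → 2 ≤ μ t → total Ls μ ≡ 0
  total-over [] {μ} {t} t∈ 2≤ with valid μ in eq
  ... | false = refl
  ... | true with ∧-split {all (λ t → μ t ≡ᵇ 1) ins} eq
  ... | p , q with t∈
  ... | inj₁ t∈ins = ⊥-elim (bad (μ t) 2≤ (all-sound _ ins p t∈ins))
    where bad : ∀ m → 2 ≤ m → (m ≡ᵇ 1) ≡ true → ⊥
          bad (suc (suc m)) _ ()
          bad (suc zero) (s≤s ()) _
  ... | inj₂ t∈fr = ⊥-elim (bad (μ t) 2≤ (all-sound _ fr q t∈fr))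
    where bad : ∀ m → 2 ≤ m → (m ≤ᵇ 1) ≡ true → ⊥
          bad (suc (suc m)) _ ()
          bad (suc zero) (s≤s ()) _
  total-over (L ∷ Ls) {μ} {t} t∈ 2≤ = cong₂ ℕ._+_ (total-over Ls t∈ (more (covers L t))) (total-over Ls t∈ 2≤)
    where more : ∀ b → 2 ≤ (if b then suc (μ t) else μ t)
          more true  = ℕP.m≤n⇒m≤1+n 2≤
          more false = 2≤

  -- The opposite cut: an inside triangle that no remaining lozenge touches stays uncovered.
  total-under : ∀ Ls {μ t} → t ∈ ins → μ t ≡ 0 → (∀ {L} → L ∈ Ls → covers L t ≡ false) → total Ls μ ≡ 0
  total-under [] {μ} {t} t∈ eq0 _ with valid μ in eq
  ... | false = refl
  ... | true with all-sound _ ins (proj₁ (∧-split {all (λ t → μ t ≡ᵇ 1) ins} eq)) t∈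
  ... | eq1 rewrite eq0 with () ← eq1
  total-under (L ∷ Ls) {μ} {t} t∈ eq0 un = cong₂ ℕ._+_ (total-under Ls t∈ same (un ∘ there)) (total-under Ls t∈ eq0 (un ∘ there))
    where same : add L μ t ≡ 0
          same rewrite un (here refl) = eq0

  total-skip : ∀ l rs Ls {μ} → l ∈ ins → μ l ≡ 1 → total (map (l ,_) rs ++ Ls) μ ≡ total Ls μ
  total-skip l []       Ls l∈ eq = refl
  total-skip l (r ∷ rs) Ls {μ} l∈ eq =
    cong₂ ℕ._+_ (total-over (map (l ,_) rs ++ Ls) (inj₁ l∈) two) (total-skip l rs Ls l∈ eq)
    where two : 2 ≤ add (l , r) μ l
          two rewrite covers-left l r | eq = s≤s (s≤s z≤n)

  -- Lozenges are listed by their left-pointing triangle, so the block of `l` is the only chance to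
  -- cover `l`, and exactly one of its members must be taken. This turns a sum over subsets into a
  -- sum over choices.
  total-choose : ∀ l rs Ls {μ} → l ∈ ins → μ l ≡ 0 → (∀ {L} → L ∈ Ls → covers L l ≡ false) →
                 total (map (l ,_) rs ++ Ls) μ ≡ sumOver (λ r → total Ls (add (l , r) μ)) rs
  total-choose l []       Ls l∈ eq un = total-under Ls l∈ eq un
  total-choose l (r ∷ rs) Ls {μ} l∈ eq un =
    cong₂ ℕ._+_ (total-skip l rs Ls l∈ one) (total-choose l rs Ls l∈ eq un)
    where one : add (l , r) μ l ≡ 1
          one rewrite covers-left l r | eq = refl

M-total : ∀ Reg → M Reg ≡ Cover.total (inside Reg) (free Reg) (lozenges Reg) (λ _ → 0)
M-total Reg = trans
  (countVec-cong (length (lozenges Reg)) (λ s → valid-cong {multiplicity (zip (toList s) (lozenges Reg))} (λ t → sym (ℕP.+-identityʳ _))))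
  (countVec-total (lozenges Reg) (λ _ → 0))
  where open Cover (inside Reg) (free Reg)

-- Matching the left-pointing triangles one by one

false≢true : false ≢ true
false≢true ()

≡ᵇ-refl : ∀ m → (m ≡ᵇ m) ≡ true
≡ᵇ-refl zero    = refl
≡ᵇ-refl (suc m) = ≡ᵇ-refl m

≡ᵇ-sound : ∀ m n → (m ≡ᵇ n) ≡ true → m ≡ n
≡ᵇ-sound zero    zero    _ = refl
≡ᵇ-sound (suc m) (suc n) e = cong suc (≡ᵇ-sound m n e)

remove : ℕ → ℕ → (ℕ → ℕ → Bool) → ℕ → ℕ → Bool
remove σ j S τ i = S τ i ∧ not ((τ ≡ᵇ σ) ∧ (i ≡ᵇ j))

remove-same : ∀ σ j S → remove σ j S σ j ≡ false
remove-same σ j S rewrite ≡ᵇ-refl σ | ≡ᵇ-refl j = ∧-zeroʳ _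

remove-other : ∀ σ j S {τ i} → (τ ≡ σ → i ≡ j → ⊥) → remove σ j S τ i ≡ S τ i
remove-other σ j S {τ} {i} ne with τ ≡ᵇ σ in e₁ | i ≡ᵇ j in e₂
... | true  | true  = ⊥-elim (ne (≡ᵇ-sound τ σ e₁) (≡ᵇ-sound i j e₂))
... | true  | false = ∧-identityʳ _
... | false | _     = ∧-identityʳ _

lower : (ℕ → ℕ) → ℕ → ℕ
lower f zero    = 0
lower f (suc i) = f i

lower-cong : ∀ {f g} → (∀ j → f j ≡ g j) → ∀ i → lower f i ≡ lower g i
lower-cong eq zero    = refl
lower-cong eq (suc i) = eq i

module Transfer (cR : ℕ → ℕ → Bool) (insR : List (ℕ × ℕ)) where
  -- Used for the two neighbours on the line farther from ℓ. They may lie outside the region or in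
  -- the hole, hence the test `cR`; the neighbour across the vertical side always exists, inside or
  -- free.
  try : (ℕ → ℕ → Bool) → ((ℕ → ℕ → Bool) → ℕ) → ℕ → ℕ → ℕ
  try S F σ j = if cR σ j ∧ S σ j then F (remove σ j S) else 0

  -- The number of ways to match the left-pointing triangles in ls, one after the other, if the
  -- right-pointing triangles not yet covered are those in S.
  matchings : List (ℕ × ℕ) → (ℕ → ℕ → Bool) → ℕ
  matchings []             S = if all (λ (σ , j) → not (S σ j)) insR then 1 else 0
  matchings ((τ , i) ∷ ls) S =
    lower (try S (matchings ls) (suc τ)) i ℕ.+ try S (matchings ls) (suc τ) i
    ℕ.+ (if S τ i then matchings ls (remove τ i S) else 0)

-- L τ i and R τ i are the i-th triangles (from below) of the two kinds
-- with vertical side on the lattice line at distance τ from ℓ.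
module Coordinates (c : ℕ) where
  height : ℕ → ℕ → ℤ
  height τ i = ℤ.- + c ℤ.+ + (τ ℕ.+ 2 ℕ.* i)

  L R : ℕ → ℕ → Tri
  L τ i = tri ◁ (ℤ.- + τ) (height τ i)
  R τ i = tri ▷ (ℤ.- + τ) (height τ i)

  height-inj : ∀ τ {i j} → height τ i ≡ height τ j → i ≡ j
  height-inj τ e = ℕP.*-cancelˡ-≡ _ _ 2
    (ℕP.+-cancelˡ-≡ τ _ _ (ℤP.+-injective (∙-cancelˡ (ℤ.- + c) _ _ e)))

  R-inj : ∀ {σ j τ i} → R σ j ≡ R τ i → σ ≡ τ × j ≡ i
  R-inj {σ} e with ℤP.+-injective (ℤP.neg-injective (cong Tri.col e))
  ... | refl = refl , height-inj σ (cong Tri.low e)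

  L-inj : ∀ {σ j τ i} → L σ j ≡ L τ i → σ ≡ τ × j ≡ i
  L-inj {σ} e with ℤP.+-injective (ℤP.neg-injective (cong Tri.col e))
  ... | refl = refl , height-inj σ (cong Tri.low e)

  L′ : ℕ × ℕ → Tri
  L′ (τ , i) = L τ i

  module Matching (ins fr : List Tri) (rs : Tri → List Tri) (cR : ℕ → ℕ → Bool) (insR : List (ℕ × ℕ)) where
    open Cover ins fr

    open Transfer cR insR

    lozengesAt : List (ℕ × ℕ) → List (Tri × Tri)
    lozengesAt ls = concatMap (λ l → map (l ,_) (rs l)) (map L′ ls)

    module _
      (ins-R : ∀ {t} → t ∈ ins → isDir ▷ t ≡ true → ∃₂ λ σ j → (σ , j) ∈ insR × t ≡ R σ j)
      (insR-ins : ∀ {σ j} → (σ , j) ∈ insR → R σ j ∈ ins)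
      (fr-R : ∀ {t} → t ∈ fr → ∃₂ λ σ j → t ≡ R σ j)
      (cR-ins : ∀ {σ j} → cR σ j ≡ true → R σ j ∈ ins)
      where

      -- The invariants: a left-pointing triangle is covered once or is still ahead in `ls`, and `S`
      -- marks the right-pointing triangles with covering number 0. So all that matters of `μ` is
      -- `S`.
      total-matchings : ∀ ls μ S → Unique ls →
        (∀ {τ i} → (τ , i) ∈ ls → ∀ g → sumOver g (rs (L τ i)) ≡
            lower (λ j → if cR (suc τ) j then g (R (suc τ) j) else 0) i
            ℕ.+ (if cR (suc τ) i then g (R (suc τ) i) else 0) ℕ.+ g (R τ i)) →
        (∀ {τ i} → (τ , i) ∈ ls → L τ i ∈ ins × (R τ i ∈ ins ⊎ R τ i ∈ fr)) →
        (∀ {t} → t ∈ ins → isDir ◁ t ≡ true → t ∈ map L′ ls ⊎ μ t ≡ 1) →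
        (∀ {l} → l ∈ ls → μ (L′ l) ≡ 0) →
        (∀ σ j → R σ j ∈ ins ⊎ R σ j ∈ fr → μ (R σ j) ≡ (if S σ j then 0 else 1)) →
        (∀ {l r} → r ∈ rs l → isDir ▷ r ≡ true) →
        total (lozengesAt ls) μ ≡ matchings ls S
      total-matchings [] μ S _ nb mem hL h0 hR rsR = cong (λ b → if b then 1 else 0) (ends _ _ refl refl)
        where
        ends : ∀ a b → valid μ ≡ a → all (λ (σ , j) → not (S σ j)) insR ≡ b → valid μ ≡ all (λ (σ , j) → not (S σ j)) insR
        ends true true p q = trans p (sym q)
        ends false false p q = trans p (sym q)
        ends true false p q = ⊥-elim (false≢true (trans (sym q) (all-complete _ insR allS)))
          where
          allS : ∀ {a} → a ∈ insR → not (S (proj₁ a) (proj₂ a)) ≡ true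
          allS {σ , j} m with S σ j in eS | hR σ j (inj₁ (insR-ins m)) | all-sound _ ins (proj₁ (∧-split {all (λ t → μ t ≡ᵇ 1) ins} p)) (insR-ins m)
          ... | false | _ | _ = refl
          ... | true  | e | e₁ rewrite e with () ← e₁
        ends false true p q = ⊥-elim (false≢true (trans (sym p) (cong₂ _∧_ (all-complete _ ins allI) (all-complete _ fr allF))))
          where
          allI : ∀ {t} → t ∈ ins → (μ t ≡ᵇ 1) ≡ true
          allI {tri ◁ a Y} m with hL m refl
          ... | inj₂ e rewrite e = refl
          allI {tri ▷ a Y} m with ins-R m refl
          ... | σ , j , m′ , refl with S σ j | hR σ j (inj₁ m) | all-sound _ insR q m′
          ... | false | e | _ rewrite e = refl
          ... | true  | _ | ()
          allF : ∀ {t} → t ∈ fr → (μ t ≤ᵇ 1) ≡ true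
          allF m with fr-R m
          ... | σ , j , refl with S σ j | hR σ j (inj₂ m)
          ... | true  | e rewrite e = refl
          ... | false | e rewrite e = refl
      total-matchings ((τ , i) ∷ ls) μ S (new ∷ uniq) nb mem hL h0 hR rsR = trans
        (total-choose (L τ i) (rs (L τ i)) (lozengesAt ls) (proj₁ (mem (here refl))) (h0 (here refl)) untouched)
        (trans (nb (here refl) _)
          (cong₂ ℕ._+_ (cong₂ ℕ._+_ (lower-cong at i) (at i)) (atR (S τ i) refl)))
        where
        untouched : ∀ {L₁} → L₁ ∈ lozengesAt ls → covers L₁ (L τ i) ≡ false
        untouched m with ∈-concatMap⁻ (λ l → map (l ,_) (rs l)) {xs = map L′ ls} m
        ... | q = go ls new q
          where
          go : ∀ ls → All (λ y → ¬ ((τ , i) ≡ y)) ls → ∀ {L₁} → Any (λ l → L₁ ∈ map (l ,_) (rs l)) (map L′ ls) → covers L₁ (L τ i) ≡ false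
          go ((σ , j) ∷ ls) (ne ∷ _) (here p) with ∈-map⁻ _ p
          ... | r , r∈ , refl = covers-other {L σ j} {r} {L τ i}
            (λ e → ne (let (a , b) = L-inj {σ} {j} {τ} {i} e in sym (cong₂ _,_ a b)))
            (λ { refl → false≢true (rsR r∈) })
          go (_ ∷ ls) (_ ∷ nes) (there p) = go ls nes p
        μ′ : ℕ → ℕ → Tri → ℕ
        μ′ σ j = add (L τ i , R σ j) μ
        next : ∀ σ j → (R σ j ∈ ins ⊎ R σ j ∈ fr) → ∀ b → S σ j ≡ b →
               total (lozengesAt ls) (μ′ σ j) ≡ (if b then matchings ls (remove σ j S) else 0)
        next σ j m false eS = total-over (lozengesAt ls) m two
          where
          two : 2 ≤ μ′ σ j (R σ j)
          two rewrite covers-right (L τ i) (R σ j) | hR σ j m | eS = s≤s (s≤s z≤n)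
        next σ j m true eS = total-matchings ls (μ′ σ j) (remove σ j S) uniq (nb ∘ there) (mem ∘ there) hL′ h0′ hR′ rsR
          where
          hL′ : ∀ {t} → t ∈ ins → isDir ◁ t ≡ true → t ∈ map L′ ls ⊎ μ′ σ j t ≡ 1
          hL′ {t} t∈ d with hL t∈ d
          ... | inj₁ (here refl) rewrite covers-left (L τ i) (R σ j) | h0 (here refl) = inj₂ refl
          ... | inj₁ (there q) = inj₁ q
          ... | inj₂ e rewrite covers-other {L τ i} {R σ j} {t}
                         (λ { refl → ℕP.0≢1+n (trans (sym (h0 (here refl))) e) }) (λ { refl → false≢true d }) = inj₂ e
          h0′ : ∀ {l} → l ∈ ls → μ′ σ j (L′ l) ≡ 0
          h0′ {τ′ , i′} l∈ rewrite covers-other {L τ i} {R σ j} {L τ′ i′}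
              (λ e → All.lookup new l∈ (let (a , b) = L-inj {τ} {i} {τ′} {i′} e in cong₂ _,_ a b)) (λ ()) = h0 (there l∈)
          hR′ : ∀ σ′ j′ → R σ′ j′ ∈ ins ⊎ R σ′ j′ ∈ fr → μ′ σ j (R σ′ j′) ≡ (if remove σ j S σ′ j′ then 0 else 1)
          hR′ σ′ j′ m′ with σ′ ℕ.≟ σ | j′ ℕ.≟ j
          ... | yes refl | yes refl rewrite covers-right (L τ i) (R σ j) | remove-same σ j S | hR σ j m | eS = refl
          ... | no ne | _ rewrite covers-other {L τ i} {R σ j} {R σ′ j′} (λ ()) (λ e → ne (sym (proj₁ (R-inj {σ} {j} {σ′} {j′} e))))
                                | remove-other σ j S {σ′} {j′} (λ e _ → ne e) = hR σ′ j′ m′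
          ... | yes _ | no ne rewrite covers-other {L τ i} {R σ j} {R σ′ j′} (λ ()) (λ e → ne (sym (proj₂ (R-inj {σ} {j} {σ′} {j′} e))))
                                | remove-other σ j S {σ′} {j′} (λ _ e → ne e) = hR σ′ j′ m′
        at : ∀ j → (if cR (suc τ) j then total (lozengesAt ls) (μ′ (suc τ) j) else 0) ≡ try S (matchings ls) (suc τ) j
        at j with cR (suc τ) j in e
        ... | true  = next (suc τ) j (inj₁ (cR-ins e)) _ refl
        ... | false = refl
        atR : ∀ b → S τ i ≡ b → total (lozengesAt ls) (μ′ τ i) ≡ (if S τ i then matchings ls (remove τ i S) else 0)
        atR b eS = trans (next τ i (proj₂ (mem (here refl))) b eS) (cong (λ b → if b then _ else 0) (sym eS))

ℕ→ℚ-+ : ∀ a b → ℕ→ℚ (a ℕ.+ b) ≡ ℕ→ℚ a + ℕ→ℚ b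
ℕ→ℚ-+ a b = fromℤ-+ (+ a) (+ b)

-- Scanning the lattice line by line

range : ℕ → ℕ → List ℕ
range i zero    = []
range i (suc m) = i ∷ range (suc i) m

range-≥ : ∀ i m {j} → j ∈ range i m → i ≤ j
range-≥ i (suc m) (here refl) = ℕP.≤-refl
range-≥ i (suc m) (there p)   = ℕP.≤-trans (ℕP.n≤1+n i) (range-≥ (suc i) m p)

filterᵇ-⊆ : {A : Set} (p : A → Bool) (as : List A) {a : A} → a ∈ filterᵇ p as → a ∈ as × p a ≡ true
filterᵇ-⊆ p (b ∷ as) m with p b in e
filterᵇ-⊆ p (b ∷ as) (here refl) | true = here refl , e
filterᵇ-⊆ p (b ∷ as) (there m)   | true = let (x , y) = filterᵇ-⊆ p as m in there x , y
filterᵇ-⊆ p (b ∷ as) m           | false = let (x , y) = filterᵇ-⊆ p as m in there x , y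

filterᵇ-cong : {A : Set} {p q : A → Bool} (as : List A) → (∀ {a} → a ∈ as → p a ≡ q a) →
               filterᵇ p as ≡ filterᵇ q as
filterᵇ-cong [] eq = refl
filterᵇ-cong {p = p} {q} (a ∷ as) eq with p a | q a | eq (here refl)
... | true  | _ | refl = cong (a ∷_) (filterᵇ-cong as (eq ∘ there))
... | false | _ | refl = filterᵇ-cong as (eq ∘ there)

filterᵇ-snoc : ∀ (p : ℕ → Bool) i m →
  filterᵇ p (range i (suc m)) ≡ filterᵇ p (range i m) ++ (if p (i ℕ.+ m) then i ℕ.+ m ∷ [] else [])
filterᵇ-snoc p i zero rewrite ℕP.+-identityʳ i with p i
... | true  = refl
... | false = refl
filterᵇ-snoc p i (suc m) with p i | filterᵇ-snoc p (suc i) m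
... | true  | e rewrite ℕP.+-suc i m = cong (i ∷_) e
... | false | e rewrite ℕP.+-suc i m = e

range-< : ∀ i m {j} → j ∈ range i m → j < i ℕ.+ m
range-< i (suc m) (here refl) rewrite ℕP.+-suc i m = s≤s (ℕP.m≤m+n i m)
range-< i (suc m) (there p)   rewrite ℕP.+-suc i m = range-< (suc i) m p

-- All positions move by half a lattice unit; in the numbering by columns, j moves to j or to suc j.
spread : (List ℕ → ℚ) → List ℕ → ℚ
spread F []       = F []
spread F (j ∷ js) = spread (λ us → F (j ∷ us)) js + spread (λ us → F (suc j ∷ us)) js

spread-cong : ∀ {F G} → (∀ us → F us ≡ G us) → ∀ js → spread F js ≡ spread G js
spread-cong eq []       = eq []
spread-cong eq (j ∷ js) = cong₂ _+_ (spread-cong (λ us → eq (j ∷ us)) js) (spread-cong (λ us → eq (suc j ∷ us)) js)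

spread-zero : ∀ {F} → (∀ us → F us ≡ 0ℚ) → ∀ js → spread F js ≡ 0ℚ
spread-zero eq []       = eq []
spread-zero eq (j ∷ js) rewrite spread-zero (λ us → eq (j ∷ us)) js | spread-zero (λ us → eq (suc j ∷ us)) js = refl

module Scan (cR : ℕ → ℕ → Bool) (insR : List (ℕ × ℕ)) (okL : ℕ → ℕ → Bool)
            (cR-insR : ∀ {σ j} → cR σ j ≡ true → (σ , j) ∈ insR) where
  open Transfer cR insR

  -- Negation of the three adjacencies: `L τ i` touches `R τ i`, `R (suc τ) i` and, one position
  -- lower, `R (suc τ) (i - 1)`.
  Away : ℕ → ℕ → ℕ × ℕ → Set
  Away σ j (τ , i) = (τ ≡ σ → i ≡ j → ⊥) × (suc τ ≡ σ → i ≡ j → ⊥) × (suc τ ≡ σ → i ≡ suc j → ⊥)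

  -- Each step removes from `S` only a neighbour of the current triangle, so `R σ j` survives to the
  -- end and spoils the final test.
  matchings-under : ∀ ls {S σ j} → cR σ j ≡ true → S σ j ≡ true → (∀ {l} → l ∈ ls → Away σ j l) →
                    matchings ls S ≡ 0
  matchings-under [] {S} {σ} {j} c∈ s away with all (λ (σ , j) → not (S σ j)) insR in e
  ... | false = refl
  ... | true with all-sound _ insR e (cR-insR c∈)
  ... | e′ rewrite s with () ← e′
  matchings-under ((τ , i) ∷ ls) {S} {σ} {j} c∈ s away with away (here refl)
  ... | ne₁ , ne₂ , ne₃ = cong₂ ℕ._+_ (cong₂ ℕ._+_ (low i refl) (at i ne₂)) right
    where
    dead : ∀ σ′ j′ → (σ ≡ σ′ → j ≡ j′ → ⊥) → matchings ls (remove σ′ j′ S) ≡ 0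
    dead σ′ j′ ne = matchings-under ls c∈ (trans (remove-other σ′ j′ S ne) s) (away ∘ there)
    at : ∀ j′ → (suc τ ≡ σ → j′ ≡ j → ⊥) → try S (matchings ls) (suc τ) j′ ≡ 0
    at j′ ne with cR (suc τ) j′ ∧ S (suc τ) j′
    ... | true  = dead (suc τ) j′ (λ p q → ne (sym p) (sym q))
    ... | false = refl
    low : ∀ i′ → i′ ≡ i → lower (try S (matchings ls) (suc τ)) i′ ≡ 0
    low zero     _    = refl
    low (suc i′) refl = at i′ (λ p q → ne₃ p (cong suc q))
    right : (if S τ i then matchings ls (remove τ i S) else 0) ≡ 0
    right with S τ i
    ... | true  = dead τ i (λ p q → ne₁ (sym p) (sym q))
    ... | false = refl

  column : ℕ → ℕ → ℕ → List (ℕ × ℕ)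
  column τ i m = map (τ ,_) (filterᵇ (okL τ) (range i m))

  -- the left-pointing triangles to the right of the line τ
  rightOf : ℕ → ℕ → List (ℕ × ℕ)
  rightOf zero    d = []
  rightOf (suc τ) d = column τ 0 (suc d) ++ rightOf τ (suc d)

  column-∈ : ∀ τ i m {l} → l ∈ column τ i m → proj₁ l ≡ τ × i ≤ proj₂ l
  column-∈ τ i m p with ∈-map⁻ _ p
  ... | j , q , refl = refl , range-≥ i m (proj₁ (filterᵇ-⊆ (okL τ) (range i m) q))

  rightOf-∈ : ∀ τ d {l} → l ∈ rightOf τ d → proj₁ l < τ
  rightOf-∈ (suc τ) d p with ∈-++⁻ (column τ 0 (suc d)) p
  ... | inj₁ q rewrite proj₁ (column-∈ τ 0 (suc d) q) = ℕP.≤-refl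
  ... | inj₂ q = ℕP.m≤n⇒m≤1+n (rightOf-∈ τ (suc d) q)

  pendingBelow : (ℕ → ℕ → Bool) → ℕ → ℕ → Bool
  pendingBelow S σ zero    = false
  pendingBelow S σ (suc j) = cR σ j ∧ S σ j

  oneIf : Bool → ℕ
  oneIf b = if b then 1 else 0

  -- The situation when line τ has been scanned up to position `i`. On line τ + 1, `U` marks the
  -- right-pointing triangles from `i` on that still wait to be covered, and `p` tells whether the
  -- one just below `i` waits; only `L τ i` can still serve it. On line τ, `acc` lists the positions
  -- below `i` that stay open for the next line. Positions in the hole are kept out of `acc`, and
  -- `holes` records that they are open.
  record State (τ i : ℕ) (S : ℕ → ℕ → Bool) (U : ℕ → Bool) (acc : List ℕ) (p : Bool) : Set where
    field
      below   : ∀ j → suc j < i → cR (suc τ) j ≡ true → S (suc τ) j ≡ false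
      last    : pendingBelow S (suc τ) i ≡ p
      pending : ∀ j → i ≤ j → cR (suc τ) j ∧ S (suc τ) j ≡ U j
      fresh   : ∀ j → i ≤ j → S τ j ≡ true
      untouched : ∀ σ j → σ < τ → S σ j ≡ true
      done    : ∀ σ j → suc τ < σ → cR σ j ≡ true → S σ j ≡ false
      holes     : ∀ j → okL τ j ≡ false → S τ j ≡ true
      open-acc : filterᵇ (λ j → okL τ j ∧ S τ j) (range 0 i) ≡ acc

  -- Of the Pfaffian the scan sees only an abstract `G`: it vanishes on repetitions (`dup`) and on
  -- positions in the hole (`kill`), and it gives the count for what the scan leaves (`rest`). The
  -- number `ℓ` of walks is constant.
  module Column (τ d : ℕ) (G : List ℕ → ℚ) (ℓ : ℕ)
    (edge : ∀ j → d ≤ j → cR (suc τ) j ≡ false)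
    (dup : ∀ as i us → G (as ++ i ∷ i ∷ us) ≡ 0ℚ)
    (kill : ∀ i → okL τ i ≡ false → ∀ as us → G (as ++ i ∷ us) ≡ 0ℚ)
    (rest : ∀ S acc → (∀ σ j → τ < σ → cR σ j ≡ true → S σ j ≡ false) → (∀ σ j → σ < τ → S σ j ≡ true) →
            (∀ j → okL τ j ≡ false → S τ j ≡ true) →
            filterᵇ (λ j → okL τ j ∧ S τ j) (range 0 (suc d)) ≡ acc → length acc ≡ ℓ →
            ℕ→ℚ (matchings (rightOf τ (suc d)) S) ≡ G acc)
    where

    -- Each waiting triangle `j` moves to `j` or `suc j`. If the one below `i` has passed over its
    -- lower option, it occupies `i`.
    value : (acc : List ℕ) (i : ℕ) → Bool → List ℕ → ℚ
    value acc i true  js = spread (λ us → G (acc ++ i ∷ us)) js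
    value acc i false js = spread (λ us → G (acc ++ us)) js

    away : ∀ i m j → suc j ≤ i → ∀ {l} → l ∈ column τ (suc i) m ++ rightOf τ (suc d) → Away (suc τ) j l
    away i m j j<i p with ∈-++⁻ (column τ (suc i) m) p
    ... | inj₁ q with column-∈ τ (suc i) m q
    ... | refl , i<l = (λ e _ → ℕP.1+n≢n (sym e)) , (λ { _ refl → ℕP.<-asym j<i i<l }) , (λ { _ refl → ℕP.<-irrefl refl (ℕP.≤-trans i<l j<i) })
    away i m j j<i {l} p | inj₂ q with rightOf-∈ τ (suc d) q
    ... | l<τ = (λ { refl _ → ℕP.<-asym l<τ (ℕP.n<1+n τ) }) , (λ { refl _ → ℕP.<-irrefl refl l<τ }) , (λ { refl _ → ℕP.<-irrefl refl l<τ })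

    open-step : ∀ {S : ℕ → ℕ → Bool} {acc i} → filterᵇ (λ j → okL τ j ∧ S τ j) (range 0 i) ≡ acc →
                ∀ (S′ : ℕ → ℕ → Bool) b → (∀ j → j < i → S′ τ j ≡ S τ j) → okL τ i ∧ S′ τ i ≡ b →
                filterᵇ (λ j → okL τ j ∧ S′ τ j) (range 0 (suc i)) ≡ acc ++ (if b then i ∷ [] else [])
    open-step {S} {acc} {i} eq S′ b same at = trans (filterᵇ-snoc _ 0 i)
      (cong₂ _++_ (trans (filterᵇ-cong (range 0 i) (λ {j} m → cong (okL τ j ∧_) (same j (range-< 0 i m)))) eq)
                  (cong (λ b → if b then i ∷ [] else []) at))

    column-skip : ∀ i m → okL τ i ≡ false → column τ i (suc m) ≡ column τ (suc i) m
    column-skip i m e rewrite e = refl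

    column-take : ∀ i m → okL τ i ≡ true → column τ i (suc m) ≡ (τ , i) ∷ column τ (suc i) m
    column-take i m e rewrite e = refl

    -- A step at position `i` changes `S` at most at the three neighbours of `L τ i`; everything
    -- else in the state carries over.
    advance : ∀ {i S U acc p} → State τ i S U acc p → ∀ S′ p′ b →
      (∀ σ j → (σ ≡ suc τ → suc j ≡ i ⊎ j ≡ i → ⊥) → (σ ≡ τ → j ≡ i → ⊥) → S′ σ j ≡ S σ j) →
      pendingBelow S′ (suc τ) i ≡ false → cR (suc τ) i ∧ S′ (suc τ) i ≡ p′ → okL τ i ∧ S′ τ i ≡ b → (okL τ i ≡ false → S′ τ i ≡ true) →
      State τ (suc i) S′ U (acc ++ (if b then i ∷ [] else [])) p′
    advance {i} {S} st S′ p′ b same nb pb ob hb = record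
      { below     = λ j j<i c → below′ j c (ℕP.m≤n⇒m<n∨m≡n j<i)
      ; last      = pb
      ; pending   = λ j i<j → trans (cong (cR (suc τ) j ∧_) (same (suc τ) j (λ _ → λ { (inj₁ refl) → ℕP.<-asym i<j (ℕP.n<1+n _) ; (inj₂ refl) → ℕP.<-irrefl refl i<j }) (λ e _ → ℕP.1+n≢n e)))
                            (State.pending st j (ℕP.<⇒≤ i<j))
      ; fresh     = λ j i<j → trans (same τ j (λ e _ → ℕP.1+n≢n (sym e)) (λ { _ refl → ℕP.<-irrefl refl i<j })) (State.fresh st j (ℕP.<⇒≤ i<j))
      ; untouched = λ σ j σ<τ → trans (same σ j (λ { refl _ → ℕP.<-asym σ<τ (ℕP.n<1+n _) }) (λ { refl _ → ℕP.<-irrefl refl σ<τ })) (State.untouched st σ j σ<τ)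
      ; done      = λ σ j τ<σ c → trans (same σ j (λ { refl _ → ℕP.<-irrefl refl τ<σ }) (λ { refl _ → ℕP.<-asym τ<σ (ℕP.n<1+n _) })) (State.done st σ j τ<σ c)
      ; holes     = hole
      ; open-acc  = open-step {S} (State.open-acc st) S′ b (λ j j<i → same τ j (λ e _ → ℕP.1+n≢n (sym e)) (λ { _ refl → ℕP.<-irrefl refl j<i })) ob
      }
      where
      hole : ∀ j → okL τ j ≡ false → S′ τ j ≡ true
      hole j e with j ℕ.≟ i
      ... | yes refl = hb e
      ... | no ne = trans (same τ j (λ e _ → ℕP.1+n≢n (sym e)) (λ _ → ne)) (State.holes st j e)
      below′ : ∀ j → cR (suc τ) j ≡ true → suc (suc j) < suc i ⊎ suc (suc j) ≡ suc i → S′ (suc τ) j ≡ false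
      below′ j c (inj₁ (s≤s lt)) = trans (same (suc τ) j (λ _ → λ { (inj₁ refl) → ℕP.<-irrefl refl lt ; (inj₂ refl) → ℕP.<-asym lt (ℕP.n<1+n _) }) (λ e _ → ℕP.1+n≢n e)) (State.below st j lt c)
      below′ j c (inj₂ refl) = trans (sym (cong (_∧ S′ (suc τ) j) c)) nb

    length-filter : ∀ U i m → length (filterᵇ U (range i (suc m))) ≡ oneIf (U i) ℕ.+ length (filterᵇ U (range (suc i) m))
    length-filter U i m with U i
    ... | true  = refl
    ... | false = refl

    try-zero : ∀ {S : ℕ → ℕ → Bool} {F : (ℕ → ℕ → Bool) → ℕ} {σ j} → F (remove σ j S) ≡ 0 → try S F σ j ≡ 0
    try-zero {S} {F} {σ} {j} e with cR σ j ∧ S σ j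
    ... | true  = e
    ... | false = refl

    ∧-left : ∀ {a b} → a ∧ b ≡ true → a ≡ true
    ∧-left {true} _ = refl

    ∧-right : ∀ {a b} → a ∧ b ≡ true → b ≡ true
    ∧-right {true} e = e

    ∧-false : ∀ a → a ∧ false ≡ false
    ∧-false true  = refl
    ∧-false false = refl

    try-true : ∀ {S : ℕ → ℕ → Bool} {F : (ℕ → ℕ → Bool) → ℕ} {σ j} → cR σ j ∧ S σ j ≡ true → try S F σ j ≡ F (remove σ j S)
    try-true e rewrite e = refl

    try-false : ∀ {S : ℕ → ℕ → Bool} {F : (ℕ → ℕ → Bool) → ℕ} {σ j} → cR σ j ∧ S σ j ≡ false → try S F σ j ≡ 0
    try-false e rewrite e = refl

    right-true : ∀ {S : ℕ → ℕ → Bool} {F : (ℕ → ℕ → Bool) → ℕ} {i} → S τ i ≡ true → (if S τ i then F (remove τ i S) else 0) ≡ F (remove τ i S)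
    right-true e rewrite e = refl

    value-snoc : ∀ acc i p js → value (acc ++ (i ∷ [])) (suc i) p js ≡ (if p then spread (λ us → G (acc ++ i ∷ suc i ∷ us)) js else spread (λ us → G (acc ++ i ∷ us)) js)
    value-snoc acc i true  js = spread-cong (λ us → cong G (++-assoc acc (i ∷ []) _)) js
    value-snoc acc i false js = spread-cong (λ us → cong G (++-assoc acc (i ∷ []) _)) js

    value-nil : ∀ acc i p js → value (acc ++ []) i p js ≡ value acc i p js
    value-nil acc i p js rewrite ++-identityʳ acc = refl

    -- Here collisions disappear: with `i` occupied, a walk waiting at `i` is forced upwards, and
    -- its other term contains `i` twice and is 0 by `dup`.
    value-up : ∀ acc i U m → (if U i then spread (λ us → G (acc ++ i ∷ suc i ∷ us)) (filterᵇ U (range (suc i) m)) else spread (λ us → G (acc ++ i ∷ us)) (filterᵇ U (range (suc i) m)))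
               ≡ spread (λ us → G (acc ++ i ∷ us)) (filterᵇ U (range i (suc m)))
    value-up acc i U m with U i
    ... | false = refl
    ... | true  = sym (trans (cong₂ _+_ (spread-zero (λ us → dup acc i us) (filterᵇ U (range (suc i) m))) refl) (ℚP.+-identityˡ _))

    -- With `i` still empty, the triangle waiting at `i` takes it or is deferred to `suc i`; these
    -- are the two halves of `spread`.
    value-both : ∀ acc i U m → (if U i then spread (λ us → G (acc ++ i ∷ us)) (filterᵇ U (range (suc i) m)) else 0ℚ)
                 + value acc (suc i) (U i) (filterᵇ U (range (suc i) m))
               ≡ spread (λ us → G (acc ++ us)) (filterᵇ U (range i (suc m)))
    value-both acc i U m with U i
    ... | false = ℚP.+-identityˡ _
    ... | true  = refl

    Scanned : ℕ → ℕ → (ℕ → ℕ → Bool) → (ℕ → Bool) → List ℕ → Bool → Set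
    Scanned m i S U acc p = State τ i S U acc p → i ℕ.+ m ≡ suc d →
           length acc ℕ.+ (oneIf p ℕ.+ length (filterᵇ U (range i m))) ≡ ℓ →
           ℕ→ℚ (matchings (column τ i m ++ rightOf τ (suc d)) S) ≡ value acc i p (filterᵇ U (range i m))

    scan : ∀ m i S U acc p → Scanned m i S U acc p
    scan zero i S U acc p st i≡ len rewrite ℕP.+-identityʳ i with i≡
    -- Line τ has one position more than line τ + 1, so nothing can be waiting beyond the last
    -- position.
    ... | refl with p | trans (sym (cong (_∧ S (suc τ) d) (edge d ℕP.≤-refl))) (State.last st)
    ... | true | ()
    ... | false | _ = trans
      (rest S acc dn (State.untouched st) (State.holes st) (State.open-acc st) (trans (sym (ℕP.+-identityʳ _)) len))
      (cong G (sym (++-identityʳ acc)))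
      where
      dn : ∀ σ j → τ < σ → cR σ j ≡ true → S σ j ≡ false
      dn σ j τ<σ c with ℕP.m≤n⇒m<n∨m≡n τ<σ
      ... | inj₁ lt = State.done st σ j lt c
      ... | inj₂ refl with j ℕ.<? d
      ... | yes lt = State.below st j (s≤s lt) c
      ... | no nlt = ⊥-elim (false≢true (trans (sym (edge j (ℕP.≮⇒≥ nlt))) c))
    scan (suc m) i S U acc p st i≡ len = step (okL τ i) refl p refl
      where
      i≡′ : suc i ℕ.+ m ≡ suc d
      i≡′ = trans (sym (ℕP.+-suc i m)) i≡
      Ls : List (ℕ × ℕ)
      Ls = column τ (suc i) m ++ rightOf τ (suc d)
      js : List ℕ
      js = filterᵇ U (range (suc i) m)
      Ui : cR (suc τ) i ∧ S (suc τ) i ≡ U i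
      Ui = State.pending st i ℕP.≤-refl
      len′ : ∀ {p₀} → p ≡ p₀ → length acc ℕ.+ (oneIf p₀ ℕ.+ (oneIf (U i) ℕ.+ length js)) ≡ ℓ
      len′ refl = trans (cong (λ z → length acc ℕ.+ (oneIf p ℕ.+ z)) (sym (length-filter U i m))) len
      snoc-len : length (acc ++ i ∷ []) ≡ suc (length acc)
      snoc-len = trans (length-++ acc) (ℕP.+-comm (length acc) 1)
      Sd : ℕ → ℕ → ℕ → Bool
      Sd j₀ = remove (suc τ) j₀ S
      otherR : ∀ j₀ → suc j₀ ≡ i ⊎ j₀ ≡ i → ∀ σ j → (σ ≡ suc τ → suc j ≡ i ⊎ j ≡ i → ⊥) → (σ ≡ τ → j ≡ i → ⊥) → Sd j₀ σ j ≡ S σ j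
      otherR j₀ at σ j h _ = remove-other (suc τ) j₀ S (λ { refl refl → h refl at })
      nodead : ∀ j₀ → suc j₀ ≡ i → pendingBelow S (suc τ) i ≡ true → ∀ S′ → S′ (suc τ) j₀ ≡ S (suc τ) j₀ → matchings Ls S′ ≡ 0
      nodead j₀ refl e S′ same = matchings-under Ls (∧-left e) (trans same (∧-right e)) (away i m j₀ ℕP.≤-refl)

      takeLower : ∀ j₀ → suc j₀ ≡ i → p ≡ true → okL τ i ≡ true →
                  ℕ→ℚ (matchings Ls (Sd j₀)) ≡ spread (λ us → G (acc ++ i ∷ us)) (filterᵇ U (range i (suc m)))
      takeLower j₀ refl pt ok = trans (scan m (suc i) (Sd j₀) U (acc ++ i ∷ []) (U i)
          (advance st (Sd j₀) (U i) true (otherR j₀ (inj₁ refl))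
            (trans (cong (cR (suc τ) j₀ ∧_) (remove-same (suc τ) j₀ S)) (∧-false _))
            (trans (cong (cR (suc τ) i ∧_) (remove-other (suc τ) j₀ S (λ _ e → ℕP.1+n≢n e))) Ui)
            (trans (cong₂ _∧_ ok (remove-other (suc τ) j₀ S (λ e _ → ℕP.1+n≢n (sym e)))) (State.fresh st i ℕP.≤-refl)) (λ e → ⊥-elim (false≢true (trans (sym e) ok))))
          i≡′ (trans (cong (ℕ._+ (oneIf (U i) ℕ.+ length js)) snoc-len) (trans (sym (ℕP.+-suc _ _)) (len′ pt))))
        (trans (value-snoc acc i (U i) js) (value-up acc i U m))

      takeUpper : p ≡ false → okL τ i ≡ true → ∀ b → U i ≡ b →
                  ℕ→ℚ (try S (matchings Ls) (suc τ) i) ≡ (if b then spread (λ us → G (acc ++ i ∷ us)) js else 0ℚ)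
      takeUpper pf ok false e = cong ℕ→ℚ (try-false {S} {matchings Ls} (trans Ui e))
      takeUpper pf ok true  e = trans (cong ℕ→ℚ (try-true {S} {matchings Ls} (trans Ui e))) (trans (scan m (suc i) (Sd i) U (acc ++ i ∷ []) false
          (advance st (Sd i) false true (otherR i (inj₂ refl)) (lowerSame i refl)
            (trans (cong (cR (suc τ) i ∧_) (remove-same (suc τ) i S)) (∧-false _))
            (trans (cong₂ _∧_ ok (remove-other (suc τ) i S (λ e _ → ℕP.1+n≢n (sym e)))) (State.fresh st i ℕP.≤-refl)) (λ e → ⊥-elim (false≢true (trans (sym e) ok))))
          i≡′ (trans (cong (ℕ._+ length js) snoc-len) (trans (sym (ℕP.+-suc _ _)) (subst (λ u → length acc ℕ.+ (oneIf u ℕ.+ length js) ≡ ℓ) e (len′ pf)))))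
        (value-snoc acc i false js))
        where
        lowerSame : ∀ i′ → i′ ≡ i → pendingBelow (Sd i) (suc τ) i′ ≡ false
        lowerSame zero     _    = refl
        lowerSame (suc j₀) refl = trans (cong (cR (suc τ) j₀ ∧_) (remove-other (suc τ) i S (λ _ e → ℕP.1+n≢n (sym e)))) (trans (State.last st) pf)

      takeRight : p ≡ false → okL τ i ≡ true →
                  ℕ→ℚ (matchings Ls (remove τ i S)) ≡ value acc (suc i) (U i) js
      takeRight pf ok = trans (scan m (suc i) (remove τ i S) U (acc ++ []) (U i)
          (advance st (remove τ i S) (U i) false (λ σ j _ h → remove-other τ i S h) (lowerSame i refl)
            (trans (cong (cR (suc τ) i ∧_) (remove-other τ i S (λ e _ → ℕP.1+n≢n e))) Ui)
            (trans (cong (okL τ i ∧_) (remove-same τ i S)) (∧-false _)) (λ e → ⊥-elim (false≢true (trans (sym e) ok))))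
          i≡′ (subst (λ z → length z ℕ.+ (oneIf (U i) ℕ.+ length js) ≡ ℓ) (sym (++-identityʳ acc)) (len′ pf)))
        (value-nil acc (suc i) (U i) js)
        where
        lowerSame : ∀ i′ → i′ ≡ i → pendingBelow (remove τ i S) (suc τ) i′ ≡ false
        lowerSame zero     _    = refl
        lowerSame (suc j₀) refl = trans (cong (cR (suc τ) j₀ ∧_) (remove-other τ i S (λ e _ → ℕP.1+n≢n e))) (trans (State.last st) pf)

      skip : p ≡ false → okL τ i ≡ false → ℕ→ℚ (matchings Ls S) ≡ value acc (suc i) (U i) js
      skip pf ok = trans (scan m (suc i) S U (acc ++ []) (U i)
          (advance st S (U i) false (λ _ _ _ _ → refl) (trans (State.last st) pf) Ui (cong (_∧ S τ i) ok) (λ _ → State.fresh st i ℕP.≤-refl))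
          i≡′ (subst (λ z → length z ℕ.+ (oneIf (U i) ℕ.+ length js) ≡ ℓ) (sym (++-identityʳ acc)) (len′ pf)))
        (value-nil acc (suc i) (U i) js)

      split : okL τ i ≡ true → ℕ→ℚ (matchings (column τ i (suc m) ++ rightOf τ (suc d)) S) ≡
              ℕ→ℚ (lower (try S (matchings Ls) (suc τ)) i ℕ.+ try S (matchings Ls) (suc τ) i) + ℕ→ℚ (matchings Ls (remove τ i S))
      split ok = trans (cong (λ l → ℕ→ℚ (matchings (l ++ rightOf τ (suc d)) S)) (column-take i m ok))
        (trans (cong (λ z → ℕ→ℚ (lower (try S (matchings Ls) (suc τ)) i ℕ.+ try S (matchings Ls) (suc τ) i ℕ.+ z)) (right-true {S} {matchings Ls} (State.fresh st i ℕP.≤-refl)))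
               (ℕ→ℚ-+ (lower (try S (matchings Ls) (suc τ)) i ℕ.+ try S (matchings Ls) (suc τ) i) (matchings Ls (remove τ i S))))

      lowerTrue : ∀ i′ → i′ ≡ i → pendingBelow S (suc τ) i ≡ true → p ≡ true → okL τ i ≡ true →
                  ℕ→ℚ (lower (try S (matchings Ls) (suc τ)) i′ ℕ.+ try S (matchings Ls) (suc τ) i) + ℕ→ℚ (matchings Ls (remove τ i S))
                  ≡ spread (λ us → G (acc ++ i ∷ us)) (filterᵇ U (range i (suc m)))
      lowerTrue zero     refl () pt ok
      lowerTrue (suc j₀) refl e  pt ok = trans
        (cong₂ (λ a b → ℕ→ℚ a + ℕ→ℚ b)
          (trans (cong₂ ℕ._+_ (try-true {S} {matchings Ls} e) (try-zero {S} {matchings Ls} (nodead j₀ refl e (Sd i) (remove-other (suc τ) i S (λ _ e → ℕP.1+n≢n (sym e)))))) (ℕP.+-identityʳ _))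
          (nodead j₀ refl e (remove τ i S) (remove-other τ i S (λ e _ → ℕP.1+n≢n e))))
        (trans (ℚP.+-identityʳ _) (takeLower j₀ refl pt ok))

      lowerFalse : ∀ i′ → i′ ≡ i → p ≡ false → lower (try S (matchings Ls) (suc τ)) i′ ≡ 0
      lowerFalse zero     _    pf = refl
      lowerFalse (suc j₀) refl pf = try-false {S} {matchings Ls} (trans (State.last st) pf)

      deadHole : ∀ i′ → i′ ≡ i → pendingBelow S (suc τ) i ≡ true → matchings Ls S ≡ 0
      deadHole zero     refl ()
      deadHole (suc j₀) refl e = nodead j₀ refl e S refl

      step : ∀ ok → okL τ i ≡ ok → ∀ p₀ → p ≡ p₀ →
             ℕ→ℚ (matchings (column τ i (suc m) ++ rightOf τ (suc d)) S) ≡ value acc i p (filterᵇ U (range i (suc m)))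
      -- `L τ i` is the last neighbour of the triangle waiting below, so of its three options only
      -- that one survives.
      step true  ok true  refl = trans (split ok) (lowerTrue i refl (State.last st) refl ok)
      -- `L τ i` serves the triangle at `i` on its left, or covers the one across its vertical side,
      -- which leaves no walk at `i`.
      step true  ok false refl = trans (split ok) (trans
        (cong₂ _+_ (trans (cong (λ z → ℕ→ℚ (z ℕ.+ try S (matchings Ls) (suc τ) i)) (lowerFalse i refl refl)) (takeUpper refl ok (U i) refl))
                   (takeRight refl ok))
        (value-both acc i U m))
      -- The last neighbour of the waiting triangle lies in the hole, so it can never be covered; on
      -- the other side `kill` applies.
      step false ok true  refl = trans (cong (λ l → ℕ→ℚ (matchings (l ++ rightOf τ (suc d)) S)) (column-skip i m ok))
        (trans (cong ℕ→ℚ (deadHole i refl (State.last st))) (sym (spread-zero (kill i ok acc) (filterᵇ U (range i (suc m))))))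
      -- No walk may enter `i`; the missing half of `spread` is 0 by `kill`.
      step false ok false refl = trans (cong (λ l → ℕ→ℚ (matchings (l ++ rightOf τ (suc d)) S)) (column-skip i m ok))
        (trans (skip refl ok) (trans (sym (ℚP.+-identityˡ _)) (trans (cong₂ _+_ (sym (killed (U i))) refl) (value-both acc i U m))))
        where
        killed : ∀ b → (if b then spread (λ us → G (acc ++ i ∷ us)) js else 0ℚ) ≡ 0ℚ
        killed false = refl
        killed true  = spread-zero (kill i ok acc) js

self-neg-zero : ∀ {x} → x ≡ - x → x ≡ 0ℚ
self-neg-zero {x} e = trans (solve 1 (λ x → x := con (+ 1) :* x) refl x)
  (trans (cong (_* x) (refl {x = 1ℚ}))
  (trans (solve 2 (λ h x → (h :+ h) :* x := h :* (x :+ x)) refl ½ x)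
  (trans (cong (λ z → ½ * (x + z)) e)
  (trans (cong (½ *_) (ℚP.+-inverseʳ x)) (ℚP.*-zeroʳ ½)))))

-- Pfaffians

module _ {V : Set} where

  Form : Set
  Form = V → ℚ

  -- contraction of a function of lists (an alternating multilinear form) with a linear form
  ∂ : Form → (List V → ℚ) → List V → ℚ
  ∂ φ F []       = 0ℚ
  ∂ φ F (w ∷ ws) = φ w * F ws - ∂ φ (λ us → F (w ∷ us)) ws

  ∂-cong : ∀ {φ ψ F G} → (∀ v → φ v ≡ ψ v) → (∀ us → F us ≡ G us) → ∀ ws → ∂ φ F ws ≡ ∂ ψ G ws
  ∂-cong p q []       = refl
  ∂-cong p q (w ∷ ws) = cong₂ _-_ (cong₂ _*_ (p w) (q ws)) (∂-cong p (λ us → q (w ∷ us)) ws)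

  ∂-linear : ∀ φ F G a b ws → ∂ φ (λ us → a * F us + b * G us) ws ≡ a * ∂ φ F ws + b * ∂ φ G ws
  ∂-linear φ F G a b []       = solve 2 (λ a b → con (+ 0) := a :* con (+ 0) :+ b :* con (+ 0)) refl a b
  ∂-linear φ F G a b (w ∷ ws) =
    trans (cong (λ z → φ w * (a * F ws + b * G ws) - z) (∂-linear φ (F ∘ (w ∷_)) (G ∘ (w ∷_)) a b ws))
      (solve 7 (λ p a b f g x y → p :* (a :* f :+ b :* g) :- (a :* x :+ b :* y)
                                := a :* (p :* f :- x) :+ b :* (p :* g :- y)) refl
        (φ w) a b (F ws) (G ws) (∂ φ (F ∘ (w ∷_)) ws) (∂ φ (G ∘ (w ∷_)) ws))

  ∂-linearˡ : ∀ φ ψ F a b ws → ∂ (λ v → a * φ v + b * ψ v) F ws ≡ a * ∂ φ F ws + b * ∂ ψ F ws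
  ∂-linearˡ φ ψ F a b []       = solve 2 (λ a b → con (+ 0) := a :* con (+ 0) :+ b :* con (+ 0)) refl a b
  ∂-linearˡ φ ψ F a b (w ∷ ws) =
    trans (cong (λ z → (a * φ w + b * ψ w) * F ws - z) (∂-linearˡ φ ψ (F ∘ (w ∷_)) a b ws))
      (solve 7 (λ p q a b f x y → (a :* p :+ b :* q) :* f :- (a :* x :+ b :* y)
                                := a :* (p :* f :- x) :+ b :* (q :* f :- y)) refl
        (φ w) (ψ w) a b (F ws) (∂ φ (F ∘ (w ∷_)) ws) (∂ ψ (F ∘ (w ∷_)) ws))

  ∂-sub : ∀ φ F G ws → ∂ φ (λ us → F us - G us) ws ≡ ∂ φ F ws - ∂ φ G ws
  ∂-sub φ F G ws = trans (∂-cong (λ _ → refl) (λ us → solve 2 (λ f g → f :- g := con (+ 1) :* f :+ con (ℤ.- + 1) :* g) refl (F us) (G us)) ws)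
    (trans (∂-linear φ F G 1ℚ (- 1ℚ) ws) (solve 2 (λ f g → con (+ 1) :* f :+ con (ℤ.- + 1) :* g := f :- g) refl (∂ φ F ws) (∂ φ G ws)))

  ∂-scale : ∀ φ F a ws → ∂ φ (λ us → a * F us) ws ≡ a * ∂ φ F ws
  ∂-scale φ F a ws = trans (∂-cong (λ _ → refl) (λ us → solve 2 (λ a f → a :* f := a :* f :+ con (+ 0) :* f) refl a (F us)) ws)
    (trans (∂-linear φ F F a 0ℚ ws) (solve 2 (λ a f → a :* f :+ con (+ 0) :* f := a :* f) refl a (∂ φ F ws)))

  ∂-zero : ∀ φ {F} → (∀ us → F us ≡ 0ℚ) → ∀ ws → ∂ φ F ws ≡ 0ℚ
  ∂-zero φ e []       = refl
  ∂-zero φ e (w ∷ ws) rewrite e ws | ∂-zero φ (λ us → e (w ∷ us)) ws = solve 1 (λ p → p :* con (+ 0) :- con (+ 0) := con (+ 0)) refl (φ w)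

  ∂∂-cons : ∀ φ ψ F w ws → ∂ φ (∂ ψ F) (w ∷ ws) ≡ φ w * ∂ ψ F ws - (ψ w * ∂ φ F ws - ∂ φ (∂ ψ (F ∘ (w ∷_))) ws)
  ∂∂-cons φ ψ F w ws = cong (λ z → φ w * ∂ ψ F ws - z)
    (trans (∂-sub φ (λ us → ψ w * F us) (∂ ψ (F ∘ (w ∷_))) ws) (cong (λ z → z - ∂ φ (∂ ψ (F ∘ (w ∷_))) ws) (∂-scale φ F (ψ w) ws)))

  -- The rule for contractions in an exterior algebra, but valid for every function of lists:
  -- exchanging the two forms reverses all signs in `∂∂-cons`.
  ∂-anticomm : ∀ φ ψ F ws → ∂ φ (∂ ψ F) ws ≡ - ∂ ψ (∂ φ F) ws
  ∂-anticomm φ ψ F []       = refl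
  ∂-anticomm φ ψ F (w ∷ ws) = trans (∂∂-cons φ ψ F w ws)
    (trans (cong (λ z → φ w * ∂ ψ F ws - (ψ w * ∂ φ F ws - z)) (∂-anticomm φ ψ (F ∘ (w ∷_)) ws))
    (trans (solve 5 (λ p q x y z → p :* x :- (q :* y :- :- z) := :- (q :* y :- (p :* x :- z))) refl
             (φ w) (ψ w) (∂ ψ F ws) (∂ φ F ws) (∂ ψ (∂ φ (F ∘ (w ∷_))) ws))
      (cong -_ (sym (∂∂-cons ψ φ F w ws)))))

  ∂-square : ∀ φ F ws → ∂ φ (∂ φ F) ws ≡ 0ℚ
  ∂-square φ F ws = self-neg-zero (∂-anticomm φ φ F ws)

  -- the Pfaffian of the matrix ω(vᵢ , vⱼ) of a list of 2m vectors, expanded along the first row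
  pf : (V → V → ℚ) → ℕ → List V → ℚ
  pf ω zero    []       = 1ℚ
  pf ω zero    (_ ∷ _)  = 0ℚ
  pf ω (suc m) []       = 0ℚ
  pf ω (suc m) (v ∷ vs) = ∂ (ω v) (pf ω m) vs

  SwapAt : List V → (List V → ℚ) → Set
  SwapAt as F = ∀ v w us → F (as ++ v ∷ w ∷ us) ≡ - F (as ++ w ∷ v ∷ us)

  Alternating : (List V → ℚ) → Set
  Alternating F = ∀ as → SwapAt as F

  ∂-alternating : ∀ φ {F} → Alternating F → Alternating (∂ φ F)
  ∂-alternating φ {F} alt [] v w us =
    trans (cong (λ z → φ v * F (w ∷ us) - (φ w * F (v ∷ us) - z))
            (trans (∂-cong (λ _ → refl) (λ ts → trans (alt [] v w ts) (solve 1 (λ x → :- x := con (ℤ.- + 1) :* x) refl (F (w ∷ v ∷ ts)))) us)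
                   (∂-scale φ (λ ts → F (w ∷ v ∷ ts)) (- 1ℚ) us)))
      (solve 5 (λ p q x y z → p :* x :- (q :* y :- con (ℤ.- + 1) :* z) := :- (q :* y :- (p :* x :- z))) refl
        (φ v) (φ w) (F (w ∷ us)) (F (v ∷ us)) (∂ φ (λ ts → F (w ∷ v ∷ ts)) us))
  ∂-alternating φ {F} alt (a ∷ as) v w us =
    trans (cong₂ (λ x y → φ a * x - y) (alt as v w us) (∂-alternating φ {F ∘ (a ∷_)} (λ bs → alt (a ∷ bs)) as v w us))
      (solve 3 (λ p x y → p :* :- x :- :- y := :- (p :* x :- y)) refl (φ a) (F (as ++ w ∷ v ∷ us)) (∂ φ (F ∘ (a ∷_)) (as ++ w ∷ v ∷ us)))

  ∂-additive : ∀ φ {F v v₁ v₂} → φ v ≡ φ v₁ + φ v₂ → (∀ as us → F (as ++ v ∷ us) ≡ F (as ++ v₁ ∷ us) + F (as ++ v₂ ∷ us)) →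
               ∀ as us → ∂ φ F (as ++ v ∷ us) ≡ ∂ φ F (as ++ v₁ ∷ us) + ∂ φ F (as ++ v₂ ∷ us)
  ∂-additive φ {F} {v} {v₁} {v₂} p q [] us = trans
    (cong₂ (λ x y → x * F us - y) p (trans (∂-cong {G = λ ts → 1ℚ * F (v₁ ∷ ts) + 1ℚ * F (v₂ ∷ ts)} (λ _ → refl)
        (λ ts → trans (q [] ts) (solve 2 (λ x y → x :+ y := con (+ 1) :* x :+ con (+ 1) :* y) refl (F (v₁ ∷ ts)) (F (v₂ ∷ ts)))) us)
      (∂-linear φ (λ ts → F (v₁ ∷ ts)) (λ ts → F (v₂ ∷ ts)) 1ℚ 1ℚ us)))
    (solve 5 (λ a b f x y → (a :+ b) :* f :- (con (+ 1) :* x :+ con (+ 1) :* y) := (a :* f :- x) :+ (b :* f :- y)) refl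
      (φ v₁) (φ v₂) (F us) (∂ φ (λ ts → F (v₁ ∷ ts)) us) (∂ φ (λ ts → F (v₂ ∷ ts)) us))
  ∂-additive φ {F} {v} {v₁} {v₂} p q (a ∷ as) us = trans
    (cong₂ (λ x y → φ a * x - y) (q as us) (∂-additive φ {F ∘ (a ∷_)} p (λ bs → q (a ∷ bs)) as us))
    (solve 5 (λ p x y z t → p :* (x :+ y) :- (z :+ t) := (p :* x :- z) :+ (p :* y :- t)) refl
      (φ a) (F (as ++ v₁ ∷ us)) (F (as ++ v₂ ∷ us)) (∂ φ (F ∘ (a ∷_)) (as ++ v₁ ∷ us)) (∂ φ (F ∘ (a ∷_)) (as ++ v₂ ∷ us)))

  module _ (ω : V → V → ℚ) (skew : ∀ v w → ω v w ≡ - ω w v) where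

    -- Swapping the first two vectors exchanges two contractions, so `∂-anticomm` applies; swaps
    -- further back are inherited through the expansion.
    pf-alternating : ∀ m → Alternating (pf ω m)
    pf-alternating zero [] v w us = refl
    pf-alternating zero (a ∷ as) v w us = refl
    pf-alternating (suc zero) [] v w us = trans (cong (λ z → z * pf ω 0 us - ∂ (ω v) (λ us → pf ω 0 (w ∷ us)) us) (skew v w))
      (trans (cong (λ z → (- ω w v) * pf ω 0 us - z) (∂-zero (ω v) (λ _ → refl) us))
      (trans (solve 2 (λ a f → (:- a) :* f :- con (+ 0) := :- (a :* f :- con (+ 0))) refl (ω w v) (pf ω 0 us))
             (cong (λ z → - (ω w v * pf ω 0 us - z)) (sym (∂-zero (ω w) (λ _ → refl) us)))))
    pf-alternating (suc (suc m)) [] v w us = trans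
      (cong₂ (λ z y → z * pf ω (suc m) us - y) (skew v w) (∂-anticomm (ω v) (ω w) (pf ω m) us))
      (solve 3 (λ a f x → (:- a) :* f :- :- x := :- (a :* f :- x)) refl (ω w v) (pf ω (suc m) us) (∂ (ω w) (∂ (ω v) (pf ω m)) us))
    pf-alternating (suc m) (a ∷ as) v w us = ∂-alternating (ω a) (pf-alternating m) as v w us

    -- Additivity in one slot is what a single step of a single walk needs, see `Pf-step`.
    pf-additive : ∀ m {v v₁ v₂} → (∀ u → ω v u ≡ ω v₁ u + ω v₂ u) →
                  ∀ as us → pf ω m (as ++ v ∷ us) ≡ pf ω m (as ++ v₁ ∷ us) + pf ω m (as ++ v₂ ∷ us)
    pf-additive zero e [] us = refl
    pf-additive zero e (a ∷ as) us = refl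
    pf-additive (suc m) {v} {v₁} {v₂} e [] us = trans
      (∂-cong {ψ = λ u → 1ℚ * ω v₁ u + 1ℚ * ω v₂ u} (λ u → trans (e u) (solve 2 (λ x y → x :+ y := con (+ 1) :* x :+ con (+ 1) :* y) refl (ω v₁ u) (ω v₂ u))) (λ _ → refl) us)
      (trans (∂-linearˡ (ω v₁) (ω v₂) (pf ω m) 1ℚ 1ℚ us)
        (solve 2 (λ x y → con (+ 1) :* x :+ con (+ 1) :* y := x :+ y) refl (∂ (ω v₁) (pf ω m) us) (∂ (ω v₂) (pf ω m) us)))
    pf-additive (suc m) {v} {v₁} {v₂} e (a ∷ as) us = ∂-additive (ω a) e′ (pf-additive m e) as us
      where
      e′ : ω a v ≡ ω a v₁ + ω a v₂
      e′ = trans (skew a v) (trans (cong -_ (e a)) (trans (solve 2 (λ x y → :- (x :+ y) := :- x :+ :- y) refl (ω v₁ a) (ω v₂ a))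
             (cong₂ _+_ (sym (skew a v₁)) (sym (skew a v₂)))))

  module _ {F : List V → ℚ} (alt : Alternating F) where

    repeat-zero : ∀ as v us → F (as ++ v ∷ v ∷ us) ≡ 0ℚ
    repeat-zero as v us = self-neg-zero (alt as v v us)

    -- moving a vector past two others is an even permutation
    move-pair : ∀ as bs v w us → F (as ++ bs ++ v ∷ w ∷ us) ≡ F (as ++ v ∷ w ∷ bs ++ us)
    move-pair as []       v w us = refl
    move-pair as (b ∷ bs) v w us = trans
      (trans (cong F (sym (++-assoc as (b ∷ []) _))) (trans (move-pair (as ++ b ∷ []) bs v w us) (cong F (++-assoc as (b ∷ []) _))))
      (trans (alt as b v (w ∷ bs ++ us))
      (trans (cong (λ z → - F z) (sym (++-assoc as (v ∷ []) _)))
      (trans (cong -_ (alt (as ++ v ∷ []) b w (bs ++ us)))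
      (trans (cong (λ z → - - F z) (++-assoc as (v ∷ []) _)) (solve 1 (λ x → :- :- x := x) refl _)))))

    duplicate-zero : ∀ as v bs us → F (as ++ v ∷ bs ++ v ∷ us) ≡ 0ℚ
    duplicate-zero as v []       us = repeat-zero as v us
    duplicate-zero as v (b ∷ bs) us = trans (alt as v b (bs ++ v ∷ us))
      (trans (cong (λ z → - F z) (sym (++-assoc as (b ∷ []) _)))
        (cong -_ (duplicate-zero (as ++ b ∷ []) v bs us)))

    member-zero : ∀ as v us → v ∈ as → F (as ++ v ∷ us) ≡ 0ℚ
    member-zero as v us v∈ with ∈-∃++ v∈
    ... | bs , cs , refl = trans (cong F (++-assoc bs (v ∷ cs) _)) (duplicate-zero bs v cs us)

pf-map : {V W : Set} (ω : W → W → ℚ) (f : V → W) → ∀ m vs → pf ω m (map f vs) ≡ pf (λ a b → ω (f a) (f b)) m vs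
pf-map {V} ω f = go
  where
  ∂-map : ∀ φ F vs → ∂ φ F (map f vs) ≡ ∂ (φ ∘ f) (F ∘ map f) vs
  ∂-map φ F []       = refl
  ∂-map φ F (v ∷ vs) = cong (λ z → φ (f v) * F (map f vs) - z) (∂-map φ (λ us → F (f v ∷ us)) vs)
  go : ∀ m vs → pf ω m (map f vs) ≡ pf (λ a b → ω (f a) (f b)) m vs
  go zero    []       = refl
  go zero    (_ ∷ _)  = refl
  go (suc m) []       = refl
  go (suc m) (v ∷ vs) = trans (∂-map (ω (f v)) (pf ω m) vs) (∂-cong (λ _ → refl) (go m) vs)

pf-cong : {V : Set} {ω ω′ : V → V → ℚ} → (∀ v w → ω v w ≡ ω′ v w) → ∀ m vs → pf ω m vs ≡ pf ω′ m vs
pf-cong e zero    []       = refl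
pf-cong e zero    (_ ∷ _)  = refl
pf-cong e (suc m) []       = refl
pf-cong e (suc m) (v ∷ vs) = ∂-cong (e v) (pf-cong e m) vs

module _ {V : Set} (ω : V → V → ℚ) (α β : V → ℚ) (t : ℚ) where

  private
    ω′ : V → V → ℚ
    ω′ u v = ω u v - t * (α u * β v - β u * α v)

  correction : ℕ → List V → ℚ
  correction zero    us = 0ℚ
  correction (suc m) us = ∂ α (∂ β (pf ω m)) us

  -- A Pfaffian is a coefficient of the exponential of its 2-form. Since the square of α∧β is 0,
  -- subtracting t·α∧β produces only a linear term in t; in the induction this is `αC` and `βC`.
  pf-perturb : ∀ m us → pf ω′ m us ≡ pf ω m us - t * correction m us
  pf-perturb zero []      = solve 1 (λ t → con (+ 1) := con (+ 1) :- t :* con (+ 0)) refl t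
  pf-perturb zero (_ ∷ _) = solve 1 (λ t → con (+ 0) := con (+ 0) :- t :* con (+ 0)) refl t
  pf-perturb (suc m) []   = solve 1 (λ t → con (+ 0) := con (+ 0) :- t :* con (+ 0)) refl t
  pf-perturb (suc m) (u ∷ us) =
    trans (∂-cong {ψ = λ v → 1ℚ * (1ℚ * ω u v + (- (t * α u)) * β v) + t * β u * α v} {G = λ us → 1ℚ * pf ω m us + (- t) * correction m us}
             (λ v → solve 6 (λ w t a b c d → w :- t :* (a :* d :- b :* c) := con (+ 1) :* (con (+ 1) :* w :+ (:- (t :* a)) :* d) :+ t :* b :* c) refl
                      (ω u v) t (α u) (β u) (α v) (β v))
             (λ us → trans (pf-perturb m us) (solve 3 (λ p t c → p :- t :* c := con (+ 1) :* p :+ (:- t) :* c) refl (pf ω m us) t (correction m us))) us)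
    (trans (∂-linearˡ (λ v → 1ℚ * ω u v + (- (t * α u)) * β v) α P 1ℚ (t * β u) us)
    (trans (cong (λ z → 1ℚ * z + t * β u * ∂ α P us) (∂-linearˡ (ω u) β P 1ℚ (- (t * α u)) us))
    (trans (cong₂ (λ x y → 1ℚ * (1ℚ * x + (- (t * α u)) * y) + t * β u * ∂ α P us) (split (ω u)) (trans (split β) (cong (λ z → 1ℚ * ∂ β (pf ω m) us + - t * z) (βC m us))))
    (trans (cong (λ y → 1ℚ * (1ℚ * (1ℚ * ∂ (ω u) (pf ω m) us + - t * ∂ (ω u) (correction m) us) + (- (t * α u)) * (1ℚ * ∂ β (pf ω m) us + - t * 0ℚ)) + t * β u * y)
             (trans (split α) (cong (λ z → 1ℚ * ∂ α (pf ω m) us + - t * z) (αC m us))))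
    (trans (solve 7 (λ t a b w c x y → con (+ 1) :* (con (+ 1) :* (con (+ 1) :* w :+ :- t :* c) :+ (:- (t :* a)) :* (con (+ 1) :* y :+ :- t :* con (+ 0))) :+ t :* b :* (con (+ 1) :* x :+ :- t :* con (+ 0))
                  := w :- t :* (a :* y :- (b :* x :- c))) refl
             t (α u) (β u) (∂ (ω u) (pf ω m) us) (∂ (ω u) (correction m) us) (∂ α (pf ω m) us) (∂ β (pf ω m) us))
      (cong (λ z → ∂ (ω u) (pf ω m) us - t * z)
        (trans (cong (λ z → α u * ∂ β (pf ω m) us - (β u * ∂ α (pf ω m) us - z)) (sym (uC m us)))
               (sym (∂∂-cons α β (pf ω m) u us)))))))))
    where
    P : List V → ℚ
    P us = 1ℚ * pf ω m us + (- t) * correction m us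
    split : ∀ φ → ∂ φ P us ≡ 1ℚ * ∂ φ (pf ω m) us + - t * ∂ φ (correction m) us
    split φ = ∂-linear φ (pf ω m) (correction m) 1ℚ (- t) us
    αC : ∀ m us → ∂ α (correction m) us ≡ 0ℚ
    αC zero    = ∂-zero α (λ _ → refl)
    αC (suc m) = ∂-square α (∂ β (pf ω m))
    βC : ∀ m us → ∂ β (correction m) us ≡ 0ℚ
    βC zero    us = ∂-zero β (λ _ → refl) us
    βC (suc m) us = trans (∂-anticomm β α (∂ β (pf ω m)) us) (cong -_ (∂-zero α (∂-square β (pf ω m)) us))
    -- Moving the contraction with `ω u` past two others costs no sign.
    uC : ∀ m us → ∂ α (∂ β (λ vs → pf ω m (u ∷ vs))) us ≡ ∂ (ω u) (correction m) us
    uC zero us = trans (∂-zero α (∂-zero β (λ _ → refl)) us) (sym (∂-zero (ω u) (λ _ → refl) us))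
    uC (suc m) us = trans (∂-cong {ψ = α} {G = λ vs → (- 1ℚ) * ∂ (ω u) (∂ β (pf ω m)) vs} (λ _ → refl)
        (λ vs → trans (∂-anticomm β (ω u) (pf ω m) vs) (solve 1 (λ x → :- x := con (ℤ.- + 1) :* x) refl (∂ (ω u) (∂ β (pf ω m)) vs))) us)
      (trans (∂-scale α (∂ (ω u) (∂ β (pf ω m))) (- 1ℚ) us)
      (trans (cong (λ z → (- 1ℚ) * z) (∂-anticomm α (ω u) (∂ β (pf ω m)) us))
        (solve 1 (λ x → con (ℤ.- + 1) :* :- x := x) refl (∂ (ω u) (∂ α (∂ β (pf ω m))) us))))

-- The Schur complement for Pfaffians. Expanding along `v` produces the same double contraction as
-- perturbing the form by the rows of `v` and `w`.
pf-condense : {V : Set} (ω : V → V → ℚ) (v w : V) (s : ℚ) → s * ω v w ≡ 1ℚ → ∀ m us →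
  pf ω (suc m) (v ∷ w ∷ us) ≡ ω v w * pf (λ a b → ω a b - s * (ω v a * ω w b - ω w a * ω v b)) m us
pf-condense ω v w s e m us = trans (cong (λ z → ω v w * pf ω m us - z) (lemma m us))
  (trans (solve 3 (λ p f c → p :* f :- c := p :* f :- con (+ 1) :* c) refl (ω v w) (pf ω m us) (correction ω (ω v) (ω w) s m us))
  (trans (cong (λ z → ω v w * pf ω m us - z * correction ω (ω v) (ω w) s m us) (sym e))
  (trans (solve 4 (λ p f s c → p :* f :- s :* p :* c := p :* (f :- s :* c)) refl (ω v w) (pf ω m us) s (correction ω (ω v) (ω w) s m us))
    (cong (ω v w *_) (sym (pf-perturb ω (ω v) (ω w) s m us))))))
  where
  lemma : ∀ m us → ∂ (ω v) (λ us → pf ω m (w ∷ us)) us ≡ correction ω (ω v) (ω w) s m us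
  lemma zero    us = ∂-zero (ω v) (λ _ → refl) us
  lemma (suc m) us = refl

-- Pairs of walks

sgn : ℤ → ℚ
sgn (+ zero)  = 0ℚ
sgn (+ suc _) = 1ℚ
sgn -[1+ _ ]  = - 1ℚ

-- signed number of pairs of ±1 walks with m steps in total, starting at distance d
q : ℕ → ℤ → ℚ
q zero    d = sgn d
q (suc m) d = q m (ℤ.pred d) + q m (ℤ.suc d)

q-neg : ∀ m d → q m (ℤ.- d) ≡ - q m d
q-neg zero (+ zero)  = refl
q-neg zero (+ suc _) = refl
q-neg zero -[1+ _ ]  = refl
q-neg (suc m) d = trans
  (cong₂ _+_ (trans (cong (q m) (ℤS.solve 1 (λ d → ℤS.con (ℤ.- + 1) ℤS.:+ ℤS.:- d ℤS.:= ℤS.:- (ℤS.con (+ 1) ℤS.:+ d)) refl d)) (q-neg m (ℤ.suc d)))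
             (trans (cong (q m) (ℤS.solve 1 (λ d → ℤS.con (+ 1) ℤS.:+ ℤS.:- d ℤS.:= ℤS.:- (ℤS.con (ℤ.- + 1) ℤS.:+ d)) refl d)) (q-neg m (ℤ.pred d))))
  (solve 2 (λ a b → :- a :+ :- b := :- (b :+ a)) refl (q m (ℤ.suc d)) (q m (ℤ.pred d)))

-- a walk started at height y with τ steps left
Walk : Set
Walk = ℕ × ℤ

-- Only the difference of the two walks matters, and this is a single ±1 walk with all the steps
-- together. The sign compares the free end points on ℓ.
ω : Walk → Walk → ℚ
ω (τ , y) (σ , z) = q (τ ℕ.+ σ) (z ℤ.- y)

ω-skew : ∀ v w → ω v w ≡ - ω w v
ω-skew (τ , y) (σ , z) = trans (cong₂ q (ℕP.+-comm τ σ) (ℤS.solve 2 (λ y z → z ℤS.:- y ℤS.:= ℤS.:- (y ℤS.:- z)) refl y z)) (q-neg (σ ℕ.+ τ) (y ℤ.- z))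

ω-step : ∀ τ y u → ω (suc τ , y) u ≡ ω (τ , ℤ.pred y) u + ω (τ , ℤ.suc y) u
ω-step τ y (σ , z) = trans (ℚP.+-comm (q (τ ℕ.+ σ) (ℤ.pred (z ℤ.- y))) _)
  (cong₂ _+_ (cong (q (τ ℕ.+ σ)) (ℤS.solve 2 (λ y z → ℤS.con (+ 1) ℤS.:+ (z ℤS.:- y) ℤS.:= z ℤS.:- (ℤS.con (ℤ.- + 1) ℤS.:+ y)) refl y z))
             (cong (q (τ ℕ.+ σ)) (ℤS.solve 2 (λ y z → ℤS.con (ℤ.- + 1) ℤS.:+ (z ℤS.:- y) ℤS.:= z ℤS.:- (ℤS.con (+ 1) ℤS.:+ y)) refl y z)))

Pf : ℕ → List Walk → ℚ
Pf = pf ω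

Pf-alternating : ∀ m → Alternating (Pf m)
Pf-alternating = pf-alternating ω ω-skew

Pf-step : ∀ m τ y as us → Pf m (as ++ (suc τ , y) ∷ us) ≡ Pf m (as ++ (τ , ℤ.pred y) ∷ us) + Pf m (as ++ (τ , ℤ.suc y) ∷ us)
Pf-step m τ y = pf-additive ω ω-skew m (ω-step τ y)

-- The height of `R τ j` up to the constant of the coordinates. With this numbering the two possible
-- steps from `pt (suc τ) j` lead to `pt τ j` and `pt τ (suc j)`, as in `spread`.
pt : ℕ → ℕ → Walk
pt τ j = τ , + (τ ℕ.+ 2 ℕ.* j)

pt-step : ∀ m τ j as us → Pf m (as ++ pt (suc τ) j ∷ us) ≡ Pf m (as ++ pt τ j ∷ us) + Pf m (as ++ pt τ (suc j) ∷ us)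
pt-step m τ j as us = trans (Pf-step m τ (+ suc (τ ℕ.+ 2 ℕ.* j)) as us)
  (cong (λ z → Pf m (as ++ pt τ j ∷ us) + Pf m (as ++ (τ , + z) ∷ us)) e)
  where
  e : suc (suc (τ ℕ.+ 2 ℕ.* j)) ≡ τ ℕ.+ 2 ℕ.* suc j
  e = trans (cong suc (sym (ℕP.+-suc τ (2 ℕ.* j)))) (trans (sym (ℕP.+-suc τ (suc (2 ℕ.* j)))) (cong (τ ℕ.+_) (sym (ℕP.*-suc 2 j))))

-- Additivity, slot by slot, collects the independent moves of all walks into one Pfaffian: the
-- recursion in τ on the Pfaffian side.
spread-Pf : ∀ m τ cs js → spread (λ us → Pf m (cs ++ map (pt τ) us)) js ≡ Pf m (cs ++ map (pt (suc τ)) js)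
spread-Pf m τ cs []       = refl
spread-Pf m τ cs (j ∷ js) = trans (cong₂ _+_ (one j) (one (suc j))) (sym (pt-step m τ j cs (map (pt (suc τ)) js)))
  where
  one : ∀ i → spread (λ us → Pf m (cs ++ pt τ i ∷ map (pt τ) us)) js ≡ Pf m (cs ++ pt τ i ∷ map (pt (suc τ)) js)
  one i = trans (spread-cong (λ us → cong (Pf m) (sym (++-assoc cs (pt τ i ∷ []) _))) js)
    (trans (spread-Pf m τ (cs ++ pt τ i ∷ []) js) (cong (Pf m) (++-assoc cs (pt τ i ∷ []) _)))

-- Walks that have ended

module _ {V : Set} where

  -- The lists at which `∂` evaluates its argument: one entry is taken out.
  data Deleted : List V → List V → Set where
    head : ∀ {v vs} → Deleted vs (v ∷ vs)
    tail : ∀ {v us vs} → Deleted us vs → Deleted (v ∷ us) (v ∷ vs)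

  Deleted-length : ∀ {us vs} → Deleted us vs → length vs ≡ suc (length us)
  Deleted-length head     = refl
  Deleted-length (tail d) = cong suc (Deleted-length d)

  Deleted-All : ∀ {P : V → Set} {us vs} → Deleted us vs → All P vs → All P us
  Deleted-All head     (_ ∷ ps) = ps
  Deleted-All (tail d) (p ∷ ps) = p ∷ Deleted-All d ps

  Deleted-AllPairs : ∀ {P : V → V → Set} {us vs} → Deleted us vs → AllPairs P vs → AllPairs P us
  Deleted-AllPairs head     (_ ∷ ps) = ps
  Deleted-AllPairs (tail d) (p ∷ ps) = Deleted-All d p ∷ Deleted-AllPairs d ps

  parity : List V → ℚ
  parity []       = 0ℚ
  parity (_ ∷ vs) = 1ℚ - parity vs

  ∂-parity : ∀ φ F vs → All (λ v → φ v ≡ 1ℚ) vs → (∀ {us} → Deleted us vs → F us ≡ 1ℚ) → ∂ φ F vs ≡ parity vs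
  ∂-parity φ F []       _        _ = refl
  ∂-parity φ F (v ∷ vs) (p ∷ ps) h = cong₂ _-_ (cong₂ _*_ p (h head)) (∂-parity φ (F ∘ (v ∷_)) vs ps (h ∘ tail))

  parity-odd : ∀ m vs → length vs ≡ suc (m ℕ.+ m) → parity vs ≡ 1ℚ
  parity-odd zero    (_ ∷ []) _ = refl
  parity-odd (suc m) (_ ∷ _ ∷ vs) e = trans (solve 1 (λ p → con (+ 1) :- (con (+ 1) :- p) := p) refl (parity vs))
    (parity-odd m vs (ℕP.suc-injective (trans (ℕP.suc-injective e) (cong suc (ℕP.+-suc m m)))))
  parity-odd (suc m) (_ ∷ []) e with () ← ℕP.suc-injective e

  -- The base of the recursion in τ. The expansion along a row of ones is an alternating sum of an
  -- odd number of ones.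
  pf-ones : ∀ (ω : V → V → ℚ) m vs → length vs ≡ m ℕ.+ m → AllPairs (λ v w → ω v w ≡ 1ℚ) vs → pf ω m vs ≡ 1ℚ
  pf-ones ω zero    []       _ _ = refl
  pf-ones ω (suc m) (v ∷ vs) e (p ∷ ps) = trans
    (∂-parity (ω v) (pf ω m) vs p (λ d → pf-ones ω m _ (ℕP.suc-injective (trans (sym (Deleted-length d)) e′)) (Deleted-AllPairs d ps)))
    (parity-odd m vs e′)
    where
    e′ : length vs ≡ suc (m ℕ.+ m)
    e′ = trans (ℕP.suc-injective e) (ℕP.+-suc m m)

ω-ascending : ∀ {a b} → a ℕ.< b → ω (pt 0 a) (pt 0 b) ≡ 1ℚ
ω-ascending {a} {b} lt with b ℕ.∸ suc a | ℕP.m+[n∸m]≡n lt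
... | t | refl = cong sgn (trans (cong (ℤ._- + (2 ℕ.* a)) (trans (cong (λ z → + z) lem) (ℤP.pos-+ (2 ℕ.* a) (suc (suc (2 ℕ.* t))))))
      (ℤS.solve 2 (λ x y → (x ℤS.:+ y) ℤS.:- x ℤS.:= y) refl (+ (2 ℕ.* a)) (+ suc (suc (2 ℕ.* t)))))
  where
  lem : 2 ℕ.* (suc a ℕ.+ t) ≡ 2 ℕ.* a ℕ.+ suc (suc (2 ℕ.* t))
  lem = ℕS.solve 2 (λ a t → ℕS.con 2 ℕS.:* (ℕS.con 1 ℕS.:+ a ℕS.:+ t) ℕS.:= ℕS.con 2 ℕS.:* a ℕS.:+ (ℕS.con 2 ℕS.:+ ℕS.con 2 ℕS.:* t)) refl a t

ascending-pairs : ∀ (U : ℕ → Bool) i m → AllPairs (λ v w → ω v w ≡ 1ℚ) (map (pt 0) (filterᵇ U (range i m)))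
ascending-pairs U i zero    = []
ascending-pairs U i (suc m) with U i
... | false = ascending-pairs U (suc i) m
... | true  = above-all (filterᵇ U (range (suc i) m)) (λ j∈ → range-≥ (suc i) m (proj₁ (filterᵇ-⊆ U _ j∈))) ∷ ascending-pairs U (suc i) m
  where
  above-all : ∀ js → (∀ {j} → j ∈ js → i ℕ.< j) → All (λ w → ω (pt 0 i) w ≡ 1ℚ) (map (pt 0) js)
  above-all []       h = []
  above-all (j ∷ js) h = ω-ascending (h (here refl)) ∷ above-all js (h ∘ there)

-- Row operations on symmetric starting points

module Centred (y₀ : ℤ) (m₀ : ℕ) where
  lo hi : ℕ → ℕ → Walk
  lo τ s = τ , y₀ ℤ.- + suc (2 ℕ.* s)
  hi τ s = τ , y₀ ℤ.+ + suc (2 ℕ.* s)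

  -- `nest` grows outwards from the centre with the number of steps fixed; `tower` stays with the
  -- innermost pair and grows by two steps at a time. Row operations turn one into the other.
  nest : ℕ → ℕ → ℕ → List Walk
  nest τ s zero    = []
  nest τ s (suc m) = lo τ s ∷ hi τ s ∷ nest τ (suc s) m

  tower : ℕ → ℕ → List Walk
  tower τ zero    = []
  tower τ (suc m) = lo τ 0 ∷ hi τ 0 ∷ tower (suc (suc τ)) m

  private
    F : List Walk → ℚ
    F = Pf m₀
    zer : ∀ {as v us} → v ∈ as → F (as ++ v ∷ us) ≡ 0ℚ
    zer {as} {v} {us} = member-zero {F = F} (Pf-alternating m₀) as v us
    sp : ∀ y → ℤ.suc (ℤ.pred y) ≡ y
    sp y = ℤS.solve 1 (λ y → ℤS.con (+ 1) ℤS.:+ (ℤS.con (ℤ.- + 1) ℤS.:+ y) ℤS.:= y) refl y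
    ps : ∀ y → ℤ.pred (ℤ.suc y) ≡ y
    ps y = ℤS.solve 1 (λ y → ℤS.con (ℤ.- + 1) ℤS.:+ (ℤS.con (+ 1) ℤS.:+ y) ℤS.:= y) refl y

    sspp : ∀ y → ℤ.suc (ℤ.suc (ℤ.pred (ℤ.pred y))) ≡ y
    sspp y = trans (cong ℤ.suc (sp (ℤ.pred y))) (sp y)
    pspp : ∀ y → ℤ.pred (ℤ.pred (ℤ.suc (ℤ.suc y))) ≡ y
    pspp y = trans (cong ℤ.pred (ps (ℤ.suc y))) (ps y)

  -- Two steps from `y` give y - 2 once, y twice and y + 2 once. The first two are rows already
  -- present, so only the outermost one is left.
  step-up : ∀ τ y {as us} → (τ , y) ∈ as → (τ , ℤ.pred (ℤ.pred y)) ∈ as →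
            F (as ++ (suc (suc τ) , y) ∷ us) ≡ F (as ++ (τ , ℤ.suc (ℤ.suc y)) ∷ us)
  step-up τ y {as} {us} a b = trans (Pf-step m₀ (suc τ) y as us)
    (trans (cong₂ _+_ (trans (Pf-step m₀ τ (ℤ.pred y) as us) (cong₂ _+_ (zer b) (trans (cong (λ z → F (as ++ (τ , z) ∷ us)) (sp y)) (zer a))))
                      (trans (Pf-step m₀ τ (ℤ.suc y) as us) (cong (λ z → z + F (as ++ (τ , ℤ.suc (ℤ.suc y)) ∷ us)) (trans (cong (λ z → F (as ++ (τ , z) ∷ us)) (ps y)) (zer a)))))
      (solve 1 (λ x → (con (+ 0) :+ con (+ 0)) :+ (con (+ 0) :+ x) := x) refl (F (as ++ (τ , ℤ.suc (ℤ.suc y)) ∷ us))))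

  step-down : ∀ τ y {as us} → (τ , y) ∈ as → (τ , ℤ.suc (ℤ.suc y)) ∈ as →
            F (as ++ (suc (suc τ) , y) ∷ us) ≡ F (as ++ (τ , ℤ.pred (ℤ.pred y)) ∷ us)
  step-down τ y {as} {us} a b = trans (Pf-step m₀ (suc τ) y as us)
    (trans (cong₂ _+_ (trans (Pf-step m₀ τ (ℤ.pred y) as us) (cong (λ z → F (as ++ (τ , ℤ.pred (ℤ.pred y)) ∷ us) + z) (trans (cong (λ z → F (as ++ (τ , z) ∷ us)) (sp y)) (zer a))))
                      (trans (Pf-step m₀ τ (ℤ.suc y) as us) (cong₂ _+_ (trans (cong (λ z → F (as ++ (τ , z) ∷ us)) (ps y)) (zer a)) (zer b))))
      (solve 1 (λ x → (x :+ con (+ 0)) :+ (con (+ 0) :+ con (+ 0)) := x) refl (F (as ++ (τ , ℤ.pred (ℤ.pred y)) ∷ us))))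

  double-suc : ∀ s → 2 ℕ.* suc s ≡ suc (suc (2 ℕ.* s))
  double-suc s = ℕP.*-suc 2 s

  hi-suc : ∀ s → ℤ.suc (ℤ.suc (y₀ ℤ.+ + suc (2 ℕ.* s))) ≡ y₀ ℤ.+ + suc (2 ℕ.* suc s)
  hi-suc s rewrite double-suc s = ℤS.solve 2 (λ y s → ℤS.con (+ 1) ℤS.:+ (ℤS.con (+ 1) ℤS.:+ (y ℤS.:+ s)) ℤS.:= y ℤS.:+ (ℤS.con (+ 2) ℤS.:+ s)) refl y₀ (+ suc (2 ℕ.* s))

  lo-suc : ∀ s → ℤ.pred (ℤ.pred (y₀ ℤ.- + suc (2 ℕ.* s))) ≡ y₀ ℤ.- + suc (2 ℕ.* suc s)
  lo-suc s rewrite double-suc s = ℤS.solve 2 (λ y s → ℤS.con (ℤ.- + 1) ℤS.:+ (ℤS.con (ℤ.- + 1) ℤS.:+ (y ℤS.:- s)) ℤS.:= y ℤS.:- (ℤS.con (+ 2) ℤS.:+ s)) refl y₀ (+ suc (2 ℕ.* s))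

  -- The outer pairs are moved inwards before the inner ones, since each move needs the rows next to
  -- it on the inside still unchanged.
  nest-lift : ∀ τ m s as → hi τ s ∈ as → lo τ s ∈ as →
    (τ , ℤ.pred (ℤ.pred (y₀ ℤ.+ + suc (2 ℕ.* s)))) ∈ as → (τ , ℤ.suc (ℤ.suc (y₀ ℤ.- + suc (2 ℕ.* s)))) ∈ as →
    F (as ++ nest τ (suc s) m) ≡ F (as ++ nest (suc (suc τ)) s m)
  nest-lift τ zero    s as _ _ _ _ = refl
  nest-lift τ (suc m) s as h l h′ l′ = trans
    (trans (cong F (sym (++-assoc as bs _))) (trans
      (nest-lift τ m (suc s) (as ++ bs) (∈-++⁺ʳ as (there (here refl))) (∈-++⁺ʳ as (here refl))
        (subst (λ z → (τ , z) ∈ as ++ bs) (trans (sym (pspp (y₀ ℤ.+ + suc (2 ℕ.* s)))) (cong (ℤ.pred ∘ ℤ.pred) (hi-suc s))) (∈-++⁺ˡ h))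
        (subst (λ z → (τ , z) ∈ as ++ bs) (trans (sym (sspp (y₀ ℤ.- + suc (2 ℕ.* s)))) (cong (ℤ.suc ∘ ℤ.suc) (lo-suc s))) (∈-++⁺ˡ l)))
      (cong F (++-assoc as bs _))))
    (trans (cong (λ z → F (as ++ (τ , z) ∷ hi τ (suc s) ∷ rest)) (sym (lo-suc s)))
    (trans (sym (step-down τ (y₀ ℤ.- + suc (2 ℕ.* s)) l l′))
    (trans (cong F (sym (++-assoc as (lo (suc (suc τ)) s ∷ []) _)))
    (trans (cong (λ z → F ((as ++ lo (suc (suc τ)) s ∷ []) ++ (τ , z) ∷ rest)) (sym (hi-suc s)))
    (trans (sym (step-up τ (y₀ ℤ.+ + suc (2 ℕ.* s)) (∈-++⁺ˡ h) (∈-++⁺ˡ h′)))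
      (cong F (++-assoc as (lo (suc (suc τ)) s ∷ []) _)))))))
    where
    bs = lo τ (suc s) ∷ hi τ (suc s) ∷ []
    rest = nest (suc (suc τ)) (suc s) m

  nest-tower : ∀ τ m as → F (as ++ nest τ 0 m) ≡ F (as ++ tower τ m)
  nest-tower τ zero    as = refl
  nest-tower τ (suc m) as = trans (cong F (sym (++-assoc as bs _)))
    (trans (nest-lift τ m 0 (as ++ bs) (∈-++⁺ʳ as (there (here refl))) (∈-++⁺ʳ as (here refl))
      -- At the centre the row two below `hi τ 0` is `lo τ 0` and vice versa, so the innermost pair
      -- supplies all four rows.
      (∈-++⁺ʳ as (here (cong (τ ,_) (ℤS.solve 1 (λ y → ℤS.con (ℤ.- + 1) ℤS.:+ (ℤS.con (ℤ.- + 1) ℤS.:+ (y ℤS.:+ ℤS.con (+ 1))) ℤS.:= y ℤS.:- ℤS.con (+ 1)) refl y₀))))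
      (∈-++⁺ʳ as (there (here (cong (τ ,_) (ℤS.solve 1 (λ y → ℤS.con (+ 1) ℤS.:+ (ℤS.con (+ 1) ℤS.:+ (y ℤS.:- ℤS.con (+ 1))) ℤS.:= y ℤS.:+ ℤS.con (+ 1)) refl y₀))))))
    (trans (nest-tower (suc (suc τ)) m (as ++ bs)) (cong F (++-assoc as bs _))))
    where
    bs = lo τ 0 ∷ hi τ 0 ∷ []

range-++ : ∀ i a b → range i (a ℕ.+ b) ≡ range i a ++ range (i ℕ.+ a) b
range-++ i zero    b rewrite ℕP.+-identityʳ i = refl
range-++ i (suc a) b rewrite ℕP.+-suc i a = cong (i ∷_) (range-++ (suc i) a b)

-- Walks from consecutive points: the innermost two may be moved to the front, and so on outwards.
module _ (τ x m₀ : ℕ) where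
  y₀ : ℤ
  y₀ = + (τ ℕ.+ 2 ℕ.* x) ℤ.- + 1

  open Centred y₀ m₀

  pt-hi : ∀ s → pt τ (x ℕ.+ s) ≡ hi τ s
  pt-hi s = cong (τ ,_) (trans (cong (λ z → + (τ ℕ.+ z)) (ℕP.*-distribˡ-+ 2 x s)) (trans (cong (λ z → + z) (sym (ℕP.+-assoc τ (2 ℕ.* x) (2 ℕ.* s))))
    (trans (ℤP.pos-+ (τ ℕ.+ 2 ℕ.* x) (2 ℕ.* s)) (ℤS.solve 2 (λ a s → a ℤS.:+ s ℤS.:= (a ℤS.:- ℤS.con (+ 1)) ℤS.:+ (ℤS.con (+ 1) ℤS.:+ s)) refl (+ (τ ℕ.+ 2 ℕ.* x)) (+ (2 ℕ.* s))))))

  pt-lo : ∀ s j → j ℕ.+ suc s ≡ x → pt τ j ≡ lo τ s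
  pt-lo s j e = cong (τ ,_) (trans (ℤS.solve 2 (λ a s → a ℤS.:= ((a ℤS.:+ (ℤS.con (+ 2) ℤS.:+ s)) ℤS.:- ℤS.con (+ 1)) ℤS.:- (ℤS.con (+ 1) ℤS.:+ s)) refl (+ (τ ℕ.+ 2 ℕ.* j)) (+ (2 ℕ.* s)))
    (cong (λ z → z ℤ.- + 1 ℤ.- + suc (2 ℕ.* s)) (trans (sym (ℤP.pos-+ (τ ℕ.+ 2 ℕ.* j) (suc (suc (2 ℕ.* s)))))
      (cong (λ z → + z) (trans (ℕP.+-assoc τ (2 ℕ.* j) _) (cong (τ ℕ.+_) (trans (cong (2 ℕ.* j ℕ.+_) (sym (ℕP.*-suc 2 s))) (trans (sym (ℕP.*-distribˡ-+ 2 j (suc s))) (cong (2 ℕ.*_) e)))))))))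

  sorted-nest : ∀ m s a as → a ℕ.+ m ℕ.+ s ≡ x →
    Pf m₀ (as ++ map (pt τ) (range a m) ++ map (pt τ) (range (x ℕ.+ s) m)) ≡ Pf m₀ (as ++ nest τ s m)
  sorted-nest zero    s a as e = refl
  sorted-nest (suc m) s a as e = trans (cong (λ l → Pf m₀ (as ++ l ++ map (pt τ) (range (x ℕ.+ s) (suc m)))) snoc)
    (trans (cong (λ l → Pf m₀ (as ++ l)) (++-assoc bs (lo τ s ∷ []) _))
    (trans (cong (λ v → Pf m₀ (as ++ bs ++ lo τ s ∷ v ∷ map (pt τ) (range (suc (x ℕ.+ s)) m))) (pt-hi s))
    (trans (move-pair {F = Pf m₀} (Pf-alternating m₀) as bs (lo τ s) (hi τ s) _)
    (trans (cong (Pf m₀) (sym (++-assoc as (lo τ s ∷ hi τ s ∷ []) _)))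
    (trans (cong (λ z → Pf m₀ ((as ++ lo τ s ∷ hi τ s ∷ []) ++ bs ++ map (pt τ) (range z m))) (sym (ℕP.+-suc x s)))
    (trans (sorted-nest m (suc s) a (as ++ lo τ s ∷ hi τ s ∷ []) (trans (ℕP.+-suc (a ℕ.+ m) s) (trans (cong (ℕ._+ s) (sym (ℕP.+-suc a m))) e)))
      (cong (Pf m₀) (++-assoc as (lo τ s ∷ hi τ s ∷ []) _))))))))
    where
    bs = map (pt τ) (range a m)
    snoc : map (pt τ) (range a (suc m)) ≡ bs ++ lo τ s ∷ []
    snoc = trans (cong (map (pt τ)) (trans (cong (range a) (ℕP.+-comm 1 m)) (range-++ a m 1)))
      (trans (map-++ (pt τ) (range a m) (a ℕ.+ m ∷ [])) (cong (λ v → bs ++ v ∷ []) (pt-lo s (a ℕ.+ m)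
        (trans (ℕP.+-suc (a ℕ.+ m) s) (trans (cong (ℕ._+ s) (sym (ℕP.+-suc a m))) e)))))

  sorted-tower : ∀ as → Pf m₀ (as ++ map (pt τ) (range 0 (x ℕ.+ x))) ≡ Pf m₀ (as ++ tower τ x)
  sorted-tower as = trans (cong (λ l → Pf m₀ (as ++ l)) (trans (cong (map (pt τ)) (range-++ 0 x x)) (map-++ (pt τ) (range 0 x) (range x x))))
    (trans (cong (λ z → Pf m₀ (as ++ map (pt τ) (range 0 x) ++ map (pt τ) (range z x))) (sym (ℕP.+-identityʳ x)))
    (trans (sorted-nest x 0 0 as (ℕP.+-identityʳ x)) (nest-tower τ x as)))

-- The entries of the Hankel matrix

q-zero : ∀ m → q m (+ 0) ≡ 0ℚ
q-zero m = self-neg-zero (q-neg m (+ 0))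

-- Number of pairs of walks with 2t steps in total that start at neighbouring points; equal to C(2t+1, t).
h : ℕ → ℚ
h t = q (2 ℕ.* t) (+ 2)

private
  -- Differencing removes the sign: without steps it is 1 at ±1 and 0 at all other odd arguments, so
  -- the recursion produces rows of Pascal's triangle.
  jump : ℕ → ℤ → ℚ
  jump m d = q m (ℤ.suc d) - q m (ℤ.pred d)

  jump-suc : ∀ m d → jump (suc m) d ≡ jump m (ℤ.pred d) + jump m (ℤ.suc d)
  jump-suc m d = trans (cong₂ (λ a b → q m a + q m (ℤ.suc (ℤ.suc d)) - (q m (ℤ.pred (ℤ.pred d)) + q m b)) e₁ e₂)
    (trans (solve 4 (λ a b c d → (a :+ b) :- (c :+ d) := (a :- c) :+ (b :- d)) refl (q m d) (q m (ℤ.suc (ℤ.suc d))) (q m (ℤ.pred (ℤ.pred d))) (q m d))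
      (cong₂ (λ a b → (q m a - q m (ℤ.pred (ℤ.pred d))) + (q m (ℤ.suc (ℤ.suc d)) - q m b)) (sym e₂) (sym e₁)))
    where
    e₁ : ℤ.pred (ℤ.suc d) ≡ d
    e₁ = ℤS.solve 1 (λ y → ℤS.con (ℤ.- + 1) ℤS.:+ (ℤS.con (+ 1) ℤS.:+ y) ℤS.:= y) refl d
    e₂ : ℤ.suc (ℤ.pred d) ≡ d
    e₂ = ℤS.solve 1 (λ y → ℤS.con (+ 1) ℤS.:+ (ℤS.con (ℤ.- + 1) ℤS.:+ y) ℤS.:= y) refl d

  jump-out : ∀ m i → jump m (ℤ.- + suc m ℤ.- + (2 ℕ.+ i)) ≡ 0ℚ
  jump-out zero    i = refl
  jump-out (suc m) i = trans (jump-suc m (ℤ.- + suc (suc m) ℤ.- + (2 ℕ.+ i)))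
    (trans (cong₂ (λ a b → jump m a + jump m b)
      (ℤS.solve 2 (λ m i → ℤS.con (ℤ.- + 1) ℤS.:+ (ℤS.:- (ℤS.con (+ 2) ℤS.:+ m) ℤS.:- (ℤS.con (+ 2) ℤS.:+ i)) ℤS.:= ℤS.:- (ℤS.con (+ 1) ℤS.:+ m) ℤS.:- (ℤS.con (+ 4) ℤS.:+ i)) refl (+ m) (+ i))
      (ℤS.solve 2 (λ m i → ℤS.con (+ 1) ℤS.:+ (ℤS.:- (ℤS.con (+ 2) ℤS.:+ m) ℤS.:- (ℤS.con (+ 2) ℤS.:+ i)) ℤS.:= ℤS.:- (ℤS.con (+ 1) ℤS.:+ m) ℤS.:- (ℤS.con (+ 2) ℤS.:+ i)) refl (+ m) (+ i)))
    (cong₂ _+_ (jump-out m (2 ℕ.+ i)) (jump-out m i)))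

  jump-binomial : ∀ m i → jump m (ℤ.- + suc m ℤ.+ + (2 ℕ.* i)) ≡ ℕ→ℚ (suc m C i)
  jump-binomial zero zero = refl
  jump-binomial zero (suc zero) = refl
  jump-binomial zero (suc (suc i)) = trans (cong (λ z → jump 0 (ℤ.- + 1 ℤ.+ + z)) (ℕP.*-distribˡ-+ 2 2 i))
    (cong ℕ→ℚ (sym (k>n⇒nCk≡0 {1} {suc (suc i)} (ℕ.s≤s (ℕ.s≤s ℕ.z≤n)))))
  jump-binomial (suc m) zero = trans (jump-suc m (ℤ.- + suc (suc m)))
    (trans (cong₂ (λ a b → jump m a + jump m b)
      (ℤS.solve 1 (λ m → ℤS.con (ℤ.- + 1) ℤS.:+ ℤS.:- (ℤS.con (+ 2) ℤS.:+ m) ℤS.:= ℤS.:- (ℤS.con (+ 1) ℤS.:+ m) ℤS.:- ℤS.con (+ 2)) refl (+ m))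
      (ℤS.solve 1 (λ m → ℤS.con (+ 1) ℤS.:+ ℤS.:- (ℤS.con (+ 2) ℤS.:+ m) ℤS.:= ℤS.:- (ℤS.con (+ 1) ℤS.:+ m) ℤS.:+ ℤS.con (+ 0)) refl (+ m)))
    (trans (cong₂ _+_ (jump-out m 0) (jump-binomial m 0)) (ℚP.+-identityˡ _)))
  jump-binomial (suc m) (suc i) = trans (jump-suc m (ℤ.- + suc (suc m) ℤ.+ + (2 ℕ.* suc i)))
    (trans (cong₂ (λ a b → jump m a + jump m b) e₁ e₂)
    (trans (cong₂ _+_ (jump-binomial m i) (jump-binomial m (suc i)))
    (trans (sym (ℕ→ℚ-+ (suc m C i) (suc m C suc i))) (cong ℕ→ℚ (nCk+nC[k+1]≡[n+1]C[k+1] (suc m) i)))))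
    where
    e₁ : ℤ.pred (ℤ.- + suc (suc m) ℤ.+ + (2 ℕ.* suc i)) ≡ ℤ.- + suc m ℤ.+ + (2 ℕ.* i)
    e₁ = trans (cong (λ z → ℤ.pred (ℤ.- + suc (suc m) ℤ.+ + z)) (ℕP.*-suc 2 i)) (ℤS.solve 2 (λ m i → ℤS.con (ℤ.- + 1) ℤS.:+ (ℤS.:- (ℤS.con (+ 2) ℤS.:+ m) ℤS.:+ (ℤS.con (+ 2) ℤS.:+ i)) ℤS.:= ℤS.:- (ℤS.con (+ 1) ℤS.:+ m) ℤS.:+ i) refl (+ m) (+ (2 ℕ.* i)))
    e₂ : ℤ.suc (ℤ.- + suc (suc m) ℤ.+ + (2 ℕ.* suc i)) ≡ ℤ.- + suc m ℤ.+ + (2 ℕ.* suc i)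
    e₂ = ℤS.solve 2 (λ m i → ℤS.con (+ 1) ℤS.:+ (ℤS.:- (ℤS.con (+ 2) ℤS.:+ m) ℤS.:+ i) ℤS.:= ℤS.:- (ℤS.con (+ 1) ℤS.:+ m) ℤS.:+ i) refl (+ m) (+ (2 ℕ.* suc i))

-- Since `q` vanishes at 0, `h` is itself a jump, namely the one at 1.
h-binomial : ∀ t → h t ≡ ℕ→ℚ (suc (2 ℕ.* t) C t)
h-binomial t = trans (solve 1 (λ x → x := x :- con (+ 0)) refl (h t))
  (trans (cong (λ z → h t - z) (sym (q-zero (2 ℕ.* t))))
  (trans (cong (jump (2 ℕ.* t)) e)
  (trans (jump-binomial (2 ℕ.* t) (suc t)) (cong ℕ→ℚ (sym e′)))))
  where
  e : + 1 ≡ ℤ.- + suc (2 ℕ.* t) ℤ.+ + (2 ℕ.* suc t)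
  e = trans (ℤS.solve 1 (λ t → ℤS.con (+ 1) ℤS.:= ℤS.:- (ℤS.con (+ 1) ℤS.:+ t) ℤS.:+ (ℤS.con (+ 2) ℤS.:+ t)) refl (+ (2 ℕ.* t))) (cong (λ z → ℤ.- + suc (2 ℕ.* t) ℤ.+ + z) (sym (ℕP.*-suc 2 t)))
  e′ : suc (2 ℕ.* t) C t ≡ suc (2 ℕ.* t) C suc t
  e′ = trans (nCk≡nC[n∸k] (ℕP.m≤n⇒m≤1+n (ℕP.m≤m+n t _))) (cong (suc (2 ℕ.* t) C_)
    (trans (cong (λ z → suc z ℕ.∸ t) (cong (t ℕ.+_) (ℕP.+-identityʳ t))) (trans (cong (ℕ._∸ t) (sym (ℕP.+-suc t t))) (ℕP.m+n∸m≡n t (suc t)))))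

choose-factorial : ∀ {n k} → k ℕ.≤ n → (n C k) ℕ.* (k ! ℕ.* (n ℕ.∸ k) !) ≡ n !
choose-factorial {n} {k} k≤n = trans (cong (ℕ._* (k ! ℕ.* (n ℕ.∸ k) !)) (nCk≡n!/k![n-k]! k≤n)) (m/n*n≡m {{k !* (n ℕ.∸ k) !≢0}} (k![n∸k]!∣n! k≤n))

h-factorial : ∀ t → h t * (ℕ→ℚ (t !) * ℕ→ℚ (suc t !)) ≡ ℕ→ℚ (suc (2 ℕ.* t) !)
h-factorial t = trans (cong₂ _*_ (h-binomial t) (sym (fromℤ-* (+ (t !)) (+ (suc t !)))))
  (trans (cong (λ z → ℕ→ℚ (suc (2 ℕ.* t) C t) * fromℤ z) (sym (ℤP.pos-* (t !) (suc t !))))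
  (trans (sym (fromℤ-* (+ (suc (2 ℕ.* t) C t)) (+ (t ! ℕ.* suc t !))))
  (trans (cong fromℤ (sym (ℤP.pos-* (suc (2 ℕ.* t) C t) (t ! ℕ.* suc t !))))
  (cong ℕ→ℚ (trans (cong (λ z → (suc (2 ℕ.* t) C t) ℕ.* (t ! ℕ.* z !)) e) (choose-factorial (ℕP.m≤n⇒m≤1+n (ℕP.m≤m+n t _))))))))
  where
  e : suc t ≡ suc (2 ℕ.* t) ℕ.∸ t
  e = sym (trans (cong (λ z → suc z ℕ.∸ t) (cong (t ℕ.+_) (ℕP.+-identityʳ t))) (trans (cong (ℕ._∸ t) (sym (ℕP.+-suc t t))) (ℕP.m+n∸m≡n t (suc t))))

-- From the Pfaffian to the Hankel matrix

-- For symmetric `K`, the Pfaffian of this form on `pairs` is the determinant of `K` on the given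
-- indices. The determinant itself is never formed.
skewForm : (ℕ → ℕ → ℚ) → ℕ × Bool → ℕ × Bool → ℚ
skewForm K (a , false) (b , true)  = K a b
skewForm K (a , true)  (b , false) = - K a b
skewForm K (a , _)     (b , _)     = 0ℚ

pairs : List ℕ → List (ℕ × Bool)
pairs []       = []
pairs (a ∷ as) = (a , false) ∷ (a , true) ∷ pairs as

-- Gaussian elimination with pivot `K a a`; both halves of the index disappear together, so no signs
-- arise.
pf-eliminate : ∀ K s a → s * K a a ≡ 1ℚ → ∀ m as →
  pf (skewForm K) (suc m) (pairs (a ∷ as)) ≡ K a a * pf (skewForm (λ b c → K b c - s * (K a b * K a c))) m (pairs as)
pf-eliminate K s a e m as = trans (pf-condense (skewForm K) (a , false) (a , true) s e m (pairs as)) (cong (λ z → K a a * z) (pf-cong same m (pairs as)))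
  where
  same : ∀ v w → skewForm K v w - s * (skewForm K (a , false) v * skewForm K (a , true) w - skewForm K (a , true) v * skewForm K (a , false) w)
                 ≡ skewForm (λ b c → K b c - s * (K a b * K a c)) v w
  same (b , false) (c , false) = solve 3 (λ s x y → con (+ 0) :- s :* (con (+ 0) :* (:- y) :- (:- x) :* con (+ 0)) := con (+ 0)) refl s (K a b) (K a c)
  same (b , true)  (c , true)  = solve 3 (λ s x y → con (+ 0) :- s :* (x :* con (+ 0) :- con (+ 0) :* y) := con (+ 0)) refl s (K a b) (K a c)
  same (b , false) (c , true)  = solve 4 (λ s x y z → z :- s :* (con (+ 0) :* con (+ 0) :- (:- x) :* y) := z :- s :* (x :* y)) refl s (K a b) (K a c) (K b c)
  same (b , true)  (c , false) = solve 4 (λ s x y z → :- z :- s :* (x :* (:- y) :- con (+ 0) :* con (+ 0)) := :- (z :- s :* (x :* y))) refl s (K a b) (K a c) (K b c)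

range-snoc-pairs : ∀ as k → pairs (as ++ k ∷ []) ≡ pairs as ++ (k , false) ∷ (k , true) ∷ []
range-snoc-pairs []       k = refl
range-snoc-pairs (a ∷ as) k = cong (λ l → (a , false) ∷ (a , true) ∷ l) (range-snoc-pairs as k)

module _ (n x k e : ℕ) (height : k ℕ.+ suc e ≡ n ℕ.+ x) where
  private
    -- The horizontal axis. It is 2n + 2x - 1 and not 2n + 2x because a triangle is recorded by the
    -- lower end of its vertical side.
    c₀ : ℤ
    c₀ = y₀ (2 ℕ.* n) x (suc x)
  open Centred c₀ (suc x)

  -- An index stands for the two walks next to the axis and counts their steps in pairs; this makes
  -- the entries depend on a + b.
  central : ℕ × Bool → Walk
  central (a , false) = lo (2 ℕ.* a) 0
  central (a , true)  = hi (2 ℕ.* a) 0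

  -- Two walks from the same height contribute 0, because `q` is odd in the distance.
  central-skewForm : ∀ v w → ω (central v) (central w) ≡ skewForm (λ a b → h (a ℕ.+ b)) v w
  central-skewForm (a , false) (b , false) = trans (cong (q (2 ℕ.* a ℕ.+ 2 ℕ.* b)) (ℤS.solve 1 (λ y → (y ℤS.:- ℤS.con (+ 1)) ℤS.:- (y ℤS.:- ℤS.con (+ 1)) ℤS.:= ℤS.con (+ 0)) refl c₀)) (q-zero (2 ℕ.* a ℕ.+ 2 ℕ.* b))
  central-skewForm (a , true)  (b , true)  = trans (cong (q (2 ℕ.* a ℕ.+ 2 ℕ.* b)) (ℤS.solve 1 (λ y → (y ℤS.:+ ℤS.con (+ 1)) ℤS.:- (y ℤS.:+ ℤS.con (+ 1)) ℤS.:= ℤS.con (+ 0)) refl c₀)) (q-zero (2 ℕ.* a ℕ.+ 2 ℕ.* b))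
  central-skewForm (a , false) (b , true)  = cong₂ q (sym (ℕP.*-distribˡ-+ 2 a b))
    (ℤS.solve 1 (λ y → (y ℤS.:+ ℤS.con (+ 1)) ℤS.:- (y ℤS.:- ℤS.con (+ 1)) ℤS.:= ℤS.con (+ 2)) refl c₀)
  central-skewForm (a , true)  (b , false) = trans (cong₂ q (sym (ℕP.*-distribˡ-+ 2 a b))
    (ℤS.solve 1 (λ y → (y ℤS.:- ℤS.con (+ 1)) ℤS.:- (y ℤS.:+ ℤS.con (+ 1)) ℤS.:= ℤS.:- ℤS.con (+ 2)) refl c₀)) (q-neg (2 ℕ.* (a ℕ.+ b)) (+ 2))

  tower-central : ∀ a m → tower (2 ℕ.* a) m ≡ map central (pairs (range a m))
  tower-central a zero    = refl
  tower-central a (suc m) = cong (λ l → lo (2 ℕ.* a) 0 ∷ hi (2 ℕ.* a) 0 ∷ l)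
    (trans (cong (λ z → tower z m) (sym (ℕP.*-suc 2 a))) (tower-central (suc a) m))

  -- The hole is centred on the axis, so its two walks are the central pair with index `k`.
  hole-lo : pt (2 ℕ.* k) e ≡ lo (2 ℕ.* k) 0
  hole-lo = cong (2 ℕ.* k ,_) (trans (ℤS.solve 1 (λ a → a ℤS.:= ((a ℤS.:+ ℤS.con (+ 2)) ℤS.:- ℤS.con (+ 1)) ℤS.:- ℤS.con (+ 1)) refl (+ (2 ℕ.* k ℕ.+ 2 ℕ.* e)))
    (cong (λ z → z ℤ.- + 1 ℤ.- + 1) (trans (sym (ℤP.pos-+ (2 ℕ.* k ℕ.+ 2 ℕ.* e) 2)) (cong (λ z → + z) e′))))
    where
    e′ : 2 ℕ.* k ℕ.+ 2 ℕ.* e ℕ.+ 2 ≡ 2 ℕ.* n ℕ.+ 2 ℕ.* x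
    e′ = trans (ℕS.solve 2 (λ k e → ℕS.con 2 ℕS.:* k ℕS.:+ ℕS.con 2 ℕS.:* e ℕS.:+ ℕS.con 2 ℕS.:= ℕS.con 2 ℕS.:* (k ℕS.:+ (ℕS.con 1 ℕS.:+ e))) refl k e)
           (trans (cong (2 ℕ.*_) height) (ℕP.*-distribˡ-+ 2 n x))

  hole-hi : pt (2 ℕ.* k) (suc e) ≡ hi (2 ℕ.* k) 0
  hole-hi = cong (2 ℕ.* k ,_) (trans (cong (λ z → + z) (trans (cong (2 ℕ.* k ℕ.+_) (ℕP.*-suc 2 e)) (ℕS.solve 2 (λ k e → k ℕS.:+ (ℕS.con 2 ℕS.:+ e) ℕS.:= k ℕS.:+ e ℕS.:+ ℕS.con 2) refl (2 ℕ.* k) (2 ℕ.* e))))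
    (trans (ℤP.pos-+ (2 ℕ.* k ℕ.+ 2 ℕ.* e) 2) (trans (cong (λ z → z ℤ.+ + 2) (cong proj₂ hole-lo))
      (ℤS.solve 1 (λ y → (y ℤS.:- ℤS.con (+ 1)) ℤS.:+ ℤS.con (+ 2) ℤS.:= y ℤS.:+ ℤS.con (+ 1)) refl c₀))))

  -- The pair of the hole is moved to the end, so that elimination can use up n, ..., n + x - 1 and
  -- stop at `k`.
  Pf-skewForm : Pf (suc x) (pt (2 ℕ.* k) e ∷ pt (2 ℕ.* k) (suc e) ∷ map (pt (2 ℕ.* n)) (range 0 (x ℕ.+ x)))
                ≡ pf (skewForm (λ a b → h (a ℕ.+ b))) (suc x) (pairs (range n x ++ k ∷ []))
  Pf-skewForm = trans (cong₂ (λ v w → Pf (suc x) (v ∷ w ∷ map (pt (2 ℕ.* n)) (range 0 (x ℕ.+ x)))) hole-lo hole-hi)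
    (trans (sorted-tower (2 ℕ.* n) x (suc x) cs)
    (trans (cong (Pf (suc x)) (cong (cs ++_) (sym (++-identityʳ (tower (2 ℕ.* n) x)))))
    (trans (sym (move-pair {F = Pf (suc x)} (Pf-alternating (suc x)) [] (tower (2 ℕ.* n) x) (lo (2 ℕ.* k) 0) (hi (2 ℕ.* k) 0) []))
    (trans (cong (λ l → Pf (suc x) (l ++ cs)) (tower-central n x))
    (trans (cong (Pf (suc x)) (trans (sym (map-++ central (pairs (range n x)) _)) (cong (map central) (sym (range-snoc-pairs (range n x) k)))))
    (trans (pf-map ω central (suc x) (pairs (range n x ++ k ∷ [])))
      (pf-cong central-skewForm (suc x) (pairs (range n x ++ k ∷ [])))))))))
    where
    cs : List Walk
    cs = lo (2 ℕ.* k) 0 ∷ hi (2 ℕ.* k) 0 ∷ []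

≤ᵇ-true : ∀ {a b} → a ≤ b → (a ≤ᵇ b) ≡ true
≤ᵇ-true {a} {b} le with a ≤ᵇ b | ℕP.≤⇒≤ᵇ le
... | true | _ = refl

≤ᵇ-sound : ∀ {a b} → (a ≤ᵇ b) ≡ true → a ≤ b
≤ᵇ-sound {a} {b} e = ℕP.≤ᵇ⇒≤ a b (subst Bool.T (sym e) _)

≤ᵇ-false : ∀ {a b} → ¬ a ≤ b → (a ≤ᵇ b) ≡ false
≤ᵇ-false {a} {b} ne with a ≤ᵇ b in e
... | true  = ⊥-elim (ne (≤ᵇ-sound e))
... | false = refl

not-false : ∀ {b} → not b ≡ false → b ≡ true
not-false {true} _ = refl

filterᵇ-all : ∀ {p : ℕ → Bool} js → (∀ {j} → j ∈ js → p j ≡ true) → filterᵇ p js ≡ js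
filterᵇ-all []       h = refl
filterᵇ-all {p} (j ∷ js) h rewrite h {j} (here refl) = cong (j ∷_) (filterᵇ-all js (h ∘ there))

filterᵇ-++ : {A : Set} (p : A → Bool) (as bs : List A) → filterᵇ p (as ++ bs) ≡ filterᵇ p as ++ filterᵇ p bs
filterᵇ-++ p []       bs = refl
filterᵇ-++ p (a ∷ as) bs with p a
... | true  = cong (a ∷_) (filterᵇ-++ p as bs)
... | false = filterᵇ-++ p as bs

range-length : ∀ i m → length (range i m) ≡ m
range-length i zero    = refl
range-length i (suc m) = cong suc (range-length (suc i) m)

-- The region in coordinates

-- The holes among the L τ i (δ = 0) and the R τ i (δ = 1), where e = x + n - k - 1.
module Hole (k e : ℕ) where
  hole : ℕ → ℕ → ℕ → Bool
  hole δ τ i = (δ ℕ.+ 2 ℕ.* k ≤ᵇ τ) ∧ (e ≤ᵇ i) ∧ (i ℕ.+ τ ≤ᵇ e ℕ.+ suc (2 ℕ.* k))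

  okL : ℕ → ℕ → Bool
  okL τ i = not (hole 0 τ i)

  holeR : ℕ → ℕ → Bool
  holeR = hole 1

  -- The three left-pointing unit triangles of the hole. The fourth unit triangle points to the
  -- right and has the position of `left`.
  data InHole : ℕ → ℕ → Set where
    right-lower : InHole (2 ℕ.* k) e
    right-upper : InHole (2 ℕ.* k) (suc e)
    left        : InHole (suc (2 ℕ.* k)) e

  in-hole : ∀ τ i → okL τ i ≡ false → InHole τ i
  in-hole τ i b with ∧-split {2 ℕ.* k ≤ᵇ τ} (not-false b)
  ... | p , q with ∧-split {e ≤ᵇ i} q
  ... | q₁ , q₂ = shape (ℕP.m≤n⇒∃[o]m+o≡n (≤ᵇ-sound {2 ℕ.* k} p)) (ℕP.m≤n⇒∃[o]m+o≡n (≤ᵇ-sound {e} q₁)) (≤ᵇ-sound {i ℕ.+ τ} q₂)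
    where
    shape : ∀ {τ i} → (∃ λ o → 2 ℕ.* k ℕ.+ o ≡ τ) → (∃ λ o → e ℕ.+ o ≡ i) → i ℕ.+ τ ≤ e ℕ.+ suc (2 ℕ.* k) → InHole τ i
    shape (δ , refl) (γ , refl) le with ℕP.+-cancelˡ-≤ (e ℕ.+ 2 ℕ.* k) (γ ℕ.+ δ) 1
        (ℕP.≤-trans (ℕP.≤-reflexive (ℕS.solve 4 (λ e k γ δ → e ℕS.:+ k ℕS.:+ (γ ℕS.:+ δ) ℕS.:= (e ℕS.:+ γ) ℕS.:+ (k ℕS.:+ δ)) refl e (2 ℕ.* k) γ δ))
          (ℕP.≤-trans le (ℕP.≤-reflexive (ℕS.solve 2 (λ e k → e ℕS.:+ (ℕS.con 1 ℕS.:+ k) ℕS.:= e ℕS.:+ k ℕS.:+ ℕS.con 1) refl e (2 ℕ.* k)))))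
    shape (zero , refl)        (zero , refl)  le | _ = subst₂ InHole (sym (ℕP.+-identityʳ _)) (sym (ℕP.+-identityʳ e)) right-lower
    shape (suc zero , refl)    (zero , refl)  le | _ = subst₂ InHole (sym (trans (ℕP.+-suc _ 0) (cong suc (ℕP.+-identityʳ _)))) (sym (ℕP.+-identityʳ e)) left
    shape (zero , refl) (suc zero , refl)     le | _ = subst₂ InHole (sym (ℕP.+-identityʳ _)) (sym (trans (ℕP.+-suc e 0) (cong suc (ℕP.+-identityʳ e)))) right-upper
    shape (suc (suc _) , refl) (zero , refl)  le | s≤s ()
    shape (zero , refl) (suc (suc γ) , refl)  le | s≤s ()
    shape (suc δ , refl) (suc γ , refl)       le | s≤s p with () ← ℕP.n≤0⇒n≡0 (ℕP.≤-trans (ℕP.m≤n+m (suc δ) γ) p)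

  -- The kinds differ only on the line of the hole's right side, where the right-pointing triangles
  -- lie outside the hole and start its two walks.
  hole-eq : ∀ τ i → τ ≢ 2 ℕ.* k → holeR τ i ≡ hole 0 τ i
  hole-eq τ i ne = cong (_∧ ((e ≤ᵇ i) ∧ (i ℕ.+ τ ≤ᵇ e ℕ.+ suc (2 ℕ.* k)))) (same (ℕP._≤?_ (2 ℕ.* k) τ))
    where
    same : Dec (2 ℕ.* k ≤ τ) → (suc (2 ℕ.* k) ≤ᵇ τ) ≡ (2 ℕ.* k ≤ᵇ τ)
    same (yes le) = trans (≤ᵇ-true (ℕP.≤∧≢⇒< le (ne ∘ sym))) (sym (≤ᵇ-true le))
    same (no nle) = trans (≤ᵇ-false (λ lt → nle (ℕP.<⇒≤ lt))) (sym (≤ᵇ-false nle))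

  right-hole : ∀ i → holeR (2 ℕ.* k) i ≡ false
  right-hole i rewrite ≤ᵇ-false {suc (2 ℕ.* k)} {2 ℕ.* k} (ℕP.<-irrefl refl) = refl

-- The Pfaffian from line to line

module Evolution (n x k e c top : ℕ) (m₀ : ℕ) (cR : ℕ → ℕ → Bool) (insR : List (ℕ × ℕ))
  (cR-insR : ∀ {σ j} → cR σ j ≡ true → (σ , j) ∈ insR)
  (insR-cR : ∀ {σ j} → (σ , j) ∈ insR → cR σ j ≡ true)
  (cR-positive : ∀ {j} → cR 0 j ≡ false)
  (cR-inside : ∀ τ d j → suc τ ℕ.+ d ≡ c → suc τ ≤ top → j < d → cR (suc τ) j ≡ not (Hole.holeR k e (suc τ) j))
  (cR-outside : ∀ τ d j → suc τ ℕ.+ d ≡ c → d ≤ j → cR (suc τ) j ≡ false)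
  (centre : 2 ℕ.* k ℕ.+ (suc (suc (e ℕ.+ e))) ≡ c)
  where
  open Hole k e
  open Transfer cR insR
  open Scan cR insR okL cR-insR
  private
    F : List Walk → ℚ
    F = Pf m₀
    P : List Walk
    P = pt (2 ℕ.* k) e ∷ pt (2 ℕ.* k) (suc e) ∷ []

  -- Left of the hole and up to the line of its right side, the two walks of the hole are supplied
  -- in advance; nearer to ℓ they are ordinary walks.
  prefix : ℕ → List Walk
  prefix τ = if 2 ℕ.* k ≤ᵇ τ then P else []

  -- Differs from `prefix` only on the line of the hole's right side, where the two open positions
  -- missing from the scan's list rejoin the others.
  before : ℕ → List Walk
  before zero    = []
  before (suc τ) = prefix τ

  G : ℕ → List ℕ → ℚ
  G τ js = F (prefix τ ++ map (pt τ) js)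

  value-at : ℕ → List ℕ → ℚ
  value-at τ js = F (before τ ++ map (pt τ) js)

  insert : ∀ τ as js → prefix τ ++ map (pt τ) (as ++ js) ≡ (prefix τ ++ map (pt τ) as) ++ map (pt τ) js
  insert τ as js = trans (cong (prefix τ ++_) (map-++ (pt τ) as js)) (sym (++-assoc (prefix τ) (map (pt τ) as) (map (pt τ) js)))

  G-dup : ∀ τ as i us → G τ (as ++ i ∷ i ∷ us) ≡ 0ℚ
  G-dup τ as i us = trans (cong F (insert τ as (i ∷ i ∷ us))) (repeat-zero {F = F} (Pf-alternating m₀) (prefix τ ++ map (pt τ) as) (pt τ i) (map (pt τ) us))

  -- The two positions on the right side of the hole repeat a vector of the prefix; the third one
  -- leads to just these two in one step.
  G-kill : ∀ τ i → okL τ i ≡ false → ∀ as us → G τ (as ++ i ∷ us) ≡ 0ℚ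
  G-kill τ i b as us = trans (cong F (insert τ as (i ∷ us))) (dead (in-hole τ i b))
    where
    zer : ∀ {as v us} → v ∈ as → F (as ++ v ∷ us) ≡ 0ℚ
    zer {as} {v} {us} = member-zero {F = F} (Pf-alternating m₀) as v us
    prefix-P : ∀ {τ} → 2 ℕ.* k ≤ τ → prefix τ ≡ P
    prefix-P le = cong (λ b → if b then P else []) (≤ᵇ-true le)
    dead : ∀ {τ i} → InHole τ i → F ((prefix τ ++ map (pt τ) as) ++ pt τ i ∷ map (pt τ) us) ≡ 0ℚ
    dead right-lower rewrite prefix-P (ℕP.≤-refl {2 ℕ.* k}) = zer {P ++ map (pt (2 ℕ.* k)) as} {pt (2 ℕ.* k) e} {map (pt (2 ℕ.* k)) us} (here refl)
    dead right-upper rewrite prefix-P (ℕP.≤-refl {2 ℕ.* k}) = zer {P ++ map (pt (2 ℕ.* k)) as} {pt (2 ℕ.* k) (suc e)} {map (pt (2 ℕ.* k)) us} (there (here refl))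
    dead left rewrite prefix-P (ℕP.n≤1+n (2 ℕ.* k)) = trans (pt-step m₀ (2 ℕ.* k) e (P ++ map (pt (suc (2 ℕ.* k))) as) (map (pt (suc (2 ℕ.* k))) us))
      (cong₂ _+_ (zer {P ++ map (pt (suc (2 ℕ.* k))) as} {pt (2 ℕ.* k) e} {map (pt (suc (2 ℕ.* k))) us} (here refl)) (zer {P ++ map (pt (suc (2 ℕ.* k))) as} {pt (2 ℕ.* k) (suc e)} {map (pt (suc (2 ℕ.* k))) us} (there (here refl))))

  pending-list : (ℕ → ℕ → Bool) → ℕ → ℕ → List ℕ
  pending-list S τ d = filterᵇ (λ j → not (holeR τ j) ∧ S τ j) (range 0 d)

  before-prefix : ∀ τ → τ ≢ 2 ℕ.* k → before τ ≡ prefix τ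
  before-prefix zero    ne = sym (cong (λ b → if b then P else []) (≤ᵇ-false {2 ℕ.* k} {0} (λ le → ne (sym (ℕP.n≤0⇒n≡0 le)))))
  before-prefix (suc τ) ne with 2 ℕ.* k ℕP.≤? τ
  ... | yes le = trans (cong (λ b → if b then P else []) (≤ᵇ-true le)) (sym (cong (λ b → if b then P else []) (≤ᵇ-true (ℕP.m≤n⇒m≤1+n le))))
  ... | no nle = trans (cong (λ b → if b then P else []) (≤ᵇ-false nle)) (sym (cong (λ b → if b then P else []) (≤ᵇ-false (λ le → nle (ℕP.≤-pred (ℕP.≤∧≢⇒< le (ne ∘ sym)))))))

  before-hole : ∀ τ → τ ≡ 2 ℕ.* k → before τ ≡ []
  before-hole zero    _ = refl
  before-hole (suc τ) e = cong (λ b → if b then P else []) (≤ᵇ-false (λ le → ℕP.<-irrefl refl (ℕP.≤-trans (ℕP.≤-reflexive e) le)))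

  -- passing from the triangles left uncovered by a column to those that are to be covered by the next
  fill-hole : ∀ τ d S → τ ℕ.+ d ≡ c → (∀ j → okL τ j ≡ false → S τ j ≡ true) →
    let acc = filterᵇ (λ j → okL τ j ∧ S τ j) (range 0 d) in
    value-at τ (pending-list S τ d) ≡ G τ acc × length (before τ) ℕ.+ length (pending-list S τ d) ≡ length (prefix τ) ℕ.+ length acc
  fill-hole τ d S d≡ holes with τ ℕ.≟ 2 ℕ.* k
  ... | no ne = cong₂ (λ p l → F (p ++ map (pt τ) l)) pre same , cong₂ (λ p l → length p ℕ.+ length l) pre same
    where
    same : pending-list S τ d ≡ filterᵇ (λ j → okL τ j ∧ S τ j) (range 0 d)
    same = filterᵇ-cong (range 0 d) (λ {j} _ → cong (λ b → not b ∧ S τ j) (hole-eq τ j ne))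
    pre : before τ ≡ prefix τ
    pre = before-prefix τ ne
  fill-hole τ d S d≡ holes | yes refl = trans (cong₂ (λ p l → F (p ++ map (pt τ) l)) before-nil pend)
      (trans (cong F (map-++ (pt τ) A (e ∷ suc e ∷ B)))
      (trans (move-pair {F = F} (Pf-alternating m₀) [] (map (pt τ) A) (pt τ e) (pt τ (suc e)) (map (pt τ) B))
        (cong₂ (λ p l → F (p ++ l)) (sym prefix-P) (trans (sym (map-++ (pt τ) A B)) (cong (map (pt τ)) (sym accs))))))
    , trans (cong₂ (λ p l → length p ℕ.+ length l) before-nil pend) (trans (trans (length-++ A) (trans (ℕP.+-suc (length A) (suc (length B))) (cong suc (ℕP.+-suc (length A) (length B)))))
        (cong₂ (λ p l → length p ℕ.+ l) (sym prefix-P) (trans (sym (length-++ A)) (cong length (sym accs)))))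
    where
    p : ℕ → Bool
    p j = okL τ j ∧ S τ j
    A = filterᵇ p (range 0 e)
    B = filterᵇ p (range (suc (suc e)) e)
    prefix-P : prefix τ ≡ P
    prefix-P = cong (λ b → if b then P else []) (≤ᵇ-true (ℕP.≤-refl {τ}))
    before-nil : before τ ≡ []
    before-nil = before-hole τ refl
    -- The two positions of the hole are the middle ones of their line, with `e` positions on either
    -- side.
    d-value : d ≡ e ℕ.+ suc (suc e)
    d-value = trans (ℕP.+-cancelˡ-≡ τ _ _ (trans d≡ (sym centre))) (trans (cong suc (sym (ℕP.+-suc e e))) (sym (ℕP.+-suc e (suc e))))
    split : range 0 d ≡ range 0 e ++ e ∷ suc e ∷ range (suc (suc e)) e
    split = trans (cong (range 0) d-value) (range-++ 0 e (suc (suc e)))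
    in-e : okL τ e ≡ false
    in-e rewrite ≤ᵇ-true (ℕP.≤-refl {τ}) | ≤ᵇ-true (ℕP.≤-refl {e}) | ≤ᵇ-true (ℕP.+-monoʳ-≤ e (ℕP.n≤1+n τ)) = refl
    in-e+1 : okL τ (suc e) ≡ false
    in-e+1 rewrite ≤ᵇ-true (ℕP.≤-refl {τ}) | ≤ᵇ-true (ℕP.n≤1+n e) | ≤ᵇ-true (ℕP.≤-reflexive (sym (ℕP.+-suc e τ))) = refl
    out : ∀ j → j ≢ e → j ≢ suc e → okL τ j ≡ true
    out j ne₁ ne₂ with okL τ j in b
    ... | true = refl
    ... | false with shape (in-hole τ j b)
      where
      shape : ∀ {σ j} → InHole σ j → j ≡ e ⊎ j ≡ suc e
      shape right-lower = inj₁ refl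
      shape right-upper = inj₂ refl
      shape left        = inj₁ refl
    ... | inj₁ q = ⊥-elim (ne₁ q)
    ... | inj₂ q = ⊥-elim (ne₂ q)
    pq : ∀ j → j ≢ e → j ≢ suc e → not (holeR τ j) ∧ S τ j ≡ p j
    pq j a b = cong (_∧ S τ j) (trans (cong not (right-hole j)) (sym (out j a b)))
    q-hole : ∀ j → okL τ j ≡ false → not (holeR τ j) ∧ S τ j ≡ true
    q-hole j b = cong₂ _∧_ (cong not (right-hole j)) (holes j b)
    keep : ∀ (q : ℕ → Bool) as {u v} bs → q u ≡ true → q v ≡ true → filterᵇ q (as ++ u ∷ v ∷ bs) ≡ filterᵇ q as ++ u ∷ v ∷ filterᵇ q bs
    keep q as {u} {v} bs eu ev = trans (filterᵇ-++ q as (u ∷ v ∷ bs)) (cong (filterᵇ q as ++_) tl)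
      where
      tl : filterᵇ q (u ∷ v ∷ bs) ≡ u ∷ v ∷ filterᵇ q bs
      tl rewrite eu | ev = refl
    drop : ∀ (q : ℕ → Bool) as {u v} bs → q u ≡ false → q v ≡ false → filterᵇ q (as ++ u ∷ v ∷ bs) ≡ filterᵇ q as ++ filterᵇ q bs
    drop q as {u} {v} bs eu ev = trans (filterᵇ-++ q as (u ∷ v ∷ bs)) (cong (filterᵇ q as ++_) tl)
      where
      tl : filterᵇ q (u ∷ v ∷ bs) ≡ filterᵇ q bs
      tl rewrite eu | ev = refl
    pend : pending-list S τ d ≡ A ++ e ∷ suc e ∷ B
    pend = trans (cong (filterᵇ _) split) (trans (keep (λ j → not (holeR τ j) ∧ S τ j) (range 0 e) (range (suc (suc e)) e) (q-hole e in-e) (q-hole (suc e) in-e+1))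
      (cong₂ (λ a b → a ++ e ∷ suc e ∷ b)
        (filterᵇ-cong (range 0 e) (λ {j} m → pq j (λ { refl → ℕP.<-irrefl refl (range-< 0 e m) }) (λ { refl → ℕP.<-asym (range-< 0 e m) (ℕP.n<1+n e) })))
        (filterᵇ-cong (range (suc (suc e)) e) (λ {j} m → pq j (λ { refl → ℕP.<-asym (range-≥ _ e m) (ℕP.n<1+n _) }) (λ { refl → ℕP.<-irrefl refl (range-≥ _ e m) })))))
    accs : filterᵇ p (range 0 d) ≡ A ++ B
    accs = trans (cong (filterᵇ p) split) (drop p (range 0 e) (range (suc (suc e)) e) (cong (_∧ S τ e) in-e) (cong (_∧ S τ (suc e)) in-e+1))

  -- Induction on the distance from ℓ. The length has to be carried along, because at τ = 0 the
  -- value 1 of the Pfaffian needs a list of exactly 2·m₀ ends.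
  count : ∀ τ d S → τ ℕ.+ d ≡ c → τ ≤ top → (∀ σ j → τ < σ → cR σ j ≡ true → S σ j ≡ false) → (∀ σ j → σ < τ → S σ j ≡ true) →
    length (before τ) ℕ.+ length (pending-list S τ d) ≡ m₀ ℕ.+ m₀ →
    ℕ→ℚ (matchings (rightOf τ d) S) ≡ value-at τ (pending-list S τ d)
  count zero d S d≡ le done fresh len = trans (cong (λ b → ℕ→ℚ (if b then 1 else 0)) (all-complete _ insR finished))
    (sym (pf-ones ω m₀ (map (pt 0) (pending-list S 0 d)) (trans (length-map (pt 0) (pending-list S 0 d)) len) (ascending-pairs _ 0 d)))
    where
    finished : ∀ {a} → a ∈ insR → not (S (proj₁ a) (proj₂ a)) ≡ true
    finished {zero , j}  a∈ = ⊥-elim (false≢true (trans (sym cR-positive) (insR-cR a∈)))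
    finished {suc σ , j} a∈ = cong not (done (suc σ) j (s≤s z≤n) (insR-cR a∈))
  count (suc τ) d S d≡ le done fresh len = trans
    (Column.scan τ d (G τ) (length (pending-list S (suc τ) d)) (λ j d≤j → cR-outside τ d j d≡ d≤j) (G-dup τ) (G-kill τ) rest (suc d) 0 S U [] false
      (record { below = λ _ () ; last = refl ; pending = λ _ _ → refl ; fresh = λ j _ → fresh τ j ℕP.≤-refl ; untouched = λ σ j lt → fresh σ j (ℕP.m≤n⇒m≤1+n lt)
              ; done = done ; holes = λ j _ → fresh τ j ℕP.≤-refl ; open-acc = refl }) refl (cong length U≡))
    (trans (cong (λ l → spread (λ us → G τ us) l) U≡) (spread-Pf m₀ τ (prefix τ) (pending-list S (suc τ) d)))
    where
    U : ℕ → Bool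
    U j = cR (suc τ) j ∧ S (suc τ) j
    U≡ : filterᵇ U (range 0 (suc d)) ≡ pending-list S (suc τ) d
    U≡ = trans (filterᵇ-snoc U 0 d) (trans (cong (λ b → filterᵇ U (range 0 d) ++ (if b ∧ S (suc τ) d then d ∷ [] else [])) (cR-outside τ d d d≡ ℕP.≤-refl))
      (trans (++-identityʳ _) (filterᵇ-cong (range 0 d) (λ {j} m → cong (_∧ S (suc τ) j) (cR-inside τ d j d≡ le (range-< 0 d m))))))
    d≡′ : τ ℕ.+ suc d ≡ c
    d≡′ = trans (ℕP.+-suc τ d) d≡
    rest : ∀ S′ acc → (∀ σ j → τ < σ → cR σ j ≡ true → S′ σ j ≡ false) → (∀ σ j → σ < τ → S′ σ j ≡ true) → (∀ j → okL τ j ≡ false → S′ τ j ≡ true) →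
      filterᵇ (λ j → okL τ j ∧ S′ τ j) (range 0 (suc d)) ≡ acc → length acc ≡ length (pending-list S (suc τ) d) →
      ℕ→ℚ (matchings (rightOf τ (suc d)) S′) ≡ G τ acc
    rest S′ _ done′ fresh′ holes refl len′ = trans
      (count τ (suc d) S′ d≡′ (ℕP.<⇒≤ le) done′ fresh′ (trans (proj₂ (fill-hole τ (suc d) S′ d≡′ holes)) (trans (cong (length (prefix τ) ℕ.+_) len′) len)))
      (proj₁ (fill-hole τ (suc d) S′ d≡′ holes))

-- The unit triangles of the region

bool-ext : ∀ {a b} → (a ≡ true → b ≡ true) → (b ≡ true → a ≡ true) → a ≡ b
bool-ext {true}  {b}     f g = sym (f refl)
bool-ext {false} {true}  f g = g refl
bool-ext {false} {false} f g = refl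

filter-concatMap : {A B : Set} (p : B → Bool) (f : A → List B) (as : List A) →
                   filterᵇ p (concatMap f as) ≡ concatMap (filterᵇ p ∘ f) as
filter-concatMap p f []       = refl
filter-concatMap p f (a ∷ as) = trans (filterᵇ-++ p (f a) (concatMap f as)) (cong (filterᵇ p (f a) ++_) (filter-concatMap p f as))

concatMap-cong∈ : {A B : Set} {f g : A → List B} (as : List A) → (∀ {a} → a ∈ as → f a ≡ g a) → concatMap f as ≡ concatMap g as
concatMap-cong∈ []       e = refl
concatMap-cong∈ (a ∷ as) e = cong₂ _++_ (e (here refl)) (concatMap-cong∈ as (e ∘ there))

concatMap-empty : {A B : Set} {f : A → List B} (as : List A) → (∀ {a} → a ∈ as → f a ≡ []) → concatMap f as ≡ []
concatMap-empty []       e = refl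
concatMap-empty (a ∷ as) e rewrite e (here refl) = concatMap-empty as (e ∘ there)

concatMap-++ : {A B : Set} (f : A → List B) (as bs : List A) → concatMap f (as ++ bs) ≡ concatMap f as ++ concatMap f bs
concatMap-++ f []       bs = refl
concatMap-++ f (a ∷ as) bs = trans (cong (f a ++_) (concatMap-++ f as bs)) (sym (++-assoc (f a) (concatMap f as) (concatMap f bs)))

concatMap-range : {B : Set} (f : ℤ → List B) (lo : ℤ) (s m : ℕ) →
  concatMap f (ℤrange (lo ℤ.+ + s) m) ≡ concatMap (λ j → f (lo ℤ.+ + j)) (range s m)
concatMap-range f lo s zero    = refl
concatMap-range f lo s (suc m) = cong (f (lo ℤ.+ + s) ++_)
  (trans (cong (λ z → concatMap f (ℤrange z m)) (ℤS.solve 2 (λ l s → l ℤS.:+ s ℤS.:+ ℤS.con (+ 1) ℤS.:= l ℤS.:+ (ℤS.con (+ 1) ℤS.:+ s)) refl lo (+ s)))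
    (concatMap-range f lo (suc s) m))

-- On a vertical line only every second doubled height belongs to a lattice point.
concatMap-even : {B : Set} (f : ℕ → List B) (τ d : ℕ) → (∀ i → f (suc (τ ℕ.+ 2 ℕ.* i)) ≡ []) →
  ∀ i → concatMap f (range (τ ℕ.+ 2 ℕ.* i) (2 ℕ.* d)) ≡ concatMap (λ j → f (τ ℕ.+ 2 ℕ.* j)) (range i d)
concatMap-even f τ zero    odd i = refl
concatMap-even f τ (suc d) odd i = trans (cong (λ w → concatMap f (range (τ ℕ.+ 2 ℕ.* i) w)) (ℕP.*-suc 2 d))
  (cong (f (τ ℕ.+ 2 ℕ.* i) ++_) (trans (cong (_++ concatMap f (range (suc (suc (τ ℕ.+ 2 ℕ.* i))) (2 ℕ.* d))) (odd i))
    (trans (cong (λ w → concatMap f (range w (2 ℕ.* d))) (sym e)) (concatMap-even f τ d odd (suc i)))))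
  where
  e : τ ℕ.+ 2 ℕ.* suc i ≡ suc (suc (τ ℕ.+ 2 ℕ.* i))
  e = ℕS.solve 2 (λ t i → t ℕS.:+ ℕS.con 2 ℕS.:* (ℕS.con 1 ℕS.:+ i) ℕS.:= ℕS.con 2 ℕS.:+ (t ℕS.:+ ℕS.con 2 ℕS.:* i)) refl τ i

∣even∣ : ∀ y → ℤ.∣ + 2 ℤ.* y ∣ % 2 ≡ 0
∣even∣ y = trans (cong (_% 2) (trans (ℤP.abs-* (+ 2) y) (ℕP.*-comm 2 ℤ.∣ y ∣))) (m*n%n≡0 ℤ.∣ y ∣ 2)

∣odd∣ : ∀ y → ℤ.∣ + 1 ℤ.+ + 2 ℤ.* y ∣ % 2 ≡ 1
∣odd∣ (+ a) = trans (cong (_% 2) (cong (λ z → ℤ.∣ + 1 ℤ.+ z ∣) (sym (ℤP.pos-* 2 a)))) (trans (cong (λ w → suc w % 2) (ℕP.*-comm 2 a)) ([m+kn]%n≡m%n 1 a 2))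
∣odd∣ -[1+ a ] = trans (cong (_% 2) (trans (cong ℤ.∣_∣ e) (ℤP.∣-i∣≡∣i∣ (+ suc (2 ℕ.* a))))) (trans (cong (λ w → suc w % 2) (ℕP.*-comm 2 a)) ([m+kn]%n≡m%n 1 a 2))
  where
  e : + 1 ℤ.+ + 2 ℤ.* -[1+ a ] ≡ ℤ.- (+ suc (2 ℕ.* a))
  e = trans (ℤS.solve 1 (λ a → ℤS.con (+ 1) ℤS.:+ ℤS.con (+ 2) ℤS.:* (ℤS.:- (ℤS.con (+ 1) ℤS.:+ a)) ℤS.:= ℤS.:- (ℤS.con (+ 1) ℤS.:+ ℤS.con (+ 2) ℤS.:* a)) refl (+ a)) (cong (λ z → ℤ.- (+ 1 ℤ.+ z)) (sym (ℤP.pos-* 2 a)))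

-- Every bound of the region compares integers that become natural numbers after adding a common
-- `r`; this transports the Boolean tests.
≤ᵇ-shift : ∀ {p q r : ℤ} {u v : ℕ} → p ℤ.+ r ≡ + u → q ℤ.+ r ≡ + v → (p ℤ.≤ᵇ q) ≡ (u ≤ᵇ v)
≤ᵇ-shift {p} {q} {r} {u} {v} ep eq = bool-ext
  (λ e → ≤ᵇ-true (ℤP.drop‿+≤+ (subst₂ ℤ._≤_ ep eq (ℤP.+-monoˡ-≤ r (ℤP.≤ᵇ⇒≤ {p} {q} (subst Bool.T (sym e) _))))))
  (λ e → T-true (ℤP.≤⇒≤ᵇ (subst₂ ℤ._≤_ (back p ep) (back q eq) (ℤP.+-monoˡ-≤ (ℤ.- r) (ℤ.+≤+ (≤ᵇ-sound e))))))
  where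
  T-true : ∀ {b} → Bool.T b → b ≡ true
  T-true {true} _ = refl
  back : ∀ p {u} → p ℤ.+ r ≡ + u → + u ℤ.+ ℤ.- r ≡ p
  back p e = trans (cong (ℤ._+ ℤ.- r) (sym e)) (ℤS.solve 2 (λ p r → p ℤS.:+ r ℤS.:+ ℤS.:- r ℤS.:= p) refl p r)

by : ∀ z {p q u v : ℕ} → p ≤ q → u ≡ z ℕ.+ p → z ℕ.+ q ≡ v → u ≤ v
by z le refl refl = ℕP.+-monoʳ-≤ z le

double : ∀ {p q} → p ≤ q → 2 ℕ.* p ≤ 2 ℕ.* q
double = ℕP.*-monoʳ-≤ 2

∧-intro : ∀ {a b} → a ≡ true → b ≡ true → a ∧ b ≡ true
∧-intro refl refl = refl

module Geometry (n x k e : ℕ) (centre : 2 ℕ.* k ℕ.+ suc (suc (e ℕ.+ e)) ≡ 2 ℕ.* x ℕ.+ 2 ℕ.* n) where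
  c : ℕ
  c = 2 ℕ.* x ℕ.+ 2 ℕ.* n
  open Coordinates c
  open Hole k e

  inT : Tri → Bool
  inT t = isLatticeTri t ∧ inConvex (inLeftHalf n x) t ∧ not (inConvex (inHole k) t)

  at : ℕ → ℤ
  at m = ℤ.- + c ℤ.+ + m

  half-point : ∀ {a Y} σ m → a ≡ ℤ.- + σ → Y ≡ at m → inLeftHalf n x (a , Y) ≡ (σ ≤ᵇ 2 ℕ.* n) ∧ (σ ≤ᵇ m) ∧ (m ℕ.+ σ ≤ᵇ c ℕ.+ c)
  half-point σ m refl refl = cong₂ _∧_
    (≤ᵇ-shift {ℤ.- + (2 ℕ.* n)} {ℤ.- + σ} {r = + (2 ℕ.* n) ℤ.+ + σ} (ℤS.solve 2 (λ n s → ℤS.:- n ℤS.:+ (n ℤS.:+ s) ℤS.:= s) refl (+ (2 ℕ.* n)) (+ σ)) (ℤS.solve 2 (λ n s → ℤS.:- s ℤS.:+ (n ℤS.:+ s) ℤS.:= n) refl (+ (2 ℕ.* n)) (+ σ)))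
    (trans (cong₂ _∧_ (≤ᵇ-shift {ℤ.- + σ} {+ 0} {r = + σ} {u = 0} {v = σ} (ℤP.+-inverseˡ (+ σ)) refl)
        (cong₂ _∧_ (≤ᵇ-shift {ℤ.- (+ c ℤ.+ ℤ.- + σ)} {at m} {r = + c} (ℤS.solve 2 (λ c s → ℤS.:- (c ℤS.:+ ℤS.:- s) ℤS.:+ c ℤS.:= s) refl (+ c) (+ σ)) (ℤS.solve 2 (λ c m → (ℤS.:- c ℤS.:+ m) ℤS.:+ c ℤS.:= m) refl (+ c) (+ m)))
          (≤ᵇ-shift {at m} {+ c ℤ.+ ℤ.- + σ} {r = + c ℤ.+ + σ} (ℤS.solve 3 (λ c m s → (ℤS.:- c ℤS.:+ m) ℤS.:+ (c ℤS.:+ s) ℤS.:= m ℤS.:+ s) refl (+ c) (+ m) (+ σ)) (ℤS.solve 2 (λ c s → (c ℤS.:+ ℤS.:- s) ℤS.:+ (c ℤS.:+ s) ℤS.:= c ℤS.:+ c) refl (+ c) (+ σ)))))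
      refl)

  k₂ : ℕ
  k₂ = 2 ℕ.* k ℕ.+ 2

  hole-point : ∀ {a Y} σ m → a ≡ ℤ.- + σ → Y ≡ at m →
    inHole k (a , Y) ≡ (σ ≤ᵇ k₂) ∧ (2 ℕ.* k ≤ᵇ σ) ∧ (σ ℕ.+ c ≤ᵇ m ℕ.+ k₂) ∧ (m ℕ.+ σ ≤ᵇ c ℕ.+ k₂)
  hole-point σ m refl refl = cong₂ _∧_
    (≤ᵇ-shift {ℤ.- + k₂} {ℤ.- + σ} {r = + k₂ ℤ.+ + σ} (ℤS.solve 2 (λ n s → ℤS.:- n ℤS.:+ (n ℤS.:+ s) ℤS.:= s) refl (+ k₂) (+ σ)) (ℤS.solve 2 (λ n s → ℤS.:- s ℤS.:+ (n ℤS.:+ s) ℤS.:= n) refl (+ k₂) (+ σ)))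
    (cong₂ _∧_ (≤ᵇ-shift {ℤ.- + σ} {ℤ.- + (2 ℕ.* k)} {r = + (2 ℕ.* k) ℤ.+ + σ} (ℤS.solve 2 (λ n s → ℤS.:- s ℤS.:+ (n ℤS.:+ s) ℤS.:= n) refl (+ (2 ℕ.* k)) (+ σ)) (ℤS.solve 2 (λ n s → ℤS.:- n ℤS.:+ (n ℤS.:+ s) ℤS.:= s) refl (+ (2 ℕ.* k)) (+ σ)))
    (cong₂ _∧_ (≤ᵇ-shift {ℤ.- (ℤ.- + σ ℤ.+ + k₂)} {at m} {r = + c ℤ.+ + k₂} (ℤS.solve 3 (λ c s k → ℤS.:- (ℤS.:- s ℤS.:+ k) ℤS.:+ (c ℤS.:+ k) ℤS.:= s ℤS.:+ c) refl (+ c) (+ σ) (+ k₂)) (ℤS.solve 3 (λ c m k → (ℤS.:- c ℤS.:+ m) ℤS.:+ (c ℤS.:+ k) ℤS.:= m ℤS.:+ k) refl (+ c) (+ m) (+ k₂)))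
      (≤ᵇ-shift {at m} {ℤ.- + σ ℤ.+ + k₂} {r = + c ℤ.+ + σ} (ℤS.solve 3 (λ c m s → (ℤS.:- c ℤS.:+ m) ℤS.:+ (c ℤS.:+ s) ℤS.:= m ℤS.:+ s) refl (+ c) (+ m) (+ σ)) (ℤS.solve 3 (λ c s k → (ℤS.:- s ℤS.:+ k) ℤS.:+ (c ℤS.:+ s) ℤS.:= c ℤS.:+ k) refl (+ c) (+ σ) (+ k₂)))))

  at+1 : ∀ m → at m ℤ.+ + 1 ≡ at (suc m)
  at+1 m = ℤS.solve 2 (λ c m → (ℤS.:- c ℤS.:+ m) ℤS.:+ ℤS.con (+ 1) ℤS.:= ℤS.:- c ℤS.:+ (ℤS.con (+ 1) ℤS.:+ m)) refl (+ c) (+ m)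

  at+2 : ∀ m → at m ℤ.+ + 2 ≡ at (suc (suc m))
  at+2 m = ℤS.solve 2 (λ c m → (ℤS.:- c ℤS.:+ m) ℤS.:+ ℤS.con (+ 2) ℤS.:= ℤS.:- c ℤS.:+ (ℤS.con (+ 2) ℤS.:+ m)) refl (+ c) (+ m)

  col-1 : ∀ τ → ℤ.- + τ ℤ.- + 1 ≡ ℤ.- + suc τ
  col-1 τ = ℤS.solve 1 (λ t → ℤS.:- t ℤS.:- ℤS.con (+ 1) ℤS.:= ℤS.:- (ℤS.con (+ 1) ℤS.:+ t)) refl (+ τ)

  col+1 : ∀ τ → ℤ.- + suc τ ℤ.+ + 1 ≡ ℤ.- + τ
  col+1 τ = ℤS.solve 1 (λ t → ℤS.:- (ℤS.con (+ 1) ℤS.:+ t) ℤS.:+ ℤS.con (+ 1) ℤS.:= ℤS.:- t) refl (+ τ)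

  HalfB : ℕ → ℕ → Bool
  HalfB σ m = (σ ≤ᵇ 2 ℕ.* n) ∧ (σ ≤ᵇ m) ∧ (m ℕ.+ σ ≤ᵇ c ℕ.+ c)

  HoleB : ℕ → ℕ → Bool
  HoleB σ m = (σ ≤ᵇ k₂) ∧ (2 ℕ.* k ≤ᵇ σ) ∧ (σ ℕ.+ c ≤ᵇ m ℕ.+ k₂) ∧ (m ℕ.+ σ ≤ᵇ c ℕ.+ k₂)

  three : ∀ {a b d a′ b′ d′} → a ≡ a′ → b ≡ b′ → d ≡ d′ → a ∧ (b ∧ (d ∧ true)) ≡ a′ ∧ b′ ∧ d′
  three {d = d} refl refl refl rewrite ∧-identityʳ d = refl

  convexL : ∀ (P : Point → Bool) (Q : ℕ → ℕ → Bool) → (∀ {a Y} σ m → a ≡ ℤ.- + σ → Y ≡ at m → P (a , Y) ≡ Q σ m) →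
    ∀ τ m → inConvex P (tri ◁ (ℤ.- + τ) (at m)) ≡ Q τ m ∧ Q τ (suc (suc m)) ∧ Q (suc τ) (suc m)
  convexL P Q h τ m = three (h τ m refl refl) (h τ (suc (suc m)) refl (at+2 m)) (h (suc τ) (suc m) (col-1 τ) (at+1 m))

  convexR : ∀ (P : Point → Bool) (Q : ℕ → ℕ → Bool) → (∀ {a Y} σ m → a ≡ ℤ.- + σ → Y ≡ at m → P (a , Y) ≡ Q σ m) →
    ∀ τ m → inConvex P (tri ▷ (ℤ.- + suc τ) (at m)) ≡ Q (suc τ) m ∧ Q (suc τ) (suc (suc m)) ∧ Q τ (suc m)
  convexR P Q h τ m = three (h (suc τ) m refl refl) (h (suc τ) (suc (suc m)) refl (at+2 m)) (h τ (suc m) (col+1 τ) (at+1 m))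

  -- The apex lies on the line beyond ℓ.
  halfR-zero : ∀ m → inConvex (inLeftHalf n x) (tri ▷ (ℤ.- + 0) (at m)) ≡ false
  halfR-zero m = trans (cong (λ b → inLeftHalf n x (ℤ.- + 0 , at m) ∧ inLeftHalf n x (ℤ.- + 0 , at m ℤ.+ + 2) ∧ (b ∧ true)) (∧-zeroʳ (ℤ.- (+ (2 ℕ.* n)) ℤ.≤ᵇ + 1)))
    (trans (cong (inLeftHalf n x (ℤ.- + 0 , at m) ∧_) (∧-zeroʳ _)) (∧-zeroʳ _))

  -- Left-pointing triangles on the leftmost line and right-pointing ones on ℓ have their apex
  -- outside.
  okL′ okR′ : ℕ → ℕ → Bool
  okL′ τ i = (suc τ ≤ᵇ 2 ℕ.* n) ∧ okL τ i
  okR′ τ i = (1 ≤ᵇ τ) ∧ not (holeR τ i)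

  private
    HalfB-intro : ∀ {σ m} → σ ≤ 2 ℕ.* n → σ ≤ m → m ℕ.+ σ ≤ c ℕ.+ c → HalfB σ m ≡ true
    HalfB-intro a b d = ∧-intro (≤ᵇ-true a) (∧-intro (≤ᵇ-true b) (≤ᵇ-true d))

  halfL : ∀ τ d i → τ ℕ.+ d ≡ c → i < d → τ ≤ 2 ℕ.* n → inConvex (inLeftHalf n x) (L τ i) ≡ (suc τ ≤ᵇ 2 ℕ.* n)
  halfL τ d i d≡ lt le = trans (convexL (inLeftHalf n x) HalfB half-point τ m) (bool-ext
      (λ p → proj₁ (∧-split (proj₂ (∧-split {HalfB τ (suc (suc m))} (proj₂ (∧-split {HalfB τ m} p))))))
      (λ p → ∧-intro (HalfB-intro le τ≤m (ℕP.≤-trans (ℕP.+-monoˡ-≤ τ (ℕP.≤-trans (ℕP.n≤1+n m) (ℕP.n≤1+n (suc m)))) top))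
        (∧-intro (HalfB-intro le (ℕP.≤-trans τ≤m (ℕP.≤-trans (ℕP.n≤1+n m) (ℕP.n≤1+n (suc m)))) top)
          (HalfB-intro (≤ᵇ-sound p) (s≤s τ≤m) (ℕP.≤-trans (ℕP.≤-reflexive (cong suc (ℕP.+-suc m τ))) top)))))
    where
    m = τ ℕ.+ 2 ℕ.* i
    τ≤m : τ ≤ m
    τ≤m = ℕP.m≤m+n τ (2 ℕ.* i)
    top : suc (suc m) ℕ.+ τ ≤ c ℕ.+ c
    top = by (τ ℕ.+ τ) (double lt) (ℕS.solve 2 (λ t i → ℕS.con 2 ℕS.:+ (t ℕS.:+ ℕS.con 2 ℕS.:* i) ℕS.:+ t ℕS.:= t ℕS.:+ t ℕS.:+ ℕS.con 2 ℕS.:* (ℕS.con 1 ℕS.:+ i)) refl τ i)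
      (trans (ℕS.solve 2 (λ t d → t ℕS.:+ t ℕS.:+ ℕS.con 2 ℕS.:* d ℕS.:= (t ℕS.:+ d) ℕS.:+ (t ℕS.:+ d)) refl τ d) (cong₂ ℕ._+_ d≡ d≡))

  halfR : ∀ τ d i → τ ℕ.+ d ≡ c → i < d → τ ≤ 2 ℕ.* n → inConvex (inLeftHalf n x) (R τ i) ≡ (1 ≤ᵇ τ)
  halfR zero    d i d≡ lt le = halfR-zero (2 ℕ.* i)
  halfR (suc τ) d i d≡ lt le = trans (convexR (inLeftHalf n x) HalfB half-point τ m)
      (∧-intro (HalfB-intro le τ≤m (ℕP.≤-trans (ℕP.+-monoˡ-≤ (suc τ) (ℕP.≤-trans (ℕP.n≤1+n m) (ℕP.n≤1+n (suc m)))) top))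
        (∧-intro (HalfB-intro le (ℕP.≤-trans τ≤m (ℕP.≤-trans (ℕP.n≤1+n m) (ℕP.n≤1+n (suc m)))) top)
          (HalfB-intro (ℕP.<⇒≤ le) (ℕP.≤-trans (ℕP.n≤1+n τ) (ℕP.≤-trans τ≤m (ℕP.n≤1+n m))) (ℕP.≤-trans (ℕP.+-mono-≤ (ℕP.n≤1+n (suc m)) (ℕP.n≤1+n τ)) top))))
    where
    m = suc τ ℕ.+ 2 ℕ.* i
    τ≤m : suc τ ≤ m
    τ≤m = ℕP.m≤m+n (suc τ) (2 ℕ.* i)
    top : suc (suc m) ℕ.+ suc τ ≤ c ℕ.+ c
    top = by (suc τ ℕ.+ suc τ) (double lt) (ℕS.solve 2 (λ t i → ℕS.con 2 ℕS.:+ (t ℕS.:+ ℕS.con 2 ℕS.:* i) ℕS.:+ t ℕS.:= t ℕS.:+ t ℕS.:+ ℕS.con 2 ℕS.:* (ℕS.con 1 ℕS.:+ i)) refl (suc τ) i)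
      (trans (ℕS.solve 2 (λ t d → t ℕS.:+ t ℕS.:+ ℕS.con 2 ℕS.:* d ℕS.:= (t ℕS.:+ d) ℕS.:+ (t ℕS.:+ d)) refl (suc τ) d) (cong₂ ℕ._+_ d≡ d≡))

  private
    K = 2 ℕ.* k
    HoleB-intro : ∀ σ m → σ ≤ k₂ → K ≤ σ → σ ℕ.+ c ≤ m ℕ.+ k₂ → m ℕ.+ σ ≤ c ℕ.+ k₂ → HoleB σ m ≡ true
    HoleB-intro σ m a b d f = ∧-intro (≤ᵇ-true a) (∧-intro (≤ᵇ-true b) (∧-intro (≤ᵇ-true d) (≤ᵇ-true f)))

    HoleB-elim : ∀ {σ m} → HoleB σ m ≡ true → K ≤ σ × σ ℕ.+ c ≤ m ℕ.+ k₂ × m ℕ.+ σ ≤ c ℕ.+ k₂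
    HoleB-elim {σ} {m} p with ∧-split {σ ≤ᵇ k₂} p
    ... | _ , p₁ with ∧-split {K ≤ᵇ σ} p₁
    ... | a , p₂ with ∧-split {σ ℕ.+ c ≤ᵇ m ℕ.+ k₂} p₂
    ... | b , d = ≤ᵇ-sound a , ≤ᵇ-sound b , ≤ᵇ-sound d

    lower-bound : ∀ τ i → e ≤ i → τ ℕ.+ c ≤ (τ ℕ.+ 2 ℕ.* i) ℕ.+ k₂
    lower-bound τ i le = by (τ ℕ.+ k₂) (double le)
      (trans (cong (τ ℕ.+_) (sym centre)) (ℕS.solve 3 (λ t k e → t ℕS.:+ (k ℕS.:+ (ℕS.con 2 ℕS.:+ (e ℕS.:+ e))) ℕS.:= t ℕS.:+ (k ℕS.:+ ℕS.con 2) ℕS.:+ ℕS.con 2 ℕS.:* e) refl τ K e))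
      (ℕS.solve 3 (λ t k i → t ℕS.:+ k ℕS.:+ ℕS.con 2 ℕS.:* i ℕS.:= t ℕS.:+ ℕS.con 2 ℕS.:* i ℕS.:+ k) refl τ k₂ i)

    lower-bound⁻ : ∀ τ i → τ ℕ.+ c ≤ (τ ℕ.+ 2 ℕ.* i) ℕ.+ k₂ → e ≤ i
    lower-bound⁻ τ i le = ℕP.*-cancelˡ-≤ 2 (ℕP.+-cancelˡ-≤ (τ ℕ.+ k₂) (2 ℕ.* e) (2 ℕ.* i) (ℕP.≤-trans (ℕP.≤-reflexive
        (trans (ℕS.solve 3 (λ t k e → t ℕS.:+ (k ℕS.:+ ℕS.con 2) ℕS.:+ ℕS.con 2 ℕS.:* e ℕS.:= t ℕS.:+ (k ℕS.:+ (ℕS.con 2 ℕS.:+ (e ℕS.:+ e)))) refl τ K e) (cong (τ ℕ.+_) centre)))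
      (ℕP.≤-trans le (ℕP.≤-reflexive (ℕS.solve 3 (λ t k i → t ℕS.:+ ℕS.con 2 ℕS.:* i ℕS.:+ k ℕS.:= t ℕS.:+ k ℕS.:+ ℕS.con 2 ℕS.:* i) refl τ k₂ i)))))

    c+k₂ : 2 ℕ.+ 2 ℕ.* (e ℕ.+ suc K) ≡ c ℕ.+ k₂
    c+k₂ = trans (ℕS.solve 2 (λ k e → ℕS.con 2 ℕS.:+ ℕS.con 2 ℕS.:* (e ℕS.:+ (ℕS.con 1 ℕS.:+ k)) ℕS.:= (k ℕS.:+ (ℕS.con 2 ℕS.:+ (e ℕS.:+ e))) ℕS.:+ (k ℕS.:+ ℕS.con 2)) refl K e) (cong (ℕ._+ k₂) centre)

    upper-form : ∀ τ i → suc (suc (τ ℕ.+ 2 ℕ.* i)) ℕ.+ τ ≡ 2 ℕ.+ 2 ℕ.* (i ℕ.+ τ)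
    upper-form τ i = ℕS.solve 2 (λ t i → ℕS.con 2 ℕS.:+ (t ℕS.:+ ℕS.con 2 ℕS.:* i) ℕS.:+ t ℕS.:= ℕS.con 2 ℕS.:+ ℕS.con 2 ℕS.:* (i ℕS.:+ t)) refl τ i

    upper-bound : ∀ τ i → i ℕ.+ τ ≤ e ℕ.+ suc K → suc (suc (τ ℕ.+ 2 ℕ.* i)) ℕ.+ τ ≤ c ℕ.+ k₂
    upper-bound τ i le = by 2 (double le) (upper-form τ i) c+k₂

    upper-bound⁻ : ∀ τ i → suc (suc (τ ℕ.+ 2 ℕ.* i)) ℕ.+ τ ≤ c ℕ.+ k₂ → i ℕ.+ τ ≤ e ℕ.+ suc K
    upper-bound⁻ τ i le = ℕP.*-cancelˡ-≤ 2 (ℕP.+-cancelˡ-≤ 2 _ _ (ℕP.≤-trans (ℕP.≤-reflexive (sym (upper-form τ i))) (ℕP.≤-trans le (ℕP.≤-reflexive (sym c+k₂)))))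

    small : ∀ τ i → e ≤ i → i ℕ.+ τ ≤ e ℕ.+ suc K → suc τ ≤ k₂
    small τ i a b = ℕP.≤-trans (s≤s (ℕP.+-cancelˡ-≤ e τ (suc K) (ℕP.≤-trans (ℕP.+-monoˡ-≤ τ a) b))) (ℕP.≤-reflexive (ℕP.+-comm 2 K))

    step≤ : ∀ {a b} → a ≤ b → a ≤ suc b
    step≤ = ℕP.m≤n⇒m≤1+n

    hole-elim : ∀ δ τ i → hole δ τ i ≡ true → δ ℕ.+ K ≤ τ × e ≤ i × i ℕ.+ τ ≤ e ℕ.+ suc K
    hole-elim δ τ i p with ∧-split {δ ℕ.+ K ≤ᵇ τ} p
    ... | a , p₁ with ∧-split {e ≤ᵇ i} p₁
    ... | b , d = ≤ᵇ-sound a , ≤ᵇ-sound b , ≤ᵇ-sound d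

  holeL-cell : ∀ τ i → inConvex (inHole k) (L τ i) ≡ hole 0 τ i
  holeL-cell τ i = trans (convexL (inHole k) HoleB hole-point τ m) (bool-ext
    (λ p → let p₁ , q = ∧-split {HoleB τ m} p ; p₂ , _ = ∧-split {HoleB τ (suc (suc m))} q
               a , b , _ = HoleB-elim {τ} {m} p₁ ; _ , _ , d = HoleB-elim {τ} {suc (suc m)} p₂
           in ∧-intro (≤ᵇ-true a) (∧-intro (≤ᵇ-true (lower-bound⁻ τ i b)) (≤ᵇ-true (upper-bound⁻ τ i d))))
    (λ p → let a , b , d = hole-elim 0 τ i p ; up = upper-bound τ i d ; lo = lower-bound τ i b ; s = small τ i b d in
      ∧-intro (HoleB-intro τ m (ℕP.<⇒≤ s) a lo (ℕP.<⇒≤ (ℕP.<⇒≤ up)))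
      (∧-intro (HoleB-intro τ (suc (suc m)) (ℕP.<⇒≤ s) a (step≤ (step≤ lo)) up)
        (HoleB-intro (suc τ) (suc m) s (step≤ a) (s≤s lo) (ℕP.≤-trans (ℕP.≤-reflexive (cong suc (ℕP.+-suc m τ))) up)))))
    where m = τ ℕ.+ 2 ℕ.* i

  holeR-cell : ∀ τ i → inConvex (inHole k) (R (suc τ) i) ≡ hole 1 (suc τ) i
  holeR-cell τ i = trans (convexR (inHole k) HoleB hole-point τ m) (bool-ext
    (λ p → let p₁ , q = ∧-split {HoleB (suc τ) m} p ; p₂ , p₃ = ∧-split {HoleB (suc τ) (suc (suc m))} q
               _ , b , _ = HoleB-elim {suc τ} {m} p₁ ; _ , _ , d = HoleB-elim {suc τ} {suc (suc m)} p₂ ; a , _ , _ = HoleB-elim {τ} {suc m} p₃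
           in ∧-intro (≤ᵇ-true (s≤s a)) (∧-intro (≤ᵇ-true (lower-bound⁻ (suc τ) i b)) (≤ᵇ-true (upper-bound⁻ (suc τ) i d))))
    (λ p → let a , b , d = hole-elim 1 (suc τ) i p ; up = upper-bound (suc τ) i d ; lo = lower-bound (suc τ) i b ; s = small (suc τ) i b d in
      ∧-intro (HoleB-intro (suc τ) m (ℕP.<⇒≤ s) (ℕP.<⇒≤ a) lo (ℕP.<⇒≤ (ℕP.<⇒≤ up)))
      (∧-intro (HoleB-intro (suc τ) (suc (suc m)) (ℕP.<⇒≤ s) (ℕP.<⇒≤ a) (step≤ (step≤ lo)) up)
        (HoleB-intro τ (suc m) (ℕP.<⇒≤ (ℕP.<⇒≤ s)) (ℕP.≤-pred a) (ℕP.<⇒≤ (step≤ lo)) (ℕP.≤-trans (ℕP.+-mono-≤ (ℕP.n≤1+n (suc m)) (ℕP.n≤1+n τ)) up)))))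
    where m = suc τ ℕ.+ 2 ℕ.* i

  lattice-even : ∀ D τ i → isLatticeTri (tri D (ℤ.- + τ) (at (τ ℕ.+ 2 ℕ.* i))) ≡ true
  lattice-even D τ i = cong (_≡ᵇ 0) (trans (cong (λ z → ℤ.∣ z ∣ % 2) (trans (cong (λ w → ℤ.- + τ ℤ.+ (ℤ.- w ℤ.+ + (τ ℕ.+ 2 ℕ.* i))) (cong (λ w → + w) (sym (ℕP.*-distribˡ-+ 2 x n))))
      (trans (cong₂ (λ u v → ℤ.- + τ ℤ.+ (ℤ.- u ℤ.+ (+ τ ℤ.+ v))) (ℤP.pos-* 2 (x ℕ.+ n)) (ℤP.pos-* 2 i))
        (ℤS.solve 3 (λ t y i → ℤS.:- t ℤS.:+ (ℤS.:- (ℤS.con (+ 2) ℤS.:* y) ℤS.:+ (t ℤS.:+ ℤS.con (+ 2) ℤS.:* i)) ℤS.:= ℤS.con (+ 2) ℤS.:* (i ℤS.:- y)) refl (+ τ) (+ (x ℕ.+ n)) (+ i))))) (∣even∣ (+ i ℤ.- + (x ℕ.+ n))))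

  lattice-odd : ∀ D τ i → isLatticeTri (tri D (ℤ.- + τ) (at (suc (τ ℕ.+ 2 ℕ.* i)))) ≡ false
  lattice-odd D τ i = cong (_≡ᵇ 0) (trans (cong (λ z → ℤ.∣ z ∣ % 2) (trans (cong (λ w → ℤ.- + τ ℤ.+ (ℤ.- w ℤ.+ + suc (τ ℕ.+ 2 ℕ.* i))) (cong (λ w → + w) (sym (ℕP.*-distribˡ-+ 2 x n))))
      (trans (cong₂ (λ u v → ℤ.- + τ ℤ.+ (ℤ.- u ℤ.+ (+ 1 ℤ.+ (+ τ ℤ.+ v)))) (ℤP.pos-* 2 (x ℕ.+ n)) (ℤP.pos-* 2 i))
        (ℤS.solve 3 (λ t y i → ℤS.:- t ℤS.:+ (ℤS.:- (ℤS.con (+ 2) ℤS.:* y) ℤS.:+ (ℤS.con (+ 1) ℤS.:+ (t ℤS.:+ ℤS.con (+ 2) ℤS.:* i))) ℤS.:= ℤS.con (+ 1) ℤS.:+ ℤS.con (+ 2) ℤS.:* (i ℤS.:- y)) refl (+ τ) (+ (x ℕ.+ n)) (+ i))))) (∣odd∣ (+ i ℤ.- + (x ℕ.+ n))))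

  inT-L : ∀ τ d i → τ ℕ.+ d ≡ c → i < d → τ ≤ 2 ℕ.* n → inT (L τ i) ≡ okL′ τ i
  inT-L τ d i d≡ lt le = trans (cong₂ (λ a b → a ∧ b ∧ not (inConvex (inHole k) (L τ i))) (lattice-even ◁ τ i) (halfL τ d i d≡ lt le)) (cong (λ b → (suc τ ≤ᵇ 2 ℕ.* n) ∧ not b) (holeL-cell τ i))

  inT-R : ∀ τ d i → τ ℕ.+ d ≡ c → i < d → τ ≤ 2 ℕ.* n → inT (R τ i) ≡ okR′ τ i
  inT-R zero    d i d≡ lt le = trans (cong₂ (λ a b → a ∧ b ∧ not (inConvex (inHole k) (R 0 i))) (lattice-even ▷ 0 i) (halfR 0 d i d≡ lt le)) refl
  inT-R (suc τ) d i d≡ lt le = trans (cong₂ (λ a b → a ∧ b ∧ not (inConvex (inHole k) (R (suc τ) i))) (lattice-even ▷ (suc τ) i) (halfR (suc τ) d i d≡ lt le)) (cong not (holeR-cell τ i))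

-- Sums over lists, and the region as a grid

sumOver-++ : {A : Set} (g : A → ℕ) (as bs : List A) → sumOver g (as ++ bs) ≡ sumOver g as ℕ.+ sumOver g bs
sumOver-++ g []       bs = refl
sumOver-++ g (a ∷ as) bs = trans (cong (g a ℕ.+_) (sumOver-++ g as bs)) (sym (ℕP.+-assoc (g a) (sumOver g as) (sumOver g bs)))

sumOver-map : {A B : Set} (g : B → ℕ) (f : A → B) (as : List A) → sumOver g (map f as) ≡ sumOver (g ∘ f) as
sumOver-map g f []       = refl
sumOver-map g f (a ∷ as) = cong (g (f a) ℕ.+_) (sumOver-map g f as)

sumOver-filter : {A : Set} (g : A → ℕ) (p : A → Bool) (as : List A) → sumOver g (filterᵇ p as) ≡ sumOver (λ a → if p a then g a else 0) as
sumOver-filter g p []       = refl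
sumOver-filter g p (a ∷ as) with p a
... | true  = cong (g a ℕ.+_) (sumOver-filter g p as)
... | false = sumOver-filter g p as

sumOver-+ : {A : Set} (f g : A → ℕ) (as : List A) → sumOver (λ a → f a ℕ.+ g a) as ≡ sumOver f as ℕ.+ sumOver g as
sumOver-+ f g []       = refl
sumOver-+ f g (a ∷ as) = trans (cong (f a ℕ.+ g a ℕ.+_) (sumOver-+ f g as))
  (ℕS.solve 4 (λ a b c d → (a ℕS.:+ b) ℕS.:+ (c ℕS.:+ d) ℕS.:= (a ℕS.:+ c) ℕS.:+ (b ℕS.:+ d)) refl (f a) (g a) (sumOver f as) (sumOver g as))

sumOver-zero : {A : Set} {f : A → ℕ} (as : List A) → (∀ {a} → a ∈ as → f a ≡ 0) → sumOver f as ≡ 0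
sumOver-zero []       e = refl
sumOver-zero (a ∷ as) e = cong₂ ℕ._+_ (e (here refl)) (sumOver-zero as (e ∘ there))

_==P_ : ℕ × ℕ → ℕ × ℕ → Bool
(σ , j) ==P (τ , i) = (σ ≡ᵇ τ) ∧ (j ≡ᵇ i)

==P-refl : ∀ a → (a ==P a) ≡ true
==P-refl (σ , j) rewrite ≡ᵇ-refl σ | ≡ᵇ-refl j = refl

==P-false : ∀ {a b} → a ≢ b → (a ==P b) ≡ false
==P-false {σ , j} {τ , i} ne with σ ≡ᵇ τ in e₁ | j ≡ᵇ i in e₂
... | true  | true  = ⊥-elim (ne (cong₂ _,_ (≡ᵇ-sound σ τ e₁) (≡ᵇ-sound j i e₂)))
... | true  | false = refl
... | false | _     = refl

delta-∈ : ∀ {as} a G → Unique as → a ∈ as → sumOver (λ b → if b ==P a then G else 0) as ≡ G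
delta-∈ {_ ∷ as} a G (new ∷ u) (here refl) rewrite ==P-refl a = trans (cong (G ℕ.+_) (sumOver-zero as (λ {b} b∈ → cong (λ z → if z then G else 0) (==P-false {b} {a} (λ { refl → All.lookup new b∈ refl }))))) (ℕP.+-identityʳ G)
delta-∈ {b ∷ as} a G (new ∷ u) (there a∈) rewrite ==P-false {b} {a} (λ { refl → All.lookup new a∈ refl }) = delta-∈ a G u a∈

delta-∉ : ∀ {as} a G → a ∉ as → sumOver (λ b → if b ==P a then G else 0) as ≡ 0
delta-∉ {as} a G a∉ = sumOver-zero as (λ {b} b∈ → cong (λ z → if z then G else 0) (==P-false {b} {a} (λ { refl → a∉ b∈ })))

-- the lines τ, …, 0, where the line τ has d positions
grid : (ℕ → ℕ → Bool) → ℕ → ℕ → List (ℕ × ℕ)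
grid p zero    d = map (0 ,_) (filterᵇ (p 0) (range 0 d))
grid p (suc τ) d = map (suc τ ,_) (filterᵇ (p (suc τ)) (range 0 d)) ++ grid p τ (suc d)

∈-filterᵇ : {A : Set} (p : A → Bool) {as : List A} {a : A} → a ∈ as → p a ≡ true → a ∈ filterᵇ p as
∈-filterᵇ p {as = a ∷ as} (here refl) e rewrite e = here refl
∈-filterᵇ p {as = b ∷ as} (there m)   e with p b
... | true  = there (∈-filterᵇ p m e)
... | false = ∈-filterᵇ p m e

∈-range : ∀ i m {j} → i ≤ j → j < i ℕ.+ m → j ∈ range i m
∈-range i zero    le lt = ⊥-elim (ℕP.<-irrefl refl (ℕP.<-≤-trans lt (ℕP.≤-trans (ℕP.≤-reflexive (ℕP.+-identityʳ i)) le)))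
∈-range i (suc m) {j} le lt with i ℕ.≟ j
... | yes refl = here refl
... | no ne    = there (∈-range (suc i) m (ℕP.≤∧≢⇒< le ne) (ℕP.<-≤-trans lt (ℕP.≤-reflexive (ℕP.+-suc i m))))

line-∈ : ∀ (p : ℕ → ℕ → Bool) τ d {a} → a ∈ map (τ ,_) (filterᵇ (p τ) (range 0 d)) → proj₁ a ≡ τ × proj₂ a < d × p τ (proj₂ a) ≡ true
line-∈ p τ d m with ∈-map⁻ _ m
... | j , q , refl with filterᵇ-⊆ (p τ) (range 0 d) q
... | q₁ , q₂ = refl , range-< 0 d q₁ , q₂

grid-∈ : ∀ (p : ℕ → ℕ → Bool) τ d {σ j} → (σ , j) ∈ grid p τ d → σ ≤ τ × suc (j ℕ.+ σ) ≤ τ ℕ.+ d × p σ j ≡ true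
grid-∈ p zero    d {σ} {j} m with line-∈ p 0 d m
... | refl , lt , e = z≤n , ℕP.≤-trans (ℕP.≤-reflexive (cong suc (ℕP.+-identityʳ j))) lt , e
grid-∈ p (suc τ) d {σ} {j} m with ∈-++⁻ (map (suc τ ,_) (filterᵇ (p (suc τ)) (range 0 d))) m
... | inj₂ q = let a , b , e = grid-∈ p τ (suc d) q in ℕP.m≤n⇒m≤1+n a , ℕP.≤-trans b (ℕP.≤-reflexive (ℕP.+-suc τ d)) , e
... | inj₁ q with line-∈ p (suc τ) d q
... | refl , lt , e = ℕP.≤-refl , ℕP.≤-trans (ℕP.+-monoˡ-≤ (suc τ) lt) (ℕP.≤-reflexive (ℕP.+-comm d (suc τ))) , e

grid-∋ : ∀ (p : ℕ → ℕ → Bool) τ d {σ j} → σ ≤ τ → suc (j ℕ.+ σ) ≤ τ ℕ.+ d → p σ j ≡ true → (σ , j) ∈ grid p τ d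
grid-∋ p zero    d {j = j} z≤n lt e = ∈-map⁺ _ (∈-filterᵇ (p 0) (∈-range 0 d z≤n (ℕP.≤-trans (ℕP.≤-reflexive (cong suc (sym (ℕP.+-identityʳ j)))) lt)) e)
grid-∋ p (suc τ) d {σ} {j} le lt e with ℕP.m≤n⇒m<n∨m≡n le
... | inj₁ (s≤s le′) = ∈-++⁺ʳ _ (grid-∋ p τ (suc d) le′ (ℕP.≤-trans lt (ℕP.≤-reflexive (sym (ℕP.+-suc τ d)))) e)
... | inj₂ refl = ∈-++⁺ˡ (∈-map⁺ _ (∈-filterᵇ (p (suc τ)) (∈-range 0 d z≤n (ℕP.+-cancelʳ-≤ (suc τ) (suc j) d (ℕP.≤-trans lt (ℕP.≤-reflexive (ℕP.+-comm (suc τ) d))))) e))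

Unique-filterᵇ : ∀ (p : ℕ → Bool) i m → Unique (filterᵇ p (range i m))
Unique-filterᵇ p i zero    = []
Unique-filterᵇ p i (suc m) with p i
... | false = Unique-filterᵇ p (suc i) m
... | true  = All.tabulate (λ j∈ → λ { refl → ℕP.<-irrefl refl (range-≥ (suc i) m (proj₁ (filterᵇ-⊆ p _ j∈))) }) ∷ Unique-filterᵇ p (suc i) m

Unique-line : ∀ (p : ℕ → ℕ → Bool) τ d → Unique (map (τ ,_) (filterᵇ (p τ) (range 0 d)))
Unique-line p τ d = UniqueP.map⁺ {f = λ j → (τ , j)} (λ { refl → refl }) (Unique-filterᵇ (p τ) 0 d)

Unique-grid : ∀ (p : ℕ → ℕ → Bool) τ d → Unique (grid p τ d)
Unique-grid p zero    d = Unique-line p 0 d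
Unique-grid p (suc τ) d = UniqueP.++⁺ (Unique-line p (suc τ) d) (Unique-grid p τ (suc d))
  (λ { (m , m′) → ℕP.<-irrefl (proj₁ (line-∈ p (suc τ) d m)) (s≤s (proj₁ (grid-∈ p τ (suc d) m′))) })

concatMap-if : {A B : Set} (p : A → Bool) (f : A → B) (as : List A) → concatMap (λ a → if p a then f a ∷ [] else []) as ≡ map f (filterᵇ p as)
concatMap-if p f []       = refl
concatMap-if p f (a ∷ as) with p a
... | true  = cong (f a ∷_) (concatMap-if p f as)
... | false = concatMap-if p f as

module Cells (n x k e : ℕ) (centre : 2 ℕ.* k ℕ.+ suc (suc (e ℕ.+ e)) ≡ 2 ℕ.* x ℕ.+ 2 ℕ.* n) where
  open Geometry n x k e centre public
  open Coordinates c public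
  open Hole k e public

  R′ : ℕ × ℕ → Tri
  R′ (σ , j) = R σ j

  cellsAt : ℕ → ℕ → List Tri
  cellsAt τ i = (if okL′ τ i then L τ i ∷ [] else []) ++ (if okR′ τ i then R τ i ∷ [] else [])

  line : ℕ → ℕ → List Tri
  line τ d = concatMap (cellsAt τ) (range 0 d)

  region : ℕ → ℕ → List Tri
  region zero    d = line 0 d
  region (suc τ) d = line (suc τ) d ++ region τ (suc d)

  both : ℕ → ℕ → List Tri
  both τ m = filterᵇ inT (tri ◁ (ℤ.- + τ) (at m) ∷ tri ▷ (ℤ.- + τ) (at m) ∷ [])

  filter₁ : ∀ (p : Tri → Bool) t {b} → p t ≡ b → filterᵇ p (t ∷ []) ≡ (if b then t ∷ [] else [])
  filter₁ p t {b} eb with p t | eb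
  ... | true  | refl = refl
  ... | false | refl = refl

  filter₂ : ∀ (p : Tri → Bool) s t {a b} → p s ≡ a → p t ≡ b → filterᵇ p (s ∷ t ∷ []) ≡ (if a then s ∷ [] else []) ++ (if b then t ∷ [] else [])
  filter₂ p s t {a} {b} ea eb with p s | ea
  ... | true  | refl = cong (s ∷_) (filter₁ p t eb)
  ... | false | refl = filter₁ p t eb

  outside : ∀ {t} → inConvex (inLeftHalf n x) t ≡ false → inT t ≡ false
  outside {t} e rewrite e = ∧-zeroʳ (isLatticeTri t)

  off-lattice : ∀ {t} → isLatticeTri t ≡ false → inT t ≡ false
  off-lattice e rewrite e = refl

  both-outside : ∀ τ m → HalfB τ m ≡ false ⊎ HalfB τ (suc (suc m)) ≡ false → both τ m ≡ []
  both-outside τ m h = filter₂ inT (tri ◁ (ℤ.- + τ) (at m)) (tri ▷ (ℤ.- + τ) (at m))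
      (outside {tri ◁ (ℤ.- + τ) (at m)} (trans (convexL (inLeftHalf n x) HalfB half-point τ m) (kill h))) (right τ h)
    where
    kill : ∀ {a b d} → a ≡ false ⊎ b ≡ false → a ∧ b ∧ d ≡ false
    kill (inj₁ refl) = refl
    kill {a} (inj₂ refl) = ∧-zeroʳ a
    right : ∀ τ → HalfB τ m ≡ false ⊎ HalfB τ (suc (suc m)) ≡ false → inT (tri ▷ (ℤ.- + τ) (at m)) ≡ false
    right zero    _ = outside {tri ▷ (ℤ.- + 0) (at m)} (halfR-zero m)
    right (suc τ) h = outside {tri ▷ (ℤ.- + suc τ) (at m)} (trans (convexR (inLeftHalf n x) HalfB half-point τ m) (kill h))

  both-odd : ∀ τ i → both τ (suc (τ ℕ.+ 2 ℕ.* i)) ≡ []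
  both-odd τ i = filter₂ inT (tri ◁ (ℤ.- + τ) (at m)) (tri ▷ (ℤ.- + τ) (at m)) (off-lattice {tri ◁ (ℤ.- + τ) (at m)} (lattice-odd ◁ τ i)) (off-lattice {tri ▷ (ℤ.- + τ) (at m)} (lattice-odd ▷ τ i))
    where m = suc (τ ℕ.+ 2 ℕ.* i)

  -- Of the 4x + 4n + 1 heights of the box, the lowest τ and the highest τ + 1 carry no triangle of
  -- the region, and the 2d between them alternate between lattice points and none.
  line-both : ∀ τ d → τ ℕ.+ d ≡ c → τ ≤ 2 ℕ.* n → concatMap (both τ) (range 0 (4 ℕ.* x ℕ.+ 4 ℕ.* n ℕ.+ 1)) ≡ line τ d
  line-both τ d d≡ le = trans (cong (concatMap (both τ)) (trans (cong (range 0) width) (trans (range-++ 0 τ (2 ℕ.* d ℕ.+ suc τ)) (cong (range 0 τ ++_) (range-++ τ (2 ℕ.* d) (suc τ))))))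
    (trans (concatMap-++ (both τ) (range 0 τ) _)
    (trans (cong₂ _++_ (concatMap-empty (range 0 τ) (λ {m} m∈ → both-outside τ m (inj₁ (below m (range-< 0 τ m∈)))))
        (trans (concatMap-++ (both τ) (range τ (2 ℕ.* d)) (range (τ ℕ.+ 2 ℕ.* d) (suc τ)))
        (trans (cong (concatMap (both τ) (range τ (2 ℕ.* d)) ++_) (concatMap-empty (range (τ ℕ.+ 2 ℕ.* d) (suc τ)) (λ {m} m∈ → both-outside τ m (inj₂ (above m (range-≥ _ (suc τ) m∈))))))
        (trans (++-identityʳ _) (trans (cong (λ s → concatMap (both τ) (range s (2 ℕ.* d))) (sym (ℕP.+-identityʳ τ))) (concatMap-even (both τ) τ d (both-odd τ) 0))))))
      (concatMap-cong∈ (range 0 d) (λ {i} i∈ → filter₂ inT (L τ i) (R τ i) (inT-L τ d i d≡ (range-< 0 d i∈) le) (inT-R τ d i d≡ (range-< 0 d i∈) le)))))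
    where
    width : 4 ℕ.* x ℕ.+ 4 ℕ.* n ℕ.+ 1 ≡ τ ℕ.+ (2 ℕ.* d ℕ.+ suc τ)
    width = trans (ℕS.solve 2 (λ x n → ℕS.con 4 ℕS.:* x ℕS.:+ ℕS.con 4 ℕS.:* n ℕS.:+ ℕS.con 1 ℕS.:= ℕS.con 2 ℕS.:* (ℕS.con 2 ℕS.:* x ℕS.:+ ℕS.con 2 ℕS.:* n) ℕS.:+ ℕS.con 1) refl x n)
      (trans (cong (λ w → 2 ℕ.* w ℕ.+ 1) (sym d≡)) (ℕS.solve 2 (λ t d → ℕS.con 2 ℕS.:* (t ℕS.:+ d) ℕS.:+ ℕS.con 1 ℕS.:= t ℕS.:+ (ℕS.con 2 ℕS.:* d ℕS.:+ (ℕS.con 1 ℕS.:+ t))) refl τ d))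
    below : ∀ m → m < τ → HalfB τ m ≡ false
    below m lt = trans (cong (λ b → (τ ≤ᵇ 2 ℕ.* n) ∧ b ∧ (m ℕ.+ τ ≤ᵇ c ℕ.+ c)) (≤ᵇ-false (ℕP.<⇒≱ lt))) (∧-zeroʳ _)
    above : ∀ m → τ ℕ.+ 2 ℕ.* d ≤ m → HalfB τ (suc (suc m)) ≡ false
    above m ge = trans (cong (λ b → (τ ≤ᵇ 2 ℕ.* n) ∧ (τ ≤ᵇ suc (suc m)) ∧ b) (≤ᵇ-false (ℕP.<⇒≱ big))) (trans (cong ((τ ≤ᵇ 2 ℕ.* n) ∧_) (∧-zeroʳ _)) (∧-zeroʳ _))
      where
      big : c ℕ.+ c < suc (suc m) ℕ.+ τ
      big = s≤s (ℕP.m≤n⇒m≤1+n (ℕP.≤-trans (ℕP.≤-reflexive (trans (cong₂ ℕ._+_ (sym d≡) (sym d≡)) (ℕS.solve 2 (λ t d → (t ℕS.:+ d) ℕS.:+ (t ℕS.:+ d) ℕS.:= (t ℕS.:+ ℕS.con 2 ℕS.:* d) ℕS.:+ t) refl τ d))) (ℕP.+-monoˡ-≤ τ ge)))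

  inside-region : holeyInside n x k ≡ region (2 ℕ.* n) (2 ℕ.* x)
  inside-region = trans (filter-concatMap inT (λ a → concatMap (λ Y → tri ◁ a Y ∷ tri ▷ a Y ∷ []) ys) as)
    (trans (cong (λ w → concatMap f (ℤrange (ℤ.- (+ (2 ℕ.* n))) w)) (ℕP.+-comm (2 ℕ.* n) 1)) (columns (2 ℕ.* n) (2 ℕ.* x) (ℕP.+-comm (2 ℕ.* n) (2 ℕ.* x)) ℕP.≤-refl))
    where
    W = 4 ℕ.* x ℕ.+ 4 ℕ.* n ℕ.+ 1
    ys = ℤrange (ℤ.- (+ c)) W
    as = ℤrange (ℤ.- (+ (2 ℕ.* n))) (2 ℕ.* n ℕ.+ 1)
    f : ℤ → List Tri
    f a = filterᵇ inT (concatMap (λ Y → tri ◁ a Y ∷ tri ▷ a Y ∷ []) ys)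
    one : ∀ τ d → τ ℕ.+ d ≡ c → τ ≤ 2 ℕ.* n → f (ℤ.- + τ) ≡ line τ d
    one τ d d≡ le = trans (filter-concatMap inT (λ Y → tri ◁ (ℤ.- + τ) Y ∷ tri ▷ (ℤ.- + τ) Y ∷ []) ys)
      (trans (cong (λ z → concatMap pair-at (ℤrange z W)) (sym (ℤP.+-identityʳ (ℤ.- (+ c)))))
      (trans (concatMap-range pair-at (ℤ.- (+ c)) 0 W) (line-both τ d d≡ le)))
      where
      pair-at : ℤ → List Tri
      pair-at Y = filterᵇ inT (tri ◁ (ℤ.- + τ) Y ∷ tri ▷ (ℤ.- + τ) Y ∷ [])
    columns : ∀ τ d → τ ℕ.+ d ≡ c → τ ≤ 2 ℕ.* n → concatMap f (ℤrange (ℤ.- + τ) (suc τ)) ≡ region τ d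
    columns zero    d d≡ le = trans (++-identityʳ (f (ℤ.- + 0))) (one 0 d d≡ le)
    columns (suc τ) d d≡ le = cong₂ _++_ (one (suc τ) d d≡ le)
      (trans (cong (λ z → concatMap f (ℤrange z (suc τ))) (col+1 τ)) (columns τ (suc d) (trans (ℕP.+-suc τ d) d≡) (ℕP.<⇒≤ le)))

  filter-line : ∀ (D : Dir) (ok : ℕ → ℕ → Bool) (f : ℕ → ℕ → Tri) → (∀ τ i → filterᵇ (isDir D) (cellsAt τ i) ≡ (if ok τ i then f τ i ∷ [] else [])) →
    ∀ τ d → filterᵇ (isDir D) (region τ d) ≡ map (λ (σ , j) → f σ j) (grid ok τ d)
  filter-line D ok f h = go
    where
    one : ∀ τ d → filterᵇ (isDir D) (line τ d) ≡ map (λ (σ , j) → f σ j) (map (τ ,_) (filterᵇ (ok τ) (range 0 d)))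
    one τ d = trans (filter-concatMap (isDir D) (cellsAt τ) (range 0 d)) (trans (concatMap-cong∈ (range 0 d) (λ {i} _ → h τ i)) (trans (concatMap-if (ok τ) (f τ) (range 0 d)) (map-∘ (filterᵇ (ok τ) (range 0 d)))))
    go : ∀ τ d → filterᵇ (isDir D) (region τ d) ≡ map (λ (σ , j) → f σ j) (grid ok τ d)
    go zero    d = one 0 d
    go (suc τ) d = trans (filterᵇ-++ (isDir D) (line (suc τ) d) (region τ (suc d))) (trans (cong₂ _++_ (one (suc τ) d) (go τ (suc d))) (sym (map-++ _ (map (suc τ ,_) (filterᵇ (ok (suc τ)) (range 0 d))) (grid ok τ (suc d)))))

  region-◁ : ∀ τ d → filterᵇ (isDir ◁) (region τ d) ≡ map L′ (grid okL′ τ d)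
  region-◁ = filter-line ◁ okL′ L at-cell
    where
    at-cell : ∀ τ i → filterᵇ (isDir ◁) (cellsAt τ i) ≡ (if okL′ τ i then L τ i ∷ [] else [])
    at-cell τ i with okL′ τ i | okR′ τ i
    ... | true  | true  = refl
    ... | true  | false = refl
    ... | false | true  = refl
    ... | false | false = refl

  region-▷ : ∀ τ d → filterᵇ (isDir ▷) (region τ d) ≡ map R′ (grid okR′ τ d)
  region-▷ = filter-line ▷ okR′ R at-cell
    where
    at-cell : ∀ τ i → filterᵇ (isDir ▷) (cellsAt τ i) ≡ (if okR′ τ i then R τ i ∷ [] else [])
    at-cell τ i with okL′ τ i | okR′ τ i
    ... | true  | true  = refl
    ... | true  | false = refl
    ... | false | true  = refl
    ... | false | false = refl

  across : Tri → List Tri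
  across (tri ◁ a Y) = if (a ==ℤ + 0) then tri ▷ a Y ∷ [] else []
  across (tri ▷ a Y) = []

  acrossℓ-concatMap : ∀ ts → acrossℓ ts ≡ concatMap across ts
  acrossℓ-concatMap ts = concatMap-cong∈ ts (λ { {tri ◁ a Y} _ → refl ; {tri ▷ a Y} _ → refl })

  free-region : ∀ τ d → acrossℓ (region τ d) ≡ map (R 0) (filterᵇ (okL′ 0) (range 0 (τ ℕ.+ d)))
  free-region τ d = trans (acrossℓ-concatMap (region τ d)) (go τ d)
    where
    concatMap-concatMap : ∀ {A : Set} (f : A → List Tri) (as : List A) → concatMap across (concatMap f as) ≡ concatMap (concatMap across ∘ f) as
    concatMap-concatMap f []       = refl
    concatMap-concatMap f (a ∷ as) = trans (concatMap-++ across (f a) (concatMap f as)) (cong (concatMap across (f a) ++_) (concatMap-concatMap f as))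
    at-zero : ∀ i → concatMap across (cellsAt 0 i) ≡ (if okL′ 0 i then R 0 i ∷ [] else [])
    at-zero i with okL′ 0 i
    ... | true  = refl
    ... | false = refl
    at-suc : ∀ τ i → concatMap across (cellsAt (suc τ) i) ≡ []
    at-suc τ i with okL′ (suc τ) i | okR′ (suc τ) i
    ... | true  | true  = refl
    ... | true  | false = refl
    ... | false | true  = refl
    ... | false | false = refl
    go : ∀ τ d → concatMap across (region τ d) ≡ map (R 0) (filterᵇ (okL′ 0) (range 0 (τ ℕ.+ d)))
    go zero    d = trans (concatMap-concatMap (cellsAt 0) (range 0 d)) (trans (concatMap-cong∈ (range 0 d) (λ {i} _ → at-zero i)) (concatMap-if (okL′ 0) (R 0) (range 0 d)))
    go (suc τ) d = trans (concatMap-++ across (line (suc τ) d) (region τ (suc d)))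
      (cong₂ _++_ (trans (concatMap-concatMap (cellsAt (suc τ)) (range 0 d)) (concatMap-empty (range 0 d) (λ {i} _ → at-suc τ i)))
        (trans (go τ (suc d)) (cong (λ w → map (R 0) (filterᵇ (okL′ 0) (range 0 w))) (ℕP.+-suc τ d))))

-- The tilings of the region as matchings

==ℤ-≡ᵇ : ∀ {a b m n} → (a ≡ b → m ≡ n) → (m ≡ n → a ≡ b) → (a ==ℤ b) ≡ (m ≡ᵇ n)
==ℤ-≡ᵇ {a} {b} {m} {n} f g = bool-ext (λ e → subst (λ z → (m ≡ᵇ z) ≡ true) (f (==ℤ-sound {a} e)) (≡ᵇ-refl m))
  (λ e → subst (λ z → (a ==ℤ z) ≡ true) (g (≡ᵇ-sound m n e)) (==ℤ-refl a))

≡ᵇ-false : ∀ {m n} → m ≢ n → (m ≡ᵇ n) ≡ false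
≡ᵇ-false {m} {n} ne with m ≡ᵇ n in e
... | true  = ⊥-elim (ne (≡ᵇ-sound m n e))
... | false = refl

lower-zero : ∀ i → lower (λ _ → 0) i ≡ 0
lower-zero zero    = refl
lower-zero (suc i) = refl

module Tilings (n x k e : ℕ) (k<n : k < n) (centre : 2 ℕ.* k ℕ.+ suc (suc (e ℕ.+ e)) ≡ 2 ℕ.* x ℕ.+ 2 ℕ.* n) where
  open Cells n x k e centre

  I Fr : List Tri
  I  = holeyInside n x k
  Fr = acrossℓ I

  top : ℕ
  top = 2 ℕ.* n

  insR freeR lefts : List (ℕ × ℕ)
  insR  = grid okR′ top (2 ℕ.* x)
  freeR = map (0 ,_) (filterᵇ (okL′ 0) (range 0 (top ℕ.+ 2 ℕ.* x)))
  lefts = grid okL′ top (2 ℕ.* x)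

  -- An arithmetical test for membership in `insR`; line σ has top + 2x - σ positions.
  cR : ℕ → ℕ → Bool
  cR σ j = (σ ≤ᵇ top) ∧ (suc (j ℕ.+ σ) ≤ᵇ top ℕ.+ 2 ℕ.* x) ∧ okR′ σ j

  cR-insR : ∀ {σ j} → cR σ j ≡ true → (σ , j) ∈ insR
  cR-insR {σ} {j} p with ∧-split {σ ≤ᵇ top} p
  ... | a , q with ∧-split {suc (j ℕ.+ σ) ≤ᵇ top ℕ.+ 2 ℕ.* x} q
  ... | b , d = grid-∋ okR′ top (2 ℕ.* x) (≤ᵇ-sound a) (≤ᵇ-sound b) d

  insR-cR : ∀ {σ j} → (σ , j) ∈ insR → cR σ j ≡ true
  insR-cR m = let a , b , d = grid-∈ okR′ top (2 ℕ.* x) m in ∧-intro (≤ᵇ-true a) (∧-intro (≤ᵇ-true b) d)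

  I-◁ : filterᵇ (isDir ◁) I ≡ map L′ lefts
  I-◁ = trans (cong (filterᵇ (isDir ◁)) inside-region) (region-◁ top (2 ℕ.* x))

  I-▷ : filterᵇ (isDir ▷) I ≡ map R′ insR
  I-▷ = trans (cong (filterᵇ (isDir ▷)) inside-region) (region-▷ top (2 ℕ.* x))

  Fr≡ : Fr ≡ map R′ freeR
  Fr≡ = trans (cong acrossℓ inside-region) (trans (free-region top (2 ℕ.* x)) (map-∘ (filterᵇ (okL′ 0) (range 0 (top ℕ.+ 2 ℕ.* x)))))

  filter-R′ : ∀ as → filterᵇ (isDir ▷) (map R′ as) ≡ map R′ as
  filter-R′ []       = refl
  filter-R′ (a ∷ as) = cong (R′ a ∷_) (filter-R′ as)

  filter-◁-R′ : ∀ as → filterᵇ (isDir ◁) (map R′ as) ≡ []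
  filter-◁-R′ []       = refl
  filter-◁-R′ (a ∷ as) = filter-◁-R′ as

  cells-◁ : filterᵇ (isDir ◁) (I ++ Fr) ≡ map L′ lefts
  cells-◁ = trans (filterᵇ-++ (isDir ◁) I Fr) (trans (cong₂ _++_ I-◁ (trans (cong (filterᵇ (isDir ◁)) Fr≡) (filter-◁-R′ freeR))) (++-identityʳ _))

  cells-▷ : filterᵇ (isDir ▷) (I ++ Fr) ≡ map R′ insR ++ map R′ freeR
  cells-▷ = trans (filterᵇ-++ (isDir ▷) I Fr) (cong₂ _++_ I-▷ (trans (cong (filterᵇ (isDir ▷)) Fr≡) (filter-R′ freeR)))

  L∉Fr : ∀ τ i → (L τ i ∈ᵇ Fr) ≡ false
  L∉Fr τ i = trans (cong (L τ i ∈ᵇ_) Fr≡) (go freeR)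
    where
    go : ∀ as → (L τ i ∈ᵇ map R′ as) ≡ false
    go []       = refl
    go (a ∷ as) = go as

  cR-positive : ∀ {j} → cR 0 j ≡ false
  cR-positive {j} = trans (cong ((0 ≤ᵇ top) ∧_) (∧-zeroʳ (suc (j ℕ.+ 0) ≤ᵇ top ℕ.+ 2 ℕ.* x))) (∧-zeroʳ (0 ≤ᵇ top))

  holeR-hole : ∀ τ i → holeR τ i ≡ true → hole 0 τ i ≡ true
  holeR-hole τ i p with ∧-split {suc (2 ℕ.* k) ≤ᵇ τ} p
  ... | a , b = ∧-intro (≤ᵇ-true {2 ℕ.* k} (ℕP.<⇒≤ (≤ᵇ-sound {suc (2 ℕ.* k)} a))) b

  lefts-cR : ∀ {τ i} → (suc τ , i) ∈ lefts → cR (suc τ) i ≡ true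
  lefts-cR {τ} {i} l∈ with grid-∈ okL′ top (2 ℕ.* x) l∈
  ... | a , b , d = ∧-intro (≤ᵇ-true a) (∧-intro (≤ᵇ-true b) (open-right (suc τ) i (proj₂ (∧-split {suc (suc τ) ≤ᵇ top} d))))
    where
    open-right : ∀ τ i → okL τ i ≡ true → not (holeR τ i) ≡ true
    open-right τ i ok with holeR τ i in e
    ... | false = refl
    ... | true  = ⊥-elim (false≢true (trans (sym (cong not (holeR-hole τ i e))) ok))

  lefts-free : ∀ {i} → (0 , i) ∈ lefts → (0 , i) ∈ freeR
  lefts-free {i} l∈ with grid-∈ okL′ top (2 ℕ.* x) l∈
  ... | _ , b , d = ∈-map⁺ (0 ,_) (∈-filterᵇ (okL′ 0) (∈-range 0 (top ℕ.+ 2 ℕ.* x) z≤n (ℕP.≤-trans (ℕP.≤-reflexive (cong suc (sym (ℕP.+-identityʳ i)))) b)) d)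

  rs : Tri → List Tri
  rs l = filterᵇ (λ r → adjacent l r ∧ not ((l ∈ᵇ Fr) ∧ (r ∈ᵇ Fr))) (filterᵇ (isDir ▷) (I ++ Fr))

  open Matching I Fr rs cR insR
  open Transfer cR insR

  adjacent-LR : ∀ τ i σ j → adjacent (L τ i) (R σ j) ≡ ((σ ≡ᵇ τ) ∧ (j ≡ᵇ i)) ∨ ((σ ≡ᵇ suc τ) ∧ ((j ≡ᵇ i) ∨ (suc j ≡ᵇ i)))
  adjacent-LR τ i σ j = cong₂ _∨_ same next
    where
    same : ((ℤ.- + σ) ==ℤ (ℤ.- + τ)) ∧ (height σ j ==ℤ height τ i) ≡ (σ ≡ᵇ τ) ∧ (j ≡ᵇ i)
    same with σ ℕ.≟ τ
    ... | yes refl = cong₂ _∧_ (==ℤ-≡ᵇ {ℤ.- + σ} {ℤ.- + σ} {σ} {σ} (λ _ → refl) (λ _ → refl)) (==ℤ-≡ᵇ {height σ j} {height σ i} {j} {i} (height-inj σ) (cong (height σ)))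
    ... | no ne = trans (cong (_∧ (height σ j ==ℤ height τ i)) (trans (==ℤ-≡ᵇ (ℤP.+-injective ∘ ℤP.neg-injective) (cong (λ z → ℤ.- + z))) (≡ᵇ-false ne))) (sym (cong (_∧ (j ≡ᵇ i)) (≡ᵇ-false ne)))
    next : ((ℤ.- + σ) ==ℤ (ℤ.- + τ ℤ.- + 1)) ∧ ((height σ j ==ℤ (height τ i ℤ.+ + 1)) ∨ (height σ j ==ℤ (height τ i ℤ.- + 1))) ≡ (σ ≡ᵇ suc τ) ∧ ((j ≡ᵇ i) ∨ (suc j ≡ᵇ i))
    next with σ ℕ.≟ suc τ
    ... | no ne = trans (cong (_∧ ((height σ j ==ℤ (height τ i ℤ.+ + 1)) ∨ (height σ j ==ℤ (height τ i ℤ.- + 1)))) (trans (cong ((ℤ.- + σ) ==ℤ_) (col-1 τ)) (trans (==ℤ-≡ᵇ (ℤP.+-injective ∘ ℤP.neg-injective) (cong (λ z → ℤ.- + z))) (≡ᵇ-false ne)))) (sym (cong (_∧ ((j ≡ᵇ i) ∨ (suc j ≡ᵇ i))) (≡ᵇ-false ne)))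
    ... | yes refl = cong₂ _∧_ (trans (cong ((ℤ.- + suc τ) ==ℤ_) (col-1 τ)) (==ℤ-≡ᵇ {ℤ.- + suc τ} {ℤ.- + suc τ} {suc τ} {suc τ} (λ _ → refl) (λ _ → refl)))
      (cong₂ _∨_ (trans (cong (height (suc τ) j ==ℤ_) (at+1 (τ ℕ.+ 2 ℕ.* i))) (==ℤ-≡ᵇ {m = j} {i} (height-inj (suc τ)) (cong (height (suc τ)))))
        (==ℤ-≡ᵇ {m = suc j} {i} (λ eq → height-inj τ (cancel (trans (sym (down-eq j)) eq))) (λ { refl → down-eq j })))
      where
      down-eq : ∀ j → height (suc τ) j ≡ height τ (suc j) ℤ.- + 1
      down-eq j = trans (ℤS.solve 2 (λ c m → (ℤS.:- c ℤS.:+ m) ℤS.:= (ℤS.:- c ℤS.:+ (ℤS.con (+ 1) ℤS.:+ m)) ℤS.:- ℤS.con (+ 1)) refl (+ c) (+ (suc τ ℕ.+ 2 ℕ.* j)))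
        (cong (λ m → (ℤ.- + c ℤ.+ + m) ℤ.- + 1) (ℕS.solve 2 (λ t j → ℕS.con 2 ℕS.:+ (t ℕS.:+ ℕS.con 2 ℕS.:* j) ℕS.:= t ℕS.:+ ℕS.con 2 ℕS.:* (ℕS.con 1 ℕS.:+ j)) refl τ j))
      cancel : ∀ {a b : ℤ} → a ℤ.- + 1 ≡ b ℤ.- + 1 → a ≡ b
      cancel {a} {b} = ∙-cancelʳ (ℤ.- + 1) a b

  -- Replaces adjacency by three point masses, in the order in which `matchings` tries the
  -- neighbours.
  select : ∀ (g : ℕ × ℕ → ℕ) τ i a → let at p = if a ==P p then g p else 0 in
    (if adjacent (L τ i) (R′ a) then g a else 0) ≡ lower (λ i′ → at (suc τ , i′)) i ℕ.+ at (suc τ , i) ℕ.+ at (τ , i)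
  select g τ i (σ , j) rewrite adjacent-LR τ i σ j with σ ℕ.≟ τ
  ... | yes refl rewrite ≡ᵇ-refl τ | ≡ᵇ-false (ℕP.1+n≢n {τ} ∘ sym) = trans own (cong (λ z → z ℕ.+ 0 ℕ.+ (if j ≡ᵇ i then g (τ , i) else 0)) (sym (lower-zero i)))
    where
    own : (if (j ≡ᵇ i) ∨ false then g (τ , j) else 0) ≡ (if j ≡ᵇ i then g (τ , i) else 0)
    own with j ℕ.≟ i
    ... | yes refl rewrite ≡ᵇ-refl i = refl
    ... | no ne    rewrite ≡ᵇ-false ne = refl
  ... | no ne rewrite ≡ᵇ-false ne with σ ℕ.≟ suc τ
  ...   | no ne′ rewrite ≡ᵇ-false ne′ = sym (trans (ℕP.+-identityʳ _) (trans (ℕP.+-identityʳ _) (lower-zero i)))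
  ...   | yes refl rewrite ≡ᵇ-refl τ = trans (next i) (sym (ℕP.+-identityʳ _))
    where
    next : ∀ i → (if (j ≡ᵇ i) ∨ (suc j ≡ᵇ i) then g (suc τ , j) else 0) ≡
      lower (λ i′ → if j ≡ᵇ i′ then g (suc τ , i′) else 0) i ℕ.+ (if j ≡ᵇ i then g (suc τ , i) else 0)
    next i with j ℕ.≟ i
    next zero    | yes refl = refl
    next (suc i) | yes refl rewrite ≡ᵇ-refl i | ≡ᵇ-false (ℕP.1+n≢n {i}) = refl
    next zero    | no ne′   rewrite ≡ᵇ-false ne′ = refl
    next (suc i) | no ne′   rewrite ≡ᵇ-false ne′ with j ℕ.≟ i
    ... | yes refl rewrite ≡ᵇ-refl i = sym (ℕP.+-identityʳ _)
    ... | no ne″   rewrite ≡ᵇ-false ne″ = refl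

  module Neighbours (g : Tri → ℕ) (τ i : ℕ) where
    δ : List (ℕ × ℕ) → ℕ × ℕ → ℕ
    δ as p = sumOver (λ a → if a ==P p then g (R′ p) else 0) as

    sum-select : ∀ as → sumOver (λ a → if adjacent (L τ i) (R′ a) then g (R′ a) else 0) as ≡
      lower (λ i′ → δ as (suc τ , i′)) i ℕ.+ δ as (suc τ , i) ℕ.+ δ as (τ , i)
    sum-select as = trans (sumOver-cong as (λ {a} _ → select (g ∘ R′) τ i a)) (trans (sumOver-+ _ _ as) (cong (ℕ._+ δ as (τ , i))
      (trans (sumOver-+ _ _ as) (cong (ℕ._+ δ as (suc τ , i)) (swap i)))))
      where
      swap : ∀ i → sumOver (λ a → lower (λ i′ → if a ==P (suc τ , i′) then g (R (suc τ) i′) else 0) i) as ≡ lower (λ i′ → δ as (suc τ , i′)) i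
      swap zero    = sumOver-zero as (λ _ → refl)
      swap (suc i) = refl

    δ-insR : ∀ p → δ insR p ≡ (if cR (proj₁ p) (proj₂ p) then g (R′ p) else 0)
    δ-insR (σ , j) with cR σ j in e
    ... | true  = delta-∈ (σ , j) (g (R σ j)) (Unique-grid okR′ top (2 ℕ.* x)) (cR-insR e)
    ... | false = delta-∉ (σ , j) (g (R σ j)) (λ m → false≢true (trans (sym e) (insR-cR m)))

    δ-freeR-suc : ∀ σ j → δ freeR (suc σ , j) ≡ 0
    δ-freeR-suc σ j = delta-∉ (suc σ , j) (g (R (suc σ) j)) (λ m → not-on (∈-map⁻ _ m))
      where
      not-on : ¬ (∃ λ i → i ∈ filterᵇ (okL′ 0) (range 0 (top ℕ.+ 2 ℕ.* x)) × (suc σ , j) ≡ (0 , i))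
      not-on (_ , _ , ())

    -- The neighbour across the vertical side is found in exactly one of the lists: in `freeR` on ℓ,
    -- in `insR` elsewhere.
    own : (τ , i) ∈ lefts → δ insR (τ , i) ℕ.+ δ freeR (τ , i) ≡ g (R τ i)
    own = here-term τ
      where
      here-term : ∀ τ → (τ , i) ∈ lefts → δ insR (τ , i) ℕ.+ δ freeR (τ , i) ≡ g (R τ i)
      here-term zero    l∈ = trans (cong₂ ℕ._+_ (trans (δ-insR (0 , i)) (cong (λ b → if b then g (R 0 i) else 0) cR-positive))
        (delta-∈ (0 , i) (g (R 0 i)) (Unique-line okL′ 0 (top ℕ.+ 2 ℕ.* x)) (lefts-free l∈))) refl
      here-term (suc τ) l∈ = trans (cong₂ ℕ._+_ (trans (δ-insR (suc τ , i)) (cong (λ b → if b then g (R (suc τ) i) else 0) (lefts-cR l∈))) (δ-freeR-suc τ i)) (ℕP.+-identityʳ _)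

    neighbours : (τ , i) ∈ lefts → sumOver g (rs (L τ i)) ≡
      lower (λ j → if cR (suc τ) j then g (R (suc τ) j) else 0) i ℕ.+ (if cR (suc τ) i then g (R (suc τ) i) else 0) ℕ.+ g (R τ i)
    neighbours l∈ = trans (sumOver-filter g _ (filterᵇ (isDir ▷) (I ++ Fr)))
      (trans (cong (sumOver _) cells-▷) (trans (sumOver-++ _ (map R′ insR) (map R′ freeR))
      (trans (cong₂ ℕ._+_ (trans (sumOver-map _ R′ insR) (trans (sumOver-cong insR (λ {a} _ → plain a)) (sum-select insR))) (trans (sumOver-map _ R′ freeR) (trans (sumOver-cong freeR (λ {a} _ → plain a)) (sum-select freeR))))
      (trans (cong₂ ℕ._+_ (cong (ℕ._+ δ insR (τ , i)) (cong₂ ℕ._+_ (lower-cong (λ j → δ-insR (suc τ , j)) i) (δ-insR (suc τ , i))))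
          (cong (ℕ._+ δ freeR (τ , i)) (cong₂ ℕ._+_ (trans (lower-cong (λ j → δ-freeR-suc τ j) i) (lower-zero i)) (δ-freeR-suc τ i))))
        (trans (ℕP.+-assoc _ (δ insR (τ , i)) (δ freeR (τ , i))) (cong (lower (λ j → if cR (suc τ) j then g (R (suc τ) j) else 0) i ℕ.+ (if cR (suc τ) i then g (R (suc τ) i) else 0) ℕ.+_) (own l∈)))))))
      where
      plain : ∀ a → (if adjacent (L τ i) (R′ a) ∧ not ((L τ i ∈ᵇ Fr) ∧ (R′ a ∈ᵇ Fr)) then g (R′ a) else 0) ≡ (if adjacent (L τ i) (R′ a) then g (R′ a) else 0)
      plain a = cong (λ b → if b then g (R′ a) else 0) (trans (cong (λ b → adjacent (L τ i) (R′ a) ∧ not (b ∧ (R′ a ∈ᵇ Fr))) (L∉Fr τ i)) (∧-identityʳ _))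

  open Scan cR insR okL cR-insR using (column; rightOf)

  below-top : ∀ τ d → τ < top → grid okL′ τ d ≡ column τ 0 d ++ rightOf τ d
  below-top τ d lt = go τ d lt
    where
    here-line : ∀ τ d → τ < top → map (τ ,_) (filterᵇ (okL′ τ) (range 0 d)) ≡ column τ 0 d
    here-line τ d lt = cong (map (τ ,_)) (filterᵇ-cong (range 0 d) (λ {i} _ → cong (_∧ okL τ i) (≤ᵇ-true lt)))
    go : ∀ τ d → τ < top → grid okL′ τ d ≡ column τ 0 d ++ rightOf τ d
    go zero    d lt = trans (here-line 0 d lt) (sym (++-identityʳ (column 0 0 d)))
    go (suc τ) d lt = cong₂ _++_ (here-line (suc τ) d lt) (go τ (suc d) (ℕP.<⇒≤ lt))

  -- `okL′` and `okL` differ only on the leftmost line, which has no left-pointing triangle inside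
  -- the region.
  lefts-rightOf : lefts ≡ rightOf top (2 ℕ.* x)
  lefts-rightOf = go top refl
    where
    none : ∀ {p : ℕ → Bool} js → (∀ j → p j ≡ false) → filterᵇ p js ≡ []
    none []       h = refl
    none {p} (j ∷ js) h rewrite h j = none js h
    go : ∀ t → t ≡ top → grid okL′ t (2 ℕ.* x) ≡ rightOf t (2 ℕ.* x)
    go zero    e = ⊥-elim (ℕP.<-irrefl e (ℕP.<-≤-trans (ℕP.≤-<-trans z≤n k<n) (ℕP.m≤m+n n (n ℕ.+ 0))))
    go (suc τ) e = cong₂ _++_ (cong (map (suc τ ,_)) (none (range 0 (2 ℕ.* x)) (λ j → cong (_∧ okL (suc τ) j) (≤ᵇ-false (λ le → ℕP.<-irrefl e le)))))
      (below-top τ (suc (2 ℕ.* x)) (ℕP.≤-reflexive e))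

  I⊆ : ∀ {t} (d : Dir) → t ∈ I → isDir d t ≡ true → t ∈ filterᵇ (isDir d) I
  I⊆ d = ∈-filterᵇ (isDir d)

  M-matchings : M (FminusHole n x k) ≡ matchings (rightOf top (2 ℕ.* x)) (λ _ _ → true)
  M-matchings = trans (M-total (FminusHole n x k))
    (trans (cong (λ ls → Cover.total I Fr (concatMap (λ l → map (l ,_) (rs l)) ls) (λ _ → 0)) cells-◁)
    (trans (total-matchings ins-R insR-ins fr-R (insR-ins ∘ cR-insR) lefts (λ _ → 0) (λ _ _ → true) (Unique-grid okL′ top (2 ℕ.* x))
        (λ {τ} {i} l∈ g → Neighbours.neighbours g τ i l∈) mem (λ t∈ d → inj₁ (subst (_ ∈_) I-◁ (I⊆ ◁ t∈ d))) (λ _ → refl) (λ _ _ _ → refl) (λ {l} → rsR {l}))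
      (cong (λ ls → matchings ls (λ _ _ → true)) lefts-rightOf)))
    where
    ins-R : ∀ {t} → t ∈ I → isDir ▷ t ≡ true → ∃₂ λ σ j → (σ , j) ∈ insR × t ≡ R σ j
    ins-R {t} t∈ d with ∈-map⁻ R′ (subst (t ∈_) I-▷ (I⊆ ▷ t∈ d))
    ... | (σ , j) , m , e = σ , j , m , e
    insR-ins : ∀ {σ j} → (σ , j) ∈ insR → R σ j ∈ I
    insR-ins {σ} {j} m = proj₁ (filterᵇ-⊆ (isDir ▷) I (subst (R σ j ∈_) (sym I-▷) (∈-map⁺ R′ m)))
    fr-R : ∀ {t} → t ∈ Fr → ∃₂ λ σ j → t ≡ R σ j
    fr-R {t} t∈ with ∈-map⁻ R′ (subst (t ∈_) Fr≡ t∈)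
    ... | (σ , j) , _ , e = σ , j , e
    mem : ∀ {τ i} → (τ , i) ∈ lefts → L τ i ∈ I × (R τ i ∈ I ⊎ R τ i ∈ Fr)
    mem {τ} {i} l∈ = proj₁ (filterᵇ-⊆ (isDir ◁) I (subst (L τ i ∈_) (sym I-◁) (∈-map⁺ L′ l∈))) , right τ l∈
      where
      right : ∀ τ → (τ , i) ∈ lefts → R τ i ∈ I ⊎ R τ i ∈ Fr
      right zero    l∈ = inj₂ (subst (R 0 i ∈_) (sym Fr≡) (∈-map⁺ R′ (lefts-free l∈)))
      right (suc τ) l∈ = inj₁ (insR-ins (cR-insR (lefts-cR l∈)))
    rsR : ∀ {l r} → r ∈ rs l → isDir ▷ r ≡ true
    rsR {l} {r} r∈ = proj₂ (filterᵇ-⊆ (isDir ▷) (I ++ Fr) (proj₁ (filterᵇ-⊆ (λ r → adjacent l r ∧ not ((l ∈ᵇ Fr) ∧ (r ∈ᵇ Fr))) (filterᵇ (isDir ▷) (I ++ Fr)) r∈)))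

  cR-inside : ∀ τ d j → suc τ ℕ.+ d ≡ c → suc τ ≤ top → j < d → cR (suc τ) j ≡ not (holeR (suc τ) j)
  cR-inside τ d j d≡ le lt rewrite ≤ᵇ-true le | ≤ᵇ-true {suc (j ℕ.+ suc τ)} {top ℕ.+ 2 ℕ.* x} (ℕP.≤-trans (ℕP.+-monoˡ-≤ (suc τ) lt) (ℕP.≤-reflexive (trans (ℕP.+-comm d (suc τ)) (trans d≡ (ℕP.+-comm (2 ℕ.* x) top))))) = refl

  cR-outside : ∀ τ d j → suc τ ℕ.+ d ≡ c → d ≤ j → cR (suc τ) j ≡ false
  cR-outside τ d j d≡ le rewrite ≤ᵇ-false {suc (j ℕ.+ suc τ)} {top ℕ.+ 2 ℕ.* x} (ℕP.≤⇒≯ (ℕP.≤-trans (ℕP.≤-reflexive (trans (ℕP.+-comm top (2 ℕ.* x)) (trans (sym d≡) (ℕP.+-comm (suc τ) d)))) (ℕP.+-monoˡ-≤ (suc τ) le))) = ∧-zeroʳ _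

  open Evolution n x k e c top (suc x) cR insR cR-insR insR-cR cR-positive cR-inside cR-outside centre

  -- Since k < n, the hole does not reach the leftmost line, and walks start from all of its 2x
  -- positions.
  all-pending : pending-list (λ _ _ → true) top (2 ℕ.* x) ≡ range 0 (x ℕ.+ x)
  all-pending = trans (filterᵇ-all (range 0 (2 ℕ.* x)) (λ {j} _ → trans (∧-identityʳ _) (cong not (no-hole j)))) (cong (λ m → range 0 (x ℕ.+ m)) (ℕP.+-identityʳ x))
    where
    no-hole : ∀ j → holeR top j ≡ false
    no-hole j with holeR top j in eq
    ... | false = refl
    ... | true with ∧-split {suc (2 ℕ.* k) ≤ᵇ top} eq
    ... | _ , p with ∧-split {e ≤ᵇ j} p
    ... | a , b = ⊥-elim (ℕP.<-irrefl refl (ℕP.<-≤-trans (ℕP.≤-trans (ℕP.≤-reflexive (ℕS.solve 1 (λ k → ℕS.con 2 ℕS.:+ ℕS.con 2 ℕS.:* k ℕS.:= ℕS.con 2 ℕS.:* (ℕS.con 1 ℕS.:+ k)) refl k)) (ℕP.*-monoʳ-≤ 2 k<n))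
      (ℕP.+-cancelˡ-≤ e top _ (ℕP.≤-trans (ℕP.+-monoˡ-≤ top (≤ᵇ-sound {e} a)) (≤ᵇ-sound {j ℕ.+ top} b)))))

  before-top : before top ≡ pt (2 ℕ.* k) e ∷ pt (2 ℕ.* k) (suc e) ∷ []
  before-top = go top (ℕP.≤-trans (ℕP.≤-reflexive (ℕS.solve 1 (λ k → ℕS.con 2 ℕS.:+ ℕS.con 2 ℕS.:* k ℕS.:= ℕS.con 2 ℕS.:* (ℕS.con 1 ℕS.:+ k)) refl k)) (ℕP.*-monoʳ-≤ 2 k<n))
    where
    go : ∀ t → suc (suc (2 ℕ.* k)) ≤ t → before t ≡ pt (2 ℕ.* k) e ∷ pt (2 ℕ.* k) (suc e) ∷ []
    go (suc t) (s≤s le) rewrite ≤ᵇ-true {2 ℕ.* k} {t} (ℕP.<⇒≤ le) = refl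

  tilings-Pf : ℕ→ℚ (M (FminusHole n x k)) ≡ Pf (suc x) (pt (2 ℕ.* k) e ∷ pt (2 ℕ.* k) (suc e) ∷ map (pt (2 ℕ.* n)) (range 0 (x ℕ.+ x)))
  tilings-Pf = trans (cong ℕ→ℚ M-matchings)
    (trans (count top (2 ℕ.* x) (λ _ _ → true) (ℕP.+-comm top (2 ℕ.* x)) ℕP.≤-refl (λ σ j lt p → ⊥-elim (ℕP.<⇒≱ lt (≤ᵇ-sound (proj₁ (∧-split {σ ≤ᵇ top} p))))) (λ _ _ _ → refl) size)
      (cong₂ (λ b l → Pf (suc x) (b ++ map (pt top) l)) before-top all-pending))
    where
    size : length (before top) ℕ.+ length (pending-list (λ _ _ → true) top (2 ℕ.* x)) ≡ suc x ℕ.+ suc x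
    size = trans (cong₂ (λ b l → length b ℕ.+ length l) before-top all-pending) (trans (cong (2 ℕ.+_) (range-length 0 (x ℕ.+ x))) (cong suc (sym (ℕP.+-suc x x))))

ι : ℕ → ℚ
ι = ℕ→ℚ

-- The Hankel determinant

c : ∀ {m} → ℕ → Polynomial m
c m = con (+ m)

ℕ→ℚ-* : ∀ a b → ι (a ℕ.* b) ≡ ι a * ι b
ℕ→ℚ-* a b = trans (cong fromℤ (ℤP.pos-* a b)) (fromℤ-* (+ a) (+ b))

ℕ→ℚ-suc : ∀ a → ι (suc a) ≡ 1ℚ + ι a
ℕ→ℚ-suc a = ℕ→ℚ-+ 1 a

-- Invertibility with a witness: closed under products and inherited by factors, which replaces case
-- distinctions on zero in all cancellations.
Unit : ℚ → Set
Unit p = ∃ λ s → s * p ≡ 1ℚ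

unit-* : ∀ {p q} → Unit p → Unit q → Unit (p * q)
unit-* {p} {q} (s , e) (t , f) = s * t , trans (solve 4 (λ s t p q → (s :* t) :* (p :* q) := (s :* p) :* (t :* q)) refl s t p q) (cong₂ _*_ e f)

unit-factor : ∀ {p q} → Unit (p * q) → Unit p
unit-factor {p} {q} (s , e) = s * q , trans (solve 3 (λ s p q → s :* q :* p := s :* (p :* q)) refl s p q) e

unit-resp : ∀ {p q} → p ≡ q → Unit p → Unit q
unit-resp refl u = u

unit-nonzero : ∀ {p} → p ≢ 0ℚ → Unit p
unit-nonzero {p} ne = (1/ p) {{≢-nonZero ne}} , ℚP.*-inverseˡ p {{≢-nonZero ne}}

unit≢0 : ∀ {p} → Unit p → p ≢ 0ℚ
unit≢0 (s , e) refl with trans (sym e) (ℚP.*-zeroʳ s)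
... | ()

unit-suc : ∀ m → Unit (ι (suc m))
unit-suc m = unit-nonzero λ e → absurd (ℚᵘP.≃-trans (ℚᵘP.≃-sym (fromℤ-lift (+ suc m))) (ℚᵘP.≃-reflexive (cong ℚ.toℚᵘ e)))
  where
  absurd : mkℚᵘ (+ suc m) 0 ℚᵘ.≃ mkℚᵘ (+ 0) 0 → _
  absurd (*≡* ())

unit-cancel : ∀ {d x y} → Unit d → d * x ≡ d * y → x ≡ y
unit-cancel {d} {x} {y} (s , e) f = trans (lem x) (trans (cong (s *_) f) (sym (lem y)))
  where
  lem : ∀ x → x ≡ s * (d * x)
  lem x = trans (solve 1 (λ x → x := con (+ 1) :* x) refl x) (trans (cong (_* x) (sym e)) (ℚP.*-assoc s d x))

/'-* : ∀ p {q} → Unit q → (p /' q) * q ≡ p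
/'-* p {q} u with q ℚP.≟ 0ℚ
... | yes e = ⊥-elim (unit≢0 u e)
... | no ne = trans (ℚP.*-assoc p _ q) (trans (cong (p *_) (ℚP.*-inverseˡ q {{≢-nonZero ne}})) (ℚP.*-identityʳ p))

unit-/' : ∀ {p q} → Unit p → Unit q → Unit (p /' q)
unit-/' {p} {q} u v = unit-factor (unit-resp (sym (/'-* p v)) u)

fact-suc : ∀ t → ι (suc t !) ≡ (1ℚ + ι t) * ι (t !)
fact-suc t = trans (ℕ→ℚ-* (suc t) (t !)) (cong (_* ι (t !)) (ℕ→ℚ-suc t))

unit-1+ : ∀ m → Unit (1ℚ + ι m)
unit-1+ m = unit-resp (ℕ→ℚ-suc m) (unit-suc m)

unit-fact : ∀ t → Unit (ι (t !))
unit-fact zero    = unit-suc 0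
unit-fact (suc t) = unit-resp (sym (fact-suc t)) (unit-* (unit-1+ t) (unit-fact t))

h-unit : ∀ t → Unit (h t)
h-unit t = unit-factor (unit-resp (sym (h-factorial t)) (unit-fact (suc (2 ℕ.* t))))

ℕ→ℚ-2* : ∀ t → ι (2 ℕ.* t) ≡ ι 2 * ι t
ℕ→ℚ-2* = ℕ→ℚ-* 2

-- The ratio C(2t+3, t+1) / C(2t+1, t) = 2(2t+3) / (t+2), obtained from the factorials; the
-- cancelled factor is ((1+t) · t!)².
h-suc : ∀ t → (ι t + ι 2) * h (suc t) ≡ ι 2 * (ι 2 * ι t + ι 3) * h t
h-suc t = unit-cancel (unit-* (unit-* (unit-1+ t) (unit-1+ t)) (unit-* (unit-fact t) (unit-fact t)))
  (trans (solve 3 (λ t f H → ((c 1 :+ t) :* (c 1 :+ t)) :* (f :* f) :* ((t :+ c 2) :* H) := H :* (((c 1 :+ t) :* f) :* ((c 1 :+ (c 1 :+ t)) :* ((c 1 :+ t) :* f)))) refl τ f (h (suc t)))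
  (trans (cong (h (suc t) *_) (cong₂ _*_ (sym (fact-suc t)) (sym (trans (fact-suc (suc t)) (cong₂ (λ a b → (1ℚ + a) * b) (ℕ→ℚ-suc t) (fact-suc t))))))
  (trans (h-factorial (suc t))
  (trans (cong (λ z → ι (suc z !)) (ℕP.*-suc 2 t))
  (trans (trans (fact-suc (suc (suc (2 ℕ.* t)))) (cong₂ (λ a b → (1ℚ + a) * b) (trans (ℕ→ℚ-suc (suc (2 ℕ.* t))) (cong (λ z → 1ℚ + z) d1)) (trans (fact-suc (suc (2 ℕ.* t))) (cong₂ (λ a b → (1ℚ + a) * b) d1 (sym (h-factorial t))))))
  (trans (cong (λ z → (1ℚ + (1ℚ + (1ℚ + ι 2 * τ))) * ((1ℚ + (1ℚ + ι 2 * τ)) * (h t * (f * z)))) (fact-suc t))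
    (solve 3 (λ t f H → (c 1 :+ (c 1 :+ (c 1 :+ c 2 :* t))) :* ((c 1 :+ (c 1 :+ c 2 :* t)) :* (H :* (f :* ((c 1 :+ t) :* f)))) := ((c 1 :+ t) :* (c 1 :+ t)) :* (f :* f) :* (c 2 :* (c 2 :* t :+ c 3) :* H)) refl τ f (h t))))))))
  where
  τ = ι t
  f = ι (t !)
  d1 : ι (suc (2 ℕ.* t)) ≡ 1ℚ + ι 2 * τ
  d1 = trans (ℕ→ℚ-suc (2 ℕ.* t)) (cong (λ z → 1ℚ + z) (ℕ→ℚ-2* t))

sum-cong : ∀ m {f g : ℕ → ℚ} → (∀ i → i ℕ.< m → f i ≡ g i) → sumBelow m f ≡ sumBelow m g
sum-cong zero    e = refl
sum-cong (suc m) e = cong₂ _+_ (sum-cong m (λ i lt → e i (ℕP.m≤n⇒m≤1+n lt))) (e m ℕP.≤-refl)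

sum-sub : ∀ m (f g : ℕ → ℚ) → sumBelow m (λ i → f i - g i) ≡ sumBelow m f - sumBelow m g
sum-sub zero    f g = refl
sum-sub (suc m) f g = trans (cong (λ z → z + (f m - g m)) (sum-sub m f g))
  (solve 4 (λ a b c d → (a :- b) :+ (c :- d) := (a :+ c) :- (b :+ d)) refl (sumBelow m f) (sumBelow m g) (f m) (g m))

sum-scale : ∀ m a (f : ℕ → ℚ) → sumBelow m (λ i → a * f i) ≡ a * sumBelow m f
sum-scale zero    a f = sym (ℚP.*-zeroʳ a)
sum-scale (suc m) a f = trans (cong (λ z → z + a * f m) (sum-scale m a f)) (sym (ℚP.*-distribˡ-+ a (sumBelow m f) (f m)))

-- LU decomposition of the Hankel matrix h(a + b), a, b ≥ n. Up to normalisation, g z b is the integral of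
-- φᵇ against the z-th orthogonal polynomial for the moments h(2n + j), which is a Jacobi polynomial; lam
-- and gam are the coefficients of its three-term recurrence.
module LU (n : ℕ) where
  private
    N : ℚ
    N = ι n

  lamDen gamDen lam gam e : ℕ → ℚ
  lamDen z = (ι 2 * N + ι 2 * ι z + 1ℚ) * (N + ι z + 1ℚ)
  lam z = ((ι 2 * ι z + 1ℚ) * (ι 2 * N + ι z + 1ℚ)) /' lamDen z
  gamDen zero    = 1ℚ
  gamDen (suc z) = (N + ι z + 1ℚ) * (ι 2 * N + ι 2 * ι z + ι 3)
  gam zero    = 0ℚ
  gam (suc z) = ((ι z + 1ℚ) * (ι 4 * N + ι 2 * ι z + ι 3)) /' gamDen (suc z)
  e zero    = 1ℚ /' h (2 ℕ.* n)
  e (suc z) = (e z * lam z) /' gam (suc z)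

  -- `r z b` is the product of (b - n - j) / (b + n + j + 2) over j < z. Its zeros b = n, ..., n + z
  -- - 1 make the decomposition triangular.
  r g : ℕ → ℕ → ℚ
  r zero    b = 1ℚ
  r (suc z) b = (r z b * (ι b - N - ι z)) /' (N + ι b + ι z + ι 2)
  g z b = h (n ℕ.+ b) * r z b

  unit-lin : ∀ a b d m → Unit (ι a * N + ι b * ι m + ι (suc d))
  unit-lin a b d m = unit-resp
    (trans (ℕ→ℚ-+ (a ℕ.* n ℕ.+ b ℕ.* m) (suc d)) (cong (λ z → z + ι (suc d)) (trans (ℕ→ℚ-+ (a ℕ.* n) (b ℕ.* m)) (cong₂ _+_ (ℕ→ℚ-* a n) (ℕ→ℚ-* b m)))))
    (unit-resp (cong ι (sym (ℕP.+-suc (a ℕ.* n ℕ.+ b ℕ.* m) d))) (unit-suc (a ℕ.* n ℕ.+ b ℕ.* m ℕ.+ d)))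

  unit-n+z+1 : ∀ z → Unit (N + ι z + 1ℚ)
  unit-n+z+1 z = unit-resp (solve 2 (λ n z → c 1 :* n :+ c 1 :* z :+ c 1 := n :+ z :+ c 1) refl N (ι z)) (unit-lin 1 1 0 z)

  unit-lamDen : ∀ z → Unit (lamDen z)
  unit-lamDen z = unit-* (unit-lin 2 2 0 z) (unit-n+z+1 z)

  unit-gamDen : ∀ z → Unit (gamDen z)
  unit-gamDen zero    = unit-suc 0
  unit-gamDen (suc z) = unit-* (unit-n+z+1 z) (unit-lin 2 2 2 z)

  unit-rDen : ∀ b z → Unit (N + ι b + ι z + ι 2)
  unit-rDen b z = unit-resp (trans (cong (λ y → 1ℚ * N + 1ℚ * y + ι 2) (ℕ→ℚ-+ b z)) (solve 3 (λ n b z → c 1 :* n :+ c 1 :* (b :+ z) :+ c 2 := n :+ b :+ z :+ c 2) refl N (ι b) (ι z)))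
    (unit-lin 1 1 1 (b ℕ.+ z))

  unit-gam : ∀ z → Unit (gam (suc z))
  unit-gam z = unit-/' (unit-* (unit-resp (ℚP.+-comm 1ℚ (ι z)) (unit-1+ z)) (unit-lin 4 2 2 z)) (unit-gamDen (suc z))

  unit-lam : ∀ z → Unit (lam z)
  unit-lam z = unit-/' (unit-* (unit-resp (solve 2 (λ n z → c 0 :* n :+ c 2 :* z :+ c 1 := c 2 :* z :+ c 1) refl N (ι z)) (unit-lin 0 2 0 z))
    (unit-resp (solve 2 (λ n z → c 2 :* n :+ c 1 :* z :+ c 1 := c 2 :* n :+ z :+ c 1) refl N (ι z)) (unit-lin 2 1 0 z))) (unit-lamDen z)

  unit-e : ∀ z → Unit (e z)
  unit-e zero    = unit-/' (unit-suc 0) (h-unit (2 ℕ.* n))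
  unit-e (suc z) = unit-/' (unit-* (unit-e z) (unit-lam z)) (unit-gam z)

  -- The weights `e` are chosen for this relation: it makes the three-term recurrence symmetric, so
  -- that neighbouring Christoffel-Darboux terms cancel.
  e-gam : ∀ z → e (suc z) * gam (suc z) ≡ e z * lam z
  e-gam z = /'-* _ (unit-gam z)

  r-suc : ∀ z b → r (suc z) b * (N + ι b + ι z + ι 2) ≡ r z b * (ι b - N - ι z)
  r-suc z b = /'-* _ (unit-rDen b z)

  -- Under this diagonal shift the products in numerator and denominator overlap except for their
  -- end factors.
  r-shift : ∀ z b → r (suc z) (suc b) * ((N + ι b + ι z + ι 2) * (N + ι b + ι z + ι 3))
            ≡ r z b * ((ι b + 1ℚ - N) * (N + ι b + ι 2))
  r-shift zero b = trans (cong (λ z → r 1 (suc b) * ((N + ι b + 0ℚ + ι 2) * z)) den)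
    (trans (solve 3 (λ r x y → r :* (x :* y) := (r :* y) :* x) refl (r 1 (suc b)) (N + ι b + 0ℚ + ι 2) (N + ι (suc b) + 0ℚ + ι 2))
    (trans (cong (λ z → z * (N + ι b + 0ℚ + ι 2)) (r-suc 0 (suc b)))
    (trans (cong (λ z → 1ℚ * (z - N - 0ℚ) * (N + ι b + 0ℚ + ι 2)) (ℕ→ℚ-suc b))
      (solve 2 (λ n b → c 1 :* (c 1 :+ b :- n :- c 0) :* (n :+ b :+ c 0 :+ c 2) := c 1 :* ((b :+ c 1 :- n) :* (n :+ b :+ c 2))) refl N (ι b)))))
    where
    den : N + ι b + 0ℚ + ι 3 ≡ N + ι (suc b) + 0ℚ + ι 2
    den = trans (solve 2 (λ n b → n :+ b :+ c 0 :+ c 3 := n :+ (c 1 :+ b) :+ c 0 :+ c 2) refl N (ι b)) (cong (λ z → N + z + 0ℚ + ι 2) (sym (ℕ→ℚ-suc b)))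
  r-shift (suc z) b = unit-cancel (unit-rDen b z)
    (trans (cong₂ (λ x y → (N + ι b + ι z + ι 2) * (r (suc (suc z)) (suc b) * (x * y))) den₁ den₂)
    (trans (solve 4 (λ a r x y → a :* (r :* (x :* y)) := (r :* y) :* (a :* x)) refl (N + ι b + ι z + ι 2) (r (suc (suc z)) (suc b)) (N + ι b + ι z + ι 3) (N + ι (suc b) + ι (suc z) + ι 2))
    (trans (cong (λ w → w * ((N + ι b + ι z + ι 2) * (N + ι b + ι z + ι 3))) (r-suc (suc z) (suc b)))
    (trans (solve 4 (λ r s x y → r :* s :* (x :* y) := r :* (x :* y) :* s) refl (r (suc z) (suc b)) (ι (suc b) - N - ι (suc z)) (N + ι b + ι z + ι 2) (N + ι b + ι z + ι 3))
    (trans (cong₂ _*_ (r-shift z b) diff)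
    (trans (solve 3 (λ r p s → r :* p :* s := (r :* s) :* p) refl (r z b) ((ι b + 1ℚ - N) * (N + ι b + ι 2)) (ι b - N - ι z))
    (trans (cong (λ w → w * ((ι b + 1ℚ - N) * (N + ι b + ι 2))) (sym (r-suc z b)))
      (solve 3 (λ r d p → (r :* d) :* p := d :* (r :* p)) refl (r (suc z) b) (N + ι b + ι z + ι 2) ((ι b + 1ℚ - N) * (N + ι b + ι 2))))))))))
    where
    den₁ : N + ι b + ι (suc z) + ι 2 ≡ N + ι b + ι z + ι 3
    den₁ = trans (cong (λ w → N + ι b + w + ι 2) (ℕ→ℚ-suc z)) (solve 3 (λ n b z → n :+ b :+ (c 1 :+ z) :+ c 2 := n :+ b :+ z :+ c 3) refl N (ι b) (ι z))
    den₂ : N + ι b + ι (suc z) + ι 3 ≡ N + ι (suc b) + ι (suc z) + ι 2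
    den₂ = trans (solve 3 (λ n b z → n :+ b :+ z :+ c 3 := n :+ (c 1 :+ b) :+ z :+ c 2) refl N (ι b) (ι (suc z))) (cong (λ w → N + w + ι (suc z) + ι 2) (sym (ℕ→ℚ-suc b)))
    diff : ι (suc b) - N - ι (suc z) ≡ ι b - N - ι z
    diff = trans (cong₂ (λ x y → x - N - y) (ℕ→ℚ-suc b) (ℕ→ℚ-suc z)) (solve 3 (λ n b z → (c 1 :+ b) :- n :- (c 1 :+ z) := b :- n :- z) refl N (ι b) (ι z))

  private
    -- All values of `r` are expressed through `r₀` and all values of `h` through `H`. After
    -- multiplication by the common denominator `D`, a polynomial identity in n, b, z is left.
    recurrence-poly : ∀ H H′ r₀ r₁ r₂ rs n b z la ga L G →
      la * ((ι 2 * n + ι 2 * (1ℚ + z) + 1ℚ) * (n + (1ℚ + z) + 1ℚ)) ≡ L → ga * ((n + z + 1ℚ) * (ι 2 * n + ι 2 * z + ι 3)) ≡ G →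
      L ≡ (ι 2 * (1ℚ + z) + 1ℚ) * (ι 2 * n + (1ℚ + z) + 1ℚ) → G ≡ (z + 1ℚ) * (ι 4 * n + ι 2 * z + ι 3) →
      (n + b + ι 2) * H′ ≡ ι 2 * (ι 2 * (n + b) + ι 3) * H →
      r₁ * (n + b + z + ι 2) ≡ r₀ * (b - n - z) →
      r₂ * (n + b + (1ℚ + z) + ι 2) ≡ r₁ * (b - n - (1ℚ + z)) →
      rs * ((n + b + z + ι 2) * (n + b + z + ι 3)) ≡ r₀ * ((b + 1ℚ - n) * (n + b + ι 2)) →
      let D = (ι 2 * n + ι 2 * z + ι 3) * (n + z + 1ℚ) * (n + z + ι 2) * ((n + b + z + ι 2) * (n + b + z + ι 3)) in
      D * (H′ * rs) ≡ D * (la * (H * r₂) + (ι 4 - la - ga) * (H * r₁) + ga * (H * r₀))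
    recurrence-poly H H′ r₀ r₁ r₂ rs n b z la ga L G eL eG L≡ G≡ eH e₁ e₂ eₛ = trans left-side (sym rhs′)
      where
      A = ι 2 * n + ι 2 * z + ι 3
      B = n + z + 1ℚ
      C′ = n + z + ι 2
      X = n + b + z + ι 2
      Y = n + b + z + ι 3
      u = b - n - z
      r₁X : r₁ * X ≡ r₀ * u
      r₁X = e₁
      r₂XY : r₂ * (X * Y) ≡ r₀ * (u * (u - 1ℚ))
      r₂XY = trans (solve 5 (λ r₂ n b z _ → r₂ :* ((n :+ b :+ z :+ c 2) :* (n :+ b :+ z :+ c 3)) := (r₂ :* (n :+ b :+ (c 1 :+ z) :+ c 2)) :* (n :+ b :+ z :+ c 2)) refl r₂ n b z n)
        (trans (cong (_* X) e₂) (trans (solve 4 (λ r₁ n b z → (r₁ :* (b :- n :- (c 1 :+ z))) :* (n :+ b :+ z :+ c 2) := (r₁ :* (n :+ b :+ z :+ c 2)) :* (b :- n :- z :- c 1)) refl r₁ n b z)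
        (trans (cong (_* (u - 1ℚ)) e₁) (solve 2 (λ r u → r :* u :* (u :- c 1) := r :* (u :* (u :- c 1))) refl r₀ u))))
      laAC : la * (A * C′) ≡ (ι 2 * z + ι 3) * (ι 2 * n + z + ι 2)
      laAC = trans (solve 3 (λ la n z → la :* ((c 2 :* n :+ c 2 :* z :+ c 3) :* (n :+ z :+ c 2)) := la :* ((c 2 :* n :+ c 2 :* (c 1 :+ z) :+ c 1) :* (n :+ (c 1 :+ z) :+ c 1))) refl la n z)
        (trans eL (trans L≡ (solve 2 (λ n z → (c 2 :* (c 1 :+ z) :+ c 1) :* (c 2 :* n :+ (c 1 :+ z) :+ c 1) := (c 2 :* z :+ c 3) :* (c 2 :* n :+ z :+ c 2)) refl n z)))
      gaBA : ga * (B * A) ≡ (z + 1ℚ) * (ι 4 * n + ι 2 * z + ι 3)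
      gaBA = trans eG G≡
      HX = H * r₀
      left-side : A * B * C′ * (X * Y) * (H′ * rs) ≡ A * B * C′ * (ι 2 * (ι 2 * (n + b) + ι 3) * (b + 1ℚ - n)) * HX
      left-side = trans (solve 5 (λ P X Y H r → P :* (X :* Y) :* (H :* r) := P :* H :* (r :* (X :* Y))) refl (A * B * C′) X Y H′ rs)
        (trans (cong (A * B * C′ * H′ *_) eₛ)
        (trans (solve 5 (λ P H r q w → P :* H :* (r :* (q :* w)) := P :* (w :* H) :* (r :* q)) refl (A * B * C′) H′ r₀ (b + 1ℚ - n) (n + b + ι 2))
        (trans (cong (λ w → A * B * C′ * w * (r₀ * (b + 1ℚ - n))) eH)
          (solve 5 (λ P k H r q → P :* (k :* H) :* (r :* q) := P :* (k :* q) :* (H :* r)) refl (A * B * C′) (ι 2 * (ι 2 * (n + b) + ι 3)) H r₀ (b + 1ℚ - n)))))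
      rhs′ : A * B * C′ * (X * Y) * (la * (H * r₂) + (ι 4 - la - ga) * (H * r₁) + ga * (H * r₀))
             ≡ A * B * C′ * (ι 2 * (ι 2 * (n + b) + ι 3) * (b + 1ℚ - n)) * HX
      rhs′ = trans (solve 4 (λ P x y w → P :* (x :+ y :+ w) := P :* x :+ P :* y :+ P :* w) refl (A * B * C′ * (X * Y)) (la * (H * r₂)) ((ι 4 - la - ga) * (H * r₁)) (ga * (H * r₀)))
        (trans (cong₂ _+_ (cong₂ _+_ t₁ t₂) t₃)
        (trans (solve 4 (λ p q w k → p :* k :+ q :* k :+ w :* k := (p :+ q :+ w) :* k) refl (LA * B * (u * (u - 1ℚ))) ((ι 4 * (A * B * C′) - LA * B - GA * C′) * Y * u) (GA * C′ * (X * Y)) HX)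
          (cong (_* HX) (solve 3 (λ n b z → let A = c 2 :* n :+ c 2 :* z :+ c 3 ; B = n :+ z :+ c 1 ; C′ = n :+ z :+ c 2 ; X = n :+ b :+ z :+ c 2 ; Y = n :+ b :+ z :+ c 3 ; u = b :- n :- z ; LA = (c 2 :* z :+ c 3) :* (c 2 :* n :+ z :+ c 2) ; GA = (z :+ c 1) :* (c 4 :* n :+ c 2 :* z :+ c 3) in
             LA :* B :* (u :* (u :- c 1)) :+ (c 4 :* (A :* B :* C′) :- LA :* B :- GA :* C′) :* Y :* u :+ GA :* C′ :* (X :* Y)
               := A :* B :* C′ :* (c 2 :* (c 2 :* (n :+ b) :+ c 3) :* (b :+ c 1 :- n))) refl n b z))))
        where
        LA = (ι 2 * z + ι 3) * (ι 2 * n + z + ι 2)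
        GA = (z + 1ℚ) * (ι 4 * n + ι 2 * z + ι 3)
        t₁ : A * B * C′ * (X * Y) * (la * (H * r₂)) ≡ LA * B * (u * (u - 1ℚ)) * HX
        t₁ = trans (solve 7 (λ A B C′ Z la H r → A :* B :* C′ :* Z :* (la :* (H :* r)) := la :* (A :* C′) :* B :* H :* (r :* Z)) refl A B C′ (X * Y) la H r₂)
          (trans (cong₂ (λ p w → p * B * H * w) laAC r₂XY) (solve 5 (λ l B H r w → l :* B :* H :* (r :* w) := l :* B :* w :* (H :* r)) refl LA B H r₀ (u * (u - 1ℚ))))
        t₂ : A * B * C′ * (X * Y) * ((ι 4 - la - ga) * (H * r₁)) ≡ (ι 4 * (A * B * C′) - LA * B - GA * C′) * Y * u * HX
        t₂ = trans (solve 5 (λ P X Y q w → P :* (X :* Y) :* (q :* w) := P :* q :* Y :* (w :* X)) refl (A * B * C′) X Y (ι 4 - la - ga) (H * r₁))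
          (trans (cong₂ (λ p w → p * Y * w)
              (trans (solve 5 (λ A B C′ la ga → A :* B :* C′ :* (c 4 :- la :- ga) := c 4 :* (A :* B :* C′) :- la :* (A :* C′) :* B :- ga :* (B :* A) :* C′) refl A B C′ la ga)
                     (cong₂ (λ p q → ι 4 * (A * B * C′) - p * B - q * C′) laAC gaBA))
              (trans (ℚP.*-assoc H r₁ X) (cong (H *_) r₁X)))
            (solve 5 (λ p Y H r u → p :* Y :* (H :* (r :* u)) := p :* Y :* u :* (H :* r)) refl (ι 4 * (A * B * C′) - LA * B - GA * C′) Y H r₀ u))
        t₃ : A * B * C′ * (X * Y) * (ga * (H * r₀)) ≡ GA * C′ * (X * Y) * HX
        t₃ = trans (solve 6 (λ A B C′ Z ga w → A :* B :* C′ :* Z :* (ga :* w) := ga :* (B :* A) :* C′ :* Z :* w) refl A B C′ (X * Y) ga HX)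
          (cong (λ p → p * C′ * (X * Y) * HX) gaBA)

    recurrence-zero : ∀ H H′ r₁ n b la →
      la * ((ι 2 * n + ι 2 * 0ℚ + 1ℚ) * (n + 0ℚ + 1ℚ)) ≡ (ι 2 * 0ℚ + 1ℚ) * (ι 2 * n + 0ℚ + 1ℚ) →
      (n + b + ι 2) * H′ ≡ ι 2 * (ι 2 * (n + b) + ι 3) * H →
      r₁ * (n + b + 0ℚ + ι 2) ≡ 1ℚ * (b - n - 0ℚ) →
      let D = (ι 2 * n + ι 2 * 0ℚ + 1ℚ) * (n + 0ℚ + 1ℚ) * (n + b + 0ℚ + ι 2) in
      D * (H′ * 1ℚ) ≡ D * (la * (H * r₁) + (ι 4 - la - 0ℚ) * (H * 1ℚ) + 0ℚ * 0ℚ)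
    recurrence-zero H H′ r₁ n b la eL eH e₁ = trans
      (trans (solve 4 (λ A X H′ b → A :* X :* (H′ :* c 1) := A :* (X :* H′)) refl A (n + b + 0ℚ + ι 2) H′ b)
        (trans (cong (λ w → A * (w * H′)) (solve 2 (λ n b → n :+ b :+ c 0 :+ c 2 := n :+ b :+ c 2) refl n b)) (cong (A *_) eH)))
      (sym (trans (solve 5 (λ A X la H r₁ → A :* X :* (la :* (H :* r₁) :+ (c 4 :- la :- c 0) :* (H :* c 1) :+ c 0 :* c 0)
                           := (la :* A) :* (H :* (r₁ :* X)) :+ (c 4 :* A :- la :* A) :* (X :* H)) refl A (n + b + 0ℚ + ι 2) la H r₁)
        (trans (cong₂ (λ p q → p * (H * q) + (ι 4 * A - p) * ((n + b + 0ℚ + ι 2) * H)) eL e₁)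
          (solve 3 (λ n b H → ((c 2 :* c 0 :+ c 1) :* (c 2 :* n :+ c 0 :+ c 1)) :* (H :* (c 1 :* (b :- n :- c 0))) :+ (c 4 :* ((c 2 :* n :+ c 2 :* c 0 :+ c 1) :* (n :+ c 0 :+ c 1)) :- ((c 2 :* c 0 :+ c 1) :* (c 2 :* n :+ c 0 :+ c 1))) :* ((n :+ b :+ c 0 :+ c 2) :* H)
             := ((c 2 :* n :+ c 2 :* c 0 :+ c 1) :* (n :+ c 0 :+ c 1)) :* (c 2 :* (c 2 :* (n :+ b) :+ c 3) :* H)) refl n b H))))
      where
      A = (ι 2 * n + ι 2 * 0ℚ + 1ℚ) * (n + 0ℚ + 1ℚ)

  previous : ℕ → ℕ → ℚ
  previous zero    b = 0ℚ
  previous (suc z) b = g z b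

  h-step : ∀ b → (N + ι b + ι 2) * h (n ℕ.+ suc b) ≡ ι 2 * (ι 2 * (N + ι b) + ι 3) * h (n ℕ.+ b)
  h-step b = trans (cong (λ w → (N + ι b + ι 2) * h w) (ℕP.+-suc n b))
    (subst (λ w → (w + ι 2) * h (suc (n ℕ.+ b)) ≡ ι 2 * (ι 2 * w + ι 3) * h (n ℕ.+ b)) (ℕ→ℚ-+ n b) (h-suc (n ℕ.+ b)))

  -- The three coefficients add up to 4: for large b all `r z b` tend to 1, and h (t+1) / h t tends
  -- to 4.
  g-recurrence : ∀ z b → g z (suc b) ≡ lam z * g (suc z) b + (ι 4 - lam z - gam z) * g z b + gam z * previous z b
  g-recurrence zero b = unit-cancel (unit-* (unit-lamDen 0) (unit-rDen b 0))
    (recurrence-zero (h (n ℕ.+ b)) (h (n ℕ.+ suc b)) (r 1 b) N (ι b) (lam 0) (/'-* _ (unit-lamDen 0)) (h-step b) (r-suc 0 b))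
  g-recurrence (suc z) b = unit-cancel
    (unit-* (unit-* (unit-* (unit-lin 2 2 2 z) (unit-n+z+1 z)) (unit-resp (solve 2 (λ n z → c 1 :* n :+ c 1 :* z :+ c 2 := n :+ z :+ c 2) refl N (ι z)) (unit-lin 1 1 1 z)))
            (unit-* (unit-rDen b z) (unit-resp (solve 3 (λ n b z → n :+ (c 1 :+ b) :+ z :+ c 2 := n :+ b :+ z :+ c 3) refl N (ι b) (ι z))
                                      (subst (λ w → Unit (N + w + ι z + ι 2)) (ℕ→ℚ-suc b) (unit-rDen (suc b) z)))))
    (recurrence-poly (h (n ℕ.+ b)) (h (n ℕ.+ suc b)) (r z b) (r (suc z) b) (r (suc (suc z)) b) (r (suc z) (suc b)) N (ι b) (ι z) (lam (suc z)) (gam (suc z)) _ _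
      (subst (λ w → lam (suc z) * ((ι 2 * N + ι 2 * w + 1ℚ) * (N + w + 1ℚ)) ≡ (ι 2 * w + 1ℚ) * (ι 2 * N + w + 1ℚ)) (ℕ→ℚ-suc z) (/'-* _ (unit-lamDen (suc z))))
      (/'-* _ (unit-gamDen (suc z))) refl refl (h-step b) (r-suc z b)
      (subst (λ w → r (suc (suc z)) b * (N + ι b + w + ι 2) ≡ r (suc z) b * (ι b - N - w)) (ℕ→ℚ-suc z) (r-suc (suc z) b))
      (r-shift z b))

  r-vanish : ∀ y t → r (suc (t ℕ.+ y)) (n ℕ.+ y) ≡ 0ℚ
  r-vanish y zero = unit-cancel {y = 0ℚ} (unit-rDen (n ℕ.+ y) y) (trans (ℚP.*-comm (N + ι (n ℕ.+ y) + ι y + ι 2) (r (suc y) (n ℕ.+ y))) (trans (r-suc y (n ℕ.+ y))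
    (trans (cong (λ w → r y (n ℕ.+ y) * (w - N - ι y)) (ℕ→ℚ-+ n y)) (solve 4 (λ r n y d → r :* (n :+ y :- n :- y) := d :* c 0) refl (r y (n ℕ.+ y)) N (ι y) (N + ι (n ℕ.+ y) + ι y + ι 2)))))
  r-vanish y (suc t) = unit-cancel {y = 0ℚ} (unit-rDen (n ℕ.+ y) (suc (t ℕ.+ y))) (trans (ℚP.*-comm (N + ι (n ℕ.+ y) + ι (suc (t ℕ.+ y)) + ι 2) (r (suc (suc (t ℕ.+ y))) (n ℕ.+ y))) (trans (r-suc (suc (t ℕ.+ y)) (n ℕ.+ y))
    (trans (cong (_* (ι (n ℕ.+ y) - N - ι (suc (t ℕ.+ y)))) (r-vanish y t)) (solve 2 (λ x d → c 0 :* x := d :* c 0) refl (ι (n ℕ.+ y) - N - ι (suc (t ℕ.+ y))) (N + ι (n ℕ.+ y) + ι (suc (t ℕ.+ y)) + ι 2)))))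

  g-vanish : ∀ y t → g (suc (t ℕ.+ y)) (n ℕ.+ y) ≡ 0ℚ
  g-vanish y t = trans (cong (h (n ℕ.+ (n ℕ.+ y)) *_) (r-vanish y t)) (ℚP.*-zeroʳ (h (n ℕ.+ (n ℕ.+ y))))

  r-unit : ∀ z t → Unit (r z (n ℕ.+ (z ℕ.+ t)))
  r-unit zero    t = unit-suc 0
  r-unit (suc z) t = unit-/' (unit-* (subst (λ w → Unit (r z (n ℕ.+ w))) (ℕP.+-suc z t) (r-unit z (suc t)))
      (unit-resp (trans (ℕ→ℚ-suc t) (sym (trans (cong (λ w → w - N - ι z) (trans (ℕ→ℚ-+ n (suc (z ℕ.+ t))) (cong (λ w → N + w) (trans (ℕ→ℚ-suc (z ℕ.+ t)) (cong (λ w → 1ℚ + w) (ℕ→ℚ-+ z t))))))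
        (solve 3 (λ n z t → n :+ (c 1 :+ (z :+ t)) :- n :- z := c 1 :+ t) refl N (ι z) (ι t))))) (unit-suc t)))
    (unit-rDen (n ℕ.+ suc (z ℕ.+ t)) z)

  g-unit : ∀ y → Unit (g y (n ℕ.+ y))
  g-unit y = unit-* (h-unit (n ℕ.+ (n ℕ.+ y))) (subst (λ w → Unit (r y (n ℕ.+ w))) (ℕP.+-identityʳ y) (r-unit y 0))

  -- Christoffel–Darboux
  private
    boundary : ℕ → ℕ → ℕ → ℚ
    boundary z a b = e z * lam z * (g (suc z) a * g z b - g z a * g (suc z) b)

    christoffel : ∀ a b z → sumBelow (suc z) (λ z → e z * (g z (suc a) * g z b) - e z * (g z a * g z (suc b))) ≡ boundary z a b
    christoffel a b zero = trans (cong₂ (λ p q → 0ℚ + (e 0 * (p * g 0 b) - e 0 * (g 0 a * q))) (g-recurrence 0 a) (g-recurrence 0 b))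
      (solve 6 (λ e l x y x′ y′ → c 0 :+ (e :* ((l :* x′ :+ (c 4 :- l :- c 0) :* x :+ c 0 :* c 0) :* y) :- e :* (x :* (l :* y′ :+ (c 4 :- l :- c 0) :* y :+ c 0 :* c 0))) := e :* l :* (x′ :* y :- x :* y′)) refl
        (e 0) (lam 0) (g 0 a) (g 0 b) (g 1 a) (g 1 b))
    christoffel a b (suc z) = trans (cong₂ _+_ (christoffel a b z) (cong₂ (λ p q → e (suc z) * (p * g (suc z) b) - e (suc z) * (g (suc z) a * q)) (g-recurrence (suc z) a) (g-recurrence (suc z) b)))
      (trans (solve 10 (λ P e l m x y x′ y′ x₀ y₀ → P :* (x :* y₀ :- x₀ :* y) :+ (e :* ((l :* x′ :+ (c 4 :- l :- m) :* x :+ m :* x₀) :* y) :- e :* (x :* (l :* y′ :+ (c 4 :- l :- m) :* y :+ m :* y₀)))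
                  := P :* (x :* y₀ :- x₀ :* y) :+ (e :* l :* (x′ :* y :- x :* y′) :- (e :* m) :* (x :* y₀ :- x₀ :* y))) refl
                  (e z * lam z) (e (suc z)) (lam (suc z)) (gam (suc z)) (g (suc z) a) (g (suc z) b) (g (suc (suc z)) a) (g (suc (suc z)) b) (g z a) (g z b))
      (trans (cong (λ w → e z * lam z * (g (suc z) a * g z b - g z a * g (suc z) b) + (boundary (suc z) a b - w * (g (suc z) a * g z b - g z a * g (suc z) b))) (e-gam z))
        (solve 2 (λ p q → p :+ (q :- p) := q) refl (e z * lam z * (g (suc z) a * g z b - g z a * g (suc z) b)) (boundary (suc z) a b))))

  -- In row a = n + y the Christoffel-Darboux boundary term vanishes, so the sum for (a + 1, b)
  -- equals the one for (a, b + 1). It thus has the Hankel property, and induction reduces it to the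
  -- row a = n.
  decomposition : ∀ y b → sumBelow (suc y) (λ z → e z * (g z (n ℕ.+ y) * g z b)) ≡ h (n ℕ.+ y ℕ.+ b)
  decomposition zero b = trans (cong (λ w → 0ℚ + e 0 * (h (n ℕ.+ w) * 1ℚ * (h (n ℕ.+ b) * 1ℚ))) (ℕP.+-identityʳ n))
    (trans (solve 3 (λ e x y → c 0 :+ e :* (x :* c 1 :* (y :* c 1)) := (e :* x) :* y) refl (e 0) (h (n ℕ.+ n)) (h (n ℕ.+ b)))
    (trans (cong₂ (λ v w → e 0 * h v * h w) (cong (n ℕ.+_) (sym (ℕP.+-identityʳ n))) (cong (ℕ._+ b) (sym (ℕP.+-identityʳ n))))
    (trans (cong (_* h (n ℕ.+ 0 ℕ.+ b)) (/'-* 1ℚ (h-unit (2 ℕ.* n)))) (ℚP.*-identityˡ _))))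
  decomposition (suc y) b = trans (cong (λ a → sumBelow (suc (suc y)) (λ z → e z * (g z a * g z b))) (ℕP.+-suc n y))
    (trans (solve 2 (λ p q → p := (p :- q) :+ q) refl A B)
    (trans (cong (_+ B) (trans (sym (sum-sub (suc (suc y)) (λ z → e z * (g z (suc a) * g z b)) (λ z → e z * (g z a * g z (suc b))))) (christoffel a b (suc y))))
    (trans (cong₂ (λ p q → e (suc y) * lam (suc y) * (p * g (suc y) b - q * g (suc (suc y)) b) + (sumBelow (suc y) (λ z → e z * (g z a * g z (suc b))) + e (suc y) * (q * g (suc y) (suc b)))) (g-vanish y 1) (g-vanish y 0))
    (trans (solve 6 (λ P x y S e w → P :* (c 0 :* x :- c 0 :* y) :+ (S :+ e :* (c 0 :* w)) := S) refl (e (suc y) * lam (suc y)) (g (suc y) b) (g (suc (suc y)) b) (sumBelow (suc y) (λ z → e z * (g z a * g z (suc b)))) (e (suc y)) (g (suc y) (suc b)))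
    (trans (decomposition y (suc b)) (cong h (trans (ℕP.+-suc (n ℕ.+ y) b) (cong (ℕ._+ b) (sym (ℕP.+-suc n y))))))))))
    where
    a = n ℕ.+ y
    A = sumBelow (suc (suc y)) (λ z → e z * (g z (suc a) * g z b))
    B = sumBelow (suc (suc y)) (λ z → e z * (g z a * g z (suc b)))

  -- the Schur complement of the rows and columns n, …, n + y - 1 in the matrix h(a + b)
  K : ℕ → ℕ → ℕ → ℚ
  K y a b = h (a ℕ.+ b) - sumBelow y (λ z → e z * (g z a * g z b))

  -- In row n + y, `decomposition` is exhausted after one more term, which is therefore all that the
  -- Schur complement has left there.
  K-pivot : ∀ y b → K y (n ℕ.+ y) b ≡ e y * (g y (n ℕ.+ y) * g y b)
  K-pivot y b = trans (cong (λ w → w - sumBelow y (λ z → e z * (g z (n ℕ.+ y) * g z b))) (sym (decomposition y b)))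
    (solve 2 (λ s t → (s :+ t) :- s := t) refl (sumBelow y (λ z → e z * (g z (n ℕ.+ y) * g z b))) (e y * (g y (n ℕ.+ y) * g y b)))

  pivot : ℕ → ℚ
  pivot y = e y * (g y (n ℕ.+ y) * g y (n ℕ.+ y))

  unit-pivot : ∀ y → Unit (pivot y)
  unit-pivot y = unit-* (unit-e y) (unit-* (g-unit y) (g-unit y))

  pivots : ℕ → ℕ → ℚ
  pivots y zero    = 1ℚ
  pivots y (suc m) = pivot y * pivots (suc y) m

  K-step : ∀ y s → s * pivot y ≡ 1ℚ → ∀ b c′ → K y b c′ - s * (K y (n ℕ.+ y) b * K y (n ℕ.+ y) c′) ≡ K (suc y) b c′
  K-step y s es b d = trans (cong₂ (λ p q → K y b d - s * (p * q)) (K-pivot y b) (K-pivot y d))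
    (trans (solve 7 (λ s e G x z S H → (H :- S) :- s :* ((e :* (G :* x)) :* (e :* (G :* z))) := H :- (S :+ (s :* (e :* (G :* G))) :* (e :* (x :* z)))) refl s (e y) (g y (n ℕ.+ y)) (g y b) (g y d) (sumBelow y (λ z → e z * (g z b * g z d))) (h (b ℕ.+ d)))
    (trans (cong (λ w → h (b ℕ.+ d) - (sumBelow y (λ z → e z * (g z b * g z d)) + w * (e y * (g y b * g y d)))) es)
      (cong (λ w → h (b ℕ.+ d) - (sumBelow y (λ z → e z * (g z b * g z d)) + w)) (ℚP.*-identityˡ _))))

  skewForm-cong : ∀ {K K′ : ℕ → ℕ → ℚ} → (∀ a b → K a b ≡ K′ a b) → ∀ v w → skewForm K v w ≡ skewForm K′ v w
  skewForm-cong eq (a , false) (b , false) = refl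
  skewForm-cong eq (a , false) (b , true)  = eq a b
  skewForm-cong eq (a , true)  (b , false) = cong -_ (eq a b)
  skewForm-cong eq (a , true)  (b , true)  = refl

  eliminate : ∀ k m y → pf (skewForm (K y)) (suc m) (pairs (range (n ℕ.+ y) m ++ k ∷ [])) ≡ pivots y m * K (y ℕ.+ m) k k
  eliminate k zero y = trans base (cong (λ w → 1ℚ * K w k k) (sym (ℕP.+-identityʳ y)))
    where
    base : K y k k * 1ℚ - 0ℚ ≡ 1ℚ * K y k k
    base = solve 1 (λ x → x :* c 1 :- c 0 := c 1 :* x) refl (K y k k)
  eliminate k (suc m) y = trans (pf-eliminate (K y) s (n ℕ.+ y) s-inverse (suc m) as)
    (trans (cong₂ _*_ (K-pivot y (n ℕ.+ y)) rest)
    (trans (sym (ℚP.*-assoc (pivot y) (pivots (suc y) m) (K (suc y ℕ.+ m) k k)))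
      (cong (λ w → pivots y (suc m) * K w k k) (sym (ℕP.+-suc y m)))))
    where
    as : List ℕ
    as = range (suc (n ℕ.+ y)) m ++ k ∷ []
    s : ℚ
    s = proj₁ (unit-pivot y)
    s-inverse : s * K y (n ℕ.+ y) (n ℕ.+ y) ≡ 1ℚ
    s-inverse = trans (cong (s *_) (K-pivot y (n ℕ.+ y))) (proj₂ (unit-pivot y))
    rest : pf (skewForm (λ b d → K y b d - s * (K y (n ℕ.+ y) b * K y (n ℕ.+ y) d))) (suc m) (pairs as) ≡ pivots (suc y) m * K (suc y ℕ.+ m) k k
    rest = trans (pf-cong (skewForm-cong (K-step y s (proj₂ (unit-pivot y)))) (suc m) (pairs as))
      (trans (cong (λ w → pf (skewForm (K (suc y))) (suc m) (pairs (range w m ++ k ∷ []))) (sym (ℕP.+-suc n y))) (eliminate k m (suc y)))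

  Pf-value : ∀ k x → pf (skewForm (λ a b → h (a ℕ.+ b))) (suc x) (pairs (range n x ++ k ∷ [])) ≡ pivots 0 x * K x k k
  Pf-value k x = trans (pf-cong (skewForm-cong {K′ = K 0} (λ a b → solve 1 (λ x → x := x :- c 0) refl (h (a ℕ.+ b)))) (suc x) (pairs (range n x ++ k ∷ [])))
    (trans (cong (λ w → pf (skewForm (K 0)) (suc x) (pairs (range w x ++ k ∷ []))) (sym (ℕP.+-identityʳ n))) (eliminate k x 0))

-- The sum over i

sq : ℚ → ℚ
sq p = p * p

sq′ : ∀ {m} → Polynomial m → Polynomial m
sq′ p = p :* p

-- The ratio of consecutive coefficients is P (i) / Q (i + 1).
module Ratio (n k : ℚ) where
  P Q̂ Q : ℚ → ℚ
  P i = (ι 2 * i + 1ℚ) * sq (n - k - i - 1ℚ) * (ι 2 * n - i)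
  Q̂ i = sq (n + k - i + 1ℚ) * (ι 4 * n - ι 2 * i + 1ℚ)
  Q i = i * Q̂ i

private
  P′ Q̂′ Q′ : ∀ {m} (n k i : Polynomial m) → Polynomial m
  P′ n k i = (c 2 :* i :+ c 1) :* sq′ (n :- k :- i :- c 1) :* (c 2 :* n :- i)
  Q̂′ n k i = sq′ (n :+ k :- i :+ c 1) :* (c 4 :* n :- c 2 :* i :+ c 1)
  Q′ n k i = i :* Q̂′ n k i

  ΔP′ ΔQ̂′ ΔQ′ : ∀ {m} (n k i j : Polynomial m) → Polynomial m
  ΔP′ n k i j = c 2 :* sq′ (n :- k :- i :- c 1) :* (c 2 :* n :- i) :+ (c 2 :* j :+ c 1) :* (i :+ j :- c 2 :* (n :- k :- c 1)) :* (c 2 :* n :- i)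
                :- (c 2 :* j :+ c 1) :* sq′ (n :- k :- j :- c 1)
  ΔQ̂′ n k i j = (i :+ j :- c 2 :* (n :+ k :+ c 1)) :* (c 4 :* n :- c 2 :* i :+ c 1) :- c 2 :* sq′ (n :+ k :- j :+ c 1)
  ΔQ′ n k i j = Q̂′ n k i :+ j :* ΔQ̂′ n k i j

  ΔP ΔQ̂ ΔQ : (n k i j : ℚ) → ℚ
  ΔP n k i j = ι 2 * sq (n - k - i - 1ℚ) * (ι 2 * n - i) + (ι 2 * j + 1ℚ) * (i + j - ι 2 * (n - k - 1ℚ)) * (ι 2 * n - i)
                - (ι 2 * j + 1ℚ) * sq (n - k - j - 1ℚ)
  ΔQ̂ n k i j = (i + j - ι 2 * (n + k + 1ℚ)) * (ι 4 * n - ι 2 * i + 1ℚ) - ι 2 * sq (n + k - j + 1ℚ)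
  ΔQ n k i j = Ratio.Q̂ n k i + j * ΔQ̂ n k i j

  -- The Δ are divided differences in i and j, written as polynomials. The factor `u` will be a
  -- multiple of a reciprocal, with u * (i - j) equal to ±1 or i, so that no division by i - j
  -- occurs.
  divided : ∀ n k i j u → let open Ratio n k in
    (u * (P i - P j) ≡ (u * (i - j)) * ΔP n k i j) × (u * (Q̂ i - Q̂ j) ≡ (u * (i - j)) * ΔQ̂ n k i j) × (u * (Q i - Q j) ≡ (u * (i - j)) * ΔQ n k i j)
  divided n k i j u =
    solve 5 (λ n k i j u → u :* (P′ n k i :- P′ n k j) := (u :* (i :- j)) :* ΔP′ n k i j) refl n k i j u ,
    solve 5 (λ n k i j u → u :* (Q̂′ n k i :- Q̂′ n k j) := (u :* (i :- j)) :* ΔQ̂′ n k i j) refl n k i j u ,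
    solve 5 (λ n k i j u → u :* (Q′ n k i :- Q′ n k j) := (u :* (i :- j)) :* ΔQ′ n k i j) refl n k i j u

-- Partial fractions: with s = i/(x+i), v = 1/(x+1+i), b = 1/(x+2n-i) and b₁ = 1/(x+1+2n-i), the right-hand side
-- is 2x+2n+1 times the difference of consecutive terms of a telescoping sum.
partial-fractions : ∀ n k x i s v b b₁ → let open Ratio n k in
  s * (x + i) ≡ i → v * (x + 1ℚ + i) ≡ 1ℚ → b * (x + ι 2 * n - i) ≡ 1ℚ → b₁ * (x + 1ℚ + ι 2 * n - i) ≡ 1ℚ →
  Q̂ (- x) * (1ℚ - s - x * b) + P (- x - 1ℚ) * (v - b₁) - ι 2 * (ι 4 * k + ι 3) * (ι 2 * x + ι 2 * n + 1ℚ) * (n - i)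
  ≡ (ι 2 * x + ι 2 * n + 1ℚ) * (P i * (v * b) - s * b₁ * Q̂ i)
partial-fractions n k x i s v b b₁ es ev eb eb₁ = trans
  (trans (solve 9 (λ p q₀ s x b v b₁ z w → q₀ :* (c 1 :- s :- x :* b) :+ p :* (v :- b₁) :- z := p :* v :+ :- x :* q₀ :* b :- p :* b₁ :- q₀ :* s :+ (q₀ :- z)) refl
            (P (- x - 1ℚ)) (Q̂ (- x)) s x b v b₁ Z Z)
    (trans (cong (λ w → P (- x - 1ℚ) * v + w * b - P (- x - 1ℚ) * b₁ - Q̂ (- x) * s + (Q̂ (- x) - Z)) end₁)
    (trans (cong (λ w → P (- x - 1ℚ) * v + P (ι 2 * n + x) * b - w * b₁ - Q̂ (- x) * s + (Q̂ (- x) - Z)) end₂)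
    (trans (cong (λ w → P (- x - 1ℚ) * v + P (ι 2 * n + x) * b - Q (ι 2 * n + x + 1ℚ) * b₁ - Q̂ (- x) * s + w) constant-part)
      (solve 12 (λ pm po ql q₀ pi qi v b b₁ s i R → pm :* v :+ po :* b :- ql :* b₁ :- q₀ :* s :+ R
                 := pi :* (b :+ v) :- qi :* (i :* b₁ :+ s) :- (v :* (pi :- pm) :+ b :* (pi :- po) :- b₁ :* (i :* qi :- ql) :- s :* (qi :- q₀)) :+ R) refl
          (P (- x - 1ℚ)) (P (ι 2 * n + x)) (Q (ι 2 * n + x + 1ℚ)) (Q̂ (- x)) (P i) (Q̂ i) v b b₁ s i (D₁ - D₂ + D₃ - i * D₄))))))
  (trans (cong (λ w → P i * (b + v) - Q̂ i * (i * b₁ + s) - w + (D₁ - D₂ + D₃ - i * D₄)) quotients)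
  (trans (solve 2 (λ a d → a :- d :+ d := a) refl (P i * (b + v) - Q̂ i * (i * b₁ + s)) (D₁ - D₂ + D₃ - i * D₄))
  (trans (cong₂ (λ p q → P i * p - Q̂ i * q) (sym sumvb) (sym sumsb))
    (solve 7 (λ L p q v b s b₁ → p :* (L :* (v :* b)) :- q :* (L :* (s :* b₁)) := L :* (p :* (v :* b) :- s :* b₁ :* q)) refl
      (ι 2 * x + ι 2 * n + 1ℚ) (P i) (Q̂ i) v b s b₁))))
  where
  open Ratio n k
  Z = ι 2 * (ι 4 * k + ι 3) * (ι 2 * x + ι 2 * n + 1ℚ) * (n - i)
  D₁ = ΔP n k i (- x - 1ℚ)
  D₂ = ΔP n k i (ι 2 * n + x)
  D₃ = ΔQ n k i (ι 2 * n + x + 1ℚ)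
  D₄ = ΔQ̂ n k i (- x)
  -- The reflection Q j = P (2n - j) makes the residues at opposite poles agree; `end₁` and `end₂`
  -- are two instances of it.
  end₁ : - x * Q̂ (- x) ≡ P (ι 2 * n + x)
  end₁ = solve 3 (λ n k x → Q′ n k (:- x) := P′ n k (c 2 :* n :+ x)) refl n k x
  end₂ : P (- x - 1ℚ) ≡ Q (ι 2 * n + x + 1ℚ)
  end₂ = solve 3 (λ n k x → P′ n k (:- x :- c 1) := Q′ n k (c 2 :* n :+ x :+ c 1)) refl n k x
  -- The origin of the constant 4k + 3: `Z` is the polynomial part that is left once the poles have
  -- been split off.
  constant-part : Q̂ (- x) - Z ≡ D₁ - D₂ + D₃ - i * D₄
  constant-part = solve 4 (λ n k x i → Q̂′ n k (:- x) :- c 2 :* (c 4 :* k :+ c 3) :* (c 2 :* x :+ c 2 :* n :+ c 1) :* (n :- i)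
                           := ΔP′ n k i (:- x :- c 1) :- ΔP′ n k i (c 2 :* n :+ x) :+ ΔQ′ n k i (c 2 :* n :+ x :+ c 1) :- i :* ΔQ̂′ n k i (:- x)) refl n k x i
  quotients : v * (P i - P (- x - 1ℚ)) + b * (P i - P (ι 2 * n + x)) - b₁ * (i * Q̂ i - Q (ι 2 * n + x + 1ℚ)) - s * (Q̂ i - Q̂ (- x)) ≡ D₁ - D₂ + D₃ - i * D₄
  quotients = trans (cong₂ (λ p q → p + q - b₁ * (Q i - Q (ι 2 * n + x + 1ℚ)) - s * (Q̂ i - Q̂ (- x)))
        (trans (proj₁ (divided n k i (- x - 1ℚ) v)) (cong (_* D₁) (trans (solve 3 (λ v x i → v :* (i :- (:- x :- c 1)) := v :* (x :+ c 1 :+ i)) refl v x i) ev)))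
        (trans (proj₁ (divided n k i (ι 2 * n + x) b)) (cong (_* D₂) (trans (solve 4 (λ b n x i → b :* (i :- (c 2 :* n :+ x)) := :- (b :* (x :+ c 2 :* n :- i))) refl b n x i) (cong -_ eb)))))
    (trans (cong₂ (λ p q → 1ℚ * D₁ + (- 1ℚ) * D₂ - p - q)
        (trans (proj₂ (proj₂ (divided n k i (ι 2 * n + x + 1ℚ) b₁))) (cong (_* D₃) (trans (solve 4 (λ b n x i → b :* (i :- (c 2 :* n :+ x :+ c 1)) := :- (b :* (x :+ c 1 :+ c 2 :* n :- i))) refl b₁ n x i) (cong -_ eb₁))))
        (trans (proj₁ (proj₂ (divided n k i (- x) s))) (cong (_* D₄) (trans (solve 3 (λ s x i → s :* (i :- :- x) := s :* (x :+ i)) refl s x i) es))))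
      (solve 5 (λ i a b d e → c 1 :* a :+ con (ℤ.- + 1) :* b :- con (ℤ.- + 1) :* d :- i :* e := a :- b :+ d :- i :* e) refl i D₁ D₂ D₃ D₄))
  sumvb : (ι 2 * x + ι 2 * n + 1ℚ) * (v * b) ≡ b + v
  sumvb = trans (solve 5 (λ x n i v b → (c 2 :* x :+ c 2 :* n :+ c 1) :* (v :* b) := (v :* (x :+ c 1 :+ i)) :* b :+ v :* (b :* (x :+ c 2 :* n :- i))) refl x n i v b)
    (trans (cong₂ (λ p q → p * b + v * q) ev eb) (solve 2 (λ b v → c 1 :* b :+ v :* c 1 := b :+ v) refl b v))
  sumsb : (ι 2 * x + ι 2 * n + 1ℚ) * (s * b₁) ≡ i * b₁ + s
  sumsb = trans (solve 5 (λ x n i s b → (c 2 :* x :+ c 2 :* n :+ c 1) :* (s :* b) := (s :* (x :+ i)) :* b :+ s :* (b :* (x :+ c 1 :+ c 2 :* n :- i))) refl x n i s b₁)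
    (trans (cong₂ (λ p q → p * b₁ + s * q) es eb₁) (solve 3 (λ i b s → i :* b :+ s :* c 1 := i :* b :+ s) refl i b₁ s))

-- `W` is the certificate for `σ-shift`. Multiplied by `coef`, the left-hand side combines the
-- summands of `σ` for k + 1 and k, and the right-hand side becomes a difference in i of `coef` ·
-- `Q` · `W`.
wz : ∀ n k i → let open Ratio n k
                   W = λ j → (ι 8 * k + ι 11) * sq n + (ι 6 * k + ι 8) * n - (k + 1ℚ) * (ι 8 * k * k + ι 25 * k + ι 19)
                             - (ι 4 * k + ι 5) * (j * (ι 2 * n + 1ℚ - j)) in
  ι 2 * (ι 4 * k + ι 5) * (ι 4 * k + ι 7) * ((n - i) * sq ((n + k + 1ℚ - i) * (n - k - 1ℚ - i)))
  - ι 2 * (ι 2 * k + ι 2) * (ι 2 * k + ι 3) * sq (ι 2 * n + ι 2 * k + ι 3) * sq (n - k - 1ℚ) * (n - i)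
  ≡ P i * W (i + 1ℚ) - W i * Q i
wz = solve 3 (λ n k i → let W = λ j → (c 8 :* k :+ c 11) :* sq′ n :+ (c 6 :* k :+ c 8) :* n :- (k :+ c 1) :* (c 8 :* k :* k :+ c 25 :* k :+ c 19)
                                      :- (c 4 :* k :+ c 5) :* (j :* (c 2 :* n :+ c 1 :- j)) in
  c 2 :* (c 4 :* k :+ c 5) :* (c 4 :* k :+ c 7) :* ((n :- i) :* sq′ ((n :+ k :+ c 1 :- i) :* (n :- k :- c 1 :- i)))
  :- c 2 :* (c 2 :* k :+ c 2) :* (c 2 :* k :+ c 3) :* sq′ (c 2 :* n :+ c 2 :* k :+ c 3) :* sq′ (n :- k :- c 1) :* (n :- i)
  := P′ n k i :* W (i :+ c 1) :- W i :* Q′ n k i) refl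

-- Telescoping in the summation index

inv : ℚ → ℚ
inv q = 1ℚ /' q

inv-* : ∀ {q} → Unit q → inv q * q ≡ 1ℚ
inv-* = /'-* 1ℚ

unit-lin₃ : ∀ a b d k t i → Unit (1ℚ + (ι a * ι k + ι b * ι t + ι d * ι i))
unit-lin₃ a b d k t i = unit-resp (cong (λ z → 1ℚ + z) (trans (ℕ→ℚ-+ (a ℕ.* k ℕ.+ b ℕ.* t) (d ℕ.* i))
  (cong₂ _+_ (trans (ℕ→ℚ-+ (a ℕ.* k) (b ℕ.* t)) (cong₂ _+_ (ℕ→ℚ-* a k) (ℕ→ℚ-* b t))) (ℕ→ℚ-* d i)))) (unit-1+ (a ℕ.* k ℕ.+ b ℕ.* t ℕ.+ d ℕ.* i))

ι-split : ∀ {n} k i t → n ≡ suc (k ℕ.+ (i ℕ.+ t)) → ι n ≡ 1ℚ + (ι k + (ι i + ι t))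
ι-split k i t refl = trans (ℕ→ℚ-suc (k ℕ.+ (i ℕ.+ t))) (cong (λ z → 1ℚ + z) (trans (ℕ→ℚ-+ k (i ℕ.+ t)) (cong (λ z → ι k + z) (ℕ→ℚ-+ i t))))

telescope : ∀ (f g : ℕ → ℚ) m → (∀ i → i ℕ.< m → g (suc i) ≡ f i) → sumBelow (suc m) (λ i → f i - g i) ≡ f m - g 0
telescope f g zero    e = ℚP.+-identityˡ _
telescope f g (suc m) e = trans (cong₂ (λ p q → p + (f (suc m) - q)) (telescope f g m (λ i lt → e i (ℕP.m≤n⇒m≤1+n lt))) (e m ℕP.≤-refl))
  (solve 3 (λ a b d → (a :- b) :+ (d :- a) := d :- b) refl (f m) (g 0) (f (suc m)))

sum-add : ∀ m (f g : ℕ → ℚ) → sumBelow m (λ i → f i + g i) ≡ sumBelow m f + sumBelow m g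
sum-add zero    f g = refl
sum-add (suc m) f g = trans (cong (λ z → z + (f m + g m)) (sum-add m f g))
  (solve 4 (λ a b c d → (a :+ b) :+ (c :+ d) := (a :+ c) :+ (b :+ d)) refl (sumBelow m f) (sumBelow m g) (f m) (g m))

-- The factor free of x in the i-th summand of the formula, divided by its value at i = 0; see
-- `full-coef`.
coef : ℕ → ℕ → ℕ → ℚ
coef n k zero    = 1ℚ
coef n k (suc i) = (coef n k i * Ratio.P (ι n) (ι k) (ι i)) /' Ratio.Q (ι n) (ι k) (ι (suc i))

module Sums (n k r : ℕ) (n≡ : n ≡ suc (k ℕ.+ r)) where
  private
    N K : ℚ
    N = ι n
    K = ι k
  open Ratio N K

  N≡ : ∀ i t → i ℕ.+ t ≡ r → N ≡ 1ℚ + (K + (ι i + ι t))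
  N≡ i t e = ι-split k i t (trans n≡ (cong (λ z → suc (k ℕ.+ z)) (sym e)))

  <-split : ∀ {i} → i ℕ.< r → ∃ λ t → i ℕ.+ suc t ≡ r
  <-split {i} lt = r ℕ.∸ suc i , trans (ℕP.+-suc i _) (ℕP.m+[n∸m]≡n lt)

  unit-Q : ∀ i → i ℕ.< r → Unit (Q (ι (suc i)))
  unit-Q i lt with <-split lt
  ... | t , e = unit-* (unit-suc i) (unit-* (unit-* A A) B)
    where
    eN : N ≡ 1ℚ + (K + (ι i + (1ℚ + ι t)))
    eN = trans (N≡ i (suc t) e) (cong (λ z → 1ℚ + (K + (ι i + z))) (ℕ→ℚ-suc t))
    A : Unit (N + K - ι (suc i) + 1ℚ)
    A = unit-resp (trans (solve 3 (λ k t i → c 1 :+ (c 2 :* k :+ c 1 :* (c 1 :+ t) :+ c 0 :* i) := (c 1 :+ (k :+ (i :+ (c 1 :+ t)))) :+ k :- (c 1 :+ i) :+ c 1) refl K (ι t) (ι i))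
         (cong₂ (λ p q → p + K - q + 1ℚ) (sym eN) (sym (ℕ→ℚ-suc i)))) (unit-resp (cong (λ z → 1ℚ + (ι 2 * K + 1ℚ * z + 0ℚ * ι i)) (ℕ→ℚ-suc t)) (unit-lin₃ 2 1 0 k (suc t) i))
    B : Unit (ι 4 * N - ι 2 * ι (suc i) + 1ℚ)
    B = unit-resp (trans (solve 3 (λ k t i → c 1 :+ (c 4 :* k :+ c 2 :* (c 1 :+ (c 1 :+ (c 1 :+ (c 2 :* t)))) :+ c 2 :* i) := c 4 :* (c 1 :+ (k :+ (i :+ (c 1 :+ t)))) :- c 2 :* (c 1 :+ i) :+ c 1) refl K (ι t) (ι i))
         (cong₂ (λ p q → ι 4 * p - ι 2 * q + 1ℚ) (sym eN) (sym (ℕ→ℚ-suc i))))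
        (unit-resp (cong (λ z → 1ℚ + (ι 4 * K + ι 2 * z + ι 2 * ι i)) (trans (ℕ→ℚ-suc (suc (suc (2 ℕ.* t)))) (cong (λ z → 1ℚ + z) (trans (ℕ→ℚ-suc (suc (2 ℕ.* t))) (cong (λ z → 1ℚ + z) (trans (ℕ→ℚ-suc (2 ℕ.* t)) (cong (λ z → 1ℚ + z) (ℕ→ℚ-2* t))))))))
          (unit-lin₃ 4 2 2 k (suc (suc (suc (2 ℕ.* t)))) i))

  coef-step : ∀ i → i ℕ.< r → coef n k (suc i) * Q (ι (suc i)) ≡ coef n k i * P (ι i)
  coef-step i lt = /'-* _ (unit-Q i lt)

  N-r : N - K - ι r - 1ℚ ≡ 0ℚ
  N-r = trans (cong (λ z → z - K - ι r - 1ℚ) (N≡ r 0 (ℕP.+-identityʳ r))) (solve 2 (λ k r → (c 1 :+ (k :+ (r :+ c 0))) :- k :- r :- c 1 := c 0) refl K (ι r))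

  P-end : P (ι r) ≡ 0ℚ
  P-end = trans (cong (λ z → (ι 2 * ι r + 1ℚ) * (z * z) * (ι 2 * N - ι r)) N-r) (solve 2 (λ a b → a :* (c 0 :* c 0) :* b := c 0) refl (ι 2 * ι r + 1ℚ) (ι 2 * N - ι r))

  -- The sum, free of x, that appears as the inhomogeneity in the recurrence of `F`.
  σ : ℚ
  σ = sumBelow (suc r) (λ i → coef n k i * (N - ι i))

  -- The large bracket of the formula divided by (x+1)_{n-k-1} (x+n+k+1)_{n-k}; see `bracket`.
  κ : ℚ → ℕ → ℚ
  κ X i = 1ℚ - ι i * inv (X + ι i) - X * inv (X + ι 2 * N - ι i)

  F : ℚ → ℚ
  F X = sumBelow (suc r) (λ i → coef n k i * κ X i)

  unit-2n-i : ∀ x i → i ℕ.≤ r → Unit (ι x + ι 2 * N - ι i)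
  unit-2n-i x i le = unit-resp (trans (solve 4 (λ x k t i → c 1 :+ (c 1 :* (c 1 :+ x) :+ c 2 :* (k :+ t) :+ c 1 :* i) := x :+ c 2 :* (c 1 :+ (k :+ (i :+ t))) :- i) refl (ι x) K (ι t) (ι i)) (cong (λ z → ι x + ι 2 * z - ι i) (sym (N≡ i t e))))
      (unit-resp (cong₂ (λ p q → 1ℚ + (1ℚ * p + ι 2 * q + 1ℚ * ι i)) (ℕ→ℚ-suc x) (ℕ→ℚ-+ k t)) (unit-lin₃ 1 2 1 (suc x) (k ℕ.+ t) i))
    where
    t = r ℕ.∸ i
    e : i ℕ.+ t ≡ r
    e = ℕP.m+[n∸m]≡n le

  -- By `partial-fractions` the i-th summand of the difference of both sides is a difference in i.
  -- The boundary terms vanish: the lower one has the factor i, the upper one the factor n - k - 1 -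
  -- i of `P`.
  recurrence-F : ∀ x → let X = ι x in
    (X + 1ℚ) * (Q̂ (- X) * F X) + P (- X - 1ℚ) * F (X + 1ℚ) ≡ (X + 1ℚ) * (ι 2 * (ι 4 * K + ι 3) * (ι 2 * X + ι 2 * N + 1ℚ) * σ)
  recurrence-F x = trans (cong (λ z → (X + 1ℚ) * (Q̂ (- X) * F X) + P (- X - 1ℚ) * z) F-next)
    (trans (solve 5 (λ x q f p y → x :* (q :* f) :+ p :* (x :* y) := x :* (q :* f :+ p :* y)) refl (X + 1ℚ) (Q̂ (- X)) (F X) (P (- X - 1ℚ)) Σvb)
      (cong ((X + 1ℚ) *_) (trans (solve 2 (λ p q → p := (p :- q) :+ q) refl (Q̂ (- X) * F X + P (- X - 1ℚ) * Σvb) (Z * σ))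
        (trans (cong (_+ Z * σ) total) (ℚP.+-identityˡ _)))))
    where
    X = ι x
    Z = ι 2 * (ι 4 * K + ι 3) * (ι 2 * X + ι 2 * N + 1ℚ)
    L = ι 2 * X + ι 2 * N + 1ℚ
    cf = coef n k
    s v b b₁ : ℕ → ℚ
    s i = ι i * inv (X + ι i)
    v i = inv (X + 1ℚ + ι i)
    b i = inv (X + ι 2 * N - ι i)
    b₁ i = inv (X + 1ℚ + ι 2 * N - ι i)
    Σvb = sumBelow (suc r) (λ i → cf i * (v i - b₁ i))
    ev : ∀ i → v i * (X + 1ℚ + ι i) ≡ 1ℚ
    ev i = inv-* (unit-resp (trans (ℕ→ℚ-suc (x ℕ.+ i)) (trans (cong (λ z → 1ℚ + z) (ℕ→ℚ-+ x i)) (solve 2 (λ x i → c 1 :+ (x :+ i) := x :+ c 1 :+ i) refl X (ι i)))) (unit-suc (x ℕ.+ i)))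
    eb : ∀ i → i ℕ.≤ r → b i * (X + ι 2 * N - ι i) ≡ 1ℚ
    eb i le = inv-* (unit-2n-i x i le)
    eb₁ : ∀ i → i ℕ.≤ r → b₁ i * (X + 1ℚ + ι 2 * N - ι i) ≡ 1ℚ
    eb₁ i le = inv-* (unit-resp (cong (λ z → z + ι 2 * N - ι i) (trans (ℕ→ℚ-suc x) (ℚP.+-comm 1ℚ X))) (unit-2n-i (suc x) i le))
    es : ∀ i → s i * (X + ι i) ≡ ι i
    -- For x = 0 this contains the inverse of 0, but multiplied by i = 0.
    es zero    = solve 2 (λ y x → c 0 :* y :* x := c 0) refl (inv (X + 0ℚ)) (X + 0ℚ)
    es (suc i) = trans (ℚP.*-assoc (ι (suc i)) (inv (X + ι (suc i))) (X + ι (suc i))) (trans (cong (ι (suc i) *_) (inv-* (unit-resp (ℕ→ℚ-+ x (suc i)) (unit-resp (cong ι (sym (ℕP.+-suc x i))) (unit-suc (x ℕ.+ i)))))) (ℚP.*-identityʳ (ι (suc i))))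
    -- The factor X + 1 splits off, as 1 - i/(X+1+i) = (X+1)/(X+1+i).
    F-next : F (X + 1ℚ) ≡ (X + 1ℚ) * Σvb
    F-next = trans (sum-cong (suc r) (λ i _ → trans (cong (cf i *_) (trans
        (cong (λ z → z - ι i * v i - (X + 1ℚ) * b₁ i) (sym (ev i))) (solve 4 (λ x v i b → v :* (x :+ c 1 :+ i) :- i :* v :- (x :+ c 1) :* b := (x :+ c 1) :* (v :- b)) refl X (v i) (ι i) (b₁ i))))
        (solve 3 (λ f x y → f :* (x :* y) := x :* (f :* y)) refl (cf i) (X + 1ℚ) (v i - b₁ i))))
      (sum-scale (suc r) (X + 1ℚ) (λ i → cf i * (v i - b₁ i)))
    f g : ℕ → ℚ
    f i = cf i * P (ι i) * (v i * b i)
    g i = cf i * (s i * b₁ i * Q̂ (ι i))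
    match : ∀ i → i ℕ.< r → g (suc i) ≡ f i
    match i lt = trans (cong₂ (λ p q → cf (suc i) * (ι (suc i) * p * q * Q̂ (ι (suc i)))) (cong inv (trans (cong (λ z → X + z) (ℕ→ℚ-suc i)) (solve 2 (λ x i → x :+ (c 1 :+ i) := x :+ c 1 :+ i) refl X (ι i))))
           (cong inv (trans (cong (λ z → X + 1ℚ + ι 2 * N - z) (ℕ→ℚ-suc i)) (solve 3 (λ x n i → x :+ c 1 :+ c 2 :* n :- (c 1 :+ i) := x :+ c 2 :* n :- i) refl X N (ι i)))))
      (trans (solve 5 (λ cc i v b q → cc :* (i :* v :* b :* q) := cc :* (i :* q) :* (v :* b)) refl (cf (suc i)) (ι (suc i)) (v i) (b i) (Q̂ (ι (suc i))))
        (cong (_* (v i * b i)) (coef-step i lt)))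
    total : Q̂ (- X) * F X + P (- X - 1ℚ) * Σvb - Z * σ ≡ 0ℚ
    total = trans (cong₂ (λ p q → p + P (- X - 1ℚ) * Σvb - q) (sym (sum-scale (suc r) (Q̂ (- X)) (λ i → cf i * κ X i))) (sym (sum-scale (suc r) Z (λ i → cf i * (N - ι i)))))
      (trans (cong (λ q → sumBelow (suc r) (λ i → Q̂ (- X) * (cf i * κ X i)) + q - sumBelow (suc r) (λ i → Z * (cf i * (N - ι i)))) (sym (sum-scale (suc r) (P (- X - 1ℚ)) (λ i → cf i * (v i - b₁ i)))))
      (trans (cong (λ q → q - sumBelow (suc r) (λ i → Z * (cf i * (N - ι i)))) (sym (sum-add (suc r) (λ i → Q̂ (- X) * (cf i * κ X i)) (λ i → P (- X - 1ℚ) * (cf i * (v i - b₁ i))))))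
      (trans (sym (sum-sub (suc r) (λ i → Q̂ (- X) * (cf i * κ X i) + P (- X - 1ℚ) * (cf i * (v i - b₁ i))) (λ i → Z * (cf i * (N - ι i)))))
      (trans (sum-cong (suc r) {g = λ i → L * (f i - g i)} each)
      (trans (sum-scale (suc r) L (λ i → f i - g i))
      (trans (cong (L *_) (telescope f g r match))
      (trans (cong₂ (λ z w → L * (cf r * z * (v r * b r) - w)) P-end g-zero)
        (solve 3 (λ l cc w → l :* (cc :* c 0 :* w :- c 0) := c 0) refl L (cf r) (v r * b r)))))))))
      where
      g-zero : g 0 ≡ 0ℚ
      g-zero = solve 4 (λ a y z u → a :* (c 0 :* y :* z :* u) := c 0) refl (cf 0) (inv (X + ι 0)) (b₁ 0) (Q̂ (ι 0))
      each : ∀ i → i ℕ.< suc r → Q̂ (- X) * (cf i * κ X i) + P (- X - 1ℚ) * (cf i * (v i - b₁ i)) - Z * (cf i * (N - ι i)) ≡ L * (f i - g i)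
      each i (ℕ.s≤s le) = trans (solve 7 (λ q cc k p w z n → q :* (cc :* k) :+ p :* (cc :* w) :- z :* (cc :* n) := cc :* (q :* k :+ p :* w :- z :* n)) refl (Q̂ (- X)) (cf i) (κ X i) (P (- X - 1ℚ)) (v i - b₁ i) Z (N - ι i))
        (trans (cong (cf i *_) (partial-fractions N K X (ι i) (s i) (v i) (b i) (b₁ i) (es i) (ev i) (eb i le) (eb₁ i le)))
          (solve 5 (λ cc l p w y → cc :* (l :* (p :* w :- y)) := l :* (cc :* p :* w :- cc :* y)) refl (cf i) L (P (ι i)) (v i * b i) (s i * b₁ i * Q̂ (ι i))))

-- The evaluation of `σ`

module _ (n k r : ℕ) (n≡ : n ≡ suc (k ℕ.+ suc r)) where
  private
    n≡′ : n ≡ suc (suc k ℕ.+ r)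
    n≡′ = trans n≡ (cong suc (ℕP.+-suc k r))
    module S₀ = Sums n k (suc r) n≡
    module S₁ = Sums n (suc k) r n≡′
    N K C′ : ℚ
    N = ι n
    K = ι k
    C′ = sq ((N + K + 1ℚ) * (N - K - 1ℚ))

    move : ∀ N K i cf₀ cf₀′ cf₁ cf₁′ →
      cf₁′ * Ratio.Q N (1ℚ + K) (1ℚ + i) ≡ cf₁ * Ratio.P N (1ℚ + K) i →
      cf₀′ * Ratio.Q N K (1ℚ + i) ≡ cf₀ * Ratio.P N K i → ∀ C′ →
      cf₁ * C′ ≡ cf₀ * sq ((N + K + 1ℚ - i) * (N - K - 1ℚ - i)) →
      Ratio.Q N (1ℚ + K) (1ℚ + i) * (cf₁′ * C′) ≡ Ratio.Q N (1ℚ + K) (1ℚ + i) * (cf₀′ * sq ((N + K + 1ℚ - (1ℚ + i)) * (N - K - 1ℚ - (1ℚ + i))))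
    move N K i f f′ g g′ e₁ e₀ C′ e = trans (solve 3 (λ q x y → q :* (x :* y) := (x :* q) :* y) refl (Ratio.Q N (1ℚ + K) (1ℚ + i)) g′ C′)
      (trans (cong (_* C′) e₁)
      (trans (solve 3 (λ x y z → x :* y :* z := (x :* z) :* y) refl g (Ratio.P N (1ℚ + K) i) C′)
      (trans (cong (_* Ratio.P N (1ℚ + K) i) e)
      (trans (solve 4 (λ n k i f → (f :* sq′ ((n :+ k :+ c 1 :- i) :* (n :- k :- c 1 :- i))) :* ((c 2 :* i :+ c 1) :* sq′ (n :- (c 1 :+ k) :- i :- c 1) :* (c 2 :* n :- i))
                := f :* ((c 2 :* i :+ c 1) :* sq′ (n :- k :- i :- c 1) :* (c 2 :* n :- i)) :* (sq′ (n :+ k :+ c 1 :- i) :* sq′ (n :- k :- i :- c 2))) refl N K i f)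
      (trans (cong (_* (sq (N + K + 1ℚ - i) * sq (N - K - i - ι 2))) (sym e₀))
        (solve 4 (λ n k i f → f :* ((c 1 :+ i) :* (sq′ (n :+ k :- (c 1 :+ i) :+ c 1) :* (c 4 :* n :- c 2 :* (c 1 :+ i) :+ c 1))) :* (sq′ (n :+ k :+ c 1 :- i) :* sq′ (n :- k :- i :- c 2))
           := ((c 1 :+ i) :* (sq′ (n :+ (c 1 :+ k) :- (c 1 :+ i) :+ c 1) :* (c 4 :* n :- c 2 :* (c 1 :+ i) :+ c 1))) :* (f :* sq′ ((n :+ k :+ c 1 :- (c 1 :+ i)) :* (n :- k :- c 1 :- (c 1 :+ i))))) refl N K i f′))))))

  -- The coefficients for k + 1 and for k differ by the square of a polynomial in i; `C′` is its
  -- value at i = 0, where both coefficients are 1.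
  coef-shift : ∀ i → i ℕ.≤ r → coef n (suc k) i * C′ ≡ coef n k i * sq ((N + K + 1ℚ - ι i) * (N - K - 1ℚ - ι i))
  coef-shift zero    _  = solve 2 (λ n k → c 1 :* sq′ ((n :+ k :+ c 1) :* (n :- k :- c 1)) := c 1 :* sq′ ((n :+ k :+ c 1 :- c 0) :* (n :- k :- c 1 :- c 0))) refl N K
  coef-shift (suc i) le = unit-cancel (S₁.unit-Q i le)
    (subst₂ (λ κ j → Ratio.Q N κ j * (coef n (suc k) (suc i) * C′) ≡ Ratio.Q N κ j * (coef n k (suc i) * sq ((N + K + 1ℚ - j) * (N - K - 1ℚ - j)))) (sym (ℕ→ℚ-suc k)) (sym (ℕ→ℚ-suc i))
      (move N K (ι i) (coef n k i) (coef n k (suc i)) (coef n (suc k) i) (coef n (suc k) (suc i))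
        (subst₂ (λ κ j → coef n (suc k) (suc i) * Ratio.Q N κ j ≡ coef n (suc k) i * Ratio.P N κ (ι i)) (ℕ→ℚ-suc k) (ℕ→ℚ-suc i) (S₁.coef-step i le))
        (subst (λ j → coef n k (suc i) * Ratio.Q N K j ≡ coef n k i * Ratio.P N K (ι i)) (ℕ→ℚ-suc i) (S₀.coef-step i (ℕP.m≤n⇒m≤1+n le)))
        C′ (coef-shift i (ℕP.≤-trans (ℕP.n≤1+n i) le))))

  -- Creative telescoping in k, with the certificate from `wz`. The boundary terms vanish as in
  -- `recurrence-F`.
  σ-shift : (ι 4 * K + ι 5) * (ι 4 * K + ι 7) * (sq (N + K + 1ℚ) * S₁.σ)
            ≡ (ι 2 * K + ι 2) * (ι 2 * K + ι 3) * sq (ι 2 * N + ι 2 * K + ι 3) * S₀.σ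
  σ-shift = unit-cancel (unit-* (unit-suc 1) (unit-* unit-R unit-R))
    (trans (solve 4 (λ a d m s → (c 2 :* (m :* m)) :* (a :* (d :* d :* s)) := (c 2 :* a) :* (sq′ (d :* m) :* s)) refl A₀ (N + K + 1ℚ) (N - K - 1ℚ) S₁.σ)
    (trans (solve 2 (λ p q → p := (p :- q) :+ q) refl (ι 2 * A₀ * (C′ * S₁.σ)) (β * S₀.σ))
    (trans (cong (_+ β * S₀.σ) vanish)
      (solve 4 (λ a b m s → c 0 :+ (c 2 :* a :* b :* (m :* m)) :* s := (c 2 :* (m :* m)) :* (a :* b :* s)) refl B₀ E₀ (N - K - 1ℚ) S₀.σ))))
    where
    A₀ = (ι 4 * K + ι 5) * (ι 4 * K + ι 7)
    B₀ = (ι 2 * K + ι 2) * (ι 2 * K + ι 3)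
    E₀ = sq (ι 2 * N + ι 2 * K + ι 3)
    β = ι 2 * B₀ * E₀ * sq (N - K - 1ℚ)
    cf = coef n k
    W : ℚ → ℚ
    W j = (ι 8 * K + ι 11) * sq N + (ι 6 * K + ι 8) * N - (K + 1ℚ) * (ι 8 * K * K + ι 25 * K + ι 19) - (ι 4 * K + ι 5) * (j * (ι 2 * N + 1ℚ - j))
    R≡ : N - K - 1ℚ ≡ ι (suc r)
    R≡ = trans (cong (λ z → z - K - 1ℚ) (S₀.N≡ (suc r) 0 (cong suc (ℕP.+-identityʳ r)))) (solve 2 (λ k r → (c 1 :+ (k :+ (r :+ c 0))) :- k :- c 1 := r) refl K (ι (suc r)))
    unit-R : Unit (N - K - 1ℚ)
    unit-R = unit-resp (sym R≡) (unit-suc r)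
    w : ℕ → ℚ
    w i = (N - ι i) * sq ((N + K + 1ℚ - ι i) * (N - K - 1ℚ - ι i))
    shifted : sumBelow (suc (suc r)) (λ i → cf i * w i) ≡ C′ * S₁.σ
    shifted = trans (cong₂ _+_ (trans (sum-cong (suc r) (λ { i (ℕ.s≤s le) → trans (solve 3 (λ f n s → f :* (n :* s) := (f :* s) :* n) refl (cf i) (N - ι i) (sq ((N + K + 1ℚ - ι i) * (N - K - 1ℚ - ι i))))
          (trans (cong (_* (N - ι i)) (sym (coef-shift i le))) (solve 3 (λ f c n → f :* c :* n := c :* (f :* n)) refl (coef n (suc k) i) C′ (N - ι i))) })) (sum-scale (suc r) C′ (λ i → coef n (suc k) i * (N - ι i))))
        -- The sum for k + 1 is one term shorter; at i = n - k - 1 the square vanishes, so the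
        -- ranges can be identified.
        (trans (cong (λ z → cf (suc r) * ((N - ι (suc r)) * sq ((N + K + 1ℚ - ι (suc r)) * (z - ι (suc r))))) R≡)
          (solve 4 (λ f n a r → f :* (n :* sq′ (a :* (r :- r))) := c 0) refl (cf (suc r)) (N - ι (suc r)) (N + K + 1ℚ - ι (suc r)) (ι (suc r)))))
      (ℚP.+-identityʳ (C′ * S₁.σ))
    f g : ℕ → ℚ
    f i = cf i * Ratio.P N K (ι i) * W (ι i + 1ℚ)
    g i = cf i * Ratio.Q N K (ι i) * W (ι i)
    vanish : ι 2 * A₀ * (C′ * S₁.σ) - β * S₀.σ ≡ 0ℚ
    vanish = trans (cong₂ _-_ (trans (cong (ι 2 * A₀ *_) (sym shifted)) (sym (sum-scale (suc (suc r)) (ι 2 * A₀) (λ i → cf i * w i)))) (sym (sum-scale (suc (suc r)) β (λ i → cf i * (N - ι i)))))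
      (trans (sym (sum-sub (suc (suc r)) (λ i → ι 2 * A₀ * (cf i * w i)) (λ i → β * (cf i * (N - ι i)))))
      (trans (sum-cong (suc (suc r)) {g = λ i → f i - g i} (λ i _ → trans
          (solve 5 (λ a b cf w n → a :* (cf :* w) :- b :* (cf :* n) := cf :* (a :* w :- b :* n)) refl (ι 2 * A₀) β (cf i) (w i) (N - ι i))
          (trans (cong (cf i *_) (trans (cong (λ z → z * w i - β * (N - ι i)) (sym (ℚP.*-assoc (ι 2) (ι 4 * K + ι 5) (ι 4 * K + ι 7))))
              (trans (cong (λ z → ι 2 * (ι 4 * K + ι 5) * (ι 4 * K + ι 7) * w i - z * E₀ * sq (N - K - 1ℚ) * (N - ι i)) (sym (ℚP.*-assoc (ι 2) (ι 2 * K + ι 2) (ι 2 * K + ι 3)))) (wz N K (ι i)))))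
            (solve 5 (λ cf p u v q → cf :* (p :* u :- v :* q) := cf :* p :* u :- cf :* q :* v) refl (cf i) (Ratio.P N K (ι i)) (W (ι i + 1ℚ)) (W (ι i)) (Ratio.Q N K (ι i))))))
      (trans (telescope f g (suc r) (λ i lt → cong₂ _*_ (S₀.coef-step i lt) (cong W (trans (ℕ→ℚ-suc i) (ℚP.+-comm 1ℚ (ι i))))))
      (trans (cong (λ z → cf (suc r) * z * W (ι (suc r) + 1ℚ) - g 0) S₀.P-end)
        (trans (cong (λ z → cf (suc r) * 0ℚ * W (ι (suc r) + 1ℚ) - z) (solve 3 (λ f q w → f :* (c 0 :* q) :* w := c 0) refl (cf 0) (Ratio.Q̂ N K (ι 0)) (W (ι 0))))
          (solve 2 (λ f w → f :* c 0 :* w :- c 0 := c 0) refl (cf (suc r)) (W (ι (suc r) + 1ℚ))))))))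

h-double : ∀ k → let K = ι k in (ι 2 * K + ι 2) * h (suc (2 ℕ.* k)) ≡ ι 2 * (ι 4 * K + ι 3) * h (2 ℕ.* k)
                            × (ι 2 * K + ι 3) * h (2 ℕ.* suc k) ≡ ι 2 * (ι 4 * K + ι 5) * h (suc (2 ℕ.* k))
h-double k = (subst (λ w → (w + ι 2) * h (suc (2 ℕ.* k)) ≡ ι 2 * (ι 2 * w + ι 3) * h (2 ℕ.* k)) (ℕ→ℚ-2* k) (h-suc (2 ℕ.* k))
      ⟫ solve 2 (λ k x → c 2 :* (c 2 :* (c 2 :* k) :+ c 3) :* x := c 2 :* (c 4 :* k :+ c 3) :* x) refl K (h (2 ℕ.* k)))
  , (solve 2 (λ k x → (c 2 :* k :+ c 3) :* x := (c 1 :+ c 2 :* k :+ c 2) :* x) refl K (h (2 ℕ.* suc k))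
     ⟫ cong (λ z → (1ℚ + ι 2 * K + ι 2) * h z) (ℕP.*-suc 2 k)
     ⟫ subst (λ w → (w + ι 2) * h (suc (suc (2 ℕ.* k))) ≡ ι 2 * (ι 2 * w + ι 3) * h (suc (2 ℕ.* k))) (trans (ℕ→ℚ-suc (2 ℕ.* k)) (cong (λ z → 1ℚ + z) (ℕ→ℚ-2* k))) (h-suc (suc (2 ℕ.* k)))
     ⟫ solve 2 (λ k x → c 2 :* (c 2 :* (c 1 :+ c 2 :* k) :+ c 3) :* x := c 2 :* (c 4 :* k :+ c 5) :* x) refl K (h (suc (2 ℕ.* k))))
  where
  K = ι k
  infixr 1 _⟫_
  _⟫_ : {a b d : ℚ} → a ≡ b → b ≡ d → a ≡ d
  _⟫_ = trans

private
  closed-base : ∀ k N h₀ h₁ h₂ → N ≡ 1ℚ + k → (ι 2 * k + ι 2) * h₁ ≡ ι 2 * (ι 4 * k + ι 3) * h₀ → (ι 2 * k + ι 3) * h₂ ≡ ι 2 * (ι 4 * k + ι 5) * h₁ →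
    ι 2 * (ι 4 * k + ι 3) * (ι 2 * N + 1ℚ) * (h₀ * h₂) * (0ℚ + 1ℚ * (N - 0ℚ)) ≡ (ι 4 * N + 1ℚ) * sq ((N + k + 1ℚ) * h₁)
  closed-base k _ h₀ h₁ h₂ refl e₁ e₂ = trans
    (solve 4 (λ k a b d → c 2 :* (c 4 :* k :+ c 3) :* (c 2 :* (c 1 :+ k) :+ c 1) :* (a :* b) :* (c 0 :+ c 1 :* ((c 1 :+ k) :- c 0))
                     := (c 2 :* (c 4 :* k :+ c 3) :* a) :* ((c 2 :* k :+ c 3) :* b) :* (c 1 :+ k)) refl k h₀ h₂ h₁)
    (trans (cong₂ (λ p q → p * q * (1ℚ + k)) (sym e₁) e₂)
      (solve 2 (λ k x → ((c 2 :* k :+ c 2) :* x) :* (c 2 :* (c 4 :* k :+ c 5) :* x) :* (c 1 :+ k) := (c 4 :* (c 1 :+ k) :+ c 1) :* sq′ (((c 1 :+ k) :+ k :+ c 1) :* x)) refl k h₁))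

  closed-step : ∀ k N h₀ h₁ h₂ hₙ H₀ H₁ S₀ S₁ → let E = sq (ι 2 * N + ι 2 * k + ι 3) in
    (ι 2 * k + ι 2) * h₁ ≡ ι 2 * (ι 4 * k + ι 3) * h₀ → (ι 2 * k + ι 3) * h₂ ≡ ι 2 * (ι 4 * k + ι 5) * h₁ →
    (N + k + ι 2) * H₁ ≡ ι 2 * (ι 2 * (N + k) + ι 3) * H₀ →
    (ι 4 * k + ι 5) * (ι 4 * k + ι 7) * (sq (N + k + 1ℚ) * S₁) ≡ (ι 2 * k + ι 2) * (ι 2 * k + ι 3) * E * S₀ →
    ι 2 * (ι 4 * (1ℚ + k) + ι 3) * (ι 2 * N + 1ℚ) * (h₂ * hₙ) * S₁ ≡ (ι 4 * N + 1ℚ) * sq ((N + (1ℚ + k) + 1ℚ) * H₁) →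
    (ι 4 * (ι 4 * k + ι 5) * E) * (ι 2 * (ι 4 * k + ι 3) * (ι 2 * N + 1ℚ) * (h₀ * hₙ) * S₀)
    ≡ (ι 4 * (ι 4 * k + ι 5) * E) * ((ι 4 * N + 1ℚ) * sq ((N + k + 1ℚ) * H₀))
  closed-step k N h₀ h₁ h₂ hₙ H₀ H₁ S₀ S₁ e₁ e₂ eH eS ih = trans
    (solve 7 (λ b a₃ h E n hₙ s → (c 4 :* b :* E) :* (c 2 :* a₃ :* n :* (h :* hₙ) :* s) := c 4 :* b :* (c 2 :* a₃ :* h) :* (n :* hₙ :* (E :* s))) refl b a₃ h₀ E n hₙ S₀)
    (trans (cong (λ w → ι 4 * b * w * (n * hₙ * (E * S₀))) (sym e₁))
    (trans (solve 7 (λ b a₂ h E n hₙ s → c 4 :* b :* (a₂ :* h) :* (n :* hₙ :* (E :* s)) := c 2 :* (c 2 :* b :* h) :* (a₂ :* (n :* hₙ :* (E :* s)))) refl b a₂ h₁ E n hₙ S₀)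
    (trans (cong (λ w → ι 2 * w * (a₂ * (n * hₙ * (E * S₀)))) (sym e₂))
    (trans (solve 7 (λ a₃′ a₂ h E n hₙ s → c 2 :* (a₃′ :* h) :* (a₂ :* (n :* hₙ :* (E :* s))) := c 2 :* h :* n :* hₙ :* (a₂ :* a₃′ :* E :* s)) refl (ι 2 * k + ι 3) a₂ h₂ E n hₙ S₀)
    (trans (cong (ι 2 * h₂ * n * hₙ *_) (sym eS))
    (trans (solve 7 (λ k N b h n hₙ s → c 2 :* h :* n :* hₙ :* (b :* (c 4 :* k :+ c 7) :* (sq′ (N :+ k :+ c 1) :* s)) := b :* sq′ (N :+ k :+ c 1) :* (c 2 :* (c 4 :* (c 1 :+ k) :+ c 3) :* n :* (h :* hₙ) :* s)) refl k N b h₂ n hₙ S₁)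
    (trans (cong (b * sq (N + k + 1ℚ) *_) (trans ih (trans (cong (λ w → (ι 4 * N + 1ℚ) * sq w) (trans (cong (_* H₁) (solve 2 (λ N k → N :+ (c 1 :+ k) :+ c 1 := N :+ k :+ c 2) refl N k)) eH)) refl)))
      (solve 4 (λ k N b H → b :* sq′ (N :+ k :+ c 1) :* ((c 4 :* N :+ c 1) :* sq′ (c 2 :* (c 2 :* (N :+ k) :+ c 3) :* H)) := (c 4 :* b :* sq′ (c 2 :* N :+ c 2 :* k :+ c 3)) :* ((c 4 :* N :+ c 1) :* sq′ ((N :+ k :+ c 1) :* H))) refl k N b H₀))))))))
    where
    E = sq (ι 2 * N + ι 2 * k + ι 3)
    a₂ = ι 2 * k + ι 2
    a₃ = ι 4 * k + ι 3
    b = ι 4 * k + ι 5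
    n = ι 2 * N + 1ℚ

-- Induction on r = n - k - 1 with n fixed, which leads from k + 1 to k; for r = 0 there is a single
-- term. The form is dictated by the case x = 0 of `decrement`.
σ-closed : ∀ r n k (n≡ : n ≡ suc (k ℕ.+ r)) →
  ι 2 * (ι 4 * ι k + ι 3) * (ι 2 * ι n + 1ℚ) * (h (2 ℕ.* k) * h (2 ℕ.* n)) * Sums.σ n k r n≡
  ≡ (ι 4 * ι n + 1ℚ) * sq ((ι n + ι k + 1ℚ) * h (n ℕ.+ k))
σ-closed zero n k n≡ = subst₂ (λ a b → ι 2 * (ι 4 * ι k + ι 3) * (ι 2 * ι n + 1ℚ) * (h (2 ℕ.* k) * h a) * (0ℚ + 1ℚ * (ι n - 0ℚ)) ≡ (ι 4 * ι n + 1ℚ) * sq ((ι n + ι k + 1ℚ) * h b))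
  (cong (2 ℕ.*_) (sym n≡′)) (trans (cong (λ z → suc (k ℕ.+ z)) (ℕP.+-identityʳ k)) (cong (ℕ._+ k) (sym n≡′)))
  (closed-base (ι k) (ι n) (h (2 ℕ.* k)) (h (suc (2 ℕ.* k))) (h (2 ℕ.* suc k)) (trans (cong ι n≡′) (ℕ→ℚ-suc k)) (proj₁ (h-double k)) (proj₂ (h-double k)))
  where
  n≡′ : n ≡ suc k
  n≡′ = trans n≡ (cong suc (ℕP.+-identityʳ k))
σ-closed (suc r) n k n≡ = unit-cancel (unit-* (unit-* (unit-suc 3) (unit-resp (solve 2 (λ n k → c 0 :* n :+ c 4 :* k :+ c 5 := c 4 :* k :+ c 5) refl (ι n) (ι k)) (LU.unit-lin n 0 4 4 k)))
                                             (unit-* (LU.unit-lin n 2 2 2 k) (LU.unit-lin n 2 2 2 k)))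
  (closed-step (ι k) (ι n) (h (2 ℕ.* k)) (h (suc (2 ℕ.* k))) (h (2 ℕ.* suc k)) (h (2 ℕ.* n)) (h (n ℕ.+ k)) (h (n ℕ.+ suc k)) (Sums.σ n k (suc r) n≡) (Sums.σ n (suc k) r n≡′)
    (proj₁ (h-double k)) (proj₂ (h-double k)) (LU.h-step n k) (σ-shift n k r n≡)
    (subst (λ w → ι 2 * (ι 4 * w + ι 3) * (ι 2 * ι n + 1ℚ) * (h (2 ℕ.* suc k) * h (2 ℕ.* n)) * Sums.σ n (suc k) r n≡′ ≡ (ι 4 * ι n + 1ℚ) * sq ((ι n + w + 1ℚ) * h (n ℕ.+ suc k))) (ℕ→ℚ-suc k)
      (σ-closed r n (suc k) n≡′)))
  where
  n≡′ : n ≡ suc (suc k ℕ.+ r)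
  n≡′ = trans n≡ (cong suc (ℕP.+-suc k r))

-- Pochhammer symbols and normalising factors

poch-+ : ∀ α a b → poch α (a ℕ.+ b) ≡ poch α a * poch (α + ι a) b
poch-+ α a zero    = trans (cong (poch α) (ℕP.+-identityʳ a)) (sym (ℚP.*-identityʳ (poch α a)))
poch-+ α a (suc b) = trans (cong (poch α) (ℕP.+-suc a b)) (trans (cong₂ (λ p q → p * (α + q)) (poch-+ α a b) (ℕ→ℚ-+ a b))
  (solve 5 (λ p q α a b → p :* q :* (α :+ (a :+ b)) := p :* (q :* (α :+ a :+ b))) refl (poch α a) (poch (α + ι a) b) α (ι a) (ι b)))

poch-cons : ∀ α m → poch α (suc m) ≡ α * poch (α + 1ℚ) m
poch-cons α m = trans (poch-+ α 1 m) (cong (_* poch (α + 1ℚ) m) (solve 1 (λ α → c 1 :* (α :+ c 0) := α) refl α))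

poch-shift : ∀ α m → poch (α + 1ℚ) m * α ≡ poch α m * (α + ι m)
poch-shift α m = trans (ℚP.*-comm (poch (α + 1ℚ) m) α) (sym (poch-cons α m))

poch-unit : ∀ α m → (∀ j → j ℕ.< m → Unit (α + ι j)) → Unit (poch α m)
poch-unit α zero    u = unit-suc 0
poch-unit α (suc m) u = unit-* (poch-unit α m (λ j lt → u j (ℕP.m≤n⇒m≤1+n lt))) (u m ℕP.≤-refl)

poch-fact : ∀ m → poch 1ℚ m ≡ ι (m !)
poch-fact zero    = refl
poch-fact (suc m) = trans (cong (_* (1ℚ + ι m)) (poch-fact m)) (trans (ℚP.*-comm (ι (m !)) (1ℚ + ι m)) (sym (fact-suc m)))

module Ratios (n k r : ℕ) (n≡ : n ≡ suc (k ℕ.+ r)) where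
  open LU n hiding (r; K)
  open Sums n k r n≡ using (σ; F; N≡; recurrence-F)
  private
    N K R : ℚ
    N = ι n
    K = ι k
    R = ι r
    N≡R : N ≡ 1ℚ + (K + (R + 0ℚ))
    N≡R = N≡ r 0 (ℕP.+-identityʳ r)

  -- The quotient (2n + ½)_x / (½)_x, by which the product of the pivots differs from the product in
  -- the formula.
  ν : ℕ → ℚ
  ν zero    = 1ℚ
  ν (suc x) = (ν x * (ι 4 * N + ι 2 * ι x + 1ℚ)) /' (ι 2 * ι x + 1ℚ)

  -- The prefactor (n+k)! / (x+n-k)_{2k+1} times the Pochhammer symbols that `κ` has lost.
  φ : ℕ → ℚ
  φ x = (ι ((n ℕ.+ k) !) * poch (ι x + 1ℚ) r * poch (ι x + (N + K + 1ℚ)) (suc r)) /' poch (ι x + ι (suc r)) (2 ℕ.* k ℕ.+ 1)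

  unit-2x+1 : ∀ x → Unit (ι 2 * ι x + 1ℚ)
  unit-2x+1 x = unit-resp (trans (ℕ→ℚ-suc (2 ℕ.* x)) (trans (ℚP.+-comm 1ℚ (ι (2 ℕ.* x))) (cong (_+ 1ℚ) (ℕ→ℚ-2* x)))) (unit-suc (2 ℕ.* x))

  ν-suc : ∀ x → ν (suc x) * (ι 2 * ι x + 1ℚ) ≡ ν x * (ι 4 * N + ι 2 * ι x + 1ℚ)
  ν-suc x = /'-* _ (unit-2x+1 x)

  unit-den : ∀ x m → Unit (poch (ι x + ι (suc r)) m)
  unit-den x m = poch-unit (ι x + ι (suc r)) m (λ j _ → unit-resp (trans (ℕ→ℚ-+ (suc (x ℕ.+ r)) j) (cong (_+ ι j) (trans (cong ι (sym (ℕP.+-suc x r))) (ℕ→ℚ-+ x (suc r))))) (unit-suc (x ℕ.+ r ℕ.+ j)))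

  φ-* : ∀ x → φ x * poch (ι x + ι (suc r)) (2 ℕ.* k ℕ.+ 1) ≡ ι ((n ℕ.+ k) !) * poch (ι x + 1ℚ) r * poch (ι x + (N + K + 1ℚ)) (suc r)
  φ-* x = /'-* _ (unit-den x (2 ℕ.* k ℕ.+ 1))

  odd : ι (2 ℕ.* k ℕ.+ 1) ≡ ι 2 * K + 1ℚ
  odd = trans (ℕ→ℚ-+ (2 ℕ.* k) 1) (cong (_+ 1ℚ) (ℕ→ℚ-2* k))

  private
    φ-combine : ∀ f a a′ b b′ p p′ φ₀ φ₁ x+1 R₁ l T →
      φ₀ * p ≡ f * a * b → φ₁ * p′ ≡ f * a′ * b′ → a′ * x+1 ≡ a * R₁ → b′ * l ≡ b * T → p′ * R₁ ≡ p * l →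
      p′ * (φ₁ * (x+1 * sq l)) ≡ p′ * (φ₀ * (sq R₁ * T))
    φ-combine f a a′ b b′ p p′ φ₀ φ₁ y R₁ l T e₀ e₁ ea eb ep = trans (solve 4 (λ p φ y l → p :* (φ :* (y :* sq′ l)) := (φ :* p) :* (y :* sq′ l)) refl p′ φ₁ y l)
      (trans (cong (_* (y * sq l)) e₁)
      (trans (solve 5 (λ f a b y l → f :* a :* b :* (y :* sq′ l) := f :* (a :* y) :* (b :* l) :* l) refl f a′ b′ y l)
      (trans (cong₂ (λ u w → f * u * w * l) ea eb)
      (trans (solve 6 (λ f a R b T l → f :* (a :* R) :* (b :* T) :* l := (f :* a :* b) :* (R :* T :* l)) refl f a R₁ b T l)
      (trans (cong (_* (R₁ * T * l)) (sym e₀))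
      (trans (solve 5 (λ φ p R T l → φ :* p :* (R :* T :* l) := φ :* R :* T :* (p :* l)) refl φ₀ p R₁ T l)
      (trans (cong (φ₀ * R₁ * T *_) (sym ep))
        (solve 4 (λ φ R T p → φ :* R :* T :* (p :* R) := p :* (φ :* (sq′ R :* T))) refl φ₀ R₁ T p′))))))))

  φ-suc : ∀ x → let X = ι x in φ (suc x) * ((X + 1ℚ) * sq (X + (N + K + 1ℚ))) ≡ φ x * (sq (X + ι (suc r)) * (X + ι 2 * N + 1ℚ))
  φ-suc x = unit-cancel (unit-den (suc x) (2 ℕ.* k ℕ.+ 1))
    (φ-combine (ι ((n ℕ.+ k) !)) (poch (X + 1ℚ) r) (poch (ι (suc x) + 1ℚ) r) (poch (X + L) (suc r)) (poch (ι (suc x) + L) (suc r))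
      (poch (X + ι (suc r)) m) (poch (ι (suc x) + ι (suc r)) m) (φ x) (φ (suc x)) (X + 1ℚ) (X + ι (suc r)) (X + L) (X + ι 2 * N + 1ℚ)
      (φ-* x) (φ-* (suc x))
      (trans (cong (λ z → poch (z + 1ℚ) r * (X + 1ℚ)) suc-x) (trans (poch-shift (X + 1ℚ) r) (cong (poch (X + 1ℚ) r *_) (trans (solve 2 (λ x r → x :+ c 1 :+ r := x :+ (c 1 :+ r)) refl X R) (cong (λ z → X + z) (sym (ℕ→ℚ-suc r)))))))
      (trans (cong (λ z → poch z (suc r) * (X + L)) (next L)) (trans (poch-shift (X + L) (suc r)) (cong (poch (X + L) (suc r) *_)
        (trans (cong₂ (λ a b → X + (a + K + 1ℚ) + b) N≡R (ℕ→ℚ-suc r)) (trans (solve 3 (λ x k r → x :+ ((c 1 :+ (k :+ (r :+ c 0))) :+ k :+ c 1) :+ (c 1 :+ r) := x :+ c 2 :* (c 1 :+ (k :+ (r :+ c 0))) :+ c 1) refl X K R) (cong (λ z → X + ι 2 * z + 1ℚ) (sym N≡R)))))))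
      (trans (cong (λ z → poch z m * (X + ι (suc r))) (next (ι (suc r)))) (trans (poch-shift (X + ι (suc r)) m) (cong (poch (X + ι (suc r)) m *_)
        (trans (cong₂ (λ a b → X + a + b) (ℕ→ℚ-suc r) odd) (trans (solve 3 (λ x k r → x :+ (c 1 :+ r) :+ (c 2 :* k :+ c 1) := x :+ ((c 1 :+ (k :+ (r :+ c 0))) :+ k :+ c 1)) refl X K R) (cong (λ z → X + (z + K + 1ℚ)) (sym N≡R))))))))
    where
    X = ι x
    L = N + K + 1ℚ
    m = 2 ℕ.* k ℕ.+ 1
    suc-x : ι (suc x) ≡ X + 1ℚ
    suc-x = trans (ℕ→ℚ-suc x) (ℚP.+-comm 1ℚ X)
    next : ∀ a → ι (suc x) + a ≡ X + a + 1ℚ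
    next a = trans (cong (_+ a) suc-x) (solve 2 (λ x a → x :+ c 1 :+ a := x :+ a :+ c 1) refl X a)

  -- The coefficient of the formula's sum at i = 0.
  c₀ : ℚ
  c₀ = 1ℚ /' (ι (r !) * ι (r !) * poch (N + K + 1ℚ) (suc r))

  unit-L : ∀ m → Unit (poch (N + K + 1ℚ) m)
  unit-L m = poch-unit (N + K + 1ℚ) m (λ j _ → unit-resp (trans (cong (λ z → 1ℚ + z) (trans (ℕ→ℚ-+ (n ℕ.+ k) j) (cong (_+ ι j) (ℕ→ℚ-+ n k)))) (solve 3 (λ n k j → c 1 :+ (n :+ k :+ j) := n :+ k :+ c 1 :+ j) refl N K (ι j))) (unit-1+ (n ℕ.+ k ℕ.+ j)))

  c₀-* : c₀ * (ι (r !) * ι (r !) * poch (N + K + 1ℚ) (suc r)) ≡ 1ℚ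
  c₀-* = /'-* 1ℚ (unit-* (unit-* (unit-fact r) (unit-fact r)) (unit-L (suc r)))

  -- Amounts to (n+k)! = r! (r+1)_{2k+1}.
  c₀φ₀ : c₀ * φ 0 ≡ 1ℚ
  c₀φ₀ = unit-cancel (unit-* (unit-den 0 m) (unit-fact r))
    (trans (solve 4 (λ p f d φ → (p :* f) :* (d :* φ) := (φ :* p) :* (d :* f)) refl (poch (0ℚ + ι (suc r)) m) (ι (r !)) c₀ (φ 0))
    (trans (cong (_* (c₀ * ι (r !))) (trans (φ-* 0) (cong₂ (λ a b → ι ((n ℕ.+ k) !) * a * b) (trans (cong (λ z → poch z r) (ℚP.+-identityˡ 1ℚ)) (poch-fact r)) (cong (λ z → poch z (suc r)) (ℚP.+-identityˡ (N + K + 1ℚ))))))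
    (trans (solve 4 (λ F f b d → F :* f :* b :* (d :* f) := F :* (d :* (f :* f :* b))) refl (ι ((n ℕ.+ k) !)) (ι (r !)) (poch (N + K + 1ℚ) (suc r)) c₀)
    (trans (cong (ι ((n ℕ.+ k) !) *_) c₀-*)
    (trans (cong (_* 1ℚ) (trans (sym (poch-fact (n ℕ.+ k))) (trans (cong (poch 1ℚ) nk) (trans (poch-+ 1ℚ r m) (cong₂ _*_ (poch-fact r) (cong (λ z → poch z m) (trans (sym (ℕ→ℚ-suc r)) (sym (ℚP.+-identityˡ (ι (suc r)))))))))))
      (solve 2 (λ f p → f :* p :* c 1 := p :* f :* c 1) refl (ι (r !)) (poch (0ℚ + ι (suc r)) m)))))))
    where
    m = 2 ℕ.* k ℕ.+ 1
    nk : n ℕ.+ k ≡ r ℕ.+ m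
    nk = trans (cong (ℕ._+ k) n≡) (ℕS.solve 2 (λ k r → ℕS.con 1 ℕS.:+ (k ℕS.:+ r) ℕS.:+ k ℕS.:= r ℕS.:+ (ℕS.con 2 ℕS.:* k ℕS.:+ ℕS.con 1)) refl k r)

  -- Everything that multiplies `F` in the formula except for the product. At x = 0 it is h(2k) =
  -- C(4k+1, 2k), the matrix entry before any elimination.
  ψ : ℕ → ℚ
  ψ x = h (2 ℕ.* k) * (c₀ * φ x)

  ψ-suc : ∀ x → let X = ι x in ψ (suc x) * ((X + 1ℚ) * sq (X + (N + K + 1ℚ))) ≡ ψ x * (sq (X + ι (suc r)) * (X + ι 2 * N + 1ℚ))
  ψ-suc x = trans (solve 4 (λ h d φ w → h :* (d :* φ) :* w := h :* d :* (φ :* w)) refl (h (2 ℕ.* k)) c₀ (φ (suc x)) ((ι x + 1ℚ) * sq (ι x + (N + K + 1ℚ))))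
    (trans (cong (h (2 ℕ.* k) * c₀ *_) (φ-suc x)) (solve 4 (λ h d φ w → h :* d :* (φ :* w) := h :* (d :* φ) :* w) refl (h (2 ℕ.* k)) c₀ (φ x) (sq (ι x + ι (suc r)) * (ι x + ι 2 * N + 1ℚ))))

  e-suc : ∀ x → let X = ι x in
    e (suc x) * ((X + 1ℚ) * (ι 4 * N + ι 2 * X + ι 3) * (ι 2 * N + ι 2 * X + 1ℚ)) ≡ e x * ((ι 2 * N + ι 2 * X + ι 3) * (ι 2 * X + 1ℚ) * (ι 2 * N + X + 1ℚ))
  e-suc x = unit-cancel (unit-n+z+1 x)
    (trans (solve 4 (λ y E a b → y :* (E :* (a :* b)) := E :* a :* (b :* y)) refl Y (e (suc x)) ((X + 1ℚ) * (ι 4 * N + ι 2 * X + ι 3)) B)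
    (trans (cong (λ w → e (suc x) * w * (B * Y)) (sym (/'-* ((X + 1ℚ) * (ι 4 * N + ι 2 * X + ι 3)) (unit-gamDen (suc x)))))
    (trans (solve 4 (λ E g d l → E :* (g :* d) :* l := (E :* g) :* (d :* l)) refl (e (suc x)) (gam (suc x)) (gamDen (suc x)) (B * Y))
    (trans (cong (_* (gamDen (suc x) * (B * Y))) (e-gam x))
    (trans (solve 4 (λ E l d w → E :* l :* (d :* w) := E :* d :* (l :* w)) refl (e x) (lam x) (gamDen (suc x)) (B * Y))
    (trans (cong (e x * gamDen (suc x) *_) (/'-* ((ι 2 * X + 1ℚ) * (ι 2 * N + X + 1ℚ)) (unit-lamDen x)))
      (solve 5 (λ E y a p q → E :* (y :* a) :* (p :* q) := y :* (E :* (a :* p :* q))) refl (e x) Y (ι 2 * N + ι 2 * X + ι 3) (ι 2 * X + 1ℚ) (ι 2 * N + X + 1ℚ))))))))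
    where
    X = ι x
    Y = N + X + 1ℚ
    B = ι 2 * N + ι 2 * X + 1ℚ

  g-suc : ∀ x → g (suc x) k * (N + K + ι x + ι 2) ≡ g x k * (K - N - ι x)
  g-suc x = trans (ℚP.*-assoc (h (n ℕ.+ k)) (r′ (suc x)) (N + K + ι x + ι 2)) (trans (cong (h (n ℕ.+ k) *_) (r-suc x k)) (sym (ℚP.*-assoc (h (n ℕ.+ k)) (r′ x) (K - N - ι x))))
    where
    r′ : ℕ → ℚ
    r′ z = LU.r n z k

  private
    decrement-step : ∀ N K X R₁ S ψ₀ ψ₁ ν₀ ν₁ e₀ e₁ g₀ g₁ → N ≡ K + R₁ →
      ψ₁ * ((X + 1ℚ) * sq (X + (N + K + 1ℚ))) ≡ ψ₀ * (sq (X + R₁) * (X + ι 2 * N + 1ℚ)) →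
      ν₁ * (ι 2 * X + 1ℚ) ≡ ν₀ * (ι 4 * N + ι 2 * X + 1ℚ) →
      e₁ * ((X + 1ℚ) * (ι 4 * N + ι 2 * X + ι 3) * (ι 2 * N + ι 2 * X + 1ℚ)) ≡ e₀ * ((ι 2 * N + ι 2 * X + ι 3) * (ι 2 * X + 1ℚ) * (ι 2 * N + X + 1ℚ)) →
      g₁ * (N + K + X + ι 2) ≡ g₀ * (K - N - X) →
      S * ψ₀ * (ι 2 * X + ι 2 * N + 1ℚ) ≡ (ι 4 * N + ι 2 * X + 1ℚ) * sq (X + (N + K + 1ℚ)) * ν₀ * (e₀ * (g₀ * g₀)) →
      let D = (ι 2 * X + 1ℚ) * (X + 1ℚ) * sq (X + (N + K + 1ℚ)) * (ι 2 * N + ι 2 * X + 1ℚ) in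
      D * (S * ψ₁ * (ι 2 * (1ℚ + X) + ι 2 * N + 1ℚ)) ≡ D * ((ι 4 * N + ι 2 * (1ℚ + X) + 1ℚ) * sq ((1ℚ + X) + (N + K + 1ℚ)) * ν₁ * (e₁ * (g₁ * g₁)))
    decrement-step N K X R₁ S ψ₀ ψ₁ ν₀ ν₁ e₀ e₁ g₀ g₁ N≡ eψ eν ee eg ih = trans left-side (sym right-side)
      where
      o = ι 2 * X + 1ℚ
      y = X + 1ℚ
      l = X + (N + K + 1ℚ)
      B = ι 2 * N + ι 2 * X + 1ℚ
      B₃ = ι 2 * N + ι 2 * X + ι 3
      A = ι 4 * N + ι 2 * X + 1ℚ
      A₃ = ι 4 * N + ι 2 * X + ι 3
      T = ι 2 * N + X + 1ℚ
      common = o * B₃ * T * sq (X + R₁) * (A * sq l * ν₀ * (e₀ * (g₀ * g₀)))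
      left-side : o * y * sq l * B * (S * ψ₁ * (ι 2 * (1ℚ + X) + ι 2 * N + 1ℚ)) ≡ common
      left-side = trans (cong (λ w → o * y * sq l * B * (S * ψ₁ * w)) (solve 2 (λ x n → c 2 :* (c 1 :+ x) :+ c 2 :* n :+ c 1 := c 2 :* n :+ c 2 :* x :+ c 3) refl X N))
        (trans (solve 7 (λ o y l B S p w → o :* y :* l :* B :* (S :* p :* w) := o :* B :* w :* S :* (p :* (y :* l))) refl o y (sq l) B S ψ₁ B₃)
        (trans (cong (o * B * B₃ * S *_) eψ)
        (trans (cong (λ w → o * B * B₃ * S * (ψ₀ * (sq (X + R₁) * w))) (solve 2 (λ x n → x :+ c 2 :* n :+ c 1 := c 2 :* n :+ x :+ c 1) refl X N))
        (trans (cong (λ w → o * w * B₃ * S * (ψ₀ * (sq (X + R₁) * T))) (solve 2 (λ x n → c 2 :* n :+ c 2 :* x :+ c 1 := c 2 :* x :+ c 2 :* n :+ c 1) refl X N))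
        (trans (solve 7 (λ o B w S p q t → o :* B :* w :* S :* (p :* (q :* t)) := o :* w :* t :* q :* (S :* p :* B)) refl o (ι 2 * X + ι 2 * N + 1ℚ) B₃ S ψ₀ (sq (X + R₁)) T)
          (cong (o * B₃ * T * sq (X + R₁) *_) ih))))))
      right-side : o * y * sq l * B * ((ι 4 * N + ι 2 * (1ℚ + X) + 1ℚ) * sq ((1ℚ + X) + (N + K + 1ℚ)) * ν₁ * (e₁ * (g₁ * g₁))) ≡ common
      right-side = trans (cong₂ (λ a b → o * y * sq l * B * (a * sq b * ν₁ * (e₁ * (g₁ * g₁)))) (solve 2 (λ x n → c 4 :* n :+ c 2 :* (c 1 :+ x) :+ c 1 := c 4 :* n :+ c 2 :* x :+ c 3) refl X N)
              (solve 3 (λ x n k → (c 1 :+ x) :+ (n :+ k :+ c 1) := n :+ k :+ x :+ c 2) refl X N K))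
        (trans (solve 9 (λ o y l B a b v E g → o :* y :* l :* B :* (a :* (b :* b) :* v :* (E :* (g :* g))) := l :* (v :* o) :* (E :* (y :* a :* B)) :* sq′ (g :* b)) refl o y (sq l) B A₃ (N + K + X + ι 2) ν₁ e₁ g₁)
        (trans (cong₂ (λ p q → sq l * p * q * sq (g₁ * (N + K + X + ι 2))) eν ee)
        (trans (cong (λ p → sq l * (ν₀ * A) * (e₀ * (B₃ * o * T)) * sq p) (trans eg (cong (g₀ *_) (trans (cong (λ w → K - w - X) N≡) (solve 3 (λ k r x → k :- (k :+ r) :- x := :- (x :+ r)) refl K R₁ X)))))
          (solve 9 (λ l v A E B o T g q → l :* (v :* A) :* (E :* (B :* o :* T)) :* sq′ (g :* :- q) := o :* B :* T :* sq′ q :* (A :* l :* v :* (E :* (g :* g)))) refl (sq l) ν₀ A e₀ B₃ o T g₀ (X + R₁)))))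

  S : ℚ
  S = ι 2 * (ι 4 * K + ι 3) * σ

  -- Identifies the inhomogeneity of `recurrence-F` with the term that the elimination in step x
  -- subtracts from the Schur complement. Both sides are hypergeometric in x, so it suffices to
  -- compare their ratios and the case x = 0, which is `σ-closed`.
  decrement : ∀ x → let X = ι x in
    S * ψ x * (ι 2 * X + ι 2 * N + 1ℚ) ≡ (ι 4 * N + ι 2 * X + 1ℚ) * sq (X + (N + K + 1ℚ)) * ν x * (e x * (g x k * g x k))
  decrement zero = unit-cancel (h-unit (2 ℕ.* n))
    (trans (cong (λ w → h (2 ℕ.* n) * (S * (h (2 ℕ.* k) * w) * (ι 2 * 0ℚ + ι 2 * N + 1ℚ))) c₀φ₀)
    (trans (solve 5 (λ hn a s hk n → hn :* ((c 2 :* a :* s) :* (hk :* c 1) :* (c 2 :* c 0 :+ c 2 :* n :+ c 1)) := c 2 :* a :* (c 2 :* n :+ c 1) :* (hk :* hn) :* s) refl (h (2 ℕ.* n)) (ι 4 * K + ι 3) σ (h (2 ℕ.* k)) N)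
    (trans (σ-closed r n k n≡)
    (trans (solve 4 (λ n k H E → (c 4 :* n :+ c 1) :* sq′ ((n :+ k :+ c 1) :* H) := c 1 :* ((c 4 :* n :+ c 1) :* sq′ ((n :+ k :+ c 1) :* H))) refl N K (h (n ℕ.+ k)) (e 0))
    (trans (cong (_* ((ι 4 * N + 1ℚ) * sq ((N + K + 1ℚ) * h (n ℕ.+ k)))) (sym (/'-* 1ℚ (h-unit (2 ℕ.* n)))))
      (solve 5 (λ n k H E hn → (E :* hn) :* ((c 4 :* n :+ c 1) :* sq′ ((n :+ k :+ c 1) :* H)) := hn :* ((c 4 :* n :+ c 2 :* c 0 :+ c 1) :* sq′ (c 0 :+ (n :+ k :+ c 1)) :* c 1 :* (E :* ((H :* c 1) :* (H :* c 1))))) refl N K (h (n ℕ.+ k)) (e 0) (h (2 ℕ.* n))))))))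
  decrement (suc x) = unit-cancel (unit-* (unit-* (unit-* (unit-2x+1 x) (unit-resp (ℚP.+-comm 1ℚ (ι x)) (unit-1+ x))) (unit-* (unit-l x) (unit-l x))) (unit-lin 2 2 0 x))
    (subst (λ w → D * (S * ψ (suc x) * (ι 2 * w + ι 2 * N + 1ℚ)) ≡ D * ((ι 4 * N + ι 2 * w + 1ℚ) * sq (w + (N + K + 1ℚ)) * ν (suc x) * (e (suc x) * (g (suc x) k * g (suc x) k)))) (sym (ℕ→ℚ-suc x))
      (decrement-step N K (ι x) (ι (suc r)) S (ψ x) (ψ (suc x)) (ν x) (ν (suc x)) (e x) (e (suc x)) (g x k) (g (suc x) k)
        (trans N≡R (trans (solve 2 (λ k r → c 1 :+ (k :+ (r :+ c 0)) := k :+ (c 1 :+ r)) refl K R) (cong (λ z → K + z) (sym (ℕ→ℚ-suc r)))))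
        (ψ-suc x) (ν-suc x) (e-suc x) (g-suc x) (decrement x)))
    where
    D = (ι 2 * ι x + 1ℚ) * (ι x + 1ℚ) * sq (ι x + (N + K + 1ℚ)) * (ι 2 * N + ι 2 * ι x + 1ℚ)
    unit-l : ∀ x → Unit (ι x + (N + K + 1ℚ))
    unit-l x = unit-resp (trans (ℕ→ℚ-suc (n ℕ.+ k ℕ.+ x)) (trans (cong (λ z → 1ℚ + z) (trans (ℕ→ℚ-+ (n ℕ.+ k) x) (cong (_+ ι x) (ℕ→ℚ-+ n k)))) (solve 3 (λ n k x → c 1 :+ (n :+ k :+ x) := x :+ (n :+ k :+ c 1)) refl N K (ι x)))) (unit-suc (n ℕ.+ k ℕ.+ x))

-- The Schur complement and the sum

sum-first : ∀ m (f : ℕ → ℚ) → (∀ i → f (suc i) ≡ 0ℚ) → sumBelow (suc m) f ≡ f 0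
sum-first zero    f z = ℚP.+-identityˡ (f 0)
sum-first (suc m) f z = trans (cong₂ _+_ (sum-first m f z) (z m)) (ℚP.+-identityʳ (f 0))

ι-∸ : ∀ {a i} → i ℕ.≤ a → ι (a ∸ i) ≡ ι a - ι i
ι-∸ {a} {i} le = trans (solve 2 (λ x i → x := (i :+ x) :- i) refl (ι (a ∸ i)) (ι i)) (cong (_- ι i) (trans (sym (ℕ→ℚ-+ i (a ∸ i))) (cong ι (ℕP.m+[n∸m]≡n le))))

module Main (n k r : ℕ) (n≡ : n ≡ suc (k ℕ.+ r)) where
  open Ratios n k r n≡
  open Sums n k r n≡ using (σ; F; κ; N≡; recurrence-F; unit-2n-i; unit-Q; coef-step)
  private
    N K R : ℚ
    N = ι n
    K = ι k
    R = ι r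
    schur : ℕ → ℚ
    schur x = LU.K n x k k
    N≡R : N ≡ 1ℚ + (K + (R + 0ℚ))
    N≡R = N≡ r 0 (ℕP.+-identityʳ r)

    -- For i > 0 the term vanishes because i/(0 + i) = 1. For i = 0 the inverse of 0 occurs, but
    -- only with the factor 0.
    F₀ : F 0ℚ ≡ 1ℚ
    F₀ = trans (sum-first r (λ i → coef n k i * κ 0ℚ i) vanish)
      (solve 2 (λ a b → c 1 :* (c 1 :- c 0 :* a :- c 0 :* b) := c 1) refl (inv (0ℚ + ι 0)) (inv (0ℚ + ι 2 * N - ι 0)))
      where
      vanish : ∀ i → coef n k (suc i) * κ 0ℚ (suc i) ≡ 0ℚ
      vanish i = trans (cong (λ w → coef n k (suc i) * (1ℚ - w - 0ℚ * inv (0ℚ + ι 2 * N - ι (suc i))))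
          (trans (cong (λ w → ι (suc i) * inv w) (ℚP.+-identityˡ (ι (suc i)))) (trans (ℚP.*-comm (ι (suc i)) (inv (ι (suc i)))) (inv-* (unit-suc i)))))
        (solve 2 (λ f w → f :* (c 1 :- c 1 :- c 0 :* w) := c 0) refl (coef n k (suc i)) (inv (0ℚ + ι 2 * N - ι (suc i))))

    -- The recurrence coefficients P (-X-1) and Q̂ (-X) consist, up to sign, of the growth factors
    -- of `ψ` and `ν`. After normalisation the recurrence therefore only subtracts a term.
    schur-step : ∀ X R₁ σ ψ₀ ψ₁ ν₀ ν₁ F₀ F₁ E K₀ → N ≡ K + R₁ →
      ψ₁ * ((X + 1ℚ) * sq (X + (N + K + 1ℚ))) ≡ ψ₀ * (sq (X + R₁) * (X + ι 2 * N + 1ℚ)) →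
      ν₁ * (ι 2 * X + 1ℚ) ≡ ν₀ * (ι 4 * N + ι 2 * X + 1ℚ) →
      (X + 1ℚ) * (Ratio.Q̂ N K (- X) * F₀) + Ratio.P N K (- X - 1ℚ) * F₁ ≡ (X + 1ℚ) * (ι 2 * (ι 4 * K + ι 3) * (ι 2 * X + ι 2 * N + 1ℚ) * σ) →
      ι 2 * (ι 4 * K + ι 3) * σ * ψ₀ * (ι 2 * X + ι 2 * N + 1ℚ) ≡ (ι 4 * N + ι 2 * X + 1ℚ) * sq (X + (N + K + 1ℚ)) * ν₀ * E →
      ψ₀ * F₀ ≡ ν₀ * K₀ →
      let D = (ι 2 * X + 1ℚ) * ((X + 1ℚ) * sq (X + (N + K + 1ℚ))) in D * (ψ₁ * F₁) ≡ D * (ν₁ * (K₀ - E))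
    schur-step X R₁ σ ψ₀ ψ₁ ν₀ ν₁ F₀ F₁ E K₀ N≡ eψ eν rec dec ih =
      trans (solve 4 (λ o w p f → o :* w :* (p :* f) := o :* (p :* w) :* f) refl o (y * sq l) ψ₁ F₁)
      (trans (cong (λ w → o * w * F₁) eψ)
      (trans (solve 5 (λ o p q t f → o :* (p :* (q :* t)) :* f := :- (p :* ((:- o :* q :* t) :* f))) refl o ψ₀ (sq (X + R₁)) T F₁)
      (trans (cong (λ w → - (ψ₀ * (w * F₁))) (sym Pform))
      (trans (solve 4 (λ p a b w → :- (p :* b) := p :* a :- p :* (a :+ b)) refl ψ₀ (y * (Ratio.Q̂ N K (- X) * F₀)) (Ratio.P N K (- X - 1ℚ) * F₁) E)
      (trans (cong (λ w → ψ₀ * (y * (Ratio.Q̂ N K (- X) * F₀)) - ψ₀ * w) rec)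
      (trans (solve 7 (λ p y q f a b s → p :* (y :* (q :* f)) :- p :* (y :* (a :* b :* s)) := y :* (q :* (p :* f) :- a :* s :* p :* b)) refl ψ₀ y (Ratio.Q̂ N K (- X)) F₀ (ι 2 * (ι 4 * K + ι 3)) (ι 2 * X + ι 2 * N + 1ℚ) σ)
      (trans (cong₂ (λ u v → y * (u * v - ι 2 * (ι 4 * K + ι 3) * σ * ψ₀ * (ι 2 * X + ι 2 * N + 1ℚ))) Qform ih)
      (trans (cong (λ w → y * (sq l * A * (ν₀ * K₀) - w)) dec)
      (trans (solve 6 (λ y l A v k E → y :* (l :* A :* (v :* k) :- A :* l :* v :* E) := (v :* A) :* (y :* l) :* (k :- E)) refl y (sq l) A ν₀ K₀ E)
      (trans (cong (λ w → w * (y * sq l) * (K₀ - E)) (sym eν))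
        (solve 4 (λ v o w k → v :* o :* w :* k := o :* w :* (v :* k)) refl ν₁ o (y * sq l) (K₀ - E))))))))))))
      where
      o = ι 2 * X + 1ℚ
      y = X + 1ℚ
      l = X + (N + K + 1ℚ)
      A = ι 4 * N + ι 2 * X + 1ℚ
      T = X + ι 2 * N + 1ℚ
      Pform : Ratio.P N K (- X - 1ℚ) ≡ - o * sq (X + R₁) * T
      Pform = trans (solve 3 (λ n k x → (c 2 :* (:- x :- c 1) :+ c 1) :* sq′ (n :- k :- (:- x :- c 1) :- c 1) :* (c 2 :* n :- (:- x :- c 1)) := :- (c 2 :* x :+ c 1) :* sq′ (x :+ (n :- k)) :* (x :+ c 2 :* n :+ c 1)) refl N K X)
        (cong (λ w → - o * sq (X + w) * T) (trans (cong (_- K) N≡) (solve 2 (λ k r → k :+ r :- k := r) refl K R₁)))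
      Qform : Ratio.Q̂ N K (- X) ≡ sq l * A
      Qform = solve 3 (λ n k x → sq′ (n :+ k :- :- x :+ c 1) :* (c 4 :* n :- c 2 :* :- x :+ c 1) := sq′ (x :+ (n :+ k :+ c 1)) :* (c 4 :* n :+ c 2 :* x :+ c 1)) refl N K X

  schur-value : ∀ x → ψ x * F (ι x) ≡ ν x * schur x
  schur-value zero = trans (cong₂ (λ u v → h (2 ℕ.* k) * u * v) c₀φ₀ F₀)
    (trans (solve 1 (λ h → h :* c 1 :* c 1 := c 1 :* (h :- c 0)) refl (h (2 ℕ.* k))) (cong (λ w → 1ℚ * (h (k ℕ.+ w) - 0ℚ)) (ℕP.+-identityʳ k)))
  schur-value (suc x) = unit-cancel (unit-* (unit-2x+1 x) (unit-* (unit-resp (ℚP.+-comm 1ℚ (ι x)) (unit-1+ x)) (unit-* ul ul)))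
    (trans (cong (λ w → (ι 2 * ι x + 1ℚ) * ((ι x + 1ℚ) * sq (ι x + (N + K + 1ℚ))) * (ψ (suc x) * F w)) (trans (ℕ→ℚ-suc x) (ℚP.+-comm 1ℚ (ι x))))
    (trans (schur-step (ι x) (ι (suc r)) σ (ψ x) (ψ (suc x)) (ν x) (ν (suc x)) (F (ι x)) (F (ι x + 1ℚ)) (LU.e n x * (LU.g n x k * LU.g n x k)) (schur x)
        (trans N≡R (trans (solve 2 (λ k r → c 1 :+ (k :+ (r :+ c 0)) := k :+ (c 1 :+ r)) refl K R) (cong (λ z → K + z) (sym (ℕ→ℚ-suc r)))))
        (ψ-suc x) (ν-suc x) (recurrence-F x) (decrement x) (schur-value x))
      (cong (λ w → (ι 2 * ι x + 1ℚ) * ((ι x + 1ℚ) * sq (ι x + (N + K + 1ℚ))) * (ν (suc x) * w))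
        (solve 3 (λ h s e → (h :- s) :- e := h :- (s :+ e)) refl (h (k ℕ.+ k)) (sumBelow x (λ z → LU.e n z * (LU.g n z k * LU.g n z k))) (LU.e n x * (LU.g n x k * LU.g n x k))))))
    where
    ul : Unit (ι x + (N + K + 1ℚ))
    ul = unit-resp (trans (ℕ→ℚ-suc (n ℕ.+ k ℕ.+ x)) (trans (cong (λ z → 1ℚ + z) (trans (ℕ→ℚ-+ (n ℕ.+ k) x) (cong (_+ ι x) (ℕ→ℚ-+ n k)))) (solve 3 (λ n k x → c 1 :+ (n :+ k :+ x) := x :+ (n :+ k :+ c 1)) refl N K (ι x)))) (unit-suc (n ℕ.+ k ℕ.+ x))

  den full : ℕ → ℕ → ℚ
  den i t = ι (i !) * ι (t !) * ι (t !) * poch (N + K - ι i + 1ℚ) (suc r) * poch (N + K - ι i + 1ℚ) i * poch (ι 2 * N - ι i + ½) i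
  full i t = poch ½ i /' den i t

  private
    unit-A : ∀ i m → i ℕ.≤ n → Unit (poch (N + K - ι i + 1ℚ) m)
    unit-A i m le = poch-unit _ m (λ j _ → unit-resp
      (trans (cong (λ z → 1ℚ + z) (trans (ℕ→ℚ-+ (n ∸ i ℕ.+ k) j) (cong (_+ ι j) (trans (ℕ→ℚ-+ (n ∸ i) k) (cong (_+ K) (ι-∸ le)))))) (solve 4 (λ n i k j → c 1 :+ (n :- i :+ k :+ j) := n :+ k :- i :+ c 1 :+ j) refl N (ι i) K (ι j)))
      (unit-1+ (n ∸ i ℕ.+ k ℕ.+ j)))
    unit-half : ∀ i m → i ℕ.≤ n → Unit (poch (ι 2 * N - ι i + ½) m)
    unit-half i m le = poch-unit _ m (λ j _ → unit-factor {q = ι 2} (unit-resp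
      (trans (cong (λ z → 1ℚ + z) (trans (ℕ→ℚ-2* (n ∸ i ℕ.+ (n ℕ.+ j))) (cong (ι 2 *_) (trans (ℕ→ℚ-+ (n ∸ i) (n ℕ.+ j)) (cong₂ _+_ (ι-∸ le) (ℕ→ℚ-+ n j))))))
        (trans (cong (_+ ι 2 * (N - ι i + (N + ι j))) (refl {x = ½ * ι 2}))
          (solve 4 (λ n i j d → d :* c 2 :+ c 2 :* (n :- i :+ (n :+ j)) := (c 2 :* n :- i :+ d :+ j) :* c 2) refl N (ι i) (ι j) ½)))
      (unit-1+ (2 ℕ.* (n ∸ i ℕ.+ (n ℕ.+ j))))))
    i≤n : ∀ i t → i ℕ.+ t ≡ r → i ℕ.≤ n
    i≤n i t e = ℕP.≤-trans (ℕP.m+n≤o⇒m≤o i (ℕP.≤-reflexive e)) (ℕP.≤-trans (ℕP.m≤n+m r (suc k)) (ℕP.≤-reflexive (sym n≡)))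

    unit-den′ : ∀ i t → i ℕ.+ t ≡ r → Unit (den i t)
    unit-den′ i t e = unit-* (unit-* (unit-* (unit-* (unit-* (unit-fact i) (unit-fact t)) (unit-fact t)) (unit-A i (suc r) (i≤n i t e))) (unit-A i i (i≤n i t e))) (unit-half i i (i≤n i t e))

    -- `H` stands for ½, which the solver knows only through 2H = 1; `t` and `f` stand for
    -- factorials, the `p` for Pochhammer symbols.
    den-combine : ∀ N K I T R f t p₁ p₂ p₃ p₁′ H → ι 2 * H ≡ 1ℚ → N ≡ K + (I + (1ℚ + T)) + 1ℚ → R ≡ I + (1ℚ + T) →
      p₁′ * (N + K - I + (1ℚ + R)) ≡ (N + K - I) * p₁ →
      let A = N + K - I ; B = ι 2 * N - (1ℚ + I) + H in
      ((1ℚ + I) * f * t * t * p₁′ * (A * p₂) * (B * p₃)) * Ratio.P N K I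
      ≡ (f * ((1ℚ + T) * t) * ((1ℚ + T) * t) * p₁ * p₂ * p₃) * ((H + I) * Ratio.Q N K (1ℚ + I))
    den-combine N K I T R f t p₁ p₂ p₃ p₁′ H eH eN eR ep = trans
      (cong (((1ℚ + I) * f * t * t * p₁′ * (A * p₂) * (B * p₃)) *_) Pform)
      (trans (solve 10 (λ i f t q a p₂ B p₃ h w → (i :* f :* t :* t :* q :* (a :* p₂) :* (B :* p₃)) :* (h :* w) := (i :* f :* t :* t :* (a :* p₂) :* (B :* p₃)) :* h :* (q :* w)) refl (1ℚ + I) f t p₁′ A p₂ B p₃ (ι 2 * (H + I) * sq (1ℚ + T)) (N + K - I + (1ℚ + R)))
      (trans (cong (((1ℚ + I) * f * t * t * (A * p₂) * (B * p₃)) * (ι 2 * (H + I) * sq (1ℚ + T)) *_) ep)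
      (trans (solve 10 (λ i f t a p₂ B p₃ h T p₁ → (i :* f :* t :* t :* (a :* p₂) :* (B :* p₃)) :* (c 2 :* h :* sq′ T) :* (a :* p₁)
                 := (f :* (T :* t) :* (T :* t) :* p₁ :* p₂ :* p₃) :* (h :* (i :* (sq′ a :* (c 2 :* B))))) refl (1ℚ + I) f t A p₂ B p₃ (H + I) (1ℚ + T) p₁)
        (cong (λ w → (f * ((1ℚ + T) * t) * ((1ℚ + T) * t) * p₁ * p₂ * p₃) * ((H + I) * w)) Qform))))
      where
      A = N + K - I
      B = ι 2 * N - (1ℚ + I) + H
      Pform : Ratio.P N K I ≡ ι 2 * (H + I) * sq (1ℚ + T) * (N + K - I + (1ℚ + R))
      Pform = trans (cong₂ (λ u v → u * sq v * (ι 2 * N - I)) (trans (cong (λ w → ι 2 * I + w) (sym eH)) (solve 2 (λ i h → c 2 :* i :+ c 2 :* h := c 2 :* (h :+ i)) refl I H))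
                (trans (cong (λ w → w - K - I - 1ℚ) eN) (solve 3 (λ k i t → k :+ (i :+ (c 1 :+ t)) :+ c 1 :- k :- i :- c 1 := c 1 :+ t) refl K I T)))
              (cong (ι 2 * (H + I) * sq (1ℚ + T) *_) (trans (solve 2 (λ n i → c 2 :* n :- i := n :+ n :- i) refl N I) (trans (cong (λ w → N + w - I) (trans eN (cong (λ w → K + w + 1ℚ) (sym eR)))) (solve 4 (λ n k r i → n :+ (k :+ r :+ c 1) :- i := n :+ k :- i :+ (c 1 :+ r)) refl N K R I))))
      Qform : (1ℚ + I) * (sq A * (ι 2 * B)) ≡ Ratio.Q N K (1ℚ + I)
      Qform = trans (cong (λ w → (1ℚ + I) * (sq A * w)) (trans (solve 3 (λ n i h → c 2 :* (c 2 :* n :- (c 1 :+ i) :+ h) := c 4 :* n :- c 2 :* (c 1 :+ i) :+ c 2 :* h) refl N I H) (cong (λ w → ι 4 * N - ι 2 * (1ℚ + I) + w) eH)))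
        (solve 3 (λ n k i → (c 1 :+ i) :* (sq′ (n :+ k :- i) :* (c 4 :* n :- c 2 :* (c 1 :+ i) :+ c 1)) := (c 1 :+ i) :* (sq′ (n :+ k :- (c 1 :+ i) :+ c 1) :* (c 4 :* n :- c 2 :* (c 1 :+ i) :+ c 1))) refl N K I)

  -- Induction on i: passing from i to i + 1 changes one factor in each Pochhammer symbol and
  -- factorial, and two in the squared factorial, which gives the ratio `P` to `Q`.
  full-coef : ∀ i t → i ℕ.+ t ≡ r → full i t ≡ c₀ * coef n k i
  full-coef zero t refl = unit-cancel (unit-den′ 0 t refl)
    (trans (ℚP.*-comm (den 0 t) (full 0 t)) (trans (/'-* 1ℚ (unit-den′ 0 t refl)) (trans (sym c₀-*)
      (trans (cong (λ w → c₀ * (ι (t !) * ι (t !) * poch w (suc t))) (solve 2 (λ n k → n :+ k :+ c 1 := n :+ k :- c 0 :+ c 1) refl N K))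
        (solve 3 (λ d f p → d :* (f :* f :* p) := (c 1 :* f :* f :* p :* c 1 :* c 1) :* (d :* c 1)) refl c₀ (ι (t !)) (poch (N + K - ι 0 + 1ℚ) (suc t)))))))
  full-coef (suc i) t e = unit-cancel (unit-* (unit-den′ (suc i) t e) (unit-Q i i<r))
    (trans (solve 3 (λ d q x → d :* q :* x := (x :* d) :* q) refl (den (suc i) t) Qi (full (suc i) t))
    (trans (cong (_* Qi) (/'-* (poch ½ (suc i)) (unit-den′ (suc i) t e)))
    (trans (ℚP.*-assoc (poch ½ i) (½ + ι i) Qi)
    (trans (cong (_* ((½ + ι i) * Qi)) (sym (/'-* (poch ½ i) (unit-den′ i (suc t) e′))))
    (trans (ℚP.*-assoc (full i (suc t)) (den i (suc t)) ((½ + ι i) * Qi))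
    (trans (cong₂ _*_ (full-coef i (suc t) e′) (sym den-step))
    (trans (solve 4 (λ z f d p → z :* f :* (d :* p) := d :* (z :* (f :* p))) refl c₀ (coef n k i) (den (suc i) t) (Ratio.P N K (ι i)))
    (trans (cong (λ w → den (suc i) t * (c₀ * w)) (sym (coef-step i i<r)))
      (solve 4 (λ d z f q → d :* (z :* (f :* q)) := d :* q :* (z :* f)) refl (den (suc i) t) c₀ (coef n k (suc i)) Qi)))))))))
    where
    e′ : i ℕ.+ suc t ≡ r
    e′ = trans (ℕP.+-suc i t) e
    i<r : i ℕ.< r
    i<r = ℕP.m+n≤o⇒m≤o (suc i) (ℕP.≤-reflexive e)
    Qi = Ratio.Q N K (ι (suc i))
    I = ι i
    T = ι t
    A≡ : N + K - ι (suc i) + 1ℚ ≡ N + K - I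
    A≡ = trans (cong (λ w → N + K - w + 1ℚ) (ℕ→ℚ-suc i)) (solve 3 (λ n k i → n :+ k :- (c 1 :+ i) :+ c 1 := n :+ k :- i) refl N K I)
    den-step : den (suc i) t * Ratio.P N K I ≡ den i (suc t) * ((½ + I) * Qi)
    den-step = trans (cong (_* Ratio.P N K I) (trans
        (cong₂ (λ a b → a * ι (t !) * ι (t !) * poch (N + K - ι (suc i) + 1ℚ) (suc r) * b * poch (ι 2 * N - ι (suc i) + ½) (suc i)) (fact-suc i)
          (trans (poch-cons (N + K - ι (suc i) + 1ℚ) i) (cong₂ (λ u v → u * poch v i) A≡ (cong (_+ 1ℚ) A≡))))
        (cong (λ b → (1ℚ + I) * ι (i !) * ι (t !) * ι (t !) * poch (N + K - ι (suc i) + 1ℚ) (suc r) * ((N + K - I) * poch (N + K - I + 1ℚ) i) * b)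
          (trans (poch-cons (ι 2 * N - ι (suc i) + ½) i) (cong₂ (λ u v → u * poch v i) (cong (λ w → ι 2 * N - w + ½) (ℕ→ℚ-suc i)) B≡)))))
      (trans (den-combine N K I T R (ι (i !)) (ι (t !)) (poch (N + K - I + 1ℚ) (suc r)) (poch (N + K - I + 1ℚ) i) (poch (ι 2 * N - I + ½) i) (poch (N + K - ι (suc i) + 1ℚ) (suc r)) ½ refl
          eN eR shifted)
        (cong₂ (λ a b → (ι (i !) * a * a * poch (N + K - I + 1ℚ) (suc r) * poch (N + K - I + 1ℚ) i * poch (ι 2 * N - I + ½) i) * ((½ + I) * Ratio.Q N K b)) (sym (fact-suc t)) (sym (ℕ→ℚ-suc i))))
      where
      B≡ : ι 2 * N - ι (suc i) + ½ + 1ℚ ≡ ι 2 * N - I + ½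
      B≡ = trans (cong (λ w → ι 2 * N - w + ½ + 1ℚ) (ℕ→ℚ-suc i)) (solve 3 (λ n i h → c 2 :* n :- (c 1 :+ i) :+ h :+ c 1 := c 2 :* n :- i :+ h) refl N I ½)
      eR : R ≡ I + (1ℚ + T)
      eR = trans (cong ι (sym e′)) (trans (ℕ→ℚ-+ i (suc t)) (cong (λ w → I + w) (ℕ→ℚ-suc t)))
      eN : N ≡ K + (I + (1ℚ + T)) + 1ℚ
      eN = trans N≡R (trans (cong (λ w → 1ℚ + (K + (w + 0ℚ))) eR) (solve 3 (λ k i t → c 1 :+ (k :+ ((i :+ (c 1 :+ t)) :+ c 0)) := k :+ (i :+ (c 1 :+ t)) :+ c 1) refl K I T))
      shifted : poch (N + K - ι (suc i) + 1ℚ) (suc r) * (N + K - I + (1ℚ + R)) ≡ (N + K - I) * poch (N + K - I + 1ℚ) (suc r)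
      shifted = trans (cong (λ w → poch w (suc r) * (N + K - I + (1ℚ + R))) A≡) (trans (cong (λ w → poch (N + K - I) (suc r) * (N + K - I + w)) (sym (ℕ→ℚ-suc r))) (trans (sym (poch-shift (N + K - I) (suc r))) (ℚP.*-comm (poch (N + K - I + 1ℚ) (suc r)) (N + K - I))))

-- The product over s and the pivots

private
  -- Raising x by 1 raises the argument 2x + 2s of a Pochhammer symbol by 2: two consecutive factors
  -- leave and two enter.
  pair : ℚ → ℚ
  pair a = a * (a + 1ℚ)

  pair′ : ∀ {m} → Polynomial m → Polynomial m
  pair′ a = a :* (a :+ c 1)

module Product (n : ℕ) where
  open LU n using (e; g; pivot; pivots; h-step; r-shift; unit-lin)
  private
    N : ℚ
    N = ι n

  -- The factors that leave and enter `box` when x grows by 1; see `box-step`.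
  lower-box upper-box : ℕ → ℕ → ℚ
  lower-box x zero    = 1ℚ
  lower-box x (suc m) = lower-box x m * pair (ι 2 * ι x + ι 2 * ι (suc m))
  upper-box x zero    = 1ℚ
  upper-box x (suc m) = upper-box x m * pair (ι 2 * ι x + ι 4 * N - ι 2 * ι (suc m) + 1ℚ)

  box : ℕ → ℕ → ℚ
  box x m = prod1to m (λ s → poch (ι (2 ℕ.* x ℕ.+ 2 ℕ.* s)) (4 ℕ.* n ∸ 4 ℕ.* s ℕ.+ 1) /' poch (ι (2 ℕ.* s)) (4 ℕ.* n ∸ 4 ℕ.* s ℕ.+ 1))

  private
    unit-poch : ∀ s l → Unit (poch (ι (2 ℕ.* suc s)) l)
    unit-poch s l = poch-unit (ι (2 ℕ.* suc s)) l (λ j _ → unit-resp (ℕ→ℚ-+ (2 ℕ.* suc s) j) (unit-suc (s ℕ.+ 1 ℕ.* suc s ℕ.+ j)))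

    poch-shift₂ : ∀ α l → poch (α + ι 2) l * pair α ≡ poch α l * pair (α + ι l)
    poch-shift₂ α l = trans (cong (λ w → poch w l * pair α) (solve 1 (λ a → a :+ c 2 := a :+ c 1 :+ c 1) refl α))
      (trans (solve 2 (λ p a → p :* (a :* (a :+ c 1)) := (p :* (a :+ c 1)) :* a) refl (poch (α + 1ℚ + 1ℚ) l) α)
      (trans (cong (_* α) (poch-shift (α + 1ℚ) l))
      (trans (solve 3 (λ p l a → p :* l :* a := (p :* a) :* l) refl (poch (α + 1ℚ) l) (α + 1ℚ + ι l) α)
      (trans (cong (_* (α + 1ℚ + ι l)) (poch-shift α l))
        (solve 3 (λ p a l → p :* (a :+ l) :* (a :+ c 1 :+ l) := p :* pair′ (a :+ l)) refl (poch α l) α (ι l))))))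

  box-step : ∀ x m → m ℕ.≤ n → box (suc x) m * lower-box x m ≡ box x m * upper-box x m
  box-step x zero    _  = refl
  box-step x (suc m) le = trans (solve 4 (λ b f v p → b :* f :* (v :* p) := (b :* v) :* (f :* p)) refl (box (suc x) m) (A (suc x) /' B) (lower-box x m) (pair α))
    (trans (cong₂ _*_ (box-step x m (ℕP.≤-trans (ℕP.n≤1+n m) le)) factor)
      (solve 4 (λ b f v p → (b :* v) :* (f :* p) := b :* f :* (v :* p)) refl (box x m) (A x /' B) (upper-box x m) (pair (ι 2 * ι x + ι 4 * N - ι 2 * ι (suc m) + 1ℚ))))
    where
    l = 4 ℕ.* n ∸ 4 ℕ.* suc m ℕ.+ 1
    A : ℕ → ℚ
    A x = poch (ι (2 ℕ.* x ℕ.+ 2 ℕ.* suc m)) l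
    B = poch (ι (2 ℕ.* suc m)) l
    α = ι 2 * ι x + ι 2 * ι (suc m)
    α≡ : ∀ x → ι (2 ℕ.* x ℕ.+ 2 ℕ.* suc m) ≡ ι 2 * ι x + ι 2 * ι (suc m)
    α≡ x = trans (ℕ→ℚ-+ (2 ℕ.* x) (2 ℕ.* suc m)) (cong₂ _+_ (ℕ→ℚ-2* x) (ℕ→ℚ-2* (suc m)))
    α+l : α + ι l ≡ ι 2 * ι x + ι 4 * N - ι 2 * ι (suc m) + 1ℚ
    α+l = trans (cong (λ w → α + w) (trans (ℕ→ℚ-+ (4 ℕ.* n ∸ 4 ℕ.* suc m) 1) (cong (_+ 1ℚ) (trans (ι-∸ (ℕP.*-monoʳ-≤ 4 le)) (cong₂ _-_ (ℕ→ℚ-* 4 n) (ℕ→ℚ-* 4 (suc m)))))))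
      (solve 3 (λ x s n → (c 2 :* x :+ c 2 :* s) :+ (c 4 :* n :- c 4 :* s :+ c 1) := c 2 :* x :+ c 4 :* n :- c 2 :* s :+ c 1) refl (ι x) (ι (suc m)) N)
    factor : (A (suc x) /' B) * pair α ≡ (A x /' B) * pair (ι 2 * ι x + ι 4 * N - ι 2 * ι (suc m) + 1ℚ)
    factor = unit-cancel (unit-poch m l)
      (trans (solve 3 (λ b f p → b :* (f :* p) := (f :* b) :* p) refl B (A (suc x) /' B) (pair α))
      (trans (cong (_* pair α) (/'-* (A (suc x)) (unit-poch m l)))
      (trans (cong (λ w → poch w l * pair α) (trans (α≡ (suc x)) (trans (cong (λ w → ι 2 * w + ι 2 * ι (suc m)) (ℕ→ℚ-suc x)) (solve 2 (λ x s → c 2 :* (c 1 :+ x) :+ c 2 :* s := c 2 :* x :+ c 2 :* s :+ c 2) refl (ι x) (ι (suc m))))))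
      (trans (poch-shift₂ α l)
      (trans (cong₂ (λ u v → poch u l * pair v) (sym (α≡ x)) α+l)
      (trans (cong (_* pair (ι 2 * ι x + ι 4 * N - ι 2 * ι (suc m) + 1ℚ)) (sym (/'-* (A x) (unit-poch m l))))
        (solve 3 (λ b f p → (f :* b) :* p := b :* (f :* p)) refl B (A x /' B) (pair (ι 2 * ι x + ι 4 * N - ι 2 * ι (suc m) + 1ℚ)))))))))

  box-zero : ∀ m → box 0 m ≡ 1ℚ
  box-zero zero    = refl
  box-zero (suc m) = trans (cong₂ _*_ (box-zero m) (trans (sym (ℚP.*-identityʳ (B /' B))) (unit-cancel (unit-poch m l) (trans (solve 2 (λ b f → b :* (f :* c 1) := f :* b) refl B (B /' B)) (trans (/'-* B (unit-poch m l)) (sym (ℚP.*-identityʳ B))))))) refl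
    where
    l = 4 ℕ.* n ∸ 4 ℕ.* suc m ℕ.+ 1
    B = poch (ι (2 ℕ.* suc m)) l

  -- Raising x by 1 moves the factor for s to that for s - 1, so only the ends of the product
  -- change.
  upper-box-step : ∀ x m → upper-box (suc x) m * pair (ι 2 * ι x + ι 4 * N - ι 2 * ι m + 1ℚ) ≡ upper-box x m * pair (ι 2 * ι x + ι 4 * N + 1ℚ)
  upper-box-step x zero    = cong (λ w → 1ℚ * pair (w + 1ℚ)) (solve 2 (λ x n → c 2 :* x :+ c 4 :* n :- c 2 :* c 0 := c 2 :* x :+ c 4 :* n) refl (ι x) N)
  upper-box-step x (suc m) = trans (cong (λ w → upper-box (suc x) m * pair w * p₁) (trans (cong₂ (λ a b → ι 2 * a + ι 4 * N - ι 2 * b + 1ℚ) (ℕ→ℚ-suc x) (ℕ→ℚ-suc m))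
        (solve 3 (λ x n m → c 2 :* (c 1 :+ x) :+ c 4 :* n :- c 2 :* (c 1 :+ m) :+ c 1 := c 2 :* x :+ c 4 :* n :- c 2 :* m :+ c 1) refl (ι x) N (ι m))))
      (trans (cong (_* p₁) (upper-box-step x m)) (solve 3 (λ a b d → a :* b :* d := a :* d :* b) refl (upper-box x m) (pair (ι 2 * ι x + ι 4 * N + 1ℚ)) p₁))
    where p₁ = pair (ι 2 * ι x + ι 4 * N - ι 2 * ι (suc m) + 1ℚ)

  lower-box-step : ∀ x m → lower-box (suc x) m * pair (ι 2 * ι x + ι 2) ≡ lower-box x m * pair (ι 2 * ι x + ι 2 * ι m + ι 2)
  lower-box-step x zero    = cong (λ w → 1ℚ * pair w) (solve 1 (λ x → c 2 :* x :+ c 2 := c 2 :* x :+ c 2 :* c 0 :+ c 2) refl (ι x))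
  lower-box-step x (suc m) = trans (solve 3 (λ a b d → a :* b :* d := a :* d :* b) refl (lower-box (suc x) m) (pair (ι 2 * ι (suc x) + ι 2 * ι (suc m))) (pair (ι 2 * ι x + ι 2)))
    (trans (cong₂ (λ u v → u * pair v) (lower-box-step x m) (trans (cong (λ a → ι 2 * a + ι 2 * ι (suc m)) (ℕ→ℚ-suc x)) (solve 2 (λ x m → c 2 :* (c 1 :+ x) :+ c 2 :* m := c 2 :* x :+ c 2 :* m :+ c 2) refl (ι x) (ι (suc m)))))
      (cong (λ w → lower-box x m * pair w * pair (ι 2 * ι x + ι 2 * ι (suc m) + ι 2)) (trans (solve 2 (λ x m → c 2 :* x :+ c 2 :* m :+ c 2 := c 2 :* x :+ c 2 :* (c 1 :+ m)) refl (ι x) (ι m)) (cong (λ a → ι 2 * ι x + ι 2 * a) (sym (ℕ→ℚ-suc m))))))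

  lower-box-zero : ∀ m → lower-box 0 m ≡ ι (suc (2 ℕ.* m) !)
  lower-box-zero zero    = refl
  lower-box-zero (suc m) = trans (cong₂ (λ a b → a * pair (ι 2 * 0ℚ + ι 2 * b)) (lower-box-zero m) (ℕ→ℚ-suc m))
    (trans (solve 2 (λ f m → f :* pair′ (c 2 :* c 0 :+ c 2 :* (c 1 :+ m)) := (c 1 :+ (c 2 :+ c 2 :* m)) :* ((c 1 :+ (c 1 :+ c 2 :* m)) :* f)) refl (ι (suc (2 ℕ.* m) !)) (ι m))
    (trans (cong₂ (λ a b → (1ℚ + a) * ((1ℚ + b) * ι (suc (2 ℕ.* m) !))) (sym (trans (ℕ→ℚ-+ 2 (2 ℕ.* m)) (cong (λ w → ι 2 + w) (ℕ→ℚ-2* m)))) (sym (trans (ℕ→ℚ-suc (2 ℕ.* m)) (cong (λ w → 1ℚ + w) (ℕ→ℚ-2* m)))))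
    (trans (cong ((1ℚ + ι (suc (suc (2 ℕ.* m)))) *_) (sym (fact-suc (suc (2 ℕ.* m)))))
    (trans (sym (fact-suc (suc (suc (2 ℕ.* m))))) (cong (λ w → ι (suc w !)) (sym (ℕP.*-suc 2 m)))))))

  upper-box-zero : ∀ m j → j ℕ.+ 2 ℕ.* m ≡ 4 ℕ.* n → upper-box 0 m * ι (j !) ≡ ι ((4 ℕ.* n) !)
  upper-box-zero zero    j e = trans (ℚP.*-identityˡ (ι (j !))) (cong (λ w → ι (w !)) (trans (sym (ℕP.+-identityʳ j)) e))
  upper-box-zero (suc m) j e = trans (cong (λ w → upper-box 0 m * pair w * ι (j !)) w≡)
    (trans (solve 3 (λ u j f → u :* pair′ (c 1 :+ j) :* f := u :* ((c 1 :+ (c 1 :+ j)) :* ((c 1 :+ j) :* f))) refl (upper-box 0 m) (ι j) (ι (j !)))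
    (trans (cong (upper-box 0 m *_) (trans (cong₂ (λ a b → (1ℚ + a) * b) (sym (ℕ→ℚ-suc j)) (sym (fact-suc j))) (sym (fact-suc (suc j)))))
      (upper-box-zero m (suc (suc j)) (trans (cong suc (sym (ℕP.+-suc j (2 ℕ.* m)))) (trans (sym (ℕP.+-suc j (suc (2 ℕ.* m)))) (trans (cong (j ℕ.+_) (sym (ℕP.*-suc 2 m))) e))))))
    where
    w≡ : ι 2 * 0ℚ + ι 4 * N - ι 2 * ι (suc m) + 1ℚ ≡ 1ℚ + ι j
    w≡ = trans (cong₂ (λ a b → ι 2 * 0ℚ + a - b + 1ℚ) (trans (sym (ℕ→ℚ-* 4 n)) (trans (cong ι (sym e)) (ℕ→ℚ-+ j (2 ℕ.* suc m)))) (sym (ℕ→ℚ-2* (suc m))))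
      (solve 2 (λ j w → c 2 :* c 0 :+ (j :+ w) :- w :+ c 1 := c 1 :+ j) refl (ι j) (ι (2 ℕ.* suc m)))

  -- The first pivot is h(2n) = (4n+1)! / ((2n)! (2n+1)!), while the two boxes are (2n+1)! and (4n)!
  -- / (2n)!.
  pivot-zero : pivot 0 * lower-box 0 n ≡ upper-box 0 n * (ι 4 * N + 1ℚ)
  pivot-zero = unit-cancel (unit-fact (2 ℕ.* n))
    (trans (solve 4 (λ f E H l → f :* (E :* ((H :* c 1) :* (H :* c 1)) :* l) := (E :* H) :* (H :* (f :* l))) refl (ι ((2 ℕ.* n) !)) (e 0) (h (n ℕ.+ (n ℕ.+ 0))) (lower-box 0 n))
    (trans (cong₂ (λ a b → a * (h (2 ℕ.* n) * (ι ((2 ℕ.* n) !) * b))) (/'-* 1ℚ (h-unit (2 ℕ.* n))) (lower-box-zero n))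
    (trans (cong (1ℚ *_) (trans (h-factorial (2 ℕ.* n)) (trans (fact-suc (2 ℕ.* (2 ℕ.* n))) (cong (λ w → (1ℚ + ι w) * ι (w !)) (sym (ℕP.*-assoc 2 2 n))))))
    (trans (cong₂ (λ a b → 1ℚ * ((1ℚ + a) * b)) (ℕ→ℚ-* 4 n) (sym (upper-box-zero n (2 ℕ.* n) (trans (sym (ℕP.*-distribʳ-+ n 2 2)) refl))))
      (solve 3 (λ n u f → c 1 :* ((c 1 :+ c 4 :* n) :* (u :* f)) := f :* (u :* (c 4 :* n :+ c 1))) refl N (upper-box 0 n) (ι ((2 ℕ.* n) !)))))))

-- The right-hand side of the formula

module Evaluation (n k r : ℕ) (n≡ : n ≡ suc (k ℕ.+ r)) where
  open LU n using (e; g; pivot; pivots; h-step; r-shift; unit-lin)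
  open Ratios n k r n≡
  open Sums n k r n≡ using (F; κ; N≡; unit-2n-i)
  open Product n
  open Main n k r n≡
  private
    N K : ℚ
    N = ι n
    K = ι k

    unit-x+1 : ∀ x → Unit (ι x + 1ℚ)
    unit-x+1 x = unit-resp (ℚP.+-comm 1ℚ (ι x)) (unit-1+ x)

    g-diagonal : ∀ x → let X = ι x in
      g (suc x) (n ℕ.+ suc x) * pair (ι 2 * N + ι 2 * X + ι 2) ≡ ι 2 * (ι 4 * N + ι 2 * X + ι 3) * (X + 1ℚ) * g x (n ℕ.+ x)
    g-diagonal x = trans (cong (λ b → h (n ℕ.+ b) * LU.r n (suc x) b * pair (ι 2 * N + ι 2 * X + ι 2)) (ℕP.+-suc n x))
      (trans (solve 5 (λ H r a b _ → H :* r :* pair′ (c 2 :* a :+ c 2 :* b :+ c 2) := H :* (r :* ((a :+ (a :+ b) :+ b :+ c 2) :* (a :+ (a :+ b) :+ b :+ c 3)))) refl H′ (LU.r n (suc x) (suc (n ℕ.+ x))) N X X)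
      (trans (cong (H′ *_) (subst (λ w → LU.r n (suc x) (suc (n ℕ.+ x)) * ((N + w + X + ι 2) * (N + w + X + ι 3)) ≡ LU.r n x (n ℕ.+ x) * ((w + 1ℚ - N) * (N + w + ι 2))) (ℕ→ℚ-+ n x) (r-shift x (n ℕ.+ x))))
      (trans (solve 4 (λ H r a b → H :* (r :* ((a :+ b :+ c 1 :- a) :* (a :+ (a :+ b) :+ c 2))) := r :* (b :+ c 1) :* ((a :+ (a :+ b) :+ c 2) :* H)) refl H′ (LU.r n x (n ℕ.+ x)) N X)
      (trans (cong (LU.r n x (n ℕ.+ x) * (X + 1ℚ) *_) (subst (λ w → (N + w + ι 2) * H′ ≡ ι 2 * (ι 2 * (N + w) + ι 3) * h (n ℕ.+ (n ℕ.+ x))) (ℕ→ℚ-+ n x) (h-step (n ℕ.+ x))))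
        (solve 4 (λ H r a b → r :* (b :+ c 1) :* (c 2 :* (c 2 :* (a :+ (a :+ b)) :+ c 3) :* H) := c 2 :* (c 4 :* a :+ c 2 :* b :+ c 3) :* (b :+ c 1) :* (H :* r)) refl (h (n ℕ.+ (n ℕ.+ x))) (LU.r n x (n ℕ.+ x)) N X)))))
      where
      X = ι x
      H′ = h (n ℕ.+ suc (n ℕ.+ x))

    ratio-step : ∀ N X e₀ e₁ g₀ g₁ l₀ l₁ u₀ u₁ →
      e₁ * ((X + 1ℚ) * (ι 4 * N + ι 2 * X + ι 3) * (ι 2 * N + ι 2 * X + 1ℚ)) ≡ e₀ * ((ι 2 * N + ι 2 * X + ι 3) * (ι 2 * X + 1ℚ) * (ι 2 * N + X + 1ℚ)) →
      g₁ * pair (ι 2 * N + ι 2 * X + ι 2) ≡ ι 2 * (ι 4 * N + ι 2 * X + ι 3) * (X + 1ℚ) * g₀ →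
      u₁ * pair (ι 2 * X + ι 4 * N - ι 2 * N + 1ℚ) ≡ u₀ * pair (ι 2 * X + ι 4 * N + 1ℚ) →
      l₁ * pair (ι 2 * X + ι 2) ≡ l₀ * pair (ι 2 * X + ι 2 * N + ι 2) →
      e₀ * (g₀ * g₀) * (ι 2 * X + 1ℚ) * l₀ ≡ u₀ * (ι 4 * N + ι 2 * X + 1ℚ) →
      let a = ι 2 * N + ι 2 * X + ι 2 ; D = ((X + 1ℚ) * (ι 4 * N + ι 2 * X + ι 3) * (ι 2 * N + ι 2 * X + 1ℚ)) * (pair a * pair a) * (ι 2 * X + ι 2) in
      D * (e₁ * (g₁ * g₁) * (ι 2 * (1ℚ + X) + 1ℚ) * l₁) ≡ D * (u₁ * (ι 4 * N + ι 2 * (1ℚ + X) + 1ℚ))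
    ratio-step N X e₀ e₁ g₀ g₁ l₀ l₁ u₀ u₁ ee eg eu el ih =
      trans (cong (λ w → (y * A₃ * B) * (pair a * pair a) * x₂ * (e₁ * (g₁ * g₁) * w * l₁)) (solve 1 (λ x → c 2 :* (c 1 :+ x) :+ c 1 := c 2 :* x :+ c 2 :+ c 1) refl X))
      (trans (solve 6 (λ t p x E G l → t :* (p :* p) :* x :* (E :* (G :* G) :* (x :+ c 1) :* l) := (E :* t) :* ((G :* p) :* (G :* p)) :* (l :* pair′ x)) refl (y * A₃ * B) (pair a) x₂ e₁ g₁ l₁)
      (trans (cong₂ (λ p q → p * (q * q) * (l₁ * pair x₂)) ee eg)
      (trans (cong (e₀ * (B₃ * o * T) * ((ι 2 * A₃ * y * g₀) * (ι 2 * A₃ * y * g₀)) *_) el)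
      (trans (solve 9 (λ E b o t A y G l p → E :* (b :* o :* t) :* ((c 2 :* A :* y :* G) :* (c 2 :* A :* y :* G)) :* (l :* p) := (E :* (G :* G) :* o :* l) :* (c 4 :* b :* t :* (A :* A) :* (y :* y) :* p)) refl e₀ B₃ o T A₃ y g₀ l₀ (pair (ι 2 * X + ι 2 * N + ι 2)))
      (trans (cong (_* (ι 4 * B₃ * T * (A₃ * A₃) * (y * y) * pair (ι 2 * X + ι 2 * N + ι 2))) ih)
      (trans (solve 4 (λ N X u A → (u :* (c 4 :* N :+ c 2 :* X :+ c 1)) :* (c 4 :* (c 2 :* N :+ c 2 :* X :+ c 3) :* (c 2 :* N :+ X :+ c 1) :* (A :* A) :* ((X :+ c 1) :* (X :+ c 1)) :* pair′ (c 2 :* X :+ c 2 :* N :+ c 2))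
                 := (u :* pair′ (c 2 :* X :+ c 4 :* N :+ c 1)) :* (c 2 :* (X :+ c 1) :* (X :+ c 1) :* (A :* A) :* pair′ (c 2 :* N :+ c 2 :* X :+ c 2) :* (c 2 :* N :+ c 2 :* X :+ c 3))) refl N X u₀ A₃)
      (trans (cong (_* (ι 2 * y * y * (A₃ * A₃) * pair a * B₃)) (sym eu))
      (trans (solve 4 (λ N X u A → (u :* pair′ (c 2 :* X :+ c 4 :* N :- c 2 :* N :+ c 1)) :* (c 2 :* (X :+ c 1) :* (X :+ c 1) :* (A :* A) :* pair′ (c 2 :* N :+ c 2 :* X :+ c 2) :* (c 2 :* N :+ c 2 :* X :+ c 3))
                 := ((X :+ c 1) :* A :* (c 2 :* N :+ c 2 :* X :+ c 1)) :* (pair′ (c 2 :* N :+ c 2 :* X :+ c 2) :* pair′ (c 2 :* N :+ c 2 :* X :+ c 2)) :* (c 2 :* X :+ c 2) :* (u :* A)) refl N X u₁ A₃)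
        (cong (λ w → (y * A₃ * B) * (pair a * pair a) * x₂ * (u₁ * w)) (solve 2 (λ n x → c 4 :* n :+ c 2 :* x :+ c 3 := c 4 :* n :+ c 2 :* (c 1 :+ x) :+ c 1) refl N X))))))))))
      where
      y = X + 1ℚ
      o = ι 2 * X + 1ℚ
      x₂ = ι 2 * X + ι 2
      a = ι 2 * N + ι 2 * X + ι 2
      A₃ = ι 4 * N + ι 2 * X + ι 3
      B = ι 2 * N + ι 2 * X + 1ℚ
      B₃ = ι 2 * N + ι 2 * X + ι 3
      T = ι 2 * N + X + 1ℚ

  -- Both sides are hypergeometric in x; the ratios come from `e-suc`, `g-diagonal` and the steps of
  -- the boxes.
  pivot-ratio : ∀ x → pivot x * (ι 2 * ι x + 1ℚ) * lower-box x n ≡ upper-box x n * (ι 4 * N + ι 2 * ι x + 1ℚ)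
  pivot-ratio zero = trans (solve 2 (λ p l → p :* (c 2 :* c 0 :+ c 1) :* l := p :* l) refl (pivot 0) (lower-box 0 n)) (trans pivot-zero (cong (upper-box 0 n *_) (solve 1 (λ n → c 4 :* n :+ c 1 := c 4 :* n :+ c 2 :* c 0 :+ c 1) refl N)))
  pivot-ratio (suc x) = unit-cancel
    (unit-* (unit-* (unit-* (unit-* (unit-x+1 x) (unit-lin 4 2 2 x)) (unit-lin 2 2 0 x)) (unit-* ua ua)) (unit-resp (solve 2 (λ n x → c 0 :* n :+ c 2 :* x :+ c 2 := c 2 :* x :+ c 2) refl N (ι x)) (unit-lin 0 2 1 x)))
    (subst (λ w → D * (pivot (suc x) * (ι 2 * w + 1ℚ) * lower-box (suc x) n) ≡ D * (upper-box (suc x) n * (ι 4 * N + ι 2 * w + 1ℚ))) (sym (ℕ→ℚ-suc x))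
      (ratio-step N (ι x) (e x) (e (suc x)) (g x (n ℕ.+ x)) (g (suc x) (n ℕ.+ suc x)) (lower-box x n) (lower-box (suc x) n) (upper-box x n) (upper-box (suc x) n)
        (e-suc x) (g-diagonal x) (upper-box-step x n) (lower-box-step x n) (pivot-ratio x)))
    where
    a = ι 2 * N + ι 2 * ι x + ι 2
    D = ((ι x + 1ℚ) * (ι 4 * N + ι 2 * ι x + ι 3) * (ι 2 * N + ι 2 * ι x + 1ℚ)) * (pair a * pair a) * (ι 2 * ι x + ι 2)
    ua : Unit (pair a)
    ua = unit-* (unit-lin 2 2 1 x) (unit-resp (solve 2 (λ n x → c 2 :* n :+ c 2 :* x :+ c 3 := c 2 :* n :+ c 2 :* x :+ c 2 :+ c 1) refl N (ι x)) (unit-lin 2 2 2 x))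

  unit-lower : ∀ x m → Unit (lower-box x m)
  unit-lower x zero    = unit-suc 0
  unit-lower x (suc m) = unit-* (unit-lower x m) (unit-*
    (unit-resp (trans (ℕ→ℚ-+ (2 ℕ.* x) (2 ℕ.* suc m)) (cong₂ _+_ (ℕ→ℚ-2* x) (ℕ→ℚ-2* (suc m)))) (unit-resp (cong ι (sym (ℕP.+-suc (2 ℕ.* x) (m ℕ.+ 1 ℕ.* suc m)))) (unit-suc (2 ℕ.* x ℕ.+ (m ℕ.+ 1 ℕ.* suc m)))))
    (unit-resp (trans (ℚP.+-comm 1ℚ (ι (2 ℕ.* x ℕ.+ 2 ℕ.* suc m))) (cong (_+ 1ℚ) (trans (ℕ→ℚ-+ (2 ℕ.* x) (2 ℕ.* suc m)) (cong₂ _+_ (ℕ→ℚ-2* x) (ℕ→ℚ-2* (suc m)))))) (unit-1+ (2 ℕ.* x ℕ.+ 2 ℕ.* suc m))))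

  pivots-snoc : ∀ y x → pivots y (suc x) ≡ pivots y x * pivot (y ℕ.+ x)
  pivots-snoc y zero    = trans (ℚP.*-comm (pivot y) 1ℚ) (cong (λ w → 1ℚ * pivot w) (sym (ℕP.+-identityʳ y)))
  pivots-snoc y (suc x) = trans (cong (pivot y *_) (pivots-snoc (suc y) x)) (trans (sym (ℚP.*-assoc (pivot y) (pivots (suc y) x) (pivot (suc y ℕ.+ x)))) (cong (λ w → pivots y (suc x) * pivot w) (sym (ℕP.+-suc y x))))

  -- The remaining factor `ν` is the one that multiplies the Schur complement in `schur-value`.
  pivots-box : ∀ x → pivots 0 x ≡ box x n * ν x
  pivots-box zero    = sym (trans (cong (_* 1ℚ) (box-zero n)) refl)
  pivots-box (suc x) = unit-cancel (unit-* (unit-lower x n) (unit-2x+1 x))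
    (trans (cong (lower-box x n * (ι 2 * ι x + 1ℚ) *_) (trans (pivots-snoc 0 x) (cong (_* pivot x) (pivots-box x))))
    (trans (solve 5 (λ l o b v p → l :* o :* (b :* v :* p) := b :* v :* (p :* o :* l)) refl (lower-box x n) (ι 2 * ι x + 1ℚ) (box x n) (ν x) (pivot x))
    (trans (cong (box x n * ν x *_) (pivot-ratio x))
    (trans (solve 4 (λ b v u A → b :* v :* (u :* A) := (b :* u) :* (v :* A)) refl (box x n) (ν x) (upper-box x n) (ι 4 * N + ι 2 * ι x + 1ℚ))
    (trans (cong₂ _*_ (sym (box-step x n ℕP.≤-refl)) (sym (ν-suc x)))
      (solve 4 (λ b l v o → (b :* l) :* (v :* o) := l :* o :* (b :* v)) refl (box (suc x) n) (lower-box x n) (ν (suc x)) (ι 2 * ι x + 1ℚ)))))))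

  private
    L : ℚ
    L = N + K + 1ℚ

  -- Each of the two products leaves out one factor: the first omits x + i from (x)_{n-k}, the
  -- second omits x + 2n - i from (x+n+k+1)_{n-k}.
  bracket : ∀ x i t → i ℕ.+ t ≡ r → let X = ι x in
    poch X i * poch (X + ι i + 1ℚ) t * poch (X + L) (suc r) - poch X (suc r) * poch (X + L) t * poch (X + ι 2 * N - ι i + 1ℚ) i
    ≡ poch (X + 1ℚ) r * poch (X + L) (suc r) * κ X i
  bracket x i t e = trans (cong₂ (λ u v → u * poch (X + L) (suc r) - v) (first i refl) second)
    (solve 5 (λ a b x s w → a :* (c 1 :- s) :* b :- a :* (x :* w) :* b := a :* b :* (c 1 :- s :- x :* w)) refl (poch (X + 1ℚ) r) (poch (X + L) (suc r)) X (ι i * inv (X + ι i)) (inv (X + ι 2 * N - ι i)))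
    where
    X = ι x
    first : ∀ j → j ≡ i → poch X j * poch (X + ι j + 1ℚ) t ≡ poch (X + 1ℚ) r * (1ℚ - ι j * inv (X + ι j))
    -- Treated apart, because for x = 0 the omitted factor x + i is 0 here and cannot be cancelled.
    first zero    refl = trans (cong₂ (λ a m → 1ℚ * poch a m) (cong (_+ 1ℚ) (ℚP.+-identityʳ X)) e) (solve 2 (λ p w → c 1 :* p := p :* (c 1 :- c 0 :* w)) refl (poch (X + 1ℚ) r) (inv (X + ι 0)))
    first (suc j) refl = unit-cancel u
      (trans (solve 3 (λ u a b → u :* (a :* b) := a :* (u :* b)) refl (X + ι (suc j)) (poch X (suc j)) (poch (X + ι (suc j) + 1ℚ) t))
      (trans (cong (poch X (suc j) *_) (sym (poch-cons (X + ι (suc j)) t)))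
      (trans (sym (poch-+ X (suc j) (suc t)))
      (trans (cong (poch X) (trans (ℕP.+-suc (suc j) t) (cong suc e)))
      (trans (poch-cons X r)
      (trans (solve 3 (λ x p i → x :* p := p :* (x :+ i :- i :* c 1)) refl X (poch (X + 1ℚ) r) (ι (suc j)))
      (trans (cong (λ w → poch (X + 1ℚ) r * (X + ι (suc j) - ι (suc j) * w)) (sym (inv-* u)))
        (solve 4 (λ p u i v → p :* (u :- i :* (v :* u)) := u :* (p :* (c 1 :- i :* v))) refl (poch (X + 1ℚ) r) (X + ι (suc j)) (ι (suc j)) (inv (X + ι (suc j)))))))))))
      where
      u : Unit (X + ι (suc j))
      u = unit-resp (ℕ→ℚ-+ x (suc j)) (unit-resp (cong ι (sym (ℕP.+-suc x j))) (unit-suc (x ℕ.+ j)))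
    w = X + ι 2 * N - ι i
    uw : Unit w
    uw = unit-2n-i x i (ℕP.m+n≤o⇒m≤o i (ℕP.≤-reflexive e))
    w≡ : X + L + ι t ≡ w
    w≡ = trans (solve 4 (λ x n k t → x :+ (n :+ k :+ c 1) :+ t := x :+ (n :+ (c 1 :+ (k :+ t)))) refl X N K (ι t))
      (trans (cong (λ z → X + (N + z)) (trans (solve 3 (λ k t i → c 1 :+ (k :+ t) := (c 1 :+ (k :+ (i :+ t))) :- i) refl K (ι t) (ι i)) (cong (_- ι i) (sym (N≡ i t e)))))
        (solve 3 (λ x n i → x :+ (n :+ (n :- i)) := x :+ c 2 :* n :- i) refl X N (ι i)))
    second : poch X (suc r) * poch (X + L) t * poch (w + 1ℚ) i ≡ poch (X + 1ℚ) r * (X * inv w) * poch (X + L) (suc r)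
    second = trans (cong (λ p → p * poch (X + L) t * poch (w + 1ℚ) i) (poch-cons X r))
      (trans (solve 4 (λ x p a b → x :* p :* a :* b := p :* x :* (c 1 :* (a :* b))) refl X (poch (X + 1ℚ) r) (poch (X + L) t) (poch (w + 1ℚ) i))
      (trans (cong (λ z → poch (X + 1ℚ) r * X * (z * (poch (X + L) t * poch (w + 1ℚ) i))) (sym (inv-* uw)))
      (trans (solve 6 (λ p x v w a b → p :* x :* ((v :* w) :* (a :* b)) := p :* (x :* v) :* (a :* (w :* b))) refl (poch (X + 1ℚ) r) X (inv w) w (poch (X + L) t) (poch (w + 1ℚ) i))
        (cong (poch (X + 1ℚ) r * (X * inv w) *_) (trans (cong (poch (X + L) t *_) (trans (sym (poch-cons w i)) (cong (λ z → poch z (suc i)) (sym w≡))))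
          (trans (sym (poch-+ (X + L) t (suc i))) (cong (poch (X + L)) (trans (ℕP.+-suc t i) (cong suc (trans (ℕP.+-comm t i) e))))))))))

  -- The summand of `rhs` under a name of its own; the two agree by computation.
  term : ℕ → ℕ → ℚ
  term x i =
    (poch ½ i /'
      (ι (i !) * ι ((n ∸ k ∸ i ∸ 1) !) * ι ((n ∸ k ∸ i ∸ 1) !)
        * poch (ι (n ℕ.+ k ∸ i ℕ.+ 1)) (n ∸ k)
        * poch (ι (n ℕ.+ k ∸ i ℕ.+ 1)) i
        * poch (ι (2 ℕ.* n ∸ i) + ½) i))
    * (poch (ι x) i * poch (ι (x ℕ.+ i ℕ.+ 1)) (n ∸ k ∸ i ∸ 1)
           * poch (ι (x ℕ.+ n ℕ.+ k ℕ.+ 1)) (n ∸ k)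
         - poch (ι x) (n ∸ k) * poch (ι (x ℕ.+ n ℕ.+ k ℕ.+ 1)) (n ∸ k ∸ i ∸ 1)
           * poch (ι (x ℕ.+ 2 ℕ.* n ∸ i ℕ.+ 1)) i)

  n-k : n ∸ k ≡ suc r
  n-k = trans (cong (_∸ k) (trans n≡ (sym (ℕP.+-suc k r)))) (ℕP.m+n∸m≡n k (suc r))

  term-value : ∀ x i → i ℕ.≤ r → term x i ≡ c₀ * (poch (ι x + 1ℚ) r * poch (ι x + L) (suc r)) * (coef n k i * κ (ι x) i)
  term-value x i le = trans (congTerm n-k n-k-i-1 A≡ B≡ C≡ E≡ G≡)
    (trans (cong₂ _*_ (full-coef i t e₁) (bracket x i t e₁))
      (solve 4 (λ a b f w → a :* f :* (b :* w) := a :* b :* (f :* w)) refl c₀ (poch (ι x + 1ℚ) r * poch (ι x + L) (suc r)) (coef n k i) (κ (ι x) i)))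
    where
    t = r ∸ i
    e₁ : i ℕ.+ t ≡ r
    e₁ = ℕP.m+[n∸m]≡n le
    shape : (m t : ℕ) (a b d f g : ℚ) → ℚ
    shape m t a b d f g = (poch ½ i /' (ι (i !) * ι (t !) * ι (t !) * poch a m * poch a i * poch b i))
      * (poch (ι x) i * poch d t * poch f m - poch (ι x) m * poch f t * poch g i)
    congTerm : ∀ {m m′ t t′ a a′ b b′ d d′ f f′ g g′} → m ≡ m′ → t ≡ t′ → a ≡ a′ → b ≡ b′ → d ≡ d′ → f ≡ f′ → g ≡ g′ → shape m t a b d f g ≡ shape m′ t′ a′ b′ d′ f′ g′
    congTerm refl refl refl refl refl refl refl = refl
    n-k-i-1 : n ∸ k ∸ i ∸ 1 ≡ t
    n-k-i-1 = trans (cong (λ w → w ∸ i ∸ 1) n-k) (trans (ℕP.∸-+-assoc (suc r) i 1) (trans (cong (suc r ∸_) (ℕP.+-comm i 1)) refl))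
    i≤n : i ℕ.≤ n
    i≤n = ℕP.≤-trans le (ℕP.≤-trans (ℕP.m≤n+m r (suc k)) (ℕP.≤-reflexive (sym n≡)))
    A≡ : ι (n ℕ.+ k ∸ i ℕ.+ 1) ≡ N + K - ι i + 1ℚ
    A≡ = trans (ℕ→ℚ-+ (n ℕ.+ k ∸ i) 1) (cong (_+ 1ℚ) (trans (ι-∸ (ℕP.≤-trans i≤n (ℕP.m≤m+n n k))) (cong (_- ι i) (ℕ→ℚ-+ n k))))
    B≡ : ι (2 ℕ.* n ∸ i) + ½ ≡ ι 2 * N - ι i + ½
    B≡ = cong (_+ ½) (trans (ι-∸ (ℕP.≤-trans i≤n (ℕP.m≤m+n n (1 ℕ.* n)))) (cong (_- ι i) (ℕ→ℚ-2* n)))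
    C≡ : ι (x ℕ.+ i ℕ.+ 1) ≡ ι x + ι i + 1ℚ
    C≡ = trans (ℕ→ℚ-+ (x ℕ.+ i) 1) (cong (_+ 1ℚ) (ℕ→ℚ-+ x i))
    E≡ : ι (x ℕ.+ n ℕ.+ k ℕ.+ 1) ≡ ι x + L
    E≡ = trans (ℕ→ℚ-+ (x ℕ.+ n ℕ.+ k) 1) (trans (cong (_+ 1ℚ) (trans (ℕ→ℚ-+ (x ℕ.+ n) k) (cong (_+ K) (ℕ→ℚ-+ x n)))) (solve 3 (λ x n k → x :+ n :+ k :+ c 1 := x :+ (n :+ k :+ c 1)) refl (ι x) N K))
    G≡ : ι (x ℕ.+ 2 ℕ.* n ∸ i ℕ.+ 1) ≡ ι x + ι 2 * N - ι i + 1ℚ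
    G≡ = trans (ℕ→ℚ-+ (x ℕ.+ 2 ℕ.* n ∸ i) 1) (cong (_+ 1ℚ) (trans (ι-∸ (ℕP.≤-trans i≤n (ℕP.≤-trans (ℕP.m≤m+n n (1 ℕ.* n)) (ℕP.m≤n+m (2 ℕ.* n) x)))) (cong (_- ι i) (trans (ℕ→ℚ-+ x (2 ℕ.* n)) (cong (λ w → ι x + w) (ℕ→ℚ-2* n))))))

  -- The binomial coefficient is h(2k), the prefactor and the Pochhammer symbols from `bracket` form
  -- `φ`, and together with `c₀` they make up `ψ`.
  rhs-value : ∀ x → rhs n x k ≡ pivots 0 x * LU.K n x k k
  rhs-value x = trans (cong (λ s → prefactor * box x n * s) sums)
    (trans (unit-cancel (unit-den x m) (trans
      (trans (solve 6 (λ p H b z a f → p :* (H :* b :* (z :* a :* f)) := (H :* p) :* b :* (z :* a :* f)) refl p prefactor (box x n) c₀ (a * b) (F (ι x)))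
      (trans (cong (λ w → w * box x n * (c₀ * (a * b) * F (ι x))) (trans (cong (λ w → prefactor * poch w m) (sym den≡)) (trans (/'-* (ι ((4 ℕ.* k ℕ.+ 1) C (2 ℕ.* k)) * fac) (subst (λ w → Unit (poch w m)) (sym den≡) (unit-den x m))) (cong (_* fac) binomial))))
      (trans (solve 7 (λ h f bx z a b F → (h :* f) :* bx :* (z :* (a :* b) :* F) := bx :* (h :* (z :* (f :* a :* b)) :* F)) refl (h (2 ℕ.* k)) fac (box x n) c₀ a b (F (ι x)))
        (cong (λ w → box x n * (h (2 ℕ.* k) * (c₀ * w) * F (ι x))) (sym (φ-* x))))))
      (solve 6 (λ bx h z φ p F → bx :* (h :* (z :* (φ :* p)) :* F) := p :* (bx :* (h :* (z :* φ) :* F))) refl (box x n) (h (2 ℕ.* k)) c₀ (φ x) p (F (ι x)))))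
    (trans (cong (box x n *_) (schur-value x))
    (trans (sym (ℚP.*-assoc (box x n) (ν x) (LU.K n x k k))) (cong (_* LU.K n x k k) (sym (pivots-box x))))))
    where
    m = 2 ℕ.* k ℕ.+ 1
    fac = ι ((n ℕ.+ k) !)
    a = poch (ι x + 1ℚ) r
    b = poch (ι x + L) (suc r)
    p = poch (ι x + ι (suc r)) m
    prefactor = (ι ((4 ℕ.* k ℕ.+ 1) C (2 ℕ.* k)) * fac) /' poch (ι (x ℕ.+ n ∸ k)) m
    den≡ : ι (x ℕ.+ n ∸ k) ≡ ι x + ι (suc r)
    den≡ = trans (cong ι (trans (ℕP.+-∸-assoc x (ℕP.≤-trans (ℕP.m≤m+n k r) (ℕP.≤-trans (ℕP.n≤1+n (k ℕ.+ r)) (ℕP.≤-reflexive (sym n≡))))) (cong (x ℕ.+_) n-k))) (ℕ→ℚ-+ x (suc r))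
    binomial : ι ((4 ℕ.* k ℕ.+ 1) C (2 ℕ.* k)) ≡ h (2 ℕ.* k)
    binomial = trans (cong (λ w → ι (w C (2 ℕ.* k))) (trans (ℕP.+-comm (4 ℕ.* k) 1) (cong suc (ℕP.*-assoc 2 2 k)))) (sym (h-binomial (2 ℕ.* k)))
    sums : sumBelow (n ∸ k) (term x) ≡ c₀ * (a * b) * F (ι x)
    sums = trans (cong (λ w → sumBelow w (term x)) n-k) (trans (sum-cong (suc r) (λ { i (ℕ.s≤s le) → term-value x i le })) (sum-scale (suc r) (c₀ * (a * b)) (λ i → coef n k i * κ (ι x) i)))

-- The number of tilings

Pf-rhs : ∀ n x k r → n ≡ suc (k ℕ.+ r) → let e = x ℕ.+ r in k ℕ.+ suc e ≡ n ℕ.+ x →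
  Pf (suc x) (pt (2 ℕ.* k) e ∷ pt (2 ℕ.* k) (suc e) ∷ map (pt (2 ℕ.* n)) (range 0 (x ℕ.+ x))) ≡ rhs n x k
Pf-rhs n x k r n≡ height = trans (Pf-skewForm n x k (x ℕ.+ r) height) (trans (LU.Pf-value n k x) (sym (Evaluation.rhs-value n k r n≡ x)))

theorem4 : (n x k : ℕ) → 1 ≤ n → 1 ≤ x → k ≤ n ∸ 1 →
    ℕ→ℚ (M (FminusHole n x k)) ≡ rhs n x k
theorem4 n x k 1≤n _ k≤n-1 = trans (Tilings.tilings-Pf n x k (x ℕ.+ r) k<n centre) (Pf-rhs n x k r n≡ height)
  where
  r : ℕ
  r = n ∸ 1 ∸ k
  n≡ : n ≡ suc (k ℕ.+ r)
  n≡ = trans (sym (ℕP.m+[n∸m]≡n 1≤n)) (cong suc (sym (ℕP.m+[n∸m]≡n k≤n-1)))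
  k<n : k < n
  k<n = ℕP.≤-trans (s≤s k≤n-1) (ℕP.≤-reflexive (ℕP.m+[n∸m]≡n 1≤n))
  -- The line at distance 2k from ℓ has x + r positions below the two of the hole and as many above.
  centre : 2 ℕ.* k ℕ.+ suc (suc ((x ℕ.+ r) ℕ.+ (x ℕ.+ r))) ≡ 2 ℕ.* x ℕ.+ 2 ℕ.* n
  centre = trans (ℕS.solve 3 (λ k x r → ℕS.con 2 ℕS.:* k ℕS.:+ (ℕS.con 2 ℕS.:+ ((x ℕS.:+ r) ℕS.:+ (x ℕS.:+ r))) ℕS.:= ℕS.con 2 ℕS.:* x ℕS.:+ ℕS.con 2 ℕS.:* (ℕS.con 1 ℕS.:+ (k ℕS.:+ r))) refl k x r)
    (cong (λ n → 2 ℕ.* x ℕ.+ 2 ℕ.* n) (sym n≡))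
  height : k ℕ.+ suc (x ℕ.+ r) ≡ n ℕ.+ x
  height = trans (ℕS.solve 3 (λ k x r → k ℕS.:+ (ℕS.con 1 ℕS.:+ (x ℕS.:+ r)) ℕS.:= ℕS.con 1 ℕS.:+ (k ℕS.:+ r) ℕS.:+ x) refl k x r) (cong (ℕ._+ x) (sym n≡))
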